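{- For every integer $q\ge 3$ and real $\varepsilon\in (0,1)$, there exists an integer $C\ge 1$ such that the following holds: if $X\subseteq G\subseteq K_n$ with $\delta(G)\ge (1-\frac{1}{2q-2} + \varepsilon)n$ and $\Delta(X) \le \frac{n}{C}$, then there exists a $C$-refined $K_q$-omni-absorber $A$ for $X$ with $A\subseteq G$ and $\Delta(A) \le C\cdot \max\left\{\Delta(X),~\sqrt{n}\cdot \log n\right\}$.
   Context: A graph $L$ is $K_q$-divisible if $\binom{q}{2}\mid e(L)$ and $(q-1)\mid d_L(v)$ for every vertex $v$. A graph $A$ is a $K_q$-omni-absorber for a graph $X$ with decomposition family $\mathcal F_A$ (a set of copies of $K_q$) and decomposition function $\mathcal Q_A$ if $X$ and $A$ are edge-disjoint and for every $K_q$-divisible subgraph $L$ of $X$, $\mathcal Q_A(L)\subseteq \mathcal F_A$ is a $K_q$-decomposition of $A\cup L$ (a partition of its edges into copies of $K_q$). It is $C$-refined if every edge of $X\cup A$ lies in at most $C$ elements of $\mathcal F_A$. -}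

module Defs where

open import Data.Nat using (ℕ; zero; suc; _+_; _*_; _∸_; _^_; _≤_; _<_; _⊔_; _<ᵇ_)
open import Data.Nat.Divisibility using (_∣_)
open import Data.Nat.Combinatorics using (_C_)
open import Data.Nat.Logarithm using (⌈log₂_⌉)
open import Data.Bool using (Bool; true; false; _∧_; _∨_; T; if_then_else_)
open import Data.Fin using (Fin; toℕ)
open import Data.Vec using (lookup)
open import Data.Fin.Subset using (Subset; ∣_∣)
open import Data.List using (List; map; allFin; foldr)
open import Data.Nat.ListAction using (sum)
open import Data.List.Relation.Unary.All using (All)
open import Data.List.Membership.Propositional using (_∈_)
open import Data.Product using (_×_; ∃-syntax)
open import Data.Sum using (_⊎_)
open import Data.Empty using (⊥)
open import Relation.Binary.PropositionalEquality using (_≡_; _≢_)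

Adj : ℕ → Set
Adj n = Fin n → Fin n → Bool

record Graph (n : ℕ) : Set where
  field
    adj  : Adj n
    sym  : ∀ i j → adj i j ≡ adj j i
    irr  : ∀ i → adj i i ≡ false
open Graph public

_∪ᵃ_ : ∀ {n} → Adj n → Adj n → Adj n
(H ∪ᵃ K) i j = H i j ∨ K i j

b2n : Bool → ℕ
b2n b = if b then 1 else 0

deg : ∀ {n} → Adj n → Fin n → ℕ
deg {n} H v = sum (map (λ u → b2n (H v u)) (allFin n))

-- maximum degree Δ (0 for the empty vertex set)
maxDeg : ∀ {n} → Adj n → ℕ
maxDeg {n} H = foldr _⊔_ 0 (map (deg H) (allFin n))

edges : ∀ {n} → Adj n → ℕ
edges {n} H = sum (map (λ i → sum (map (λ j → b2n (H i j ∧ (toℕ i <ᵇ toℕ j))) (allFin n))) (allFin n))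

_⊆ᵍ_ : ∀ {n} → Adj n → Adj n → Set
H ⊆ᵍ K = ∀ i j → T (H i j) → T (K i j)

EdgeDisjoint : ∀ {n} → Adj n → Adj n → Set
EdgeDisjoint H K = ∀ i j → T (H i j) → T (K i j) → ⊥

Divisible : ∀ {n} → ℕ → Adj n → Set
Divisible {n} q L = ((q C 2) ∣ edges L) × (∀ v → (q ∸ 1) ∣ deg L v)

-- a copy of K_q in K_n, given by its vertex set (a q-subset of Fin n)
IsKq : ∀ {n} → ℕ → Subset n → Set
IsKq q S = ∣ S ∣ ≡ q

cover : ∀ {n} → List (Subset n) → Fin n → Fin n → ℕ
cover F i j = sum (map (λ S → b2n (lookup S i ∧ lookup S j)) F)

IsDecomp : ∀ {n} → ℕ → Adj n → List (Subset n) → Set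
IsDecomp q H Q =
  All (IsKq q) Q ×
  (∀ S → S ∈ Q → ∀ i j → i ≢ j → T (lookup S i) → T (lookup S j) → T (H i j)) ×
  (∀ i j → T (H i j) → cover Q i j ≡ 1)

OmniAbsorber : ∀ {n} → ℕ → Adj n → Adj n → List (Subset n) → Set
OmniAbsorber {n} q X A F =
  EdgeDisjoint X A ×
  All (IsKq q) F ×
  ((L : Graph n) → adj L ⊆ᵍ X → Divisible q (adj L) →
     ∃[ Q ] (All (_∈ F) Q × IsDecomp q (A ∪ᵃ adj L) Q))

Refined : ∀ {n} → ℕ → Adj n → Adj n → List (Subset n) → Set
Refined C X A F = ∀ i j → T ((X ∪ᵃ A) i j) → cover F i j ≤ C

-- Δ(A) ≤ C · max{Δ(X), √n · log n}, with log n := ⌈log₂ n⌉, squared out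
DegBound : ℕ → ℕ → ℕ → ℕ → Set
DegBound C n ΔA ΔX = (ΔA ≤ C * ΔX) ⊎ (ΔA ^ 2 ≤ C ^ 2 * n * ⌈log₂ n ⌉ ^ 2)

{-# OPTIONS --safe #-}
-- The proof is deterministic. An edge e = uv of X is traded, modulo copies of K_q, for other pairs of vertices; only the
-- degrees modulo q-1 and the number of edges modulo (q choose 2) matter. The vertices are arranged in a √n × √n grid. The
-- edges between two rows are gathered in blocks of at most D = max{Δ(X), √n} edges at a hub w, by uv = uw + wv - ww, and are
-- then pushed along the two rows to the row representatives and along these to a single vertex. Pushing from a vertex x to
-- its predecessor y leaves a multiple of x - y, and if L is divisible then all these multiples vanish in the end. This is
-- done by a circuit of gadgets of bounded size in which every vertex has load O(D), because there are O(√n) blocks at each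
-- row. Consecutive gadgets share tokens, that is, paths u s t v of which one gadget consumes st and the other us and tv.
-- All that a gadget may have to consume is a divisible graph B of bounded size, and each such B gets a private absorber.
--
-- The absorber of B comes from one transformer: the stars of x and x' over a (q-1)-set N are exchanged with the help of a
-- (q-1) × (q-2) grid of new vertices of degree 2q-2. Two of these exchange {uv, st} for {us, vt}; having done this for all
-- edges uv of B, further ones move all ends us and vt to a common vertex z. The result depends only on e(B), so B is
-- exchanged for a disjoint union of copies of K_q. Since everything is (2q-2)-degenerate over its roots, it can be embedded
-- greedily, choosing new vertices among those that are not yet saturated.

module Submission where

open import Defs
open import Data.Nat hiding (_≟_)
open import Data.Nat.Properties
open import Data.Nat.ListAction using (sum)
open import Data.Nat.Solver using (module +-*-Solver)
open +-*-Solver using (solve; con; _:+_; _:*_; _:=_)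
open import Data.Bool using (Bool; true; false; T; _∧_; _∨_)
open import Data.Fin using (Fin; zero; suc; toℕ; fromℕ<)
open import Data.Fin.Properties using (toℕ-injective; toℕ<n; toℕ-fromℕ<; all?) renaming (_≟_ to _≟ᶠ_)
open import Data.List using (List; []; _∷_; _++_; map; concat; concatMap; length; tabulate; allFin; foldr; replicate; [_])
open import Data.List.Properties using (map-tabulate; length-tabulate; length-++; length-map; ++-assoc; ++-identityʳ; length-replicate)
open import Data.List.Membership.Propositional using (_∈_)
open import Data.List.Relation.Unary.Any using (here; there)
open import Data.List.Relation.Unary.All as AllDec using (All; []; _∷_)
open import Data.List.Relation.Binary.Permutation.Propositional using (_↭_; refl; prep; swap; trans)
open import Data.Product using (_×_; _,_; proj₁; proj₂; ∃; ∃-syntax; Σ-syntax; uncurry)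
open import Data.Sum using (_⊎_; inj₁; inj₂)
open import Data.Empty using (⊥-elim)
open import Data.Unit using (⊤; tt)
open import Function using (_∘_; id)
open import Relation.Nullary using (¬_; Dec; yes; no; does)
open import Relation.Nullary.Decidable using (_×-dec_; ¬?)
open import Relation.Binary.PropositionalEquality as ≡ using (_≡_; _≢_; cong; cong₂; subst; subst₂)

open import Data.List.Relation.Binary.Permutation.Propositional.Properties using (++⁺; ++⁺ʳ; ++-commutativeMonoid)
open import Data.List.Relation.Binary.Permutation.Propositional using (↭-refl; ↭-sym; ↭-reflexive)
open import Data.List.Membership.Propositional.Properties using (∈-++⁺ˡ; ∈-++⁺ʳ; ∈-++⁻; ∈-map⁺; ∈-map⁻; ∈-allFin)
open import Data.Nat.Divisibility using (_∣_; _∣?_; divides; ∣m+n∣m⇒∣n)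
open import Data.Nat.DivMod using (_mod_; m%n<n; m≡m%n+[m/n]*n; m<n⇒m%n≡m; m<n*o⇒m/o<n; [m+n]%n≡m%n)
open import Data.Nat.Combinatorics using (nC1≡n; nCk+nC[k+1]≡[n+1]C[k+1]) renaming (_C_ to _choose_)
open import Data.Fin.Subset using (Subset; ∣_∣)
open import Data.Vec as Vec using ()
open import Data.Vec.Properties using (lookup∘tabulate)
open import Relation.Binary.Definitions using (tri<; tri≈; tri>)
open import Data.Nat.Logarithm using (⌈log₂_⌉; ⌈log₂⌉-mono-≤)

-- Refinement is the obstacle: an edge may lie in boundedly many cliques only, so no gadget can
-- react to `L` as a whole. What travels through the circuit are residues modulo m = q(q-1), a
-- common multiple of q-1 and (q choose 2), carried by m tokens for each wire created. A gadget then
-- meets at most 8m pieces with two states each, and every one of the at most 2^(8m) graphs that it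
-- may face can afford an absorber of its own. The grid comes from balancing loads. Sweeping a row
-- of length s to one end costs O(1) at each of its positions but O(s) at the hub. With at most 2s
-- blocks on either side of a row, and each position a hub at most twice, the load is O(s + D),
-- which is O(D) once s ≤ D; and s² ≥ n is needed to place all vertices. The differences x - y are
-- not cancelled block by block. They are stored in accumulators shared by all blocks, and
-- conservation alone makes them vanish at the end. Edges are kept in lists that are compared by
-- summing symmetric functions over them, so that statements on degrees, multiplicities and loads
-- become instances of linear identities.

private variable
  𝒜 ℬ : Set

-- Sums over lists and over `Fin n`

Σl : (𝒜 → ℕ) → List 𝒜 → ℕ
Σl f []       = 0
Σl f (x ∷ xs) = f x + Σl f xs

Σl≡sum : (f : 𝒜 → ℕ) (xs : List 𝒜) → Σl f xs ≡ sum (map f xs)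
Σl≡sum f []       = ≡.refl
Σl≡sum f (x ∷ xs) = cong (f x +_) (Σl≡sum f xs)

Σl-++ : (f : 𝒜 → ℕ) (xs ys : List 𝒜) → Σl f (xs ++ ys) ≡ Σl f xs + Σl f ys
Σl-++ f []       ys = ≡.refl
Σl-++ f (x ∷ xs) ys = ≡.trans (cong (f x +_) (Σl-++ f xs ys)) (≡.sym (+-assoc (f x) _ _))

Σl-map : (f : ℬ → ℕ) (h : 𝒜 → ℬ) (xs : List 𝒜) → Σl f (map h xs) ≡ Σl (f ∘ h) xs
Σl-map f h []       = ≡.refl
Σl-map f h (x ∷ xs) = cong (f (h x) +_) (Σl-map f h xs)

Σl-concatMap : (f : ℬ → ℕ) (h : 𝒜 → List ℬ) (xs : List 𝒜) → Σl f (concatMap h xs) ≡ Σl (λ x → Σl f (h x)) xs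
Σl-concatMap f h []       = ≡.refl
Σl-concatMap f h (x ∷ xs) = ≡.trans (Σl-++ f (h x) _) (cong (Σl f (h x) +_) (Σl-concatMap f h xs))

Σl-concat : (f : 𝒜 → ℕ) (xss : List (List 𝒜)) → Σl f (concat xss) ≡ Σl (Σl f) xss
Σl-concat f []         = ≡.refl
Σl-concat f (xs ∷ xss) = ≡.trans (Σl-++ f xs _) (cong (Σl f xs +_) (Σl-concat f xss))

Σl-cong : {f h : 𝒜 → ℕ} → (∀ x → f x ≡ h x) → ∀ xs → Σl f xs ≡ Σl h xs
Σl-cong e []       = ≡.refl
Σl-cong e (x ∷ xs) = cong₂ _+_ (e x) (Σl-cong e xs)

Σl-mono : {f h : 𝒜 → ℕ} → (∀ x → f x ≤ h x) → ∀ xs → Σl f xs ≤ Σl h xs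
Σl-mono e []       = z≤n
Σl-mono e (x ∷ xs) = +-mono-≤ (e x) (Σl-mono e xs)

Σl-monoAll : {f h : 𝒜 → ℕ} {xs : List 𝒜} → All (λ x → f x ≤ h x) xs → Σl f xs ≤ Σl h xs
Σl-monoAll []       = z≤n
Σl-monoAll (e ∷ es) = +-mono-≤ e (Σl-monoAll es)

+-interchange : ∀ a b c d → (a + b) + (c + d) ≡ (a + c) + (b + d)
+-interchange = solve 4 (λ a b c d → (a :+ b) :+ (c :+ d) := (a :+ c) :+ (b :+ d)) ≡.refl

+-swap : ∀ a b c → a + (b + c) ≡ b + (a + c)
+-swap = solve 3 (λ a b c → a :+ (b :+ c) := b :+ (a :+ c)) ≡.refl

Σl-+ : (f h : 𝒜 → ℕ) (xs : List 𝒜) → Σl (λ x → f x + h x) xs ≡ Σl f xs + Σl h xs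
Σl-+ f h []       = ≡.refl
Σl-+ f h (x ∷ xs) = ≡.trans (cong (f x + h x +_) (Σl-+ f h xs)) (+-interchange (f x) (h x) _ _)

Σl-* : (c : ℕ) (f : 𝒜 → ℕ) (xs : List 𝒜) → Σl (λ x → c * f x) xs ≡ c * Σl f xs
Σl-* c f []       = ≡.sym (*-zeroʳ c)
Σl-* c f (x ∷ xs) = ≡.trans (cong (c * f x +_) (Σl-* c f xs)) (≡.sym (*-distribˡ-+ c (f x) _))

Σl-*ʳ : (c : ℕ) (f : 𝒜 → ℕ) (xs : List 𝒜) → Σl (λ x → f x * c) xs ≡ Σl f xs * c
Σl-*ʳ c f xs = ≡.trans (Σl-cong (λ x → *-comm (f x) c) xs) (≡.trans (Σl-* c f xs) (*-comm c _))

Σl-zero : (xs : List 𝒜) → Σl (λ _ → 0) xs ≡ 0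
Σl-zero []       = ≡.refl
Σl-zero (x ∷ xs) = Σl-zero xs

Σl-const : (c : ℕ) (xs : List 𝒜) → Σl (λ _ → c) xs ≡ length xs * c
Σl-const c []       = ≡.refl
Σl-const c (x ∷ xs) = cong (c +_) (Σl-const c xs)

Σl-swap : (f : 𝒜 → ℬ → ℕ) (xs : List 𝒜) (ys : List ℬ) →
  Σl (λ x → Σl (f x) ys) xs ≡ Σl (λ y → Σl (λ x → f x y) xs) ys
Σl-swap f []       ys = ≡.sym (Σl-zero ys)
Σl-swap f (x ∷ xs) ys = ≡.trans (cong (Σl (f x) ys +_) (Σl-swap f xs ys))
  (≡.sym (Σl-+ (f x) (λ y → Σl (λ x → f x y) xs) ys))

Σl-↭ : (f : 𝒜 → ℕ) {xs ys : List 𝒜} → xs ↭ ys → Σl f xs ≡ Σl f ys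
Σl-↭ f refl         = ≡.refl
Σl-↭ f (prep x p)   = cong (f x +_) (Σl-↭ f p)
Σl-↭ f {ys = _ ∷ _ ∷ ys} (swap x y p) = ≡.trans (cong (λ t → f x + (f y + t)) (Σl-↭ f p)) (+-swap (f x) (f y) (Σl f ys))
Σl-↭ f (trans p p') = ≡.trans (Σl-↭ f p) (Σl-↭ f p')

Σl-∈ : (f : 𝒜 → ℕ) {x : 𝒜} {xs : List 𝒜} → x ∈ xs → f x ≤ Σl f xs
Σl-∈ f (here ≡.refl) = m≤m+n _ _
Σl-∈ f (there p)     = ≤-trans (Σl-∈ f p) (m≤n+m _ _)

ΣF : ∀ {n} → (Fin n → ℕ) → ℕ
ΣF {n} f = Σl f (allFin n)

ΣF-suc : ∀ {n} (f : Fin (suc n) → ℕ) → ΣF f ≡ f zero + ΣF (f ∘ suc)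
ΣF-suc {n} f = cong (f zero +_) (≡.trans (cong (Σl f) (≡.sym (map-tabulate id suc))) (Σl-map f suc (allFin n)))

ΣF-const : ∀ n (c : ℕ) → ΣF {n} (λ _ → c) ≡ n * c
ΣF-const n c = ≡.trans (Σl-const c (allFin n)) (cong (_* c) (length-tabulate {n = n} id))

δ : ∀ {n} → Fin n → Fin n → ℕ
δ x y = b2n (does (x ≟ᶠ y))

δ-refl : ∀ {n} (x : Fin n) → δ x x ≡ 1
δ-refl x with x ≟ᶠ x
... | yes _ = ≡.refl
... | no ¬p = ⊥-elim (¬p ≡.refl)

δ-≢ : ∀ {n} {x y : Fin n} → x ≢ y → δ x y ≡ 0
δ-≢ {x = x} {y} ne with x ≟ᶠ y
... | yes p = ⊥-elim (ne p)
... | no _  = ≡.refl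

δ-sym : ∀ {n} (x y : Fin n) → δ x y ≡ δ y x
δ-sym x y with x ≟ᶠ y
... | yes ≡.refl = ≡.sym (δ-refl x)
... | no ¬p      = ≡.sym (δ-≢ (¬p ∘ ≡.sym))

δ≤1 : ∀ {n} (x y : Fin n) → δ x y ≤ 1
δ≤1 x y with does (x ≟ᶠ y)
... | true  = ≤-refl
... | false = z≤n

δ-0⇒≢ : ∀ {n} {x y : Fin n} → δ x y ≡ 0 → x ≢ y
δ-0⇒≢ {x = x} e ≡.refl with ≡.trans (≡.sym (δ-refl x)) e
... | ()

ΣF-cong : ∀ {n} {f h : Fin n → ℕ} → (∀ x → f x ≡ h x) → ΣF f ≡ ΣF h
ΣF-cong {n} e = Σl-cong e (allFin n)

ΣF-mono : ∀ {n} {f h : Fin n → ℕ} → (∀ x → f x ≤ h x) → ΣF f ≤ ΣF h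
ΣF-mono {n} e = Σl-mono e (allFin n)

ΣF-+ : ∀ {n} (f h : Fin n → ℕ) → ΣF (λ x → f x + h x) ≡ ΣF f + ΣF h
ΣF-+ {n} f h = Σl-+ f h (allFin n)

ΣF-δ* : ∀ {n} (x : Fin n) (f : Fin n → ℕ) → ΣF (λ y → δ x y * f y) ≡ f x
ΣF-δ* {suc n} zero f = ≡.trans (ΣF-suc (λ y → δ zero y * f y))
  (≡.trans (cong (1 * f zero +_) (≡.trans (ΣF-cong {n} {f = λ y → δ {suc n} zero (suc y) * f (suc y)} {h = λ _ → 0} (λ y → ≡.refl)) (Σl-zero (allFin n))))
    (≡.trans (+-identityʳ _) (*-identityˡ _)))
ΣF-δ* {suc n} (suc x) f = ≡.trans (ΣF-suc (λ y → δ (suc x) y * f y)) (ΣF-δ* x (f ∘ suc))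

ΣF-δ : ∀ {n} (x : Fin n) → ΣF (δ x) ≡ 1
ΣF-δ x = ≡.trans (ΣF-cong (λ y → ≡.sym (*-identityʳ (δ x y)))) (ΣF-δ* x (λ _ → 1))

ΣF-∈ : ∀ {n} (f : Fin n → ℕ) x → f x ≤ ΣF f
ΣF-∈ {suc n} f zero    = ≤-trans (m≤m+n _ _) (≤-reflexive (≡.sym (ΣF-suc f)))
ΣF-∈ {suc n} f (suc x) = ≤-trans (ΣF-∈ (f ∘ suc) x) (≤-trans (m≤n+m _ _) (≤-reflexive (≡.sym (ΣF-suc f))))

-- Pigeonhole in the form needed by the greedy choice: `f` counts the objections to each vertex, and
-- fewer than `n` objections in all leave some vertex without any.
vanishes : ∀ {n} (f : Fin n → ℕ) → ΣF f < n → ∃[ x ] f x ≡ 0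
vanishes {suc n} f lt = go (f zero) ≡.refl
  where
  go : ∀ k → f zero ≡ k → ∃[ x ] f x ≡ 0
  go zero    e = zero , e
  go (suc k) e = let x , e' = vanishes (f ∘ suc) (s≤s⁻¹ (≤-trans (s≤s bound) lt)) in suc x , e'
    where
    bound : suc (ΣF (f ∘ suc)) ≤ ΣF f
    bound = ≤-trans (s≤s (m≤n+m _ k)) (≤-reflexive (≡.sym (≡.trans (ΣF-suc f) (cong (_+ ΣF (f ∘ suc)) e))))

ind : {P : Set} → Dec P → ℕ
ind (yes _) = 1
ind (no _)  = 0

-- Edge lists as multigraphs, tested by symmetric functions

Edge : ℕ → Set
Edge n = Fin n × Fin n

Symmetric : ∀ {n} → (Fin n → Fin n → ℕ) → Set
Symmetric ψ = ∀ u v → ψ u v ≡ ψ v u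

-- Two edge lists count as the same multigraph when `ev ψ` agrees for every symmetric `ψ`. This
-- replaces permutations and orientations by linear identities; taking `incψ x`, `adψ i j` or the
-- constant 1 for `ψ` later returns degrees, multiplicities and numbers of edges.
ev : ∀ {n} → (Fin n → Fin n → ℕ) → List (Edge n) → ℕ
ev ψ = Σl (uncurry ψ)

cnt : ∀ {n} → Fin n → List (Fin n) → ℕ
cnt v = Σl (λ x → δ x v)

Unique : ∀ {n} → List (Fin n) → Set
Unique xs = ∀ v → cnt v xs ≤ 1

star : ∀ {n} → Fin n → List (Fin n) → List (Edge n)
star x = map (x ,_)

cl : ∀ {n} → List (Fin n) → List (Edge n)
cl []       = []
cl (x ∷ xs) = star x xs ++ cl xs

cls : ∀ {n} → List (List (Fin n)) → List (Edge n)
cls = concatMap cl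

incψ : ∀ {n} → Fin n → Fin n → Fin n → ℕ
incψ x u v = δ u x + δ v x

-- For distinct `i` and `j` this is the indicator of the pair ij. On the diagonal a loop counts
-- twice, so that `mg es i i ≡ 0` says that `es` has no loop at `i`.
adψ : ∀ {n} → Fin n → Fin n → Fin n → Fin n → ℕ
adψ i j u v = δ u i * δ v j + δ v i * δ u j

degL : ∀ {n} → List (Edge n) → Fin n → ℕ
degL es x = ev (incψ x) es

mg : ∀ {n} → List (Edge n) → Fin n → Fin n → ℕ
mg es i j = ev (adψ i j) es

incψ-sym : ∀ {n} (x : Fin n) → Symmetric (incψ x)
incψ-sym x u v = +-comm (δ u x) (δ v x)

adψ-sym : ∀ {n} (i j : Fin n) → Symmetric (adψ i j)
adψ-sym i j u v = +-comm (δ u i * δ v j) _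

adψ-flip : ∀ {n} (i j u v : Fin n) → adψ i j u v ≡ adψ j i u v
adψ-flip i j u v = lem (δ u i) (δ v j) (δ v i) (δ u j)
  where
  lem : ∀ a b c d → a * b + c * d ≡ d * c + b * a
  lem = solve 4 (λ a b c d → a :* b :+ c :* d := d :* c :+ b :* a) ≡.refl

ev-star : ∀ {n} (ψ : Fin n → Fin n → ℕ) x N → ev ψ (star x N) ≡ Σl (ψ x) N
ev-star ψ x N = Σl-map (uncurry ψ) (x ,_) N

mg-sym : ∀ {n} (es : List (Edge n)) i j → mg es i j ≡ mg es j i
mg-sym es i j = Σl-cong (λ (u , v) → adψ-flip i j u v) es

ΣF-adψ : ∀ {n} (i u v : Fin n) → ΣF (λ j → adψ i j u v) ≡ incψ i u v
ΣF-adψ i u v = ≡.trans (ΣF-+ (λ j → δ u i * δ v j) (λ j → δ v i * δ u j)) (cong₂ _+_ (one u v) (one v u))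
  where
  one : ∀ a b → ΣF (λ j → δ a i * δ b j) ≡ δ a i
  one a b = ≡.trans (Σl-* (δ a i) (δ b) (allFin _)) (≡.trans (cong (δ a i *_) (ΣF-δ b)) (*-identityʳ _))

ΣF-mg : ∀ {n} (es : List (Edge n)) i → ΣF (mg es i) ≡ degL es i
ΣF-mg {n} es i = ≡.trans (Σl-swap (λ j e → uncurry (adψ i j) e) (allFin n) es)
  (Σl-cong (λ (u , v) → ΣF-adψ i u v) es)

ΣF-mg′ : ∀ {n} (es : List (Edge n)) i → ΣF (λ w → mg es w i) ≡ degL es i
ΣF-mg′ es i = ≡.trans (ΣF-cong (λ w → mg-sym es w i)) (ΣF-mg es i)

ΣF-degL : ∀ {n} (es : List (Edge n)) → ΣF (degL es) ≡ 2 * length es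
ΣF-degL {n} es = ≡.trans (Σl-swap (λ x e → uncurry (incψ x) e) (allFin n) es)
  (≡.trans (Σl-cong (λ (u , v) → ≡.trans (ΣF-+ (δ u) (δ v)) (cong₂ _+_ (ΣF-δ u) (ΣF-δ v))) es)
    (≡.trans (Σl-const 2 es) (*-comm (length es) 2)))

degL≤ : ∀ {n} (es : List (Edge n)) x → degL es x ≤ 2 * length es
degL≤ es x = ≤-trans (ΣF-∈ (degL es) x) (≤-reflexive (ΣF-degL es))

mg-star : ∀ {n} (w : Fin n) ρ i j → mg (star w ρ) i j ≡ δ w i * cnt j ρ + δ w j * cnt i ρ
mg-star w ρ i j = ≡.trans (ev-star (adψ i j) w ρ)
  (≡.trans (Σl-+ (λ x → δ w i * δ x j) (λ x → δ x i * δ w j) ρ)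
    (cong₂ _+_ (Σl-* (δ w i) (λ x → δ x j) ρ) (≡.trans (Σl-*ʳ (δ w j) (λ x → δ x i) ρ) (*-comm _ (δ w j)))))

-- This is (n choose 2), by the recursion that `cl` follows; `tri≡C` makes the link with binomial
-- coefficients.
tri : ℕ → ℕ
tri zero    = 0
tri (suc n) = n + tri n

length-star : ∀ {n} (x : Fin n) N → length (star x N) ≡ length N
length-star x N = length-map _ N

length-cl : ∀ {n} (S : List (Fin n)) → length (cl S) ≡ tri (length S)
length-cl []       = ≡.refl
length-cl (x ∷ S) = ≡.trans (length-++ (star x S)) (cong₂ _+_ (length-star x S) (length-cl S))

degL-cl : ∀ {n} (S : List (Fin n)) x → degL (cl S) x ≡ cnt x S * pred (length S)
degL-cl []      x = ≡.refl
degL-cl (y ∷ S) x = ≡.trans (Σl-++ (uncurry (incψ x)) (star y S) (cl S))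
  (≡.trans (cong₂ _+_ (≡.trans (ev-star (incψ x) y S) (≡.trans (Σl-+ (λ _ → δ y x) (λ z → δ z x) S)
     (cong (_+ cnt x S) (Σl-const (δ y x) S)))) (degL-cl S x)) (lem S))
  where
  arith : ∀ a b l → (1 + l) * a + b + b * l ≡ (a + b) * (1 + l)
  arith = solve 3 (λ a b l → (con 1 :+ l) :* a :+ b :+ b :* l := (a :+ b) :* (con 1 :+ l)) ≡.refl
  lem : ∀ S → length S * δ y x + cnt x S + cnt x S * pred (length S) ≡ (δ y x + cnt x S) * length S
  lem []       = ≡.sym (*-zeroʳ (δ y x + 0))
  lem (z ∷ S') = arith (δ y x) (cnt x (z ∷ S')) (length S')

length≡ev : ∀ {n} (es : List (Edge n)) → length es ≡ ev (λ _ _ → 1) es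
length≡ev es = ≡.sym (≡.trans (Σl-const 1 es) (*-identityʳ _))

ΣF-cnt : ∀ {n} (xs : List (Fin n)) → ΣF (λ w → cnt w xs) ≡ length xs
ΣF-cnt {n} xs = ≡.trans (Σl-swap (λ w x → δ x w) (allFin n) xs)
  (≡.trans (Σl-cong ΣF-δ xs) (≡.trans (Σl-const 1 xs) (*-identityʳ _)))

-- Greedy choice of a common neighbour

-- The edges of base are not available. During the process the used edges number at most Emax and have degrees at most Bmax,
-- a vertex of used degree τ is saturated, and up to Av further vertices may be avoided at each choice.
record Host (n : ℕ) : Set where
  field
    g base : Fin n → Fin n → ℕ
    gsym : ∀ i j → g i j ≡ g j i
    girr : ∀ i → g i i ≡ 0
    bsym : ∀ i j → base i j ≡ base j i
    k r τ Bmax Emax Av b0 : ℕ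
    k>0   : 0 < k
    τ>0   : 0 < τ
    codeg : ∀ v → k * r * ΣF (λ w → 1 ∸ g w v) + k * n ≤ r * n
    bdeg  : ∀ v → ΣF (λ w → base w v) ≤ b0
    room  : 2 * (r * (k * (b0 + Bmax) + Av)) < n
    sparse : 4 * r * Emax ≤ τ * n

module Greedy {n : ℕ} (H : Host n) where
  open Host H

  Legal : List (Edge n) → Set
  Legal U = ∀ i j → mg U i j + base i j ≤ g i j

  -- By `codeg` a vertex has at most n/k - n/r non-neighbours, so `k` vertices together have at most
  -- n - n/r. A shorter `ρ` lacks `e` entries, and for each of these the inequality `k * n ≤ r * n`
  -- stands in for `codeg`.
  codegΣ : ∀ ρ → length ρ ≤ k → k * n ≤ r * n → r * Σl (λ v → ΣF (λ w → 1 ∸ g w v)) ρ + n ≤ r * n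
  codegΣ ρ l kn = *-cancelˡ-≤ k ⦃ >-nonZero k>0 ⦄ (begin
    k * (r * N + n)               ≡⟨ lem₁ k r N n ⟩
    k * r * N + k * n             ≤⟨ +-monoʳ-≤ (k * r * N) (*-monoʳ-≤ k (m≤n*m n k ⦃ >-nonZero k>0 ⦄)) ⟩
    k * r * N + k * (k * n)       ≡⟨ cong (_+ k * (k * n)) eqN ⟩
    M + k * (k * n)               ≡⟨ cong (λ t → M + t * (k * n)) (≡.sym (m+[n∸m]≡n l)) ⟩
    M + (length ρ + e) * (k * n)  ≡⟨ lem₂ M (length ρ) e (k * n) ⟩
    (M + length ρ * (k * n)) + e * (k * n)
                                  ≤⟨ +-mono-≤ (≤-reflexive (≡.sym eqM)) (*-monoʳ-≤ e kn) ⟩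
    Σl (λ v → k * r * nn v + k * n) ρ + e * (r * n)
                                  ≤⟨ +-monoˡ-≤ (e * (r * n)) (Σl-mono codeg ρ) ⟩
    Σl (λ _ → r * n) ρ + e * (r * n) ≡⟨ cong (_+ e * (r * n)) (Σl-const (r * n) ρ) ⟩
    length ρ * (r * n) + e * (r * n) ≡⟨ *-distribʳ-+ (r * n) (length ρ) e ⟨
    (length ρ + e) * (r * n)      ≡⟨ cong (_* (r * n)) (m+[n∸m]≡n l) ⟩
    k * (r * n)                   ∎)
    where
    open ≤-Reasoning
    nn : Fin n → ℕ
    nn v = ΣF (λ w → 1 ∸ g w v)
    N M e : ℕ
    N = Σl nn ρ
    M = Σl (λ v → k * r * nn v) ρ
    e = k ∸ length ρ
    eqN : k * r * N ≡ M
    eqN = ≡.sym (Σl-* (k * r) nn ρ)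
    eqM : Σl (λ v → k * r * nn v + k * n) ρ ≡ M + length ρ * (k * n)
    eqM = ≡.trans (Σl-+ (λ v → k * r * nn v) (λ _ → k * n) ρ) (cong (M +_) (Σl-const (k * n) ρ))
    lem₁ : ∀ k r N n → k * (r * N + n) ≡ k * r * N + k * n
    lem₁ = solve 4 (λ k r N n → k :* (r :* N :+ n) := k :* r :* N :+ k :* n) ≡.refl
    lem₂ : ∀ M l e x → M + (l + e) * x ≡ (M + l * x) + e * x
    lem₂ = solve 4 (λ M l e x → M :+ (l :+ e) :* x := (M :+ l :* x) :+ e :* x) ≡.refl

  -- As `g` vanishes on the diagonal, being joined to all of `ρ` already excludes being in `ρ`.
  w∉ρ : ∀ U w {ρ} → All (λ x → 1 ∸ g w x ≡ 0 × base w x ≡ 0 × mg U w x ≡ 0) ρ → cnt w ρ ≡ 0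
  w∉ρ U w [] = ≡.refl
  w∉ρ U w {x ∷ ρ} ((p , _) ∷ ps) = cong₂ _+_ (δ-≢ x≢w) (w∉ρ U w ps)
    where
    x≢w : x ≢ w
    x≢w ≡.refl with ≡.trans (≡.sym (cong (1 ∸_) (girr w))) p
    ... | ()

  legal-star : ∀ U w ρ → Unique ρ → Legal U →
    All (λ x → 1 ∸ g w x ≡ 0 × base w x ≡ 0 × mg U w x ≡ 0) ρ → Legal (star w ρ ++ U)
  legal-star U w ρ uρ lU good i j = ≤-trans (≤-reflexive (cong (_+ base i j)
      (≡.trans (Σl-++ (uncurry (adψ i j)) (star w ρ) U) (cong (_+ mg U i j) (mg-star w ρ i j)))))
      (go (w ≟ᶠ i) (w ≟ᶠ j))
    where
    one : ∀ x {ρ} → All (λ x → 1 ∸ g w x ≡ 0 × base w x ≡ 0 × mg U w x ≡ 0) ρ → cnt x ρ ≤ 1 →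
          cnt x ρ + mg U w x + base w x ≤ g w x
    one x [] _ = lU w x
    one x {y ∷ ρ} ((p , b , u) ∷ ps) c with y ≟ᶠ x
    ... | no _ = one x ps c
    ... | yes ≡.refl = ≤-trans (+-mono-≤ (+-mono-≤ c (≤-reflexive u)) (≤-reflexive b)) (m∸n≡0⇒m≤n p)
    go : _ → _ → δ w i * cnt j ρ + δ w j * cnt i ρ + mg U i j + base i j ≤ g i j
    go (yes ≡.refl) _ = ≤-trans (≤-reflexive (cong (λ t → t + mg U w j + base w j)
        (≡.trans (cong₂ _+_ (≡.trans (cong (_* cnt j ρ) (δ-refl w)) (*-identityˡ _))
          (≡.trans (cong (δ w j *_) (w∉ρ U w good)) (*-zeroʳ (δ w j)))) (+-identityʳ _)))) (one j good (uρ j))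
    go (no ne) (yes ≡.refl) = ≤-trans (≤-reflexive (cong₂ _+_ (cong₂ _+_
        (≡.trans (cong₂ _+_ (cong (_* cnt w ρ) (δ-≢ ne)) (≡.trans (cong (_* cnt i ρ) (δ-refl w)) (*-identityˡ _))) ≡.refl)
        (mg-sym U i w)) (bsym i w))) (≤-trans (one i good (uρ i)) (≤-reflexive (gsym w i)))
    go (no ne) (no ne') = ≤-trans (≤-reflexive (cong (λ t → t + mg U i j + base i j)
        (cong₂ _+_ (cong (_* cnt j ρ) (δ-≢ ne)) (cong (_* cnt i ρ) (δ-≢ ne'))))) (lU i j)

  -- Of the at least n/r common neighbours of `ρ`, fewer than n/(2r) are spoilt by barred or used
  -- pairs or by `av`, which is `room`. At most 2·Emax/τ ≤ n/(2r) vertices are saturated, which is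
  -- `sparse`, because the degrees in `U` add up to twice its length.
  pick : ∀ U → Legal U → (∀ v → degL U v ≤ Bmax) → length U ≤ Emax → ∀ ρ av → length ρ ≤ k → length av ≤ Av → Unique ρ →
    ∃[ w ] (cnt w av ≡ 0 × degL U w < τ × cnt w ρ ≡ 0 × Legal (star w ρ ++ U))
  pick U lU dU eU ρ av lρ lav uρ = finish (vanishes β few)
    where
    sat β : Fin n → ℕ
    sat w = ind (τ ≤? degL U w)
    bad : Fin n → Fin n → ℕ
    bad w x = (1 ∸ g w x) + (base w x + mg U w x)
    -- All objections to `w` in one number: missing, barred and used pairs, saturation, and
    -- membership in `av`.
    β w = Σl (bad w) ρ + (sat w + cnt w av)
    n>0 : 0 < n
    n>0 = ≤-trans (s≤s z≤n) room
    v₀ : Fin n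
    v₀ = fromℕ< n>0
    N : ℕ
    N = Σl (λ v → ΣF (λ w → 1 ∸ g w v)) ρ
    Tsat : τ * ΣF sat ≤ 2 * Emax
    Tsat = ≤-trans (≤-reflexive (≡.sym (Σl-* τ sat (allFin n))))
      (≤-trans (ΣF-mono each) (≤-trans (≤-reflexive (ΣF-degL U)) (*-monoʳ-≤ 2 eU)))
      where
      each : ∀ w → τ * sat w ≤ degL U w
      each w with τ ≤? degL U w
      ... | yes p = ≤-trans (≤-reflexive (*-identityʳ τ)) p
      ... | no _  = ≤-trans (≤-reflexive (*-zeroʳ τ)) z≤n
    2rsat : 2 * r * ΣF sat ≤ n
    2rsat = *-cancelˡ-≤ τ ⦃ >-nonZero τ>0 ⦄ (begin
      τ * (2 * r * ΣF sat)   ≡⟨ lem τ r (ΣF sat) ⟩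
      2 * r * (τ * ΣF sat)   ≤⟨ *-monoʳ-≤ (2 * r) Tsat ⟩
      2 * r * (2 * Emax)     ≡⟨ lem' r Emax ⟩
      4 * r * Emax           ≤⟨ sparse ⟩
      τ * n                  ∎)
      where
      open ≤-Reasoning
      lem : ∀ τ r s → τ * (2 * r * s) ≡ 2 * r * (τ * s)
      lem = solve 3 (λ τ r s → τ :* (con 2 :* r :* s) := con 2 :* r :* (τ :* s)) ≡.refl
      lem' : ∀ r e → 2 * r * (2 * e) ≡ 4 * r * e
      lem' = solve 2 (λ r e → con 2 :* r :* (con 2 :* e) := con 4 :* r :* e) ≡.refl
    Q : ℕ
    Q = k * (b0 + Bmax)
    ΣFβ : ΣF β ≤ N + (Q + (ΣF sat + Av))
    ΣFβ = begin
      ΣF β ≡⟨ ΣF-+ (λ w → Σl (bad w) ρ) (λ w → sat w + cnt w av) ⟩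
      ΣF (λ w → Σl (bad w) ρ) + ΣF (λ w → sat w + cnt w av)
        ≡⟨ cong₂ _+_ (Σl-swap bad (allFin n) ρ) (≡.trans (ΣF-+ sat (λ w → cnt w av)) (cong (ΣF sat +_) (ΣF-cnt av))) ⟩
      Σl (λ x → ΣF (λ w → bad w x)) ρ + (ΣF sat + length av)
        ≤⟨ +-mono-≤ (Σl-mono each ρ) (+-monoʳ-≤ (ΣF sat) lav) ⟩
      Σl (λ x → ΣF (λ w → 1 ∸ g w x) + (b0 + Bmax)) ρ + (ΣF sat + Av)
        ≡⟨ cong (_+ (ΣF sat + Av)) (≡.trans (Σl-+ (λ x → ΣF (λ w → 1 ∸ g w x)) (λ _ → b0 + Bmax) ρ)
             (cong (N +_) (Σl-const (b0 + Bmax) ρ))) ⟩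
      N + length ρ * (b0 + Bmax) + (ΣF sat + Av)
        ≤⟨ +-monoˡ-≤ (ΣF sat + Av) (+-monoʳ-≤ N (*-monoˡ-≤ (b0 + Bmax) lρ)) ⟩
      N + Q + (ΣF sat + Av) ≡⟨ +-assoc N Q _ ⟩
      N + (Q + (ΣF sat + Av)) ∎
      where
      open ≤-Reasoning
      each : ∀ x → ΣF (λ w → bad w x) ≤ ΣF (λ w → 1 ∸ g w x) + (b0 + Bmax)
      each x = ≤-trans (≤-reflexive (≡.trans (ΣF-+ (λ w → 1 ∸ g w x) (λ w → base w x + mg U w x))
          (cong (ΣF (λ w → 1 ∸ g w x) +_) (ΣF-+ (λ w → base w x) (λ w → mg U w x)))))
        (+-monoʳ-≤ (ΣF (λ w → 1 ∸ g w x)) (+-mono-≤ (bdeg x) (≤-trans (≤-reflexive (ΣF-mg′ U x)) (dU x))))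
    2r : ℕ
    2r = 2 * r
    -- The comparison is multiplied by `2 * r`, since n/r and n/(2r) need not be integers.
    few : ΣF β < n
    few = *-cancelˡ-< 2r _ _ (begin-strict
      2r * ΣF β                             ≤⟨ *-monoʳ-≤ 2r ΣFβ ⟩
      2r * (N + (Q + (ΣF sat + Av)))        ≡⟨ lem r N Q (ΣF sat) Av ⟩
      2 * (r * N) + (2r * ΣF sat + 2 * (r * (Q + Av)))
        <⟨ +-monoʳ-< (2 * (r * N)) (+-mono-≤-< 2rsat room) ⟩
      2 * (r * N) + (n + n)                 ≡⟨ lem' (r * N) n ⟩
      2 * (r * N + n)                       ≤⟨ *-monoʳ-≤ 2 (codegΣ ρ lρ (≤-trans (m≤n+m _ _) (codeg v₀))) ⟩
      2 * (r * n)                           ≡⟨ *-assoc 2 r n ⟨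
      2r * n                                ∎)
      where
      open ≤-Reasoning
      lem : ∀ r N Q s a → 2 * r * (N + (Q + (s + a))) ≡ 2 * (r * N) + (2 * r * s + 2 * (r * (Q + a)))
      lem = solve 5 (λ r N Q s a → con 2 :* r :* (N :+ (Q :+ (s :+ a))) := con 2 :* (r :* N) :+ (con 2 :* r :* s :+ con 2 :* (r :* (Q :+ a)))) ≡.refl
      lem' : ∀ x n → 2 * x + (n + n) ≡ 2 * (x + n)
      lem' = solve 2 (λ x n → con 2 :* x :+ (n :+ n) := con 2 :* (x :+ n)) ≡.refl
    unsat : ∀ w → sat w ≡ 0 → degL U w < τ
    unsat w e with τ ≤? degL U w
    ... | no ¬p = ≰⇒> ¬p
    good : ∀ w ρ → Σl (bad w) ρ ≡ 0 → All (λ x → 1 ∸ g w x ≡ 0 × base w x ≡ 0 × mg U w x ≡ 0) ρ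
    good w []      _ = []
    good w (x ∷ ρ) e = let b = m+n≡0⇒m≡0 (bad w x) e
                           c = m+n≡0⇒n≡0 (1 ∸ g w x) b
      in (m+n≡0⇒m≡0 (1 ∸ g w x) b , m+n≡0⇒m≡0 (base w x) c , m+n≡0⇒n≡0 (base w x) c) ∷ good w ρ (m+n≡0⇒n≡0 (bad w x) e)
    finish : ∃[ w ] β w ≡ 0 → ∃[ w ] (cnt w av ≡ 0 × degL U w < τ × cnt w ρ ≡ 0 × Legal (star w ρ ++ U))
    finish (w , e) = w , m+n≡0⇒n≡0 (sat w) rest0 , unsat w (m+n≡0⇒m≡0 (sat w) rest0) , w∉ρ U w gd , legal-star U w ρ uρ lU gd
      where
      rest0 : sat w + cnt w av ≡ 0
      rest0 = m+n≡0⇒n≡0 (Σl (bad w) ρ) e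
      gd : All (λ x → 1 ∸ g w x ≡ 0 × base w x ≡ 0 × mg U w x ≡ 0) ρ
      gd = good w ρ (m+n≡0⇒m≡0 (Σl (bad w) ρ) e)

-- Transformers between stars

cnt-++ : ∀ {n} (v : Fin n) xs ys → cnt v (xs ++ ys) ≡ cnt v xs + cnt v ys
cnt-++ v = Σl-++ (λ x → δ x v)

-- The edges new form a transformer between A and B.
record Exch {n : ℕ} (q : ℕ) (A B new : List (Edge n)) : Set where
  field
    Q₁ Q₀ : List (List (Fin n))
    size₁ : All (λ S → length S ≡ q) Q₁
    size₀ : All (λ S → length S ≡ q) Q₀
    fwd : ∀ ψ → Symmetric ψ → ev ψ A + ev ψ new ≡ ev ψ (cls Q₁)
    bwd : ∀ ψ → Symmetric ψ → ev ψ B + ev ψ new ≡ ev ψ (cls Q₀)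

-- A program: edges are added to U0, touching only vertices that are demanded or have small degree in U0.
record Context {n : ℕ} (H : Host n) : Set where
  open Host H
  open Greedy H
  field
    U0  : List (Edge n)
    dem : Fin n → ℕ
    K   : ℕ
    legal0 : Legal U0
    deg0   : ∀ v → 2 * K + degL U0 v ≤ Bmax
    len0   : K + length U0 ≤ Emax

module Program {n : ℕ} {H : Host n} (Γ : Context H) where
  open Host H
  open Greedy H
  open Context Γ

  -- The degree is measured in `U0`, before the program starts. Hence a vertex without demand
  -- exceeds `τ` by at most what a single program can add.
  Fr : Fin n → Set
  Fr v = 0 < dem v ⊎ degL U0 v < τ

  -- `j` is the number of edges that may still be spent. Programs are stated for every remainder
  -- `j`, which is what makes them composable.
  record Inv (j : ℕ) (E : List (Edge n)) : Set where
    field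
      leg : Legal (E ++ U0)
      frs : All (λ (u , v) → Fr u × Fr v) E
      bud : length E + j ≤ K
  open Inv

  weaken : ∀ {i j E} → i ≤ j → Inv j E → Inv i E
  weaken {E = E} le I = record { leg = leg I ; frs = frs I ; bud = ≤-trans (+-monoʳ-≤ (length E) le) (bud I) }

  start : Inv K []
  start = record { leg = legal0 ; frs = [] ; bud = ≤-refl }

  record Res (E : List (Edge n)) (j : ℕ) (P : List (Edge n) → Set) : Set where
    constructor res
    field
      new  : List (Edge n)
      inv  : Inv j (new ++ E)
      post : P new
  open Res

  mapRes : ∀ {E j} {P P' : List (Edge n) → Set} → Res E j P → (∀ a → P a → P' a) → Res E j P'
  mapRes (res a I p) f = res a I (f a p)

  -- Every choice is charged `k` edges, also for a shorter `ρ`, so that costs depend only on the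
  -- number of choices.
  pickP : ∀ {j E} ρ av → length ρ ≤ k → length av ≤ Av → Unique ρ → All Fr ρ → Inv (k + j) E →
    ∃[ w ] (cnt w av ≡ 0 × cnt w ρ ≡ 0 × Fr w × Inv j (star w ρ ++ E))
  pickP {j} {E} ρ av lρ lav uρ fρ I = cont (pick (E ++ U0) (leg I) dE eE ρ av lρ lav uρ)
    where
    E≤K : length E ≤ K
    E≤K = ≤-trans (m≤m+n _ _) (bud I)
    dE : ∀ v → degL (E ++ U0) v ≤ Bmax
    dE v = ≤-trans (≤-reflexive (Σl-++ (uncurry (incψ v)) E U0)) (≤-trans (+-monoˡ-≤ _ (≤-trans (degL≤ E v) (*-monoʳ-≤ 2 E≤K))) (deg0 v))
    eE : length (E ++ U0) ≤ Emax
    eE = ≤-trans (≤-reflexive (length-++ E)) (≤-trans (+-monoˡ-≤ _ E≤K) len0)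
    lem : ∀ a b c → a + b + c ≡ b + (a + c)
    lem = solve 3 (λ a b c → a :+ b :+ c := b :+ (a :+ c)) ≡.refl
    cont : ∃[ w ] (cnt w av ≡ 0 × degL (E ++ U0) w < τ × cnt w ρ ≡ 0 × Legal (star w ρ ++ E ++ U0)) →
           ∃[ w ] (cnt w av ≡ 0 × cnt w ρ ≡ 0 × Fr w × Inv j (star w ρ ++ E))
    cont (w , a , s , r0 , l) = w , a , r0 , frw , record
      { leg = subst Legal (≡.sym (++-assoc (star w ρ) E U0)) l
      ; frs = go ρ fρ
      ; bud = ≤-trans (≤-reflexive (cong (_+ j) (length-++ (star w ρ)))) (≤-trans (+-monoˡ-≤ j (+-monoˡ-≤ (length E)
                (≤-trans (≤-reflexive (length-star w ρ)) lρ))) (≤-trans (≤-reflexive (lem k (length E) j)) (bud I))) }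
      where
      frw : Fr w
      frw = inj₂ (≤-trans (s≤s (≤-trans (m≤n+m _ _) (≤-reflexive (≡.sym (Σl-++ (uncurry (incψ w)) E U0))))) s)
      go : ∀ ρ → All Fr ρ → All (λ (u , v) → Fr u × Fr v) (star w ρ ++ E)
      go []      []       = frs I
      go (x ∷ ρ) (f ∷ fs) = (frw , f) ∷ go ρ fs

  _⊑_ : List (Fin n) → List (Fin n) → Set
  xs ⊑ ys = ∀ v → cnt v xs ≤ cnt v ys

  unique-∷ : ∀ {w : Fin n} {env : List (Fin n)} → Unique env → cnt w env ≡ 0 → Unique (w ∷ env)
  unique-∷ {w} {env} u e v with w ≟ᶠ v
  ... | yes ≡.refl = ≤-reflexive (cong suc e)
  ... | no _       = u v

  ⊑-∷ : ∀ {xs env} w → xs ⊑ env → xs ⊑ (w ∷ env)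
  ⊑-∷ w p v = ≤-trans (p v) (m≤n+m _ (δ w v))

  module StarSwap (d : ℕ) (k≡ : k ≡ 2 + (d + d)) (x x' : Fin n) (fx : Fr x) (fx' : Fr x') where

    -- Invariant of a column that the current row has not reached yet: it must be disjoint from the
    -- row and from the elements `Nr` of `N` that will complete later rows. Both are stored as
    -- inclusions into the repetition-free list `env`, and so survive when `env` grows.
    record Col (env row Nr c : List (Fin n)) : Set where
      field
        inRow  : (x ∷ x' ∷ row ++ c) ⊑ env
        inNext : (x ∷ x' ∷ c ++ Nr) ⊑ env
        fc     : All Fr c
        short  : length c ≤ d
    open Col

    -- `value` is the balance of one row: the new edges are the growth of the row clique and of the
    -- column cliques, together with the edges from the new vertices `ws` to `x` and `x'`.
    record RowRes (row : List (Fin n)) (todo : List (List (Fin n))) (Nr env : List (Fin n)) (new : List (Edge n)) : Set where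
      field
        ws env'  : List (Fin n)
        cols     : List (List (Fin n))
        uniq     : Unique env'
        lenEnv   : length env' ≡ length todo + length env
        grows    : env ⊑ env'
        colsOK   : All (λ c → (x ∷ x' ∷ c ++ Nr) ⊑ env' × All Fr c) cols
        lenCols  : length cols ≡ length todo
        heights  : ∀ h → All (λ c → length c ≡ h) todo → All (λ c → length c ≡ suc h) cols
        lenWs    : length ws ≡ length todo
        content  : ∀ f → Σl f (concat cols) ≡ Σl f ws + Σl f (concat todo)
        value    : ∀ ψ → Symmetric ψ → ev ψ new + ev ψ (cl row) + ev ψ (cls todo) ≡
                     ev ψ (cl (ws ++ row)) + ev ψ (cls cols) + (Σl (ψ x) ws + Σl (ψ x') ws)

    private
      extendRow : ∀ {w c row todo Nr env b} → Fr w → Col env row Nr c → RowRes (w ∷ row) todo Nr (w ∷ env) b →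
        RowRes row (c ∷ todo) Nr env (b ++ star w (x ∷ x' ∷ row ++ c))
      extendRow {w} {c} {row} {todo} {Nr} {env} {b} fw oc R = record
        { ws = ws ++ [ w ] ; env' = env' ; cols = (w ∷ c) ∷ cols ; uniq = uniq
        ; lenEnv = ≡.trans lenEnv (+-suc (length todo) (length env))
        ; grows = λ v → ≤-trans (m≤n+m _ (δ w v)) (grows v)
        ; colsOK = ((λ v → ≤-trans (≤-trans (≤-reflexive (lem (δ x v) (δ x' v) (δ w v) (cnt v (c ++ Nr)))) (+-monoʳ-≤ (δ w v) (inNext oc v))) (grows v))
                     , fw ∷ fc oc) ∷ colsOK
        ; lenCols = cong suc lenCols
        ; heights = λ { h (p ∷ ps) → cong suc p ∷ heights h ps }
        ; lenWs = ≡.trans (length-++ ws) (≡.trans (+-comm _ 1) (cong suc lenWs))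
        ; content = λ f → ≡.trans (cong (f w +_) (≡.trans (Σl-++ f c (concat cols)) (cong (Σl f c +_) (content f))))
             (≡.trans (lem₂ (f w) (Σl f c) (Σl f ws) (Σl f (concat todo)))
               (≡.sym (cong₂ _+_ (Σl-++ f ws [ w ]) (Σl-++ f c (concat todo)))))
        ; value = val }
        where
        open RowRes R
        lem : ∀ a b c d → a + (b + (c + d)) ≡ c + (a + (b + d))
        lem = solve 4 (λ a b c d → a :+ (b :+ (c :+ d)) := c :+ (a :+ (b :+ d))) ≡.refl
        lem₂ : ∀ a b c d → a + (b + (c + d)) ≡ c + (a + 0) + (b + d)
        lem₂ = solve 4 (λ a b c d → a :+ (b :+ (c :+ d)) := c :+ (a :+ con 0) :+ (b :+ d)) ≡.refl
        ρ : List (Fin n)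
        ρ = x ∷ x' ∷ row ++ c
        a₁ : ∀ b p p' r c R C t → b + (p + (p' + (r + c))) + R + (C + t) ≡ b + (r + R) + t + (p + p' + (c + C))
        a₁ = solve 8 (λ b p p' r c R C t → b :+ (p :+ (p' :+ (r :+ c))) :+ R :+ (C :+ t) := b :+ (r :+ R) :+ t :+ (p :+ p' :+ (c :+ C))) ≡.refl
        a₂ : ∀ A B s s' p p' C → A + B + (s + s') + (p + p' + C) ≡ A + (C + B) + ((s + (p + 0)) + (s' + (p' + 0)))
        a₂ = solve 7 (λ A B s s' p p' C → A :+ B :+ (s :+ s') :+ (p :+ p' :+ C) := A :+ (C :+ B) :+ ((s :+ (p :+ con 0)) :+ (s' :+ (p' :+ con 0)))) ≡.refl
        val : ∀ ψ → Symmetric ψ → ev ψ (b ++ star w ρ) + ev ψ (cl row) + ev ψ (cls (c ∷ todo)) ≡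
                     ev ψ (cl ((ws ++ [ w ]) ++ row)) + ev ψ (cls ((w ∷ c) ∷ cols)) + (Σl (ψ x) (ws ++ [ w ]) + Σl (ψ x') (ws ++ [ w ]))
        val ψ s = begin
          ev ψ (b ++ star w ρ) + ev ψ (cl row) + ev ψ (cl c ++ cls todo)
            ≡⟨ cong₂ _+_ (cong (_+ ev ψ (cl row)) (≡.trans (Σl-++ (uncurry ψ) b (star w ρ)) (cong (ev ψ b +_) evρ))) (Σl-++ (uncurry ψ) (cl c) (cls todo)) ⟩
          ev ψ b + (ψ x w + (ψ x' w + (Sr + Sc))) + ev ψ (cl row) + (ev ψ (cl c) + ev ψ (cls todo))
            ≡⟨ a₁ (ev ψ b) (ψ x w) (ψ x' w) Sr Sc (ev ψ (cl row)) (ev ψ (cl c)) (ev ψ (cls todo)) ⟩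
          ev ψ b + (Sr + ev ψ (cl row)) + ev ψ (cls todo) + (ψ x w + ψ x' w + (Sc + ev ψ (cl c)))
            ≡⟨ cong (λ t → ev ψ b + t + ev ψ (cls todo) + (ψ x w + ψ x' w + (Sc + ev ψ (cl c)))) (≡.sym (clw row)) ⟩
          ev ψ b + ev ψ (cl (w ∷ row)) + ev ψ (cls todo) + (ψ x w + ψ x' w + (Sc + ev ψ (cl c)))
            ≡⟨ cong₂ _+_ (value ψ s) (cong (ψ x w + ψ x' w +_) (≡.sym (clw c))) ⟩
          ev ψ (cl (ws ++ w ∷ row)) + ev ψ (cls cols) + (Σl (ψ x) ws + Σl (ψ x') ws) + (ψ x w + ψ x' w + ev ψ (cl (w ∷ c)))
            ≡⟨ a₂ (ev ψ (cl (ws ++ w ∷ row))) (ev ψ (cls cols)) (Σl (ψ x) ws) (Σl (ψ x') ws) (ψ x w) (ψ x' w) (ev ψ (cl (w ∷ c))) ⟩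
          ev ψ (cl (ws ++ w ∷ row)) + (ev ψ (cl (w ∷ c)) + ev ψ (cls cols)) + ((Σl (ψ x) ws + (ψ x w + 0)) + (Σl (ψ x') ws + (ψ x' w + 0)))
            ≡⟨ cong₂ _+_ (cong₂ _+_ (cong (λ l → ev ψ (cl l)) (≡.sym (++-assoc ws [ w ] row))) (≡.sym (Σl-++ (uncurry ψ) (cl (w ∷ c)) (cls cols))))
                 (≡.sym (cong₂ _+_ (Σl-++ (ψ x) ws [ w ]) (Σl-++ (ψ x') ws [ w ]))) ⟩
          ev ψ (cl ((ws ++ [ w ]) ++ row)) + ev ψ (cls ((w ∷ c) ∷ cols)) + (Σl (ψ x) (ws ++ [ w ]) + Σl (ψ x') (ws ++ [ w ])) ∎
          where
          open ≡.≡-Reasoning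
          Sr Sc : ℕ
          Sr = Σl (ψ w) row
          Sc = Σl (ψ w) c
          evρ : ev ψ (star w ρ) ≡ ψ x w + (ψ x' w + (Sr + Sc))
          evρ = ≡.trans (ev-star ψ w ρ) (cong₂ _+_ (s w x) (cong₂ _+_ (s w x') (Σl-++ (ψ w) row c)))
          clw : ∀ l → ev ψ (cl (w ∷ l)) ≡ Σl (ψ w) l + ev ψ (cl l)
          clw l = ≡.trans (Σl-++ (uncurry ψ) (star w l) (cl l)) (cong (_+ ev ψ (cl l)) (ev-star ψ w l))

      All-++ : ∀ {xs ys} → All Fr xs → All Fr ys → All Fr (xs ++ ys)
      All-++ []       q = q
      All-++ (p ∷ ps) q = p ∷ All-++ ps q

      advance : ∀ {w env row Nr cs} → All (Col env row Nr) cs → All (Col (w ∷ env) (w ∷ row) Nr) cs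
      advance [] = []
      advance {w} {env} {row} {Nr} {c ∷ _} (o ∷ os) = record
        { inRow = λ v → ≤-trans (≤-reflexive (lem (δ x v) (δ x' v) (δ w v) (cnt v (row ++ c)))) (+-monoʳ-≤ (δ w v) (inRow o v))
        ; inNext = ⊑-∷ {x ∷ x' ∷ c ++ Nr} {env} w (inNext o) ; fc = fc o ; short = short o } ∷ advance os
        where
        lem : ∀ a b c d → a + (b + (c + d)) ≡ c + (a + (b + d))
        lem = solve 4 (λ a b c d → a :+ (b :+ (c :+ d)) := c :+ (a :+ (b :+ d))) ≡.refl

    -- A new grid vertex must be joined to `x` and `x'`, to at most `d` earlier vertices of its row
    -- and to at most `d` of its column. These 2 + 2d = 2q-2 neighbours are the source of the degree
    -- condition.
    pickRow : ∀ row todo Nr env {j E} → Unique env → length todo + length env ≤ Av → length todo + length row ≤ suc d →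
      All Fr row → All (Col env row Nr) todo → Inv (length todo * k + j) E → Res E j (RowRes row todo Nr env)
    pickRow row [] Nr env uq la lr fr [] I = res [] I record
      { ws = [] ; env' = env ; cols = [] ; uniq = uq ; lenEnv = ≡.refl ; grows = λ _ → ≤-refl ; colsOK = [] ; lenCols = ≡.refl
      ; heights = λ _ _ → [] ; lenWs = ≡.refl ; content = λ _ → ≡.refl ; value = λ ψ _ → ≡.sym (+-identityʳ _) }
    pickRow row (c ∷ todo) Nr env {j} {E} uq la lr fr (oc ∷ os) I =
      cont (pickP {j = length todo * k + j} {E = E} ρ env short' (≤-trans (m≤n+m _ (suc (length todo))) la) (λ v → ≤-trans (inRow oc v) (uq v))
             (fx ∷ fx' ∷ All-++ fr (fc oc)) (subst (λ t → Inv t E) (+-assoc k _ j) I))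
      where
      ρ : List (Fin n)
      ρ = x ∷ x' ∷ row ++ c
      short' : length ρ ≤ k
      short' = ≤-trans (s≤s (s≤s (≤-trans (≤-reflexive (length-++ row))
                 (+-mono-≤ (s≤s⁻¹ (≤-trans (s≤s (m≤n+m _ (length todo))) lr)) (short oc))))) (≤-reflexive (≡.sym k≡))
      cont : ∃[ w ] (cnt w env ≡ 0 × cnt w ρ ≡ 0 × Fr w × Inv (length todo * k + j) (star w ρ ++ E)) →
             Res E j (RowRes row (c ∷ todo) Nr env)
      cont (w , w∉env , _ , fw , J) = glue (pickRow (w ∷ row) todo Nr (w ∷ env) (unique-∷ {w} {env} uq w∉env)
               (≤-trans (≤-reflexive (+-suc (length todo) (length env))) la)
               (≤-trans (≤-reflexive (+-suc (length todo) (length row))) lr) (fw ∷ fr) (advance os) J)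
        where
        glue : Res (star w ρ ++ E) j (RowRes (w ∷ row) todo Nr (w ∷ env)) → Res E j (RowRes row (c ∷ todo) Nr env)
        glue (res b J' R) = res (b ++ star w ρ) (subst (Inv j) (≡.sym (++-assoc b (star w ρ) E)) J') (extendRow fw oc R)

    record GridRes (ys : List (Fin n)) (cols : List (List (Fin n))) (h : ℕ) (new : List (Edge n)) : Set where
      field
        rows cols' : List (List (Fin n))
        W          : List (Fin n)
        lenRows : All (λ r → length r ≡ suc (length cols)) rows
        lenCols : All (λ c → length c ≡ h + length ys) cols'
        rowSum  : ∀ f → Σl (Σl f) rows ≡ Σl f ys + Σl f W
        content : ∀ f → Σl f (concat cols') ≡ Σl f W + Σl f (concat cols)
        value   : ∀ ψ → Symmetric ψ → ev ψ new + ev ψ (cls cols) ≡ ev ψ (cls rows) + ev ψ (cls cols') + (Σl (ψ x) W + Σl (ψ x') W)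

    private
      extendGrid : ∀ {y ys cols h env a b} → (R : RowRes [ y ] cols ys env a) → GridRes ys (RowRes.cols R) (suc h) b →
        GridRes (y ∷ ys) cols h (b ++ a)
      extendGrid {y} {ys} {cols} {h} {env} {a} {b} R G = record
        { rows = (ws ++ [ y ]) ∷ rows ; cols' = cols' ; W = ws ++ W
        ; lenRows = ≡.trans (length-++ ws) (≡.trans (+-comm _ 1) (cong suc lenWs))
                    ∷ subst (λ t → All (λ r → length r ≡ suc t) rows) (RowRes.lenCols R) lenRows
        ; lenCols = subst (λ t → All (λ c → length c ≡ t) cols') (≡.sym (+-suc h (length ys))) lenCols
        ; rowSum = λ f → ≡.trans (cong₂ _+_ (Σl-++ f ws [ y ]) (rowSum f))
             (≡.trans (s₁ (Σl f ws) (f y) (Σl f ys) (Σl f W)) (cong (f y + Σl f ys +_) (≡.sym (Σl-++ f ws W))))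
        ; content = λ f → ≡.trans (content f) (≡.trans (cong (Σl f W +_) (RowRes.content R f))
             (≡.trans (s₂ (Σl f W) (Σl f ws) (Σl f (concat cols))) (cong (_+ Σl f (concat cols)) (≡.sym (Σl-++ f ws W)))))
        ; value = val }
        where
        open RowRes R using (ws; lenWs)
        open GridRes G
        s₁ : ∀ w y s W → w + (y + 0) + (s + W) ≡ y + s + (w + W)
        s₁ = solve 4 (λ w y s W → w :+ (y :+ con 0) :+ (s :+ W) := y :+ s :+ (w :+ W)) ≡.refl
        s₂ : ∀ W w c → W + (w + c) ≡ w + W + c
        s₂ = solve 3 (λ W w c → W :+ (w :+ c) := w :+ W :+ c) ≡.refl
        s₃ : ∀ b a c → b + a + c ≡ a + 0 + c + b
        s₃ = solve 3 (λ b a c → b :+ a :+ c := a :+ con 0 :+ c :+ b) ≡.refl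
        s₄ : ∀ r c w w' b → r + c + (w + w') + b ≡ r + (b + c) + (w + w')
        s₄ = solve 5 (λ r c w w' b → r :+ c :+ (w :+ w') :+ b := r :+ (b :+ c) :+ (w :+ w')) ≡.refl
        s₅ : ∀ r R C W W' w w' → r + (R + C + (W + W')) + (w + w') ≡ r + R + C + ((w + W) + (w' + W'))
        s₅ = solve 7 (λ r R C W W' w w' → r :+ (R :+ C :+ (W :+ W')) :+ (w :+ w') := r :+ R :+ C :+ ((w :+ W) :+ (w' :+ W'))) ≡.refl
        val : ∀ ψ → Symmetric ψ → ev ψ (b ++ a) + ev ψ (cls cols) ≡
          ev ψ (cls ((ws ++ [ y ]) ∷ rows)) + ev ψ (cls cols') + (Σl (ψ x) (ws ++ W) + Σl (ψ x') (ws ++ W))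
        val ψ s = begin
          ev ψ (b ++ a) + ev ψ (cls cols)                      ≡⟨ cong (_+ ev ψ (cls cols)) (Σl-++ (uncurry ψ) b a) ⟩
          ev ψ b + ev ψ a + ev ψ (cls cols)                    ≡⟨ s₃ (ev ψ b) (ev ψ a) (ev ψ (cls cols)) ⟩
          ev ψ a + 0 + ev ψ (cls cols) + ev ψ b                ≡⟨ cong (_+ ev ψ b) (RowRes.value R ψ s) ⟩
          r₁ + ev ψ (cls C) + (Σl (ψ x) ws + Σl (ψ x') ws) + ev ψ b
            ≡⟨ s₄ r₁ (ev ψ (cls C)) (Σl (ψ x) ws) (Σl (ψ x') ws) (ev ψ b) ⟩
          r₁ + (ev ψ b + ev ψ (cls C)) + (Σl (ψ x) ws + Σl (ψ x') ws)
            ≡⟨ cong (λ t → r₁ + t + (Σl (ψ x) ws + Σl (ψ x') ws)) (value ψ s) ⟩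
          r₁ + (ev ψ (cls rows) + ev ψ (cls cols') + (Σl (ψ x) W + Σl (ψ x') W)) + (Σl (ψ x) ws + Σl (ψ x') ws)
            ≡⟨ s₅ r₁ (ev ψ (cls rows)) (ev ψ (cls cols')) (Σl (ψ x) W) (Σl (ψ x') W) (Σl (ψ x) ws) (Σl (ψ x') ws) ⟩
          r₁ + ev ψ (cls rows) + ev ψ (cls cols') + ((Σl (ψ x) ws + Σl (ψ x) W) + (Σl (ψ x') ws + Σl (ψ x') W))
            ≡⟨ cong₂ (λ t u → t + ev ψ (cls cols') + u) (≡.sym (Σl-++ (uncurry ψ) (cl (ws ++ [ y ])) (cls rows)))
                 (≡.sym (cong₂ _+_ (Σl-++ (ψ x) ws W) (Σl-++ (ψ x') ws W))) ⟩
          ev ψ (cls ((ws ++ [ y ]) ∷ rows)) + ev ψ (cls cols') + (Σl (ψ x) (ws ++ W) + Σl (ψ x') (ws ++ W)) ∎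
          where
          open ≡.≡-Reasoning
          C : List (List (Fin n))
          C = RowRes.cols R
          r₁ : ℕ
          r₁ = ev ψ (cl (ws ++ [ y ]))

    -- The equation `h + length ys ≡ suc d` ties the height of the columns to the rows still to
    -- come, so that all columns end with q-1 vertices.
    grid : ∀ ys cols h env {j E} → Unique env → length ys * length cols + length env ≤ Av → length cols ≤ d → h + length ys ≡ suc d →
      All (λ c → (x ∷ x' ∷ c ++ ys) ⊑ env × All Fr c) cols → All (λ c → length c ≡ h) cols → All Fr ys →
      Inv (length ys * (length cols * k) + j) E → Res E j (GridRes ys cols h)
    grid [] cols h env uq la lc hy ok hs fy I = res [] I record
      { rows = [] ; cols' = cols ; W = [] ; lenRows = [] ; lenCols = subst (λ t → All (λ c → length c ≡ t) cols) (≡.sym (+-identityʳ h)) hs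
      ; rowSum = λ _ → ≡.refl ; content = λ _ → ≡.refl ; value = λ _ _ → ≡.sym (+-identityʳ _) }
    grid (y ∷ ys) cols h env {j} {E} uq la lc hy ok hs (fy ∷ fys) I =
      cont (pickRow [ y ] cols ys env uq (≤-trans (+-monoˡ-≤ (length env) (m≤m+n (length cols) _)) la)
        (≤-trans (≤-reflexive (+-comm (length cols) 1)) (s≤s lc)) (fy ∷ []) (mk ok hs) (subst (λ t → Inv t E) (+-assoc (length cols * k) _ j) I))
      where
      h≤d : h ≤ d
      h≤d = ≤-trans (m≤m+n h (length ys)) (≤-reflexive (suc-injective (≡.trans (≡.sym (+-suc h (length ys))) hy)))
      lem : ∀ a b y c → a + (b + (y + c)) ≡ a + (b + (c + y))
      lem = solve 4 (λ a b y c → a :+ (b :+ (y :+ c)) := a :+ (b :+ (c :+ y))) ≡.refl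
      mk : ∀ {cs} → All (λ c → (x ∷ x' ∷ c ++ y ∷ ys) ⊑ env × All Fr c) cs → All (λ c → length c ≡ h) cs → All (Col env [ y ] ys) cs
      mk [] [] = []
      mk {c ∷ _} ((p , f) ∷ ok) (e ∷ hs) = record
        { inRow = λ v → ≤-trans (≤-trans (≤-reflexive (lem (δ x v) (δ x' v) (δ y v) (cnt v c)))
                    (+-monoʳ-≤ (δ x v) (+-monoʳ-≤ (δ x' v) (≤-trans (+-monoʳ-≤ (cnt v c) (m≤m+n (δ y v) (cnt v ys))) (≤-reflexive (≡.sym (cnt-++ v c (y ∷ ys)))))))) (p v)
        ; inNext = λ v → ≤-trans (+-monoʳ-≤ (δ x v) (+-monoʳ-≤ (δ x' v) (≤-trans (≤-reflexive (cnt-++ v c ys))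
                    (≤-trans (+-monoʳ-≤ (cnt v c) (m≤n+m (cnt v ys) (δ y v))) (≤-reflexive (≡.sym (cnt-++ v c (y ∷ ys)))))))) (p v)
        ; fc = f ; short = ≤-trans (≤-reflexive e) h≤d } ∷ mk ok hs
      cont : Res E (length ys * (length cols * k) + j) (RowRes [ y ] cols ys env) → Res E j (GridRes (y ∷ ys) cols h)
      cont (res a J R) = glue (grid ys (RowRes.cols R) (suc h) (RowRes.env' R) (RowRes.uniq R)
          (≤-trans (≤-reflexive (≡.trans (cong₂ _+_ (cong (length ys *_) (RowRes.lenCols R)) (RowRes.lenEnv R)) (≡.trans (+-swap (length ys * length cols) (length cols) (length env)) (≡.sym (+-assoc (length cols) _ _))))) la)
          (≤-trans (≤-reflexive (RowRes.lenCols R)) lc) (≡.trans (≡.sym (+-suc h (length ys))) hy)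
          (RowRes.colsOK R) (RowRes.heights R h hs) fys
          (subst (λ t → Inv (length ys * (t * k) + j) (a ++ E)) (≡.sym (RowRes.lenCols R)) J))
        where
        glue : Res (a ++ E) j (GridRes ys (RowRes.cols R) (suc h)) → Res E j (GridRes (y ∷ ys) cols h)
        glue (res b J' G) = res (b ++ a) (subst (Inv j) (≡.sym (++-assoc b a E)) J') (extendGrid R G)

  ev-cones : ∀ ψ (x : Fin n) Q → ev ψ (cls (map (x ∷_) Q)) ≡ Σl (Σl (ψ x)) Q + ev ψ (cls Q)
  ev-cones ψ x []      = ≡.refl
  ev-cones ψ x (S ∷ Q) = ≡.trans (Σl-++ (uncurry ψ) (star x S ++ cl S) _) (≡.trans
    (cong₂ _+_ (≡.trans (Σl-++ (uncurry ψ) (star x S) (cl S)) (cong (_+ ev ψ (cl S)) (ev-star ψ x S))) (ev-cones ψ x Q))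
    (≡.trans (+-interchange (Σl (ψ x) S) _ _ _) (cong (Σl (ψ x) S + Σl (Σl (ψ x)) Q +_) (≡.sym (Σl-++ (uncurry ψ) (cl S) (cls Q))))))

  -- The star at x over N is exchanged for the star at x': a (q-1) × (q-2) grid of new vertices is joined to
  -- x and x', its rows are completed by the elements of N, and its rows and columns are made cliques.
  module _ (d : ℕ) (k≡ : k ≡ 2 + (d + d)) where
    swapCost : ℕ
    swapCost = suc d * (d * k)

    starSwap : ∀ x x' N {j E} → Unique (x ∷ x' ∷ N) → length N ≡ suc d → suc d * d + (2 + suc d) ≤ Av → Fr x → Fr x' → All Fr N →
      Inv (swapCost + j) E → Res E j (Exch (2 + d) (star x N) (star x' N))
    starSwap x x' N {j} {E} uq lN la fx fx' fN I =
      mapRes (grid N cols 0 (x ∷ x' ∷ N) uq la' (≤-reflexive (length-replicate d)) lN (ok d) (hs d) fN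
        (subst (λ t → Inv t E) (cong (_+ j) (≡.sym (cong₂ (λ a b → a * (b * k)) lN (length-replicate d)))) I)) finish
      where
      open StarSwap d k≡ x x' fx fx'
      cols : List (List (Fin n))
      cols = replicate d []
      la' : length N * length cols + length (x ∷ x' ∷ N) ≤ Av
      la' = ≤-trans (≤-reflexive (cong₂ _+_ (cong₂ _*_ lN (length-replicate d)) (cong (2 +_) lN))) la
      ok : ∀ d → All (λ c → (x ∷ x' ∷ c ++ N) ⊑ (x ∷ x' ∷ N) × All Fr c) (replicate d [])
      ok zero    = []
      ok (suc d) = ((λ _ → ≤-refl) , []) ∷ ok d
      hs : ∀ d → All (λ c → length c ≡ 0) (replicate d (List (Fin n) Function.∋ []))
      hs zero    = []
      hs (suc d) = ≡.refl ∷ hs d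
      cls0 : ∀ ψ d → ev ψ (cls (replicate d [])) ≡ 0
      cls0 ψ zero    = ≡.refl
      cls0 ψ (suc d) = cls0 ψ d
      con0 : ∀ (f : Fin n → ℕ) d → Σl f (concat (replicate d [])) ≡ 0
      con0 f zero    = ≡.refl
      con0 f (suc d) = con0 f d
      sizes : ∀ z {m Q} → All (λ S → length S ≡ m) Q → All (λ S → length S ≡ suc m) (map (z ∷_) Q)
      sizes z []       = []
      sizes z (p ∷ ps) = cong suc p ∷ sizes z ps
      All-++ : ∀ {P : List (Fin n) → Set} {xs ys} → All P xs → All P ys → All P (xs ++ ys)
      All-++ []       q = q
      All-++ (p ∷ ps) q = p ∷ All-++ ps q
      arith : ∀ N R C W W' → N + (R + C + (W + W')) ≡ N + W + R + (W' + C)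
      arith = solve 5 (λ N R C W W' → N :+ (R :+ C :+ (W :+ W')) := N :+ W :+ R :+ (W' :+ C)) ≡.refl
      finish : ∀ new → GridRes N cols 0 new → Exch (2 + d) (star x N) (star x' N) new
      finish new G = record
        { Q₁ = map (x ∷_) rows ++ map (x' ∷_) cols' ; Q₀ = map (x' ∷_) rows ++ map (x ∷_) cols'
        ; size₁ = sz x x' ; size₀ = sz x' x
        ; fwd = λ ψ s → half ψ x x' (val ψ s)
        ; bwd = λ ψ s → half ψ x' x (≡.trans (val ψ s) (cong (ev ψ (cls rows) + ev ψ (cls cols') +_) (+-comm (Σl (ψ x) W) _))) }
        where
        open GridRes G
        sz : ∀ a b → All (λ S → length S ≡ 2 + d) (map (a ∷_) rows ++ map (b ∷_) cols')
        sz a b = All-++ (sizes a (subst (λ t → All (λ r → length r ≡ suc t) rows) (length-replicate d) lenRows))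
                        (sizes b (subst (λ t → All (λ c → length c ≡ t) cols') lN lenCols))
        val : ∀ ψ → Symmetric ψ → ev ψ new ≡ ev ψ (cls rows) + ev ψ (cls cols') + (Σl (ψ x) W + Σl (ψ x') W)
        val ψ s = ≡.trans (≡.trans (≡.sym (+-identityʳ _)) (cong (ev ψ new +_) (≡.sym (cls0 ψ d)))) (value ψ s)
        -- The rows are coned over `a` and the columns over `b`. Only the rows contain `N`, so the
        -- star over `N` used in this way is the one at `a`; the two states differ by exchanging `x`
        -- and `x'`, in which `new` is symmetric.
        half : ∀ ψ a b → ev ψ new ≡ ev ψ (cls rows) + ev ψ (cls cols') + (Σl (ψ a) W + Σl (ψ b) W) →
          ev ψ (star a N) + ev ψ new ≡ ev ψ (cls (map (a ∷_) rows ++ map (b ∷_) cols'))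
        half ψ a b v = begin
          ev ψ (star a N) + ev ψ new ≡⟨ cong₂ _+_ (ev-star ψ a N) v ⟩
          Σl (ψ a) N + (ev ψ (cls rows) + ev ψ (cls cols') + (Σl (ψ a) W + Σl (ψ b) W))
            ≡⟨ arith (Σl (ψ a) N) (ev ψ (cls rows)) (ev ψ (cls cols')) (Σl (ψ a) W) (Σl (ψ b) W) ⟩
          (Σl (ψ a) N + Σl (ψ a) W + ev ψ (cls rows)) + (Σl (ψ b) W + ev ψ (cls cols'))
            ≡⟨ ≡.sym (cong₂ _+_ (≡.trans (ev-cones ψ a rows) (cong (_+ ev ψ (cls rows)) (rowSum (ψ a))))
                 (≡.trans (ev-cones ψ b cols') (cong (_+ ev ψ (cls cols')) (≡.trans (≡.sym (Σl-concat (ψ b) cols')) (≡.trans (content (ψ b))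
                    (≡.trans (cong (Σl (ψ b) W +_) (con0 (ψ b) d)) (+-identityʳ _))))))) ⟩
          ev ψ (cls (map (a ∷_) rows)) + ev ψ (cls (map (b ∷_) cols'))
            ≡⟨ ≡.sym (≡.trans (Σl-concatMap (uncurry ψ) cl (map (a ∷_) rows ++ map (b ∷_) cols')) (≡.trans (Σl-++ (λ S → ev ψ (cl S)) (map (a ∷_) rows) _)
                 (≡.sym (cong₂ _+_ (Σl-concatMap (uncurry ψ) cl (map (a ∷_) rows)) (Σl-concatMap (uncurry ψ) cl (map (b ∷_) cols')))))) ⟩
          ev ψ (cls (map (a ∷_) rows ++ map (b ∷_) cols')) ∎
          where open ≡.≡-Reasoning

-- Algebra of exchanges

ev-++ : ∀ {n} (ψ : Fin n → Fin n → ℕ) es fs → ev ψ (es ++ fs) ≡ ev ψ es + ev ψ fs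
ev-++ ψ = Σl-++ (uncurry ψ)

ev-cls-++ : ∀ {n} (ψ : Fin n → Fin n → ℕ) Q Q' → ev ψ (cls (Q ++ Q')) ≡ ev ψ (cls Q) + ev ψ (cls Q')
ev-cls-++ ψ Q Q' = ≡.trans (Σl-concatMap (uncurry ψ) cl (Q ++ Q')) (≡.trans (Σl-++ (λ S → ev ψ (cl S)) Q Q')
  (≡.sym (cong₂ _+_ (Σl-concatMap (uncurry ψ) cl Q) (Σl-concatMap (uncurry ψ) cl Q'))))

All-++⁺ : {X : Set} {P : X → Set} {xs ys : List X} → All P xs → All P ys → All P (xs ++ ys)
All-++⁺ []       q = q
All-++⁺ (p ∷ ps) q = p ∷ All-++⁺ ps q

exch-++ : ∀ {n q} {A B a A' B' b : List (Edge n)} → Exch q A B a → Exch q A' B' b → Exch q (A ++ A') (B ++ B') (b ++ a)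
exch-++ {A = A} {B} {a} {A'} {B'} {b} X Y = record
  { Q₁ = X.Q₁ ++ Y.Q₁ ; Q₀ = X.Q₀ ++ Y.Q₀ ; size₁ = All-++⁺ X.size₁ Y.size₁ ; size₀ = All-++⁺ X.size₀ Y.size₀
  ; fwd = λ ψ s → one ψ A A' X.Q₁ Y.Q₁ (X.fwd ψ s) (Y.fwd ψ s) ; bwd = λ ψ s → one ψ B B' X.Q₀ Y.Q₀ (X.bwd ψ s) (Y.bwd ψ s) }
  where
  module X = Exch X
  module Y = Exch Y
  arith : ∀ A A' a b → A + A' + (b + a) ≡ A + a + (A' + b)
  arith = solve 4 (λ A A' a b → A :+ A' :+ (b :+ a) := A :+ a :+ (A' :+ b)) ≡.refl
  one : ∀ ψ A A' Q Q' → ev ψ A + ev ψ a ≡ ev ψ (cls Q) → ev ψ A' + ev ψ b ≡ ev ψ (cls Q') →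
    ev ψ (A ++ A') + ev ψ (b ++ a) ≡ ev ψ (cls (Q ++ Q'))
  one ψ A A' Q Q' p p' = ≡.trans (cong₂ _+_ (ev-++ ψ A A') (ev-++ ψ b a)) (≡.trans (arith (ev ψ A) _ _ _)
    (≡.trans (cong₂ _+_ p p') (≡.sym (ev-cls-++ ψ Q Q'))))

-- Only sums with the auxiliary edges matter, so edges that occur on both sides of an exchange can
-- be moved into the transformer itself. All catalysts below enter in this way.
exch-conv : ∀ {n q} {A B a : List (Edge n)} A' B' a' → Exch q A B a →
  (∀ ψ → Symmetric ψ → ev ψ A' + ev ψ a' ≡ ev ψ A + ev ψ a) → (∀ ψ → Symmetric ψ → ev ψ B' + ev ψ a' ≡ ev ψ B + ev ψ a) → Exch q A' B' a'
exch-conv A' B' a' X f b = record { Q₁ = Q₁ ; Q₀ = Q₀ ; size₁ = size₁ ; size₀ = size₀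
  ; fwd = λ ψ s → ≡.trans (f ψ s) (fwd ψ s) ; bwd = λ ψ s → ≡.trans (b ψ s) (bwd ψ s) }
  where open Exch X

exch-flip : ∀ {n q} {A B a : List (Edge n)} → Exch q A B a → Exch q B A a
exch-flip X = record { Q₁ = Q₀ ; Q₀ = Q₁ ; size₁ = size₀ ; size₀ = size₁ ; fwd = bwd ; bwd = fwd }
  where open Exch X

exch-[] : ∀ {n q} → Exch {n} q [] [] []
exch-[] = record { Q₁ = [] ; Q₀ = [] ; size₁ = [] ; size₀ = [] ; fwd = λ _ _ → ≡.refl ; bwd = λ _ _ → ≡.refl }

-- An item ((u , v) , (s , t)) is an edge uv with two apices: s will be joined to u, and t to v.
Item : ℕ → Set
Item n = Edge n × Edge n

baseE apexE legE : ∀ {n} → List (Item n) → List (Edge n)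
baseE []                          = []
baseE ((e , _) ∷ is)              = e ∷ baseE is
apexE []                          = []
apexE ((_ , f) ∷ is)              = f ∷ apexE is
legE []                           = []
legE (((u , v) , (s , t)) ∷ is) = (u , s) ∷ (v , t) ∷ legE is

apexV : ∀ {n} → List (Item n) → List (Fin n)
apexV []                    = []
apexV ((_ , (s , t)) ∷ is) = s ∷ t ∷ apexV is

sel : ∀ {n} → Fin n → Fin n → Fin n → List (Fin n)
sel u x s with u ≟ᶠ x
... | yes _ = [ s ]
... | no _  = []

-- After all switches these apices are what is left to treat at a vertex `x` of the base graph.
-- Their number is the degree of `x` there, a multiple of q-1 if the base graph is divisible.
ends : ∀ {n} → Fin n → List (Item n) → List (Fin n)
ends x []                          = []
ends x (((u , v) , (s , t)) ∷ is) = sel u x s ++ sel v x t ++ ends x is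

Σl-sel : ∀ {n} (f : Fin n → ℕ) u x s → Σl f (sel u x s) ≡ δ u x * f s
Σl-sel f u x s with u ≟ᶠ x
... | yes _ = ≡.refl
... | no _  = ≡.refl

Σl-ends : ∀ {n} (f : Fin n → ℕ) x is → Σl f (ends x is) ≡ Σl (λ ((u , v) , (s , t)) → δ u x * f s + δ v x * f t) is
Σl-ends f x [] = ≡.refl
Σl-ends f x (((u , v) , (s , t)) ∷ is) = ≡.trans (Σl-++ f (sel u x s) _) (≡.trans (cong₂ _+_ (Σl-sel f u x s)
  (≡.trans (Σl-++ f (sel v x t) _) (cong₂ _+_ (Σl-sel f v x t) (Σl-ends f x is)))) (≡.sym (+-assoc (δ u x * f s) _ _)))

length-ends : ∀ {n} (x : Fin n) is → length (ends x is) ≡ degL (baseE is) x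
length-ends x is = ≡.trans (≡.sym (≡.trans (Σl-const 1 (ends x is)) (*-identityʳ _))) (≡.trans (Σl-ends (λ _ → 1) x is) (go is))
  where
  go : ∀ is → Σl (λ ((u , v) , (s , t)) → δ u x * 1 + δ v x * 1) is ≡ degL (baseE is) x
  go [] = ≡.refl
  go (((u , v) , _) ∷ is) = cong₂ _+_ (cong₂ _+_ (*-identityʳ (δ u x)) (*-identityʳ (δ v x))) (go is)

cnt-ends : ∀ {n} (x : Fin n) is v → cnt v (ends x is) ≤ cnt v (apexV is)
cnt-ends x is w = ≤-trans (≤-reflexive (Σl-ends (λ s → δ s w) x is)) (go is)
  where
  le : ∀ u c → δ u x * c ≤ c
  le u c = ≤-trans (*-monoˡ-≤ c (δ≤1 u x)) (≤-reflexive (*-identityˡ c))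
  go : ∀ is → Σl (λ ((u , v) , (s , t)) → δ u x * δ s w + δ v x * δ t w) is ≤ cnt w (apexV is)
  go [] = z≤n
  go (((u , v) , (s , t)) ∷ is) = ≤-trans (+-mono-≤ (+-mono-≤ (le u (δ s w)) (le v (δ t w))) (go is)) (≤-reflexive (+-assoc (δ s w) _ _))

ΣF-ends : ∀ {n} (ψ : Fin n → Fin n → ℕ) (is : List (Item n)) → ev ψ (concatMap (λ x → star x (ends x is)) (allFin n)) ≡ ev ψ (legE is)
ΣF-ends {n} ψ is = ≡.trans (Σl-concatMap (uncurry ψ) (λ x → star x (ends x is)) (allFin n))
  (≡.trans (ΣF-cong (λ x → ≡.trans (ev-star ψ x (ends x is)) (Σl-ends (ψ x) x is)))
  (≡.trans (Σl-swap (λ x ((u , v) , (s , t)) → δ u x * ψ x s + δ v x * ψ x t) (allFin n) is) (go is)))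
  where
  go : ∀ is → Σl (λ ((u , v) , (s , t)) → ΣF (λ x → δ u x * ψ x s + δ v x * ψ x t)) is ≡ ev ψ (legE is)
  go [] = ≡.refl
  go (((u , v) , (s , t)) ∷ is) = ≡.trans (cong₂ _+_ (≡.trans (ΣF-+ (λ x → δ u x * ψ x s) (λ x → δ v x * ψ x t))
    (cong₂ _+_ (ΣF-δ* u (λ x → ψ x s)) (ΣF-δ* v (λ x → ψ x t)))) (go is)) (+-assoc (ψ u s) _ _)

ΣF-ends-z : ∀ {n} (ψ : Fin n → Fin n → ℕ) z (is : List (Item n)) →
  ev ψ (concatMap (λ x → star z (ends x is)) (allFin n)) ≡ Σl (ψ z) (apexV is)
ΣF-ends-z {n} ψ z is = ≡.trans (Σl-concatMap (uncurry ψ) (λ x → star z (ends x is)) (allFin n))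
  (≡.trans (ΣF-cong (λ x → ≡.trans (ev-star ψ z (ends x is)) (Σl-ends (ψ z) x is)))
  (≡.trans (Σl-swap (λ x ((u , v) , (s , t)) → δ u x * ψ z s + δ v x * ψ z t) (allFin n) is) (go is)))
  where
  one : ∀ u c → ΣF (λ x → δ u x * c) ≡ c
  one u c = ΣF-δ* u (λ _ → c)
  go : ∀ is → Σl (λ ((u , v) , (s , t)) → ΣF (λ x → δ u x * ψ z s + δ v x * ψ z t)) is ≡ Σl (ψ z) (apexV is)
  go [] = ≡.refl
  go (((u , v) , (s , t)) ∷ is) = ≡.trans (cong₂ _+_ (≡.trans (ΣF-+ (λ x → δ u x * ψ z s) (λ x → δ v x * ψ z t))
    (cong₂ _+_ (one u (ψ z s)) (one v (ψ z t)))) (go is)) (+-assoc (ψ z s) _ _)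

-- Absorbers of divisible graphs of bounded size

module Absorber {n : ℕ} {H : Host n} (Γ : Context H) (d : ℕ) (k≡ : Host.k H ≡ 2 + (d + d)) (4≤k : 4 ≤ Host.k H)
                (avS : suc d * d + (2 + suc d) ≤ Host.Av H) where
  open Host H
  open Program Γ

  q : ℕ
  q = 2 + d

  sc : ℕ
  sc = swapCost d k≡

  Prog : ℕ → (List (Edge n) → Set) → Set
  Prog c P = ∀ {j E} → Inv (c + j) E → Res E j P

  infixr 2 _⨾_
  _⨾_ : ∀ {c c' A B A' B'} → Prog c (Exch q A B) → Prog c' (Exch q A' B') → Prog (c + c') (Exch q (A ++ A') (B ++ B'))
  _⨾_ {c} {c'} {A} {B} {A'} {B'} p p' {j} {E} I = cont (p (subst (λ t → Inv t E) (+-assoc c c' j) I))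
    where
    cont : Res E (c' + j) (Exch q A B) → Res E j (Exch q (A ++ A') (B ++ B'))
    cont (res a J X) = glue (p' J)
      where
      glue : Res (a ++ E) j (Exch q A' B') → Res E j (Exch q (A ++ A') (B ++ B'))
      glue (res b J' Y) = res (b ++ a) (subst (Inv j) (≡.sym (++-assoc b a E)) J') (exch-++ X Y)

  relax : ∀ {c c' P} → c ≤ c' → Prog c P → Prog c' P
  relax le p {j} I = p (weaken (+-monoˡ-≤ j le) I)

  stop : Prog 0 (Exch q [] [])
  stop I = res [] I exch-[]

  record Many (m : ℕ) (ρ env : List (Fin n)) (new : List (Edge n)) : Set where
    field
      P : List (Fin n)
      len : length P ≡ m
      fresh : Unique (P ++ env)
      fr : All Fr P
      value : ∀ ψ → Symmetric ψ → ev ψ new ≡ Σl (λ r → Σl (ψ r) P) ρ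

  pickMany : ∀ m ρ env → length ρ ≤ k → m + length env ≤ Av → Unique ρ → All Fr ρ → Unique env → Prog (m * k) (Many m ρ env)
  pickMany zero ρ env lρ la uρ fρ ue I = res [] I record { P = [] ; len = ≡.refl ; fresh = ue ; fr = []
    ; value = λ ψ _ → ≡.sym (Σl-zero ρ) }
  pickMany (suc m) ρ env lρ la uρ fρ ue {j} {E} I =
    cont (pickMany m ρ env lρ (≤-trans (n≤1+n _) la) uρ fρ ue (subst (λ t → Inv t E) (lem k (m * k) j) I))
    where
    lem : ∀ k m j → k + m + j ≡ m + (k + j)
    lem = solve 3 (λ k m j → k :+ m :+ j := m :+ (k :+ j)) ≡.refl
    cont : Res E (k + j) (Many m ρ env) → Res E j (Many (suc m) ρ env)
    cont (res a J M) = glue (pickP {j} {a ++ E} ρ (P ++ env) lρ (≤-trans (≤-reflexive (≡.trans (length-++ P) (cong (_+ length env) len))) (≤-trans (n≤1+n _) la)) uρ fρ J)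
      where
      open Many M
      glue : ∃[ w ] (cnt w (P ++ env) ≡ 0 × cnt w ρ ≡ 0 × Fr w × Inv j (star w ρ ++ a ++ E)) → Res E j (Many (suc m) ρ env)
      glue (w , w∉ , _ , fw , J') = res (star w ρ ++ a) (subst (Inv j) (≡.sym (++-assoc (star w ρ) a E)) J') record
        { P = w ∷ P ; len = cong suc len ; fresh = unique-∷ {w} {P ++ env} fresh w∉ ; fr = fw ∷ fr
        ; value = λ ψ s → ≡.trans (ev-++ ψ (star w ρ) a) (≡.trans (cong₂ _+_ (≡.trans (ev-star ψ w ρ) (Σl-cong (s w) ρ)) (value ψ s))
            (≡.sym (Σl-+ (λ r → ψ r w) (λ r → Σl (ψ r) P) ρ))) }

  Uniq4 : Fin n → Fin n → Fin n → Fin n → Set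
  Uniq4 u v s t = Unique (u ∷ t ∷ v ∷ s ∷ [])

  switchCost : ℕ
  switchCost = d * k + (sc + sc)

  -- {uv, st} is exchanged for {us, vt}: with auxiliary neighbours P of u and t, these are two star swaps between u and t.
  switch : ∀ u v s t → Uniq4 u v s t → Fr u → Fr v → Fr s → Fr t → d + 4 ≤ Av →
    Prog switchCost (Exch q ((u , v) ∷ (s , t) ∷ []) ((u , s) ∷ (v , t) ∷ []))
  switch u v s t uq fu fv fs ft la {j} {E} I =
    cont (pickMany d (u ∷ t ∷ []) (u ∷ t ∷ v ∷ s ∷ []) (≤-trans (s≤s (s≤s z≤n)) 4≤k) la
      (λ w → ≤-trans (+-monoʳ-≤ (δ u w) (+-monoʳ-≤ (δ t w) z≤n)) (uq w)) (fu ∷ ft ∷ []) uq (subst (λ c → Inv c E) (+-assoc (d * k) _ j) I))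
    where
    A' B' : List (Edge n)
    A' = (u , v) ∷ (s , t) ∷ []
    B' = (u , s) ∷ (v , t) ∷ []
    cont : Res E (sc + sc + j) (Many d (u ∷ t ∷ []) (u ∷ t ∷ v ∷ s ∷ [])) → Res E j (Exch q A' B')
    cont (res a J M) = glue (_⨾_ {sc} {sc} (starSwap d k≡ u t (v ∷ P) uq₁ (cong suc len) avS fu ft (fv ∷ fr))
                                  (starSwap d k≡ t u (s ∷ P) uq₂ (cong suc len) avS ft fu (fs ∷ fr)) J)
      where
      open Many M
      c₁ : ∀ u t v s p → p + (u + (t + (v + (s + 0)))) ≡ u + (t + (v + p)) + s
      c₁ = solve 5 (λ u t v s p → p :+ (u :+ (t :+ (v :+ (s :+ con 0)))) := u :+ (t :+ (v :+ p)) :+ s) ≡.refl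
      c₂ : ∀ u t v s p → p + (u + (t + (v + (s + 0)))) ≡ t + (u + (s + p)) + v
      c₂ = solve 5 (λ u t v s p → p :+ (u :+ (t :+ (v :+ (s :+ con 0)))) := t :+ (u :+ (s :+ p)) :+ v) ≡.refl
      uq₁ : Unique (u ∷ t ∷ v ∷ P)
      uq₁ w = ≤-trans (m≤m+n _ (δ s w)) (≤-trans (≤-reflexive (≡.sym (≡.trans (cnt-++ w P _) (c₁ (δ u w) (δ t w) (δ v w) (δ s w) (cnt w P))))) (fresh w))
      uq₂ : Unique (t ∷ u ∷ s ∷ P)
      uq₂ w = ≤-trans (m≤m+n _ (δ v w)) (≤-trans (≤-reflexive (≡.sym (≡.trans (cnt-++ w P _) (c₂ (δ u w) (δ t w) (δ v w) (δ s w) (cnt w P))))) (fresh w))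
      -- `P` fills both stars up to the q-1 leaves that `starSwap` demands. The pairs from `u` and
      -- `t` to `P` are the same on both sides, so only uv, ts against tv, us remains.
      X₁ Y₁ : List (Edge n)
      X₁ = star u (v ∷ P) ++ star t (s ∷ P)
      Y₁ = star t (v ∷ P) ++ star u (s ∷ P)
      s₁ : ∀ uv st b U τ → uv + (st + 0) + (b + (U + (τ + 0))) ≡ uv + U + (st + τ) + b
      s₁ = solve 5 (λ uv st b U τ → uv :+ (st :+ con 0) :+ (b :+ (U :+ (τ :+ con 0))) := uv :+ U :+ (st :+ τ) :+ b) ≡.refl
      s₂ : ∀ us vt b U τ → us + (vt + 0) + (b + (U + (τ + 0))) ≡ vt + τ + (us + U) + b
      s₂ = solve 5 (λ us vt b U τ → us :+ (vt :+ con 0) :+ (b :+ (U :+ (τ :+ con 0))) := vt :+ τ :+ (us :+ U) :+ b) ≡.refl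
      glue : Res (a ++ E) j (Exch q X₁ Y₁) → Res E j (Exch q A' B')
      glue (res b J' X) = res (b ++ a) (subst (Inv j) (≡.sym (++-assoc b a E)) J') (exch-conv A' B' (b ++ a) X
        (λ ψ sy → ≡.trans (cong (ev ψ A' +_) (≡.trans (ev-++ ψ b a) (cong (ev ψ b +_) (value ψ sy))))
          (≡.trans (s₁ (ψ u v) (ψ s t) (ev ψ b) (Σl (ψ u) P) (Σl (ψ t) P))
            (≡.sym (cong (_+ ev ψ b) (≡.trans (ev-++ ψ (star u (v ∷ P)) (star t (s ∷ P)))
              (cong₂ _+_ (ev-star ψ u (v ∷ P)) (≡.trans (ev-star ψ t (s ∷ P)) (cong (_+ Σl (ψ t) P) (sy t s)))))))))
        (λ ψ sy → ≡.trans (cong (ev ψ B' +_) (≡.trans (ev-++ ψ b a) (cong (ev ψ b +_) (value ψ sy))))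
          (≡.trans (s₂ (ψ u s) (ψ v t) (ev ψ b) (Σl (ψ u) P) (Σl (ψ t) P))
            (≡.sym (cong (_+ ev ψ b) (≡.trans (ev-++ ψ (star t (v ∷ P)) (star u (s ∷ P)))
              (cong₂ _+_ (≡.trans (ev-star ψ t (v ∷ P)) (cong (_+ Σl (ψ t) P) (sy t v))) (ev-star ψ u (s ∷ P)))))))))

  mapProg : ∀ {c P P'} → Prog c P → (∀ a → P a → P' a) → Prog c P'
  mapProg p f I = mapRes (p I) f

  -- `starSwap` moves exactly q-1 leaves at a time; this is where degrees divisible by q-1 are used.
  chunks : ∀ t x z N → length N ≡ t * suc d → Unique (x ∷ z ∷ N) → Fr x → Fr z → All Fr N → Prog (t * sc) (Exch q (star x N) (star z N))
  chunks zero    x z []      e uq fx fz fN = stop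
  chunks zero    x z (_ ∷ _) () uq fx fz fN
  chunks (suc t) x z N       e uq fx fz fN = go (cut (suc d) N e)
    where
    cut : ∀ m (N : List (Fin n)) {l} → length N ≡ m + l → ∃[ N₁ ] ∃[ N₂ ] (N ≡ N₁ ++ N₂ × length N₁ ≡ m × length N₂ ≡ l)
    cut zero    N       e = [] , N , ≡.refl , ≡.refl , e
    cut (suc m) (y ∷ N) e = let N₁ , N₂ , e₀ , e₁ , e₂ = cut m N (suc-injective e) in y ∷ N₁ , N₂ , cong (y ∷_) e₀ , cong suc e₁ , e₂
    splitAll : ∀ N₁ {N₂} → All Fr (N₁ ++ N₂) → All Fr N₁ × All Fr N₂
    splitAll []       f       = [] , f
    splitAll (_ ∷ N₁) (p ∷ f) = let a , b = splitAll N₁ f in p ∷ a , b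
    go : ∃[ N₁ ] ∃[ N₂ ] (N ≡ N₁ ++ N₂ × length N₁ ≡ suc d × length N₂ ≡ t * suc d) → Prog (suc t * sc) (Exch q (star x N) (star z N))
    go (N₁ , N₂ , ≡.refl , e₁ , e₂) = mapProg
      (_⨾_ {sc} {t * sc} (starSwap d k≡ x z N₁ (λ w → ≤-trans (mono w (≤-trans (m≤m+n _ _) (≤-reflexive (≡.sym (cnt-++ w N₁ N₂))))) (uq w)) e₁ avS fx fz (proj₁ (splitAll N₁ fN)))
           (chunks t x z N₂ e₂ (λ w → ≤-trans (mono w (≤-trans (m≤n+m _ (cnt w N₁)) (≤-reflexive (≡.sym (cnt-++ w N₁ N₂))))) (uq w)) fx fz (proj₂ (splitAll N₁ fN))))
      (λ a X → exch-conv (star x (N₁ ++ N₂)) (star z (N₁ ++ N₂)) a X (λ ψ _ → cong (_+ ev ψ a) (st ψ x)) (λ ψ _ → cong (_+ ev ψ a) (st ψ z)))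
      where
      mono : ∀ w {a b} → a ≤ b → δ x w + (δ z w + a) ≤ δ x w + (δ z w + b)
      mono w p = +-monoʳ-≤ (δ x w) (+-monoʳ-≤ (δ z w) p)
      st : ∀ ψ y → ev ψ (star y (N₁ ++ N₂)) ≡ ev ψ (star y N₁ ++ star y N₂)
      st ψ y = ≡.trans (ev-star ψ y (N₁ ++ N₂)) (≡.trans (Σl-++ (ψ y) N₁ N₂)
        (≡.sym (≡.trans (ev-++ ψ (star y N₁) (star y N₂)) (cong₂ _+_ (ev-star ψ y N₁) (ev-star ψ y N₂)))))

  Apart : List (Fin n) → List (Fin n) → Set
  Apart xs ys = ∀ v → cnt v xs ≡ 0 ⊎ cnt v ys ≡ 0

  apart-∷ : ∀ {w xs ys} → Apart xs ys → cnt w ys ≡ 0 → Apart (w ∷ xs) ys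
  apart-∷ {w} ap e v with w ≟ᶠ v
  ... | yes ≡.refl = inj₂ e
  ... | no _       = ap v

  apart-out : ∀ {v xs ys} → Apart xs ys → 1 ≤ cnt v ys → cnt v xs ≡ 0
  apart-out {v} ap p with ap v
  ... | inj₁ e = e
  ... | inj₂ e with ≤-trans p (≤-reflexive e)
  ... | ()

  record ItemOK (z : Fin n) (av : List (Fin n)) (i : Item n) : Set where
    constructor mkItem
    u = proj₁ (proj₁ i)
    v = proj₂ (proj₁ i)
    s = proj₁ (proj₂ i)
    t = proj₂ (proj₂ i)
    field
      uq : Uniq4 u v s t
      fu : Fr u
      fv : Fr v
      fs : Fr s
      ft : Fr t
      u∈ : 1 ≤ cnt u av
      v∈ : 1 ≤ cnt v av
      u≢z : u ≢ z
      v≢z : v ≢ z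

  -- The pass visits all `n` vertices, but its cost is charged to the degrees in the base graph.
  -- These sum to twice the number of items, so the total cost does not depend on `n`.
  endsProg : ∀ z is → (∀ x → ends x is ≡ [] ⊎ (Unique (x ∷ z ∷ ends x is) × Fr x)) → (∀ x → ∃[ t ] degL (baseE is) x ≡ t * suc d) →
    Fr z → (∀ x → All Fr (ends x is)) → ∀ xs →
    Prog (Σl (λ x → degL (baseE is) x * sc) xs) (Exch q (concatMap (λ x → star x (ends x is)) xs) (concatMap (λ x → star z (ends x is)) xs))
  endsProg z is uq dv fz fe []       = stop
  endsProg z is uq dv fz fe (x ∷ xs) = _⨾_ {degL (baseE is) x * sc} (one (uq x) (dv x)) (endsProg z is uq dv fz fe xs)
    where
    one : ends x is ≡ [] ⊎ (Unique (x ∷ z ∷ ends x is) × Fr x) → ∃[ t ] degL (baseE is) x ≡ t * suc d →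
      Prog (degL (baseE is) x * sc) (Exch q (star x (ends x is)) (star z (ends x is)))
    one (inj₁ e) _ = relax z≤n (subst (λ N → Prog 0 (Exch q (star x N) (star z N))) (≡.sym e) stop)
    one (inj₂ (u , fx)) (t , e) = relax (*-monoˡ-≤ sc (≤-trans (m≤m*n t (suc d)) (≤-reflexive (≡.sym e))))
      (chunks t x z (ends x is) (≡.trans (length-ends x is) e) u fx fz (fe x))

  switches : ∀ {z av} is → All (ItemOK z av) is → d + 4 ≤ Av → Prog (length is * switchCost) (Exch q (baseE is ++ apexE is) (legE is))
  switches []       []         la = stop
  switches (((u , v) , (s , t)) ∷ is) (ok ∷ oks) la = mapProg
      (_⨾_ {switchCost} {length is * switchCost} (switch u v s t (ItemOK.uq ok) (ItemOK.fu ok) (ItemOK.fv ok) (ItemOK.fs ok) (ItemOK.ft ok) la) (switches is oks la))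
      (λ a X → exch-conv _ _ a X (λ ψ _ → cong (_+ ev ψ a) (perm ψ)) (λ ψ _ → ≡.refl))
    where
    arith : ∀ e f b a → e + (b + (f + a)) ≡ e + (f + (b + a))
    arith = solve 4 (λ e f b a → e :+ (b :+ (f :+ a)) := e :+ (f :+ (b :+ a))) ≡.refl
    perm : ∀ ψ → ev ψ (((u , v) ∷ baseE is) ++ ((s , t) ∷ apexE is)) ≡ ev ψ (((u , v) ∷ (s , t) ∷ []) ++ (baseE is ++ apexE is))
    perm ψ = ≡.trans (cong (ψ u v +_) (ev-++ ψ (baseE is) _)) (≡.trans (arith (ψ u v) (ψ s t) (ev ψ (baseE is)) _)
      (cong (λ c → ψ u v + (ψ s t + c)) (≡.sym (ev-++ ψ (baseE is) (apexE is)))))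

  halfCost : ℕ → ℕ
  halfCost l = l * switchCost + 2 * l * sc

  -- The legs stand on both sides because the switches produce them and the star swaps use them up:
  -- as host edges they are a catalyst. Besides them only the star of `z` over the apices remains,
  -- which has forgotten the base graph.
  half : ∀ z av is → All (ItemOK z av) is → Unique (apexV is) → Apart (apexV is) av → 1 ≤ cnt z av → Fr z → d + 4 ≤ Av →
    (∀ x → ∃[ t ] degL (baseE is) x ≡ t * suc d) →
    Prog (halfCost (length is)) (Exch q (baseE is ++ apexE is ++ legE is) (star z (apexV is) ++ legE is))
  half z av is oks uS ap z∈ fz la dv = relax (≤-reflexive cost) (mapProg
      (_⨾_ {length is * switchCost} (switches is oks la) (endsProg z is ends-ok dv fz (λ x → fe x is oks) (allFin n)))
      (λ a X → exch-conv _ _ a X (λ ψ _ → cong (_+ ev ψ a) (l ψ)) (λ ψ _ → cong (_+ ev ψ a) (r' ψ))))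
    where
    len-base : ∀ is → length (baseE is) ≡ length is
    len-base [] = ≡.refl
    len-base (_ ∷ is) = cong suc (len-base is)
    cost : length is * switchCost + Σl (λ x → degL (baseE is) x * sc) (allFin n) ≡ halfCost (length is)
    cost = cong (length is * switchCost +_) (≡.trans (Σl-*ʳ sc (degL (baseE is)) (allFin n))
      (cong (_* sc) (≡.trans (ΣF-degL (baseE is)) (cong (2 *_) (len-base is)))))
    selFr : ∀ u x {s} → Fr s → All Fr (sel u x s)
    selFr u x f with u ≟ᶠ x
    ... | yes _ = f ∷ []
    ... | no _  = []
    fe : ∀ x is → All (ItemOK z av) is → All Fr (ends x is)
    fe x [] [] = []
    fe x (((u , v) , (s , t)) ∷ is) (ok ∷ oks) = All-++⁺ (selFr u x (ItemOK.fs ok)) (All-++⁺ (selFr v x (ItemOK.ft ok)) (fe x is oks))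
    touched : ∀ x is → All (ItemOK z av) is → ends x is ≡ [] ⊎ (1 ≤ cnt x av × x ≢ z × Fr x)
    touched x [] [] = inj₁ ≡.refl
    touched x (((u , v) , (s , t)) ∷ is) (ok ∷ oks) with u ≟ᶠ x
    ... | yes ≡.refl = inj₂ (ItemOK.u∈ ok , ItemOK.u≢z ok , ItemOK.fu ok)
    ... | no _ with v ≟ᶠ x
    ...   | yes ≡.refl = inj₂ (ItemOK.v∈ ok , ItemOK.v≢z ok , ItemOK.fv ok)
    ...   | no _ = touched x is oks
    ends-ok : ∀ x → ends x is ≡ [] ⊎ (Unique (x ∷ z ∷ ends x is) × Fr x)
    ends-ok x with touched x is oks
    ... | inj₁ e = inj₁ e
    ... | inj₂ (x∈ , x≢z , fx) = inj₂ (unique-∷ {x} {z ∷ ends x is} (unique-∷ {z} {ends x is} uE (none z∈)) (cong₂ _+_ (δ-≢ (x≢z ∘ ≡.sym)) (none x∈)) , fx)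
      where
      uE : Unique (ends x is)
      uE w = ≤-trans (cnt-ends x is w) (uS w)
      none : ∀ {w} → 1 ≤ cnt w av → cnt w (ends x is) ≡ 0
      none {w} p = n≤0⇒n≡0 (≤-trans (cnt-ends x is w) (≤-reflexive (apart-out {w} {apexV is} {av} ap p)))
    l : ∀ ψ → ev ψ (baseE is ++ apexE is ++ legE is) ≡ ev ψ ((baseE is ++ apexE is) ++ concatMap (λ x → star x (ends x is)) (allFin n))
    l ψ = ≡.trans (cong (ev ψ) (≡.sym (++-assoc (baseE is) (apexE is) (legE is)))) (≡.trans (ev-++ ψ (baseE is ++ apexE is) (legE is))
      (≡.sym (≡.trans (ev-++ ψ (baseE is ++ apexE is) _) (cong (ev ψ (baseE is ++ apexE is) +_) (ΣF-ends ψ is)))))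
    r' : ∀ ψ → ev ψ (star z (apexV is) ++ legE is) ≡ ev ψ (legE is ++ concatMap (λ x → star z (ends x is)) (allFin n))
    r' ψ = ≡.trans (ev-++ ψ (star z (apexV is)) (legE is)) (≡.trans (+-comm _ (ev ψ (legE is)))
      (≡.sym (≡.trans (ev-++ ψ (legE is) _) (cong (ev ψ (legE is) +_) (≡.trans (ΣF-ends-z ψ z is) (≡.sym (ev-star ψ z (apexV is))))))))

  record Clique (m : ℕ) (env av : List (Fin n)) (new : List (Edge n)) : Set where
    field
      S : List (Fin n)
      len : length S ≡ m
      fr : All Fr S
      uniq : Unique (S ++ env)
      apart : Apart S av
      value : ∀ ψ → Symmetric ψ → ev ψ new ≡ ev ψ (cl S)

  pickClique : ∀ m env av → Unique env → m ≤ suc k → m + (length env + length av) ≤ Av → Prog (m * k) (Clique m env av)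
  pickClique zero env av uq mk la I = res [] I record { S = [] ; len = ≡.refl ; fr = [] ; uniq = uq ; apart = λ _ → inj₁ ≡.refl ; value = λ _ _ → ≡.refl }
  pickClique (suc m) env av uq mk la {j} {E} I = cont (pickClique m env av uq (≤-trans (n≤1+n m) mk) (≤-trans (n≤1+n _) la) (subst (λ t → Inv t E) (lem k (m * k) j) I))
    where
    lem : ∀ k m j → k + m + j ≡ m + (k + j)
    lem = solve 3 (λ k m j → k :+ m :+ j := m :+ (k :+ j)) ≡.refl
    cont : Res E (k + j) (Clique m env av) → Res E j (Clique (suc m) env av)
    cont (res a J M) = glue (pickP {j} {a ++ E} S ((S ++ env) ++ av) (≤-trans (≤-reflexive len) (s≤s⁻¹ mk))
        (≤-trans (≤-reflexive (≡.trans (length-++ (S ++ env)) (≡.trans (cong (_+ length av) (≡.trans (length-++ S) (cong (_+ length env) len))) (+-assoc m _ _)))) (≤-trans (n≤1+n _) la))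
        (λ v → ≤-trans (≤-trans (m≤m+n _ _) (≤-reflexive (≡.sym (cnt-++ v S env)))) (uniq v)) fr J)
      where
      open Clique M
      glue : ∃[ w ] (cnt w ((S ++ env) ++ av) ≡ 0 × cnt w S ≡ 0 × Fr w × Inv j (star w S ++ a ++ E)) → Res E j (Clique (suc m) env av)
      glue (w , w∉ , _ , fw , J') = res (star w S ++ a) (subst (Inv j) (≡.sym (++-assoc (star w S) a E)) J') record
        { S = w ∷ S ; len = cong suc len ; fr = fw ∷ fr ; uniq = unique-∷ {w} {S ++ env} uniq (m+n≡0⇒m≡0 _ w∉')
        ; apart = apart-∷ {w} {S} {av} apart (m+n≡0⇒n≡0 (cnt w (S ++ env)) w∉')
        ; value = λ ψ s → ≡.trans (ev-++ ψ (star w S) a) (≡.trans (cong (ev ψ (star w S) +_) (value ψ s)) (≡.sym (ev-++ ψ (star w S) (cl S)))) }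
        where
        w∉' : cnt w (S ++ env) + cnt w av ≡ 0
        w∉' = ≡.trans (≡.sym (cnt-++ w (S ++ env) av)) w∉

  record Cliques (t : ℕ) (env av : List (Fin n)) (new : List (Edge n)) : Set where
    field
      Ks : List (List (Fin n))
      len : length Ks ≡ t
      size : All (λ S → length S ≡ q) Ks
      fr : All (All Fr) Ks
      uniq : Unique (concat Ks ++ env)
      apart : Apart (concat Ks) av
      lenC : length (concat Ks) ≡ t * q
      value : ∀ ψ → Symmetric ψ → ev ψ new ≡ ev ψ (cls Ks)

  pickCliques : ∀ t env av → Unique env → q ≤ suc k → t * q + (length env + length av) ≤ Av → Prog (t * (q * k)) (Cliques t env av)
  pickCliques zero env av uq qk la I = res [] I record { Ks = [] ; len = ≡.refl ; size = [] ; fr = [] ; uniq = uq ; apart = λ _ → inj₁ ≡.refl ; lenC = ≡.refl ; value = λ _ _ → ≡.refl }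
  pickCliques (suc t) env av uq qk la {j} {E} I =
    cont (pickCliques t env av uq qk (≤-trans (m≤n+m _ q) (≤-trans (≤-reflexive (≡.sym (+-assoc q (t * q) _))) la)) (subst (λ c → Inv c E) (lem (q * k) (t * (q * k)) j) I))
    where
    lem : ∀ k m j → k + m + j ≡ m + (k + j)
    lem = solve 3 (λ k m j → k :+ m :+ j := m :+ (k :+ j)) ≡.refl
    lem₂ : ∀ q c e a → q + (c + e + a) ≡ q + c + (e + a)
    lem₂ = solve 4 (λ q c e a → q :+ (c :+ e :+ a) := q :+ c :+ (e :+ a)) ≡.refl
    cont : Res E (q * k + j) (Cliques t env av) → Res E j (Cliques (suc t) env av)
    cont (res a J M) = glue (pickClique q (concat Ks ++ env) av uniq qk
        (≤-trans (≤-reflexive (≡.trans (cong (λ c → q + (c + length av)) (≡.trans (length-++ (concat Ks)) (cong (_+ length env) lenC))) (lem₂ q (t * q) (length env) (length av)))) la) J)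
      where
      open Cliques M
      glue : Res (a ++ E) j (Clique q (concat Ks ++ env) av) → Res E j (Cliques (suc t) env av)
      glue (res b J' C) = res (b ++ a) (subst (Inv j) (≡.sym (++-assoc b a E)) J') record
        { Ks = S ∷ Ks ; len = cong suc len ; size = C.len ∷ size ; fr = C.fr ∷ fr
        ; uniq = subst Unique (≡.sym (++-assoc S (concat Ks) env)) C.uniq
        ; apart = ap
        ; lenC = ≡.trans (length-++ S) (cong₂ _+_ C.len lenC)
        ; value = λ ψ s → ≡.trans (ev-++ ψ b a) (≡.trans (cong₂ _+_ (C.value ψ s) (value ψ s)) (≡.sym (ev-++ ψ (cl S) (cls Ks)))) }
        where
        module C = Clique C
        S : List (Fin n)
        S = C.S
        ap : Apart (S ++ concat Ks) av
        ap v with C.apart v | apart v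
        ... | inj₂ e | _      = inj₂ e
        ... | inj₁ _ | inj₂ e = inj₂ e
        ... | inj₁ e | inj₁ f = inj₁ (≡.trans (cnt-++ v S (concat Ks)) (cong₂ _+_ e f))

  record PairOK (z : Fin n) (av : List (Fin n)) (p : Edge n × Edge n) : Set where
    u = proj₁ (proj₁ p)
    v = proj₂ (proj₁ p)
    a = proj₁ (proj₂ p)
    b = proj₂ (proj₂ p)
    field
      uq₁ : Unique (u ∷ z ∷ a ∷ [])
      uq₂ : Unique (v ∷ z ∷ b ∷ [])
      u≢v : u ≢ v
      a≢b : a ≢ b
      u∈ : 1 ≤ cnt u av
      v∈ : 1 ≤ cnt v av
      a∈ : 1 ≤ cnt a av
      b∈ : 1 ≤ cnt b av
      fu : Fr u
      fv : Fr v
      fa : Fr a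
      fb : Fr b

  firsts seconds : List (Edge n × Edge n) → List (Edge n)
  firsts = map proj₁
  seconds = map proj₂

  -- `B` and the cliques receive the same apices (`sameV`, `sameE`), so that their halves end in the
  -- same star at `z`. This is why the edges of both are matched in pairs, and why their numbers
  -- must agree.
  record Apices (z : Fin n) (av : List (Fin n)) (ps : List (Edge n × Edge n)) (new : List (Edge n)) : Set where
    field
      isB isK : List (Item n)
      lenB : length isB ≡ length ps
      lenK : length isK ≡ length ps
      baseB : baseE isB ≡ firsts ps
      baseK : baseE isK ≡ seconds ps
      sameV : apexV isK ≡ apexV isB
      sameE : apexE isK ≡ apexE isB
      okB : All (ItemOK z av) isB
      okK : All (ItemOK z av) isK
      lenV : length (apexV isB) ≡ 2 * length ps
      uniq : Unique (apexV isB)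
      apart : Apart (apexV isB) av
      value : ∀ ψ → Symmetric ψ → ev ψ new ≡ ev ψ (legE isB) + ev ψ (legE isK) + (Σl (ψ z) (apexV isB) + ev ψ (apexE isB))

  private
    triple≢ : ∀ {x y w : Fin n} → Unique (x ∷ y ∷ w ∷ []) → x ≢ y × w ≢ y
    triple≢ {x} {y} {w} uq = (λ { ≡.refl → bad (≤-trans (≤-trans (≤-reflexive (cong₂ _+_ (≡.sym (δ-refl x)) (≡.sym (δ-refl x)))) (+-monoʳ-≤ (δ x x) (m≤m+n _ _))) (uq x)) })
                           , (λ { ≡.refl → bad (≤-trans (≤-trans (≤-reflexive (cong₂ _+_ (≡.sym (δ-refl w)) (≡.sym (δ-refl w))))
                               (≤-trans (+-monoʳ-≤ (δ w w) (m≤m+n _ 0)) (m≤n+m _ (δ x w)))) (uq w)) })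
      where
      bad : ¬ (2 ≤ 1)
      bad (s≤s ())
    out≢ : ∀ {v w : Fin n} {av} → 1 ≤ cnt v av → cnt w av ≡ 0 → w ≢ v
    out≢ p e ≡.refl with ≤-trans p (≤-reflexive e)
    ... | ()
    unique-[] : Unique {n} []
    unique-[] _ = z≤n
    uniq4 : ∀ {u v s t} → u ≢ v → s ≢ u → s ≢ v → t ≢ u → t ≢ v → t ≢ s → Uniq4 u v s t
    uniq4 {u} {v} {s} {t} uv su sv tu tv ts = unique-∷ {u} {t ∷ v ∷ s ∷ []} (unique-∷ {t} {v ∷ s ∷ []} (unique-∷ {v} {s ∷ []} (unique-∷ {s} {[]} unique-[] ≡.refl)
      (cong (_+ 0) (δ-≢ sv))) (cong₂ _+_ (δ-≢ (tv ∘ ≡.sym)) (cong (_+ 0) (δ-≢ (ts ∘ ≡.sym)))))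
      (cong₂ _+_ (δ-≢ tu) (cong₂ _+_ (δ-≢ (uv ∘ ≡.sym)) (cong (_+ 0) (δ-≢ su))))

  -- The apex `s` sees u, z, a, and then `t` sees s, v, z, b. The four neighbours of `t` require
  -- 2q-2 ≥ 4, that is q ≥ 3.
  pickApices : ∀ z av ps → Fr z → 1 ≤ cnt z av → 2 * length ps + length av ≤ Av → All (PairOK z av) ps → Prog (length ps * (k + k)) (Apices z av ps)
  pickApices z av [] fz z∈ la [] I = res [] I record { isB = [] ; isK = [] ; lenB = ≡.refl ; lenK = ≡.refl ; baseB = ≡.refl ; baseK = ≡.refl ; sameV = ≡.refl ; sameE = ≡.refl
    ; okB = [] ; okK = [] ; lenV = ≡.refl ; uniq = unique-[] ; apart = λ _ → inj₁ ≡.refl ; value = λ _ _ → ≡.refl }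
  pickApices z av (((u , v) , (a , b)) ∷ ps) fz z∈ la (ok ∷ oks) {j} {E} I =
    cont₀ (pickApices z av ps fz z∈ (≤-trans (n≤1+n _) (≤-trans (n≤1+n _) la')) oks (subst (λ t → Inv t E) (lem k (length ps * (k + k)) j) I))
    where
    open PairOK ok using (uq₁; uq₂; u≢v; a≢b; u∈; v∈; a∈; b∈; fu; fv; fa; fb)
    lem : ∀ k m j → k + k + m + j ≡ m + (k + (k + j))
    lem = solve 3 (λ k m j → k :+ k :+ m :+ j := m :+ (k :+ (k :+ j))) ≡.refl
    lem₂ : ∀ l a → 2 + (2 * l + a) ≡ 2 * (1 + l) + a
    lem₂ = solve 2 (λ l a → con 2 :+ (con 2 :* l :+ a) := con 2 :* (con 1 :+ l) :+ a) ≡.refl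
    la' : 2 + (2 * length ps + length av) ≤ Av
    la' = ≤-trans (≤-reflexive (lem₂ (length ps) (length av))) la
    cont₀ : Res E (k + (k + j)) (Apices z av ps) → Res E j (Apices z av (((u , v) , (a , b)) ∷ ps))
    cont₀ (res c J M) = cont₁ (pickP {k + j} {c ++ E} ρ₁ (V ++ av) (≤-trans (n≤1+n 3) 4≤k)
        (≤-trans (≤-reflexive (≡.trans (length-++ V) (cong (_+ length av) lenV))) (≤-trans (n≤1+n _) (≤-trans (n≤1+n _) la'))) uq₁ (fu ∷ fz ∷ fa ∷ []) J)
      where
      open Apices M
      V ρ₁ : List (Fin n)
      V = apexV isB
      ρ₁ = u ∷ z ∷ a ∷ []
      cont₁ : ∃[ s ] (cnt s (V ++ av) ≡ 0 × cnt s ρ₁ ≡ 0 × Fr s × Inv (k + j) (star s ρ₁ ++ c ++ E)) → Res E j (Apices z av (((u , v) , (a , b)) ∷ ps))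
      cont₁ (s , s∉ , _ , fs , J₁) = cont₂ (pickP {j} {star s ρ₁ ++ c ++ E} ρ₂ ((s ∷ V) ++ av) 4≤k
          (≤-trans (s≤s (≤-reflexive (≡.trans (length-++ V) (cong (_+ length av) lenV)))) (≤-trans (n≤1+n _) la')) uqρ₂ (fs ∷ fv ∷ fz ∷ fb ∷ []) J₁)
        where
        s∉' : cnt s V + cnt s av ≡ 0
        s∉' = ≡.trans (≡.sym (cnt-++ s V av)) s∉
        s∉V : cnt s V ≡ 0
        s∉V = m+n≡0⇒m≡0 _ s∉'
        s∉av : cnt s av ≡ 0
        s∉av = m+n≡0⇒n≡0 (cnt s V) s∉'
        s≢ : ∀ {y} → 1 ≤ cnt y av → s ≢ y
        s≢ p = out≢ {av = av} p s∉av
        ρ₂ : List (Fin n)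
        ρ₂ = s ∷ v ∷ z ∷ b ∷ []
        uqρ₂ : Unique ρ₂
        uqρ₂ = unique-∷ {s} {v ∷ z ∷ b ∷ []} uq₂ (cong₂ _+_ (δ-≢ (s≢ v∈ ∘ ≡.sym)) (cong₂ _+_ (δ-≢ (s≢ z∈ ∘ ≡.sym)) (cong (_+ 0) (δ-≢ (s≢ b∈ ∘ ≡.sym)))))
        cont₂ : ∃[ t ] (cnt t ((s ∷ V) ++ av) ≡ 0 × cnt t ρ₂ ≡ 0 × Fr t × Inv j (star t ρ₂ ++ star s ρ₁ ++ c ++ E)) → Res E j (Apices z av (((u , v) , (a , b)) ∷ ps))
        cont₂ (t , t∉ , _ , ft , J₂) = res (star t ρ₂ ++ star s ρ₁ ++ c) J₂ record
          { isB = ((u , v) , (s , t)) ∷ isB ; isK = ((a , b) , (s , t)) ∷ isK ; lenB = cong suc lenB ; lenK = cong suc lenK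
          ; baseB = cong (_ ∷_) baseB ; baseK = cong (_ ∷_) baseK ; sameV = cong (λ l → s ∷ t ∷ l) sameV ; sameE = cong (_ ∷_) sameE
          ; okB = mkItem (uniq4 u≢v (s≢ u∈) (s≢ v∈) (t≢ u∈) (t≢ v∈) t≢s) fu fv fs ft u∈ v∈ (proj₁ (triple≢ {u} {z} {a} uq₁)) (proj₁ (triple≢ {v} {z} {b} uq₂)) ∷ okB
          ; okK = mkItem (uniq4 a≢b (s≢ a∈) (s≢ b∈) (t≢ a∈) (t≢ b∈) t≢s) fa fb fs ft a∈ b∈ (proj₂ (triple≢ {u} {z} {a} uq₁)) (proj₂ (triple≢ {v} {z} {b} uq₂)) ∷ okK
          ; lenV = ≡.trans (cong (2 +_) lenV) (lem₃ (length ps))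
          ; uniq = unique-∷ {s} {t ∷ V} (unique-∷ {t} {V} uniq t∉V) (cong₂ _+_ (δ-≢ t≢s) s∉V)
          ; apart = apart-∷ {s} {t ∷ V} {av} (apart-∷ {t} {V} {av} apart t∉av) s∉av
          ; value = val }
          where
          lem₃ : ∀ l → 2 + 2 * l ≡ 2 * (1 + l)
          lem₃ = solve 1 (λ l → con 2 :+ con 2 :* l := con 2 :* (con 1 :+ l)) ≡.refl
          t∉' : δ s t + (cnt t V + cnt t av) ≡ 0
          t∉' = ≡.trans (cong (δ s t +_) (≡.sym (cnt-++ t V av))) t∉
          t∉₂ : cnt t V + cnt t av ≡ 0
          t∉₂ = m+n≡0⇒n≡0 (δ s t) t∉'
          t∉V : cnt t V ≡ 0
          t∉V = m+n≡0⇒m≡0 _ t∉₂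
          t∉av : cnt t av ≡ 0
          t∉av = m+n≡0⇒n≡0 (cnt t V) t∉₂
          t≢ : ∀ {y} → 1 ≤ cnt y av → t ≢ y
          t≢ p = out≢ {av = av} p t∉av
          t≢s : t ≢ s
          t≢s = δ-0⇒≢ (m+n≡0⇒m≡0 _ t∉') ∘ ≡.sym
          arith : ∀ st vt zt bt us zs as LB LK Z A → (st + (vt + (zt + (bt + 0)))) + ((us + (zs + (as + 0))) + (LB + LK + (Z + A))) ≡ (us + (vt + LB)) + (as + (bt + LK)) + ((zs + (zt + Z)) + (st + A))
          arith = solve 11 (λ st vt zt bt us zs as LB LK Z A → (st :+ (vt :+ (zt :+ (bt :+ con 0)))) :+ ((us :+ (zs :+ (as :+ con 0))) :+ (LB :+ LK :+ (Z :+ A))) := (us :+ (vt :+ LB)) :+ (as :+ (bt :+ LK)) :+ ((zs :+ (zt :+ Z)) :+ (st :+ A))) ≡.refl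
          val : ∀ ψ → Symmetric ψ → ev ψ (star t ρ₂ ++ star s ρ₁ ++ c) ≡
            (ψ u s + (ψ v t + ev ψ (legE isB))) + (ψ a s + (ψ b t + ev ψ (legE isK))) + ((ψ z s + (ψ z t + Σl (ψ z) V)) + (ψ s t + ev ψ (apexE isB)))
          val ψ sy = ≡.trans (ev-++ ψ (star t ρ₂) (star s ρ₁ ++ c)) (≡.trans (cong₂ _+_
             (cong₂ _+_ (sy t s) (cong₂ _+_ (sy t v) (cong₂ _+_ (sy t z) (cong (_+ 0) (sy t b)))))
             (≡.trans (ev-++ ψ (star s ρ₁) c) (cong₂ _+_ (cong₂ _+_ (sy s u) (cong₂ _+_ (sy s z) (cong (_+ 0) (sy s a)))) (value ψ sy))))
             (arith (ψ s t) (ψ v t) (ψ z t) (ψ b t) (ψ u s) (ψ z s) (ψ a s) (ev ψ (legE isB)) (ev ψ (legE isK)) (Σl (ψ z) V) (ev ψ (apexE isB))))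

  vertices : List (Edge n) → List (Fin n)
  vertices []             = []
  vertices ((u , v) ∷ es) = u ∷ v ∷ vertices es

  length-vertices : ∀ es → length (vertices es) ≡ 2 * length es
  length-vertices []       = ≡.refl
  length-vertices (_ ∷ es) = ≡.trans (cong (2 +_) (length-vertices es)) (lem (length es))
    where
    lem : ∀ l → 2 + 2 * l ≡ 2 * (1 + l)
    lem = solve 1 (λ l → con 2 :+ con 2 :* l := con 2 :* (con 1 :+ l)) ≡.refl

  private
    Inside : List (Fin n) → Edge n → Set
    Inside V (a , b) = a ≢ b × 1 ≤ cnt a V × 1 ≤ cnt b V × Fr a × Fr b

    cnt-self : ∀ (x : Fin n) V → 1 ≤ cnt x (x ∷ V)
    cnt-self x V = ≤-trans (≤-reflexive (≡.sym (δ-refl x))) (m≤m+n _ _)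

    inside-vertices : ∀ B V → (∀ w → cnt w (vertices B) ≤ cnt w V) → All (λ (u , v) → u ≢ v × Fr u × Fr v) B → All (Inside V) B
    inside-vertices []             V le [] = []
    inside-vertices ((u , v) ∷ es) V le ((ne , fu , fv) ∷ ok) =
      (ne , ≤-trans (cnt-self u (v ∷ vertices es)) (le u) , ≤-trans (≤-trans (cnt-self v (vertices es)) (m≤n+m _ (δ u v))) (le v) , fu , fv)
      ∷ inside-vertices es V (λ w → ≤-trans (≤-trans (m≤n+m _ (δ v w)) (m≤n+m _ (δ u w))) (le w)) ok

    inside-star : ∀ x S V → cnt x S ≡ 0 → 1 ≤ cnt x V → (∀ w → cnt w S ≤ cnt w V) → Fr x → All Fr S → All (Inside V) (star x S)
    inside-star x []      V e x∈ le fx []       = []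
    inside-star x (y ∷ S) V e x∈ le fx (fy ∷ f) =
      (δ-0⇒≢ (m+n≡0⇒m≡0 _ e) ∘ ≡.sym , x∈ , ≤-trans (cnt-self y S) (le y) , fx , fy)
      ∷ inside-star x S V (m+n≡0⇒n≡0 (δ y x) e) x∈ (λ w → ≤-trans (m≤n+m _ (δ y w)) (le w)) fx f

    inside-cl : ∀ S V → Unique S → (∀ w → cnt w S ≤ cnt w V) → All Fr S → All (Inside V) (cl S)
    inside-cl []      V uq le []       = []
    inside-cl (x ∷ S) V uq le (fx ∷ f) = All-++⁺
      (inside-star x S V (n≤0⇒n≡0 (s≤s⁻¹ (≤-trans (≤-reflexive (cong (_+ cnt x S) (≡.sym (δ-refl x)))) (uq x)))) (≤-trans (cnt-self x S) (le x)) le' fx f)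
      (inside-cl S V (λ w → ≤-trans (m≤n+m _ (δ x w)) (uq w)) le' f)
      where
      le' : ∀ w → cnt w S ≤ cnt w V
      le' w = ≤-trans (m≤n+m _ (δ x w)) (le w)

    inside-cls : ∀ Ks V → Unique (concat Ks) → (∀ w → cnt w (concat Ks) ≤ cnt w V) → All (All Fr) Ks → All (Inside V) (cls Ks)
    inside-cls []       V uq le []       = []
    inside-cls (S ∷ Ks) V uq le (fS ∷ f) = All-++⁺
      (inside-cl S V (λ w → ≤-trans (left w) (uq w)) (λ w → ≤-trans (left w) (le w)) fS)
      (inside-cls Ks V (λ w → ≤-trans (right w) (uq w)) (λ w → ≤-trans (right w) (le w)) f)
      where
      left : ∀ w → cnt w S ≤ cnt w (S ++ concat Ks)
      left w = ≤-trans (m≤m+n _ _) (≤-reflexive (≡.sym (cnt-++ w S (concat Ks))))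
      right : ∀ w → cnt w (concat Ks) ≤ cnt w (S ++ concat Ks)
      right w = ≤-trans (m≤n+m _ (cnt w S)) (≤-reflexive (≡.sym (cnt-++ w S (concat Ks))))

    pairUp : List (Edge n) → List (Edge n) → List (Edge n × Edge n)
    pairUp (e ∷ es) (f ∷ fs) = (e , f) ∷ pairUp es fs
    pairUp _        _        = []

    pairUp-firsts : ∀ es fs → length es ≡ length fs → firsts (pairUp es fs) ≡ es
    pairUp-firsts []       []       _ = ≡.refl
    pairUp-firsts (e ∷ es) (f ∷ fs) p = cong (e ∷_) (pairUp-firsts es fs (suc-injective p))

    pairUp-seconds : ∀ es fs → length es ≡ length fs → seconds (pairUp es fs) ≡ fs
    pairUp-seconds []       []       _ = ≡.refl
    pairUp-seconds (e ∷ es) (f ∷ fs) p = cong (f ∷_) (pairUp-seconds es fs (suc-injective p))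

    pairUp-All : ∀ {P Q : Edge n → Set} {R : Edge n × Edge n → Set} → (∀ {e f} → P e → Q f → R (e , f)) →
      ∀ es fs → All P es → All Q fs → All R (pairUp es fs)
    pairUp-All h []       fs       _        _        = []
    pairUp-All h (e ∷ es) []       _        _        = []
    pairUp-All h (e ∷ es) (f ∷ fs) (p ∷ ps) (r ∷ rs) = h p r ∷ pairUp-All h es fs ps rs

  length-cls : ∀ {Q : List (List (Fin n))} → All (λ S → length S ≡ q) Q → length (cls Q) ≡ length Q * tri q
  length-cls []                 = ≡.refl
  length-cls {S ∷ Q} (e ∷ es) = ≡.trans (length-++ (cl S)) (cong₂ _+_ (≡.trans (length-cl S) (cong tri e)) (length-cls es))

  degL-cls : ∀ {Q : List (List (Fin n))} → All (λ S → length S ≡ q) Q → ∀ x → degL (cls Q) x ≡ cnt x (concat Q) * suc d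
  degL-cls []                 x = ≡.refl
  degL-cls {S ∷ Q} (e ∷ es) x = ≡.trans (ev-++ (incψ x) (cl S) (cls Q)) (≡.trans
    (cong₂ _+_ (≡.trans (degL-cl S x) (cong (λ m → cnt x S * pred m) e)) (degL-cls es x))
    (≡.trans (≡.sym (*-distribʳ-+ (suc d) (cnt x S) _)) (cong (_* suc d) (≡.sym (cnt-++ x S (concat Q))))))

  absCost : ℕ → ℕ → ℕ
  absCost t l = k + (t * (q * k) + (l * (k + k) + (halfCost l + halfCost l)))

  -- A divisible B is exchanged for t disjoint cliques: both are exchanged for the pairs of edges from z to the apices.
  absorb : ∀ B t → All (λ (u , v) → u ≢ v × Fr u × Fr v) B → length B ≡ t * tri q → (∀ x → ∃[ c ] degL B x ≡ c * suc d) →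
    q ≤ suc k → 1 + (t * q + 4 * length B) ≤ Av → d + 4 ≤ Av → Prog (absCost t (length B)) (Exch q B [])
  absorb B t okB lB dB qk la la₄ {j} {E} I =
    cont₀ (pickP {c₁ + j} {E} [] VB z≤n (≤-trans (≤-reflexive (length-vertices B)) (≤-trans (*-monoˡ-≤ (length B) 2≤4) (≤-trans (≤-trans (m≤n+m _ (t * q)) (n≤1+n _)) la)))
      (λ _ → z≤n) [] (subst (λ c → Inv c E) (+-assoc k c₁ j) I))
    where
    2≤4 : 2 ≤ 4
    2≤4 = s≤s (s≤s z≤n)
    l : ℕ
    l = length B
    VB : List (Fin n)
    VB = vertices B
    c₁ c₂ c₃ : ℕ
    c₁ = t * (q * k) + c₂
    c₂ = l * (k + k) + c₃
    c₃ = halfCost l + halfCost l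
    cont₀ : ∃[ z ] (cnt z VB ≡ 0 × cnt z [] ≡ 0 × Fr z × Inv (c₁ + j) E) → Res E j (Exch q B [])
    cont₀ (z , z∉ , _ , fz , J₀) = cont₁ (pickCliques t [ z ] VB (λ w → ≤-trans (≤-reflexive (+-identityʳ _)) (δ≤1 z w)) qk
        (≤-trans (≤-reflexive (≡.trans (cong (λ c → t * q + (1 + c)) (length-vertices B)) (+-suc _ _))) (≤-trans (s≤s (+-monoʳ-≤ (t * q) (*-monoˡ-≤ l 2≤4))) la))
        (subst (λ c → Inv c E) (+-assoc (t * (q * k)) c₂ j) J₀))
      where
      cont₁ : Res E (c₂ + j) (Cliques t [ z ] VB) → Res E j (Exch q B [])
      cont₁ (res a J₁ M) = cont₂ (pickApices z av ps fz (cnt-self z (KV ++ VB)) la₂ (pairUp-All mkPair B K (inside-vertices B VB (λ _ → ≤-refl) okB)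
             (inside-cls Ks KV (λ w → ≤-trans (≤-trans (m≤m+n _ _) (≤-reflexive (≡.sym (cnt-++ w KV [ z ])))) (uniq w)) (λ _ → ≤-refl) fr))
             (subst (λ c → Inv c (a ++ E)) (≡.trans (+-assoc (l * (k + k)) c₃ j) (cong (λ m → m * (k + k) + (c₃ + j)) (≡.sym lps))) J₁))
        where
        open Cliques M
        K : List (Edge n)
        K = cls Ks
        KV av : List (Fin n)
        KV = concat Ks
        av = z ∷ KV ++ VB
        ps : List (Edge n × Edge n)
        ps = pairUp B K
        lBK : length B ≡ length K
        lBK = ≡.trans lB (≡.sym (≡.trans (length-cls size) (cong (_* tri q) len)))
        lps : length ps ≡ l
        lps = ≡.trans (≡.sym (length-map proj₁ ps)) (cong length (pairUp-firsts B K lBK))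
        lem₁ : ∀ l c → 2 * l + (1 + (c + 2 * l)) ≡ 1 + (c + 4 * l)
        lem₁ = solve 2 (λ l c → con 2 :* l :+ (con 1 :+ (c :+ con 2 :* l)) := con 1 :+ (c :+ con 4 :* l)) ≡.refl
        la₂ : 2 * length ps + length av ≤ Av
        la₂ = ≤-trans (≤-reflexive (≡.trans (cong₂ (λ x y → 2 * x + suc y) lps (≡.trans (length-++ KV) (cong₂ _+_ lenC (length-vertices B)))) (lem₁ l (t * q)))) la
        inK : ∀ {x} → 1 ≤ cnt x KV → 1 ≤ cnt x av
        inK {x} p = ≤-trans p (≤-trans (≤-trans (m≤m+n _ _) (≤-reflexive (≡.sym (cnt-++ x KV VB)))) (m≤n+m _ (δ z x)))
        inB : ∀ {x} → 1 ≤ cnt x VB → 1 ≤ cnt x av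
        inB {x} p = ≤-trans p (≤-trans (≤-trans (m≤n+m _ (cnt x KV)) (≤-reflexive (≡.sym (cnt-++ x KV VB)))) (m≤n+m _ (δ z x)))
        a≢z : ∀ {x} → 1 ≤ cnt x KV → x ≢ z
        a≢z {x} p ≡.refl with ≤-trans (+-mono-≤ p (≤-trans (≤-reflexive (≡.sym (δ-refl x))) (m≤m+n _ 0))) (≤-trans (≤-reflexive (≡.sym (cnt-++ x KV [ x ]))) (uniq x))
        ... | s≤s ()
        uniq3 : ∀ {u a} → 1 ≤ cnt u VB → 1 ≤ cnt a KV → Unique (u ∷ z ∷ a ∷ [])
        uniq3 {u} {a} p r = unique-∷ {u} {z ∷ a ∷ []} (unique-∷ {z} {a ∷ []} (unique-∷ {a} {[]} (λ _ → z≤n) ≡.refl) (cong (_+ 0) (δ-≢ (a≢z r))))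
          (cong₂ _+_ (δ-≢ (out≢ {u} {z} {VB} p z∉)) (cong (_+ 0) (δ-≢ (λ e → out≢ {a} {u} {KV} r (apart-out {u} {KV} {VB} apart p) (≡.sym e)))))
        mkPair : ∀ {e f} → Inside VB e → Inside KV f → PairOK z av (e , f)
        mkPair (ne , u∈ , v∈ , fu , fv) (ne' , a∈ , b∈ , fa , fb) = record { uq₁ = uniq3 u∈ a∈ ; uq₂ = uniq3 v∈ b∈ ; u≢v = ne ; a≢b = ne'
          ; u∈ = inB u∈ ; v∈ = inB v∈ ; a∈ = inK a∈ ; b∈ = inK b∈ ; fu = fu ; fv = fv ; fa = fa ; fb = fb }
        cont₂ : Res (a ++ E) (c₃ + j) (Apices z av ps) → Res E j (Exch q B [])
        -- The second half is run backwards: `B` goes to the common star, and the star goes to the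
        -- cliques.
        cont₂ (res c J₂ N) = cont₃ (_⨾_ {halfCost l} {halfCost l}
            (relax (≤-reflexive (cong halfCost (≡.trans N.lenB lps))) (half z av N.isB N.okB N.uniq N.apart (cnt-self z (KV ++ VB)) fz la₄ (λ x → subst (λ es → ∃[ c ] degL es x ≡ c * suc d) (≡.sym bB) (dB x))))
            (relax (≤-reflexive (cong halfCost (≡.trans N.lenK lps))) (mapProg (half z av N.isK N.okK (subst Unique (≡.sym N.sameV) N.uniq) (subst (λ V → Apart V av) (≡.sym N.sameV) N.apart) (cnt-self z (KV ++ VB)) fz la₄
              (λ x → cnt x KV , ≡.trans (cong (λ es → degL es x) bK) (degL-cls size x))) (λ _ → exch-flip))) J₂)
          where
          module N = Apices N
          bB : baseE N.isB ≡ B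
          bB = ≡.trans N.baseB (pairUp-firsts B K lBK)
          bK : baseE N.isK ≡ K
          bK = ≡.trans N.baseK (pairUp-seconds B K lBK)
          AB BB AK BK : List (Edge n)
          AB = baseE N.isB ++ apexE N.isB ++ legE N.isB
          BB = star z (apexV N.isB) ++ legE N.isB
          AK = baseE N.isK ++ apexE N.isK ++ legE N.isK
          BK = star z (apexV N.isK) ++ legE N.isK
          arith₁ : ∀ B b lB lK Z A K → B + (b + (lB + lK + (Z + A) + K)) ≡ B + (A + lB) + (Z + lK) + K + b
          arith₁ = solve 7 (λ B b lB lK Z A K → B :+ (b :+ (lB :+ lK :+ (Z :+ A) :+ K)) := B :+ (A :+ lB) :+ (Z :+ lK) :+ K :+ b) ≡.refl
          arith₂ : ∀ b lB lK Z A K → b + (lB + lK + (Z + A) + K) ≡ Z + lB + (K + (A + lK)) + 0 + b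
          arith₂ = solve 6 (λ b lB lK Z A K → b :+ (lB :+ lK :+ (Z :+ A) :+ K) := Z :+ lB :+ (K :+ (A :+ lK)) :+ con 0 :+ b) ≡.refl
          -- With `B` present the cliques are decomposed by themselves; without it they take its
          -- place as one end of the exchange.
          evK : Exch q K [] []
          evK = record { Q₁ = Ks ; Q₀ = [] ; size₁ = size ; size₀ = [] ; fwd = λ _ _ → +-identityʳ _ ; bwd = λ _ _ → ≡.refl }
          cont₃ : Res (c ++ a ++ E) j (Exch q (AB ++ BK) (BB ++ AK)) → Res E j (Exch q B [])
          cont₃ (res b J₃ X) = res (b ++ c ++ a)
            (subst (Inv j) (≡.trans (cong (b ++_) (≡.sym (++-assoc c a E))) (≡.sym (++-assoc b (c ++ a) E))) J₃)
            (exch-conv B [] (b ++ c ++ a) (exch-++ X evK)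
              (λ ψ sy → ≡.trans (cong (ev ψ B +_) (total ψ sy)) (≡.trans (arith₁ (ev ψ B) (ev ψ b) (lB' ψ) (lK' ψ) (Z' ψ) (A' ψ) (ev ψ K))
                 (cong (_+ ev ψ b) (≡.sym (≡.trans (ev-++ ψ (AB ++ BK) K) (cong (_+ ev ψ K) (≡.trans (ev-++ ψ AB BK) (cong₂ _+_ (evAB ψ) (evBK ψ)))))))))
              (λ ψ sy → ≡.trans (total ψ sy) (≡.trans (arith₂ (ev ψ b) (lB' ψ) (lK' ψ) (Z' ψ) (A' ψ) (ev ψ K))
                 (cong (_+ ev ψ b) (≡.sym (≡.trans (ev-++ ψ (BB ++ AK) []) (cong (_+ 0) (≡.trans (ev-++ ψ BB AK) (cong₂ _+_ (evBB ψ) (evAK ψ))))))))))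
            where
            lB' lK' Z' A' : (Fin n → Fin n → ℕ) → ℕ
            lB' ψ = ev ψ (legE N.isB)
            lK' ψ = ev ψ (legE N.isK)
            Z' ψ = Σl (ψ z) (apexV N.isB)
            A' ψ = ev ψ (apexE N.isB)
            total : ∀ ψ → Symmetric ψ → ev ψ (b ++ c ++ a) ≡ ev ψ b + (lB' ψ + lK' ψ + (Z' ψ + A' ψ) + ev ψ K)
            total ψ sy = ≡.trans (ev-++ ψ b (c ++ a)) (cong (ev ψ b +_) (≡.trans (ev-++ ψ c a) (cong₂ _+_ (N.value ψ sy) (value ψ sy))))
            three : ∀ ψ (x y w : List (Edge n)) → ev ψ (x ++ y ++ w) ≡ ev ψ x + (ev ψ y + ev ψ w)
            three ψ x y w = ≡.trans (ev-++ ψ x (y ++ w)) (cong (ev ψ x +_) (ev-++ ψ y w))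
            evAB : ∀ ψ → ev ψ AB ≡ ev ψ B + (A' ψ + lB' ψ)
            evAB ψ = ≡.trans (three ψ (baseE N.isB) (apexE N.isB) (legE N.isB)) (cong (λ es → ev ψ es + (A' ψ + lB' ψ)) bB)
            evAK : ∀ ψ → ev ψ AK ≡ ev ψ K + (A' ψ + lK' ψ)
            evAK ψ = ≡.trans (three ψ (baseE N.isK) (apexE N.isK) (legE N.isK)) (cong₂ (λ es fs → ev ψ es + (ev ψ fs + lK' ψ)) bK N.sameE)
            evBB : ∀ ψ → ev ψ BB ≡ Z' ψ + lB' ψ
            evBB ψ = ≡.trans (ev-++ ψ (star z (apexV N.isB)) (legE N.isB)) (cong (_+ lB' ψ) (ev-star ψ z (apexV N.isB)))
            evBK : ∀ ψ → ev ψ BK ≡ Z' ψ + lK' ψ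
            evBK ψ = ≡.trans (ev-++ ψ (star z (apexV N.isK)) (legE N.isK)) (cong (_+ lK' ψ) (≡.trans (ev-star ψ z (apexV N.isK)) (cong (Σl (ψ z)) N.sameV)))

-- Executing many requests one after another

module Sequence {n : ℕ} (H : Host n) (c : ℕ) where
  open Host H
  open Greedy H

  -- The length is bounded by `c` and also by `c` times the total demand. By the second bound a
  -- request without demand leaves no edges, so the number of such requests is irrelevant.
  Executes : {Req : Set} → (Req → Fin n → ℕ) → (Req → List (Edge n) → Set) → Set
  Executes {Req} dem Out = ∀ U → Legal U → (∀ v → 2 * c + degL U v ≤ Bmax) → c + length U ≤ Emax → ∀ r →
    ∃[ E ] (Legal (E ++ U) × Out r E × length E ≤ c × length E ≤ c * ΣF (dem r) ×
            All (λ (u , v) → (0 < dem r u ⊎ degL U u < τ) × (0 < dem r v ⊎ degL U v < τ)) E)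

  flat : {Req : Set} {Out : Req → List (Edge n) → Set} {rs : List Req} → All (λ r → ∃ (Out r)) rs → List (Edge n)
  flat []              = []
  flat ((E , _) ∷ Es) = E ++ flat Es

  -- A vertex pays at most `2 * c` for each unit of demand. Without demand it is touched only while
  -- its degree is below `τ`, and then ends with at most `τ + 2 * c`, however often this happens.
  sequence : {Req : Set} (dem : Req → Fin n → ℕ) (Out : Req → List (Edge n) → Set) → Executes dem Out →
    ∀ (rs : List Req) → (∀ v → 2 * c + (τ + 2 * c + 2 * c * Σl (λ r → dem r v) rs) ≤ Bmax) →
    c + c * Σl (λ r → ΣF (dem r)) rs ≤ Emax → (Legal []) →
    Σ[ Es ∈ All (λ r → ∃ (Out r)) rs ] (Legal (flat Es) × (∀ v → degL (flat Es) v ≤ τ + 2 * c + 2 * c * Σl (λ r → dem r v) rs) ×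
      length (flat Es) ≤ c * Σl (λ r → ΣF (dem r)) rs)
  sequence dem Out ex [] bB bE l0 = [] , l0 , (λ _ → z≤n) , z≤n
  sequence {Req} dem Out ex (r ∷ rs) bB bE l0 = cont (sequence dem Out ex rs bB' bE' l0)
    where
    bB' : ∀ v → 2 * c + (τ + 2 * c + 2 * c * Σl (λ r → dem r v) rs) ≤ Bmax
    bB' v = ≤-trans (+-monoʳ-≤ (2 * c) (+-monoʳ-≤ (τ + 2 * c) (*-monoʳ-≤ (2 * c) (m≤n+m _ (dem r v))))) (bB v)
    bE' : c + c * Σl (λ r → ΣF (dem r)) rs ≤ Emax
    bE' = ≤-trans (+-monoʳ-≤ c (*-monoʳ-≤ c (m≤n+m _ (ΣF (dem r))))) bE
    Goal : Set
    Goal = Σ[ Es ∈ All (λ r → ∃ (Out r)) (r ∷ rs) ] (Legal (flat Es) × (∀ v → degL (flat Es) v ≤ τ + 2 * c + 2 * c * Σl (λ r → dem r v) (r ∷ rs)) ×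
      length (flat Es) ≤ c * Σl (λ r → ΣF (dem r)) (r ∷ rs))
    cont : Σ[ Es ∈ All (λ r → ∃ (Out r)) rs ] (Legal (flat Es) × (∀ v → degL (flat Es) v ≤ τ + 2 * c + 2 * c * Σl (λ r → dem r v) rs) ×
      length (flat Es) ≤ c * Σl (λ r → ΣF (dem r)) rs) → Goal
    cont (Es , lU , dU , eU) = glue (ex U lU (λ v → ≤-trans (+-monoʳ-≤ (2 * c) (dU v)) (bB' v)) (≤-trans (+-monoʳ-≤ c eU) bE') r)
      where
      U : List (Edge n)
      U = flat Es
      Fr : Fin n → Set
      Fr v = 0 < dem r v ⊎ degL U v < τ
      touched : ∀ v E → All (λ (a , b) → Fr a × Fr b) E → degL E v ≡ 0 ⊎ Fr v
      touched v [] [] = inj₁ ≡.refl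
      touched v ((a , b) ∷ E) ((fa , fb) ∷ fs) with a ≟ᶠ v
      ... | yes ≡.refl = inj₂ fa
      ... | no _ with b ≟ᶠ v
      ...   | yes ≡.refl = inj₂ fb
      ...   | no _ = touched v E fs
      r₁ : ∀ t c s → c + (t + c * s) ≡ t + c * (1 + s)
      r₁ = solve 3 (λ t c s → c :+ (t :+ c :* s) := t :+ c :* (con 1 :+ s)) ≡.refl
      glue : ∃[ E ] (Legal (E ++ U) × Out r E × length E ≤ c × length E ≤ c * ΣF (dem r) × All (λ (u , v) → Fr u × Fr v) E) → Goal
      glue (E , lE , o , e≤ , e≤' , fs) = (E , o) ∷ Es , lE , dE , ≤-trans (≤-reflexive (length-++ E)) (≤-trans (+-mono-≤ e≤' eU) (≤-reflexive (≡.sym (*-distribˡ-+ c (ΣF (dem r)) _))))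
        where
        S : Fin n → ℕ
        S v = Σl (λ r → dem r v) rs
        small : ∀ v → degL E v ≤ 2 * c
        small v = ≤-trans (degL≤ E v) (*-monoʳ-≤ 2 e≤)
        dE : ∀ v → degL (E ++ U) v ≤ τ + 2 * c + 2 * c * (dem r v + S v)
        dE v = ≤-trans (≤-reflexive (Σl-++ (uncurry (incψ v)) E U)) (by (touched v E fs))
          where
          by : degL E v ≡ 0 ⊎ Fr v → degL E v + degL U v ≤ τ + 2 * c + 2 * c * (dem r v + S v)
          by (inj₁ e) = ≤-trans (≤-reflexive (cong (_+ degL U v) e)) (≤-trans (dU v) (+-monoʳ-≤ (τ + 2 * c) (*-monoʳ-≤ (2 * c) (m≤n+m _ (dem r v)))))
          by (inj₂ (inj₁ p)) = ≤-trans (+-mono-≤ (small v) (dU v)) (≤-trans (≤-reflexive (r₁ (τ + 2 * c) (2 * c) (S v)))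
             (+-monoʳ-≤ (τ + 2 * c) (*-monoʳ-≤ (2 * c) (+-monoˡ-≤ (S v) p))))
          by (inj₂ (inj₂ p)) = ≤-trans (+-mono-≤ (small v) (<⇒≤ p)) (≤-trans (≤-reflexive (+-comm (2 * c) τ)) (m≤m+n _ _))

-- Ports and tokens

-- A pair of endpoints together with two states of consumption, differing by the edge between them in the quotient by cliques.
record Port (n d : ℕ) (u v : Fin n) : Set where
  field
    e₀ e₁ : List (Edge n)
    deg₀ : ∀ x → ∃[ c ] degL e₀ x ≡ c * suc d
    len₀ : ∃[ c ] length e₀ ≡ c * tri (2 + d)
    deg₁ : ∀ x → degL e₁ x ≡ degL e₀ x + incψ x u v
    len₁ : length e₁ ≡ suc (length e₀)
    small : length e₀ ≤ tri (2 + d)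

-- A token between two gadgets: if the receiver consumes its port in one state, the sender consumes its port in the other state.
record Token (n d : ℕ) (u v : Fin n) (E : List (Edge n)) : Set where
  field
    receiver sender : Port n d u v
    split₀ : ∀ ψ → Symmetric ψ → ev ψ (Port.e₀ receiver) + ev ψ (Port.e₁ sender) ≡ ev ψ E
    split₁ : ∀ ψ → Symmetric ψ → ev ψ (Port.e₁ receiver) + ev ψ (Port.e₀ sender) ≡ ev ψ E

data Tokens (n d : ℕ) (u v : Fin n) : ℕ → List (Edge n) → Set where
  []  : Tokens n d u v 0 []
  _∷_ : ∀ {m a b} → Token n d u v a → Tokens n d u v m b → Tokens n d u v (suc m) (b ++ a)

-- A token is a path u s t v with two copies of K_q minus the edge st.
module TokenProgram {n : ℕ} {H : Host n} (Γ : Context H) (d : ℕ) (k≡ : Host.k H ≡ 2 + (d + d)) where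
  open Host H
  open Program Γ

  -- `new` omits the clique on `S₀`. For `S₀ = t ∷ s ∷ []` it is thus K_q minus the edge st, and one
  -- edge st can serve two extensions.
  record Ext (m : ℕ) (S₀ : List (Fin n)) (new : List (Edge n)) : Set where
    field
      S : List (Fin n)
      len : length S ≡ m + length S₀
      fr : All Fr S
      uniq : Unique S
      value : ∀ ψ → Symmetric ψ → ev ψ new + ev ψ (cl S₀) ≡ ev ψ (cl S)

  extend : ∀ m S₀ {j E} → All Fr S₀ → Unique S₀ → m + length S₀ ≤ suc k → Inv (m * k + j) E → Res E j (Ext m S₀)
  extend zero S₀ fS uS le I = res [] I record { S = S₀ ; len = ≡.refl ; fr = fS ; uniq = uS ; value = λ _ _ → ≡.refl }
  extend (suc m) S₀ {j} {E} fS uS le I = cont (extend m S₀ fS uS (≤-trans (n≤1+n _) le) (subst (λ t → Inv t E) (lem k (m * k) j) I))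
    where
    lem : ∀ k m j → k + m + j ≡ m + (k + j)
    lem = solve 3 (λ k m j → k :+ m :+ j := m :+ (k :+ j)) ≡.refl
    cont : Res E (k + j) (Ext m S₀) → Res E j (Ext (suc m) S₀)
    cont (res a J M) = glue (pickP {j} {a ++ E} S [] (≤-trans (≤-reflexive len) (s≤s⁻¹ le)) z≤n uniq fr J)
      where
      open Ext M
      glue : ∃[ w ] (cnt w [] ≡ 0 × cnt w S ≡ 0 × Fr w × Inv j (star w S ++ a ++ E)) → Res E j (Ext (suc m) S₀)
      glue (w , _ , w∉ , fw , J') = res (star w S ++ a) (subst (Inv j) (≡.sym (++-assoc (star w S) a E)) J') record
        { S = w ∷ S ; len = cong suc len ; fr = fw ∷ fr ; uniq = unique-∷ {w} {S} uniq w∉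
        ; value = λ ψ s → ≡.trans (cong (_+ ev ψ (cl S₀)) (ev-++ ψ (star w S) a)) (≡.trans (+-assoc (ev ψ (star w S)) _ _)
            (≡.trans (cong (ev ψ (star w S) +_) (value ψ s)) (≡.sym (ev-++ ψ (star w S) (cl S))))) }

  tokenCost : ℕ
  tokenCost = k + (k + (d * k + d * k))

  token : ∀ u v {j E} → Fr u → Fr v → 1 ≤ Av → Inv (tokenCost + j) E → Res E j (Token n d u v)
  token u v {j} {E} fu fv av I = cont₁ (pickP {c₁ + j} {E} [ u ] [ v ] (≤-trans (s≤s z≤n) 2≤k) av
      (λ w → ≤-trans (≤-reflexive (+-identityʳ _)) (δ≤1 u w)) (fu ∷ []) (subst (λ c → Inv c E) (+-assoc k c₁ j) I))
    where
    2≤k : 2 ≤ k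
    2≤k = ≤-trans (s≤s (s≤s z≤n)) (≤-reflexive (≡.sym k≡))
    c₁ c₂ : ℕ
    c₁ = k + c₂
    c₂ = d * k + d * k
    q≤ : d + 2 ≤ suc k
    q≤ = ≤-trans (≤-trans (≤-reflexive (+-comm d 2)) (≤-trans (s≤s (s≤s (m≤m+n d d))) (≤-reflexive (≡.sym k≡)))) (n≤1+n k)
    cont₁ : ∃[ s ] (cnt s [ v ] ≡ 0 × cnt s [ u ] ≡ 0 × Fr s × Inv (c₁ + j) (star s [ u ] ++ E)) → Res E j (Token n d u v)
    cont₁ (s , s∉v , _ , fs , J₁) = cont₂ (pickP {c₂ + j} {star s [ u ] ++ E} (s ∷ v ∷ []) [] 2≤k z≤n
        (unique-∷ {s} {[ v ]} (λ w → ≤-trans (≤-reflexive (+-identityʳ _)) (δ≤1 v w)) s∉v) (fs ∷ fv ∷ []) (subst (λ c → Inv c (star s [ u ] ++ E)) (+-assoc k c₂ j) J₁))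
      where
      cont₂ : ∃[ t ] (cnt t [] ≡ 0 × cnt t (s ∷ v ∷ []) ≡ 0 × Fr t × Inv (c₂ + j) (star t (s ∷ v ∷ []) ++ star s [ u ] ++ E)) → Res E j (Token n d u v)
      cont₂ (t , _ , t∉ , ft , J₂) = cont₃ (extend d S₀ fS₀ uS₀ q≤ (subst (λ c → Inv c E₂) (+-assoc (d * k) (d * k) j) J₂))
        where
        E₂ : List (Edge n)
        E₂ = star t (s ∷ v ∷ []) ++ star s [ u ] ++ E
        S₀ : List (Fin n)
        S₀ = t ∷ s ∷ []
        fS₀ : All Fr S₀
        fS₀ = ft ∷ fs ∷ []
        uS₀ : Unique S₀
        uS₀ = unique-∷ {t} {[ s ]} (λ w → ≤-trans (≤-reflexive (+-identityʳ _)) (δ≤1 s w)) (cong (_+ 0) (m+n≡0⇒m≡0 (δ s t) t∉))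
        -- `e₀` is a copy of K_q, hence neutral. Replacing its edge st by us and tv keeps the
        -- degrees of `s` and `t`, adds one at `u` and `v`, and adds one edge: modulo cliques, `e₁`
        -- acts as the edge uv.
        port : ∀ {a} → Ext d S₀ a → Port n d u v
        port {a} M = record { e₀ = cl S ; e₁ = (u , s) ∷ (t , v) ∷ a
          ; deg₀ = λ x → cnt x S , ≡.trans (degL-cl S x) (cong (λ m → cnt x S * pred m) lenS)
          ; len₀ = 1 , ≡.trans (≡.trans (length-cl S) (cong tri lenS)) (≡.sym (+-identityʳ _))
          ; deg₁ = λ x → ≡.trans (dg (δ u x) (δ s x) (δ t x) (δ v x) (degL a x)) (cong (_+ incψ x u v) (value (incψ x) (incψ-sym x)))
          ; len₁ = cong suc (≡.trans (+-comm 1 (length a)) (≡.trans (cong₂ _+_ (length≡ev a) ≡.refl) (≡.trans (value (λ _ _ → 1) (λ _ _ → ≡.refl)) (≡.sym (length≡ev (cl S))))))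
          ; small = ≤-reflexive (≡.trans (length-cl S) (cong tri lenS)) }
          where
          open Ext M
          lenS : length S ≡ 2 + d
          lenS = ≡.trans len (+-comm d 2)
          dg : ∀ u s t v a → u + s + (t + v + a) ≡ a + (t + s + 0) + (u + v)
          dg = solve 5 (λ u s t v a → u :+ s :+ (t :+ v :+ a) := a :+ (t :+ s :+ con 0) :+ (u :+ v)) ≡.refl
        cont₃ : Res E₂ (d * k + j) (Ext d S₀) → Res E j (Token n d u v)
        cont₃ (res a J₃ M) = cont₄ (extend d S₀ fS₀ uS₀ q≤ J₃)
          where
          new : List (Edge n) → List (Edge n)
          new b = b ++ a ++ star t (s ∷ v ∷ []) ++ star s [ u ]
          ar : ∀ ts tv us a b → a + (ts + 0) + (us + (tv + b)) ≡ b + (a + (ts + (tv + (us + 0))))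
          ar = solve 5 (λ ts tv us a b → a :+ (ts :+ con 0) :+ (us :+ (tv :+ b)) := b :+ (a :+ (ts :+ (tv :+ (us :+ con 0))))) ≡.refl
          ar' : ∀ ts tv us a b → us + (tv + a) + (b + (ts + 0)) ≡ b + (a + (ts + (tv + (us + 0))))
          ar' = solve 5 (λ ts tv us a b → us :+ (tv :+ a) :+ (b :+ (ts :+ con 0)) := b :+ (a :+ (ts :+ (tv :+ (us :+ con 0))))) ≡.refl
          cont₄ : Res (a ++ E₂) j (Ext d S₀) → Res E j (Token n d u v)
          cont₄ (res b J₄ N) = res (new b) (subst (Inv j) assoc J₄) record
            { receiver = port M ; sender = port N
            ; split₀ = λ ψ sy → ≡.trans (cong₂ _+_ (≡.sym (Ext.value M ψ sy)) (cong (_+ (ψ t v + ev ψ b)) (sy u s))) (≡.trans (ar (ψ t s) (ψ t v) (ψ s u) (ev ψ a) (ev ψ b)) (≡.sym (total ψ)))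
            ; split₁ = λ ψ sy → ≡.trans (cong₂ _+_ (cong (_+ (ψ t v + ev ψ a)) (sy u s)) (≡.sym (Ext.value N ψ sy))) (≡.trans (ar' (ψ t s) (ψ t v) (ψ s u) (ev ψ a) (ev ψ b)) (≡.sym (total ψ))) }
            where
            assoc : b ++ a ++ E₂ ≡ new b ++ E
            assoc = ≡.trans (cong (b ++_) (≡.sym (++-assoc a ((t , s) ∷ (t , v) ∷ (s , u) ∷ []) E))) (≡.sym (++-assoc b (a ++ (t , s) ∷ (t , v) ∷ (s , u) ∷ []) E))
            total : ∀ ψ → ev ψ (new b) ≡ ev ψ b + (ev ψ a + (ψ t s + (ψ t v + (ψ s u + 0))))
            total ψ = ≡.trans (ev-++ ψ b (a ++ (t , s) ∷ (t , v) ∷ (s , u) ∷ [])) (cong (ev ψ b +_) (ev-++ ψ a ((t , s) ∷ (t , v) ∷ (s , u) ∷ [])))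

  tokens : ∀ m u v {j E} → Fr u → Fr v → 1 ≤ Av → Inv (m * tokenCost + j) E → Res E j (Tokens n d u v m)
  tokens zero    u v         fu fv av I = res [] I []
  tokens (suc m) u v {j} {E} fu fv av I = cont (token u v fu fv av (subst (λ c → Inv c E) (+-assoc tokenCost (m * tokenCost) j) I))
    where
    cont : Res E (m * tokenCost + j) (Token n d u v) → Res E j (Tokens n d u v (suc m))
    cont (res a J t) = glue (tokens m u v fu fv av J)
      where
      glue : Res (a ++ E) j (Tokens n d u v m) → Res E j (Tokens n d u v (suc m))
      glue (res b J' ts) = res (b ++ a) (subst (Inv j) (≡.sym (++-assoc b a E)) J') (t ∷ ts)

-- Circuits moving degrees modulo q-1 and the number of edges modulo (q choose 2)

-- Congruence of natural numbers without subtraction: multiples of `k` may be added on either side.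
Cong : ℕ → ℕ → ℕ → Set
Cong k a b = ∃[ s ] ∃[ t ] a + s * k ≡ b + t * k

cong-≡ : ∀ {k a b} → a ≡ b → Cong k a b
cong-≡ e = 0 , 0 , cong (_+ 0) e

cong-sym : ∀ {k a b} → Cong k a b → Cong k b a
cong-sym (s , t , e) = t , s , ≡.sym e

cong-trans : ∀ {k a b c} → Cong k a b → Cong k b c → Cong k a c
cong-trans {k} {a} {b} {c} (s , t , e) (s' , t' , e') = s + s' , t' + t ,
  ≡.trans (l₁ a s s' k) (≡.trans (cong (_+ s' * k) e) (≡.trans (l₂ b t s' k) (≡.trans (cong (_+ t * k) e') (≡.sym (l₁ c t' t k)))))
  where
  l₁ : ∀ a s s' k → a + (s + s') * k ≡ a + s * k + s' * k
  l₁ = solve 4 (λ a s s' k → a :+ (s :+ s') :* k := a :+ s :* k :+ s' :* k) ≡.refl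
  l₂ : ∀ b t s' k → b + t * k + s' * k ≡ b + s' * k + t * k
  l₂ = solve 4 (λ b t s' k → b :+ t :* k :+ s' :* k := b :+ s' :* k :+ t :* k) ≡.refl

cong-+ : ∀ {k a b c d} → Cong k a b → Cong k c d → Cong k (a + c) (b + d)
cong-+ {k} {a} {b} {c} {d} (s , t , e) (s' , t' , e') = s + s' , t + t' ,
  ≡.trans (l a s c s' k) (≡.trans (cong₂ _+_ e e') (≡.sym (l b t d t' k)))
  where
  l : ∀ a s c s' k → a + c + (s + s') * k ≡ (a + s * k) + (c + s' * k)
  l = solve 5 (λ a s c s' k → a :+ c :+ (s :+ s') :* k := (a :+ s :* k) :+ (c :+ s' :* k)) ≡.refl

cong-cancelˡ : ∀ {k a b c} → Cong k (a + b) (a + c) → Cong k b c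
cong-cancelˡ {k} {a} {b} {c} (s , t , e) = s , t , +-cancelˡ-≡ a _ _ (≡.trans (≡.sym (+-assoc a b _)) (≡.trans e (+-assoc a c _)))

cong-* : ∀ {k a b} c → Cong k a b → Cong k (c * a) (c * b)
cong-* {k} {a} {b} c (s , t , e) = c * s , c * t , ≡.trans (l c a s k) (≡.trans (cong (c *_) e) (≡.sym (l c b t k)))
  where
  l : ∀ c a s k → c * a + c * s * k ≡ c * (a + s * k)
  l = solve 4 (λ c a s k → c :* a :+ c :* s :* k := c :* (a :+ s :* k)) ≡.refl

cong-mult : ∀ {k} c → Cong k (c * k) 0
cong-mult {k} c = 0 , c , +-identityʳ _

module Perms {A : Set} where
  open import Algebra.Solver.CommutativeMonoid (++-commutativeMonoid {A = A}) renaming (solve to solveP)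

  perm₁ : (a b c d : List A) → (a ++ b) ++ (c ++ d) ↭ (b ++ d) ++ (a ++ c)
  perm₁ = solveP 4 (λ a b c d → (a ⊕ b) ⊕ (c ⊕ d) ⊜ (b ⊕ d) ⊕ (a ⊕ c)) ↭-refl

  perm₂ : (a b c : List A) → (a ++ b) ++ c ↭ (a ++ c) ++ b
  perm₂ = solveP 3 (λ a b c → (a ⊕ b) ⊕ c ⊜ (a ⊕ c) ⊕ b) ↭-refl

  perm₃ : (a b c : List A) → a ++ (b ++ c) ↭ b ++ (a ++ c)
  perm₃ = solveP 3 (λ a b c → a ⊕ (b ⊕ c) ⊜ b ⊕ (a ⊕ c)) ↭-refl

  perm₄ : (e u U v V w : List A) → e ++ ((u ++ U) ++ ((v ++ V) ++ w)) ↭ (e ++ u ++ v ++ w) ++ (U ++ V)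
  perm₄ = solveP 6 (λ e u U v V w → e ⊕ ((u ⊕ U) ⊕ ((v ⊕ V) ⊕ w)) ⊜ (e ⊕ (u ⊕ (v ⊕ w))) ⊕ (U ⊕ V)) ↭-refl

  perm₅ : (u U v V w : List A) → (u ++ v ++ w) ++ (U ++ V) ↭ (u ++ U) ++ ((v ++ V) ++ w)
  perm₅ = solveP 5 (λ u U v V w → (u ⊕ (v ⊕ w)) ⊕ (U ⊕ V) ⊜ (u ⊕ U) ⊕ ((v ⊕ V) ⊕ w)) ↭-refl

  perm₆ : (a b w g : List A) → (a ++ (b ++ w)) ++ g ↭ (b ++ w) ++ (a ++ g)
  perm₆ = solveP 4 (λ a b w g → (a ⊕ (b ⊕ w)) ⊕ g ⊜ (b ⊕ w) ⊕ (a ⊕ g)) ↭-refl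

  perm₇ : (b w y g : List A) → (b ++ w) ++ (y ++ g) ↭ (w ++ y) ++ (b ++ g)
  perm₇ = solveP 4 (λ b w y g → (b ⊕ w) ⊕ (y ⊕ g) ⊜ (w ⊕ y) ⊕ (b ⊕ g)) ↭-refl

  perm₈ : (w y y' g : List A) → (w ++ y) ++ (y' ++ g) ↭ (y ++ (y' ++ w)) ++ g
  perm₈ = solveP 4 (λ w y y' g → (w ⊕ y) ⊕ (y' ⊕ g) ⊜ (y ⊕ (y' ⊕ w)) ⊕ g) ↭-refl

  perm₉ : (a b c g : List A) → (a ++ b) ++ (c ++ g) ↭ (a ++ g) ++ (b ++ c)
  perm₉ = solveP 4 (λ a b c g → (a ⊕ b) ⊕ (c ⊕ g) ⊜ (a ⊕ g) ⊕ (b ⊕ c)) ↭-refl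

  perm₀ : (a g r c : List A) → (a ++ g) ++ (r ++ c) ↭ (a ++ c) ++ (r ++ g)
  perm₀ = solveP 4 (λ a g r c → (a ⊕ g) ⊕ (r ⊕ c) ⊜ (a ⊕ c) ⊕ (r ⊕ g)) ↭-refl

-- In the application `M₁` is q-1, `M₂` is (q choose 2), `I` is the set of grid positions and `Cfg`
-- that of divisible subgraphs. The modulus `suc m'` is a common multiple of both, so that the
-- coefficient `m'` acts as -1.
module Circuit (I Cfg : Set) (M₁ M₂ m' x₁ x₂ : ℕ) (m≡₁ : suc m' ≡ x₁ * M₁) (m≡₂ : suc m' ≡ x₂ * M₂) where
  open Perms

  Val : Set
  Val = Cfg → ℕ

  -- A wire stands for val copies, modulo m, of the pair ab; val depends on the graph that is to be absorbed.
  record Wire : Set where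
    constructor W
    field
      a b : I
      val : Val
  open Wire

  -- Degrees tested against an arbitrary weight. Conservation for all `φ` is conservation of degrees
  -- at every position; it also survives when positions are identified by a map to vertices, and
  -- special weights later isolate single wires.
  Φ : (I → ℕ) → List Wire → Cfg → ℕ
  Φ φ Ws c = Σl (λ w → val w c * (φ (a w) + φ (b w))) Ws

  N : List Wire → Cfg → ℕ
  N Ws c = Σl (λ w → val w c) Ws

  endpoints : List Wire → List (I × I)
  endpoints = map (λ w → a w , b w)

  Λ : (I → ℕ) → List (I × I) → ℕ
  Λ φ = Σl (λ (x , y) → φ x + φ y)

  Conserves : List Wire → List Wire → Set
  Conserves In Out = ∀ c → (∀ φ → Cong M₁ (Φ φ In c) (Φ φ Out c)) × Cong M₂ (N In c) (N Out c)

  -- Derivations, indexed by the pairs of endpoints of the wires that they create.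
  data Der : List Wire → List Wire → List (I × I) → Set where
    perm : ∀ {A B} → A ↭ B → Der A B []
    -- A fixed bound on the number of wires keeps the graphs to be absorbed bounded independently of
    -- `n`. The largest gadgets used have four inputs and three outputs.
    gad  : ∀ In Out → length In + length Out ≤ 8 → Conserves In Out → Der In Out (endpoints Out)
    par  : ∀ {A B A' B' o o'} → Der A B o → Der A' B' o' → Der (A ++ A') (B ++ B') (o ++ o')
    seq  : ∀ {A B C o o'} → Der A B o → Der B C o' → Der A C (o ++ o')

  conserves : ∀ {A B o} → Der A B o → Conserves A B
  conserves (perm p) c = (λ φ → cong-≡ (Σl-↭ _ p)) , cong-≡ (Σl-↭ _ p)
  conserves (gad _ _ _ h) c = h c
  conserves (par {A} {B} {A'} {B'} d e) c =
    (λ φ → cong-trans (cong-≡ (Σl-++ _ A A')) (cong-trans (cong-+ (proj₁ (conserves d c) φ) (proj₁ (conserves e c) φ)) (cong-≡ (≡.sym (Σl-++ _ B B'))))) ,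
    cong-trans (cong-≡ (Σl-++ _ A A')) (cong-trans (cong-+ (proj₂ (conserves d c)) (proj₂ (conserves e c))) (cong-≡ (≡.sym (Σl-++ _ B B'))))
  conserves (seq d e) c = (λ φ → cong-trans (proj₁ (conserves d c) φ) (proj₁ (conserves e c) φ)) , cong-trans (proj₂ (conserves d c)) (proj₂ (conserves e c))

  Cost : Set
  Cost = (I → ℕ) → ℕ

  -- The cost is bounded for all weights at once. With the indicator of a vertex as `φ`, the same
  -- derivation yields the number of wire ends created at that vertex.
  DerC : List Wire → List Wire → Cost → Set
  DerC A B κ = ∃[ o ] (Der A B o × (∀ φ → Λ φ o ≤ κ φ))

  permC : ∀ {A B} → A ↭ B → DerC A B (λ _ → 0)
  permC p = [] , perm p , λ _ → z≤n

  gadC : ∀ In Out → length In + length Out ≤ 8 → Conserves In Out → DerC In Out (λ φ → Λ φ (endpoints Out))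
  gadC In Out l h = endpoints Out , gad In Out l h , λ _ → ≤-refl

  infixr 3 _∥_
  _∥_ : ∀ {A B A' B' κ κ'} → DerC A B κ → DerC A' B' κ' → DerC (A ++ A') (B ++ B') (λ φ → κ φ + κ' φ)
  (o , d , h) ∥ (o' , d' , h') = o ++ o' , par d d' , λ φ → ≤-trans (≤-reflexive (Σl-++ _ o o')) (+-mono-≤ (h φ) (h' φ))

  infixr 2 _▸_
  _▸_ : ∀ {A B C κ κ'} → DerC A B κ → DerC B C κ' → DerC A C (λ φ → κ φ + κ' φ)
  (o , d , h) ▸ (o' , d' , h') = o ++ o' , seq d d' , λ φ → ≤-trans (≤-reflexive (Σl-++ _ o o')) (+-mono-≤ (h φ) (h' φ))

  loosen : ∀ {A B κ κ'} → (∀ φ → κ φ ≤ κ' φ) → DerC A B κ → DerC A B κ'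
  loosen le (o , d , h) = o , d , λ φ → ≤-trans (h φ) (le φ)

  before : ∀ {A B C κ} → A ↭ B → DerC B C κ → DerC A C κ
  before p d = permC p ▸ d

  after : ∀ {A B C κ} → DerC A B κ → B ↭ C → DerC A C κ
  after d p = loosen (λ φ → ≤-reflexive (+-identityʳ _)) (d ▸ permC p)

  frame : ∀ {A B κ} R → DerC A B κ → DerC (A ++ R) (B ++ R) κ
  frame R d = loosen (λ φ → ≤-reflexive (+-identityʳ _)) (d ∥ permC (↭-refl {x = R}))

  frameˡ : ∀ {A B κ} R → DerC A B κ → DerC (R ++ A) (R ++ B) κ
  frameˡ R d = permC (↭-refl {x = R}) ∥ d

  -- An identity modulo the common multiple `suc m'` implies both congruences. The witnesses given
  -- below count how often a coefficient `m'` has to be completed to `suc m'`.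
  conserve : ∀ In Out → (∀ c φ → ∃[ s ] ∃[ t ] Φ φ In c + s * suc m' ≡ Φ φ Out c + t * suc m') →
    (∀ c → ∃[ s ] ∃[ t ] N In c + s * suc m' ≡ N Out c + t * suc m') → Conserves In Out
  conserve In Out p r c = (λ φ → lift M₁ x₁ m≡₁ (p c φ)) , lift M₂ x₂ m≡₂ (r c)
    where
    lift : ∀ {y z} M x → suc m' ≡ x * M → ∃[ s ] ∃[ t ] y + s * suc m' ≡ z + t * suc m' → Cong M y z
    lift {y} {z} M x e (s , t , h) = s * x , t * x , ≡.trans (cong (y +_) (mul s)) (≡.trans h (≡.sym (cong (z +_) (mul t))))
      where
      mul : ∀ s → s * x * M ≡ s * suc m'
      mul s = ≡.trans (*-assoc s x M) (cong (s *_) (≡.sym e))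

  zeroV : Val
  zeroV _ = 0

  _⊞_ : Val → Val → Val
  (f ⊞ g) c = f c + g c

  _⊡_ : ℕ → Val → Val
  (k ⊡ f) c = k * f c

  sumV : ∀ {k} → (Fin k → Val) → Val
  sumV {zero}  f = zeroV
  sumV {suc k} f = sumV (f ∘ suc) ⊞ f zero

  colL : ∀ {k} → (Fin k → I) → I → (Fin k → Val) → List Wire
  colL c w f = tabulate (λ i → W (c i) w (f i))

  -- f copies of x - y: as m' = -1 modulo m, the second wire takes away f copies of yy.
  diffL : I → I → Val → List Wire
  diffL x y f = W x y f ∷ W y y (m' ⊡ f) ∷ []

  accL : ∀ {k} → (Fin (suc k) → I) → (Fin k → Val) → List Wire
  accL {zero}  c α = []
  accL {suc k} c α = diffL (c (suc zero)) (c zero) (α zero) ++ accL (c ∘ suc) (α ∘ suc)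

  -- `F` copies of c₁w equal `F` copies of c₀w plus `F` copies of the difference c₁ - c₀, which is
  -- added to the amount `α` stored before.
  step-conserves : ∀ c₁ c₀ w F f α → Conserves (W c₁ w F ∷ W c₀ w f ∷ diffL c₁ c₀ α) (W c₀ w (F ⊞ f) ∷ diffL c₁ c₀ (α ⊞ F))
  step-conserves c₁ c₀ w F f α = conserve (W c₁ w F ∷ W c₀ w f ∷ diffL c₁ c₀ α) (W c₀ w (F ⊞ f) ∷ diffL c₁ c₀ (α ⊞ F))
      (λ c φ → 2 * F c * φ c₀ , 0 , r₁ m' (F c) (f c) (α c) (φ c₀) (φ c₁) (φ w)) (λ c → F c , 0 , r₂ m' (F c) (f c) (α c))
    where
    r₁ : ∀ m F f α p₀ p₁ w → F * (p₁ + w) + (f * (p₀ + w) + (α * (p₁ + p₀) + (m * α * (p₀ + p₀) + 0))) + 2 * F * p₀ * (1 + m) ≡ (F + f) * (p₀ + w) + ((α + F) * (p₁ + p₀) + (m * (α + F) * (p₀ + p₀) + 0)) + 0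
    r₁ = solve 7 (λ m F f α p₀ p₁ w → F :* (p₁ :+ w) :+ (f :* (p₀ :+ w) :+ (α :* (p₁ :+ p₀) :+ (m :* α :* (p₀ :+ p₀) :+ con 0))) :+ con 2 :* F :* p₀ :* (con 1 :+ m) := (F :+ f) :* (p₀ :+ w) :+ ((α :+ F) :* (p₁ :+ p₀) :+ (m :* (α :+ F) :* (p₀ :+ p₀) :+ con 0)) :+ con 0) ≡.refl
    r₂ : ∀ m F f α → F + (f + (α + (m * α + 0))) + F * (1 + m) ≡ (F + f) + ((α + F) + (m * (α + F) + 0)) + 0
    r₂ = solve 4 (λ m F f α → F :+ (f :+ (α :+ (m :* α :+ con 0))) :+ F :* (con 1 :+ m) := (F :+ f) :+ ((α :+ F) :+ (m :* (α :+ F) :+ con 0)) :+ con 0) ≡.refl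

  private
    -- A step creates c₀w, c₁c₀ and the loop c₀c₀: four ends at c₀ and one each at c₁ and `w`. An
    -- inner position plays both parts, hence 5; the last one only that of c₀, hence 4.
    tight : ∀ {k} → (Fin (suc k) → I) → I → Cost
    tight {k} c w φ = 4 * φ (c zero) + (5 * ΣF {k} (λ i → φ (c (suc i))) + k * φ w)

  -- The accumulators are read and written again with new values. Since differences are stored and
  -- not cancelled, one chain of accumulators serves every column that is ever collapsed along `c`.
  collapse′ : ∀ {k} (c : Fin (suc k) → I) w f (α : Fin k → Val) →
    ∃[ α' ] DerC (colL c w f ++ accL c α) (W (c zero) w (sumV f) ∷ accL c α') (tight c w)
  collapse′ {zero}  c w f α = α , loosen (λ _ → z≤n) (permC ↭-refl)
  collapse′ {suc k} c w f α = cont (collapse′ (c ∘ suc) w (f ∘ suc) (α ∘ suc))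
    where
    c₁ c₀ : I
    c₁ = c (suc zero)
    c₀ = c zero
    D : List Wire
    D = diffL c₁ c₀ (α zero)
    F : Val
    F = sumV (f ∘ suc)
    cont : ∃[ α' ] DerC (colL (c ∘ suc) w (f ∘ suc) ++ accL (c ∘ suc) (α ∘ suc)) (W c₁ w F ∷ accL (c ∘ suc) α') (tight (c ∘ suc) w) → _
    cont (α' , d) = (λ { zero → α zero ⊞ F ; (suc i) → α' i }) , loosen bound (
        before (perm₁ [ W c₀ w (f zero) ] (colL (c ∘ suc) w (f ∘ suc)) D (accL (c ∘ suc) (α ∘ suc)))
        (frame ([ W c₀ w (f zero) ] ++ D) d
        ▸ before (perm₂ [ W c₁ w F ] (accL (c ∘ suc) α') ([ W c₀ w (f zero) ] ++ D))
        (frame (accL (c ∘ suc) α') (gadC (W c₁ w F ∷ W c₀ w (f zero) ∷ D) (W c₀ w (F ⊞ f zero) ∷ diffL c₁ c₀ (α zero ⊞ F)) (s≤s (s≤s (s≤s (s≤s (s≤s (s≤s (s≤s z≤n)))))))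
           (step-conserves c₁ c₀ w F (f zero) (α zero))))))
      where
      bound : ∀ φ → tight (c ∘ suc) w φ + ((φ c₀ + φ w) + ((φ c₁ + φ c₀) + ((φ c₀ + φ c₀) + 0))) ≤ tight c w φ
      bound φ = ≤-reflexive (≡.trans (b₁ (φ c₀) (φ w) (φ c₁) (ΣF {k} (λ i → φ (c (suc (suc i))))) k) (cong (λ t → 4 * φ c₀ + (5 * t + suc k * φ w)) (≡.sym (ΣF-suc (λ i → φ (c (suc i)))))))
        where
        b₁ : ∀ p w r S k → 4 * r + (5 * S + k * w) + ((p + w) + ((r + p) + ((p + p) + 0))) ≡ 4 * p + (5 * (r + S) + (1 + k) * w)
        b₁ = solve 5 (λ p w r S k → con 4 :* r :+ (con 5 :* S :+ k :* w) :+ ((p :+ w) :+ ((r :+ p) :+ ((p :+ p) :+ con 0))) := con 4 :* p :+ (con 5 :* (r :+ S) :+ (con 1 :+ k) :* w)) ≡.refl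

  collapseCost : ∀ {k} → (Fin (suc k) → I) → I → Cost
  collapseCost {k} c w φ = 5 * ΣF (φ ∘ c) + suc k * φ w

  collapse : ∀ {k} (c : Fin (suc k) → I) w f (α : Fin k → Val) →
    ∃[ α' ] DerC (colL c w f ++ accL c α) (W (c zero) w (sumV f) ∷ accL c α') (collapseCost c w)
  collapse {k} c w f α = let α' , d = collapse′ c w f α in α' , loosen (λ φ → ≤-trans (≤-reflexive (≡.sym (+-assoc (4 * φ (c zero)) (5 * ΣF {k} (λ i → φ (c (suc i)))) (k * φ w))))
    (+-mono-≤ (≤-trans (+-monoˡ-≤ (5 * ΣF {k} (λ i → φ (c (suc i)))) (*-monoˡ-≤ (φ (c zero)) (n≤1+n 4)))
       (≤-reflexive (≡.trans (≡.sym (*-distribˡ-+ 5 (φ (c zero)) _)) (cong (5 *_) (≡.sym (ΣF-suc (φ ∘ c))))))) (m≤n+m _ (φ w)))) d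

  gadE : ∀ In Out → length In + length Out ≤ 8 → (∀ c φ → Φ φ In c ≡ Φ φ Out c) → (∀ c → N In c ≡ N Out c) → DerC In Out (λ φ → Λ φ (endpoints Out))
  gadE In Out l p r = gadC In Out l (λ c → (λ φ → cong-≡ (p c φ)) , cong-≡ (r c))

  -- Wires of value 0 change neither invariant, so they can be created from nothing.
  zeroCol : ∀ {k} (c : Fin k → I) w → DerC [] (colL c w (λ _ → zeroV)) (λ φ → ΣF (φ ∘ c) + k * φ w)
  zeroCol {zero}  c w = permC ↭-refl
  zeroCol {suc k} c w = loosen (λ φ → ≤-reflexive (≡.trans (r₁ (φ (c zero)) (φ w) (ΣF (λ i → φ (c (suc i)))) (k * φ w)) (cong (_+ suc k * φ w) (≡.sym (ΣF-suc (φ ∘ c))))))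
    (gadE [] [ W (c zero) w zeroV ] (s≤s z≤n) (λ _ _ → ≡.refl) (λ _ → ≡.refl) ∥ zeroCol (c ∘ suc) w)
    where
    r₁ : ∀ p w s t → p + w + 0 + (s + t) ≡ p + s + (w + t)
    r₁ = solve 4 (λ p w s t → p :+ w :+ con 0 :+ (s :+ t) := p :+ s :+ (w :+ t)) ≡.refl

  zeroAcc : ∀ {k} (c : Fin (suc k) → I) → DerC [] (accL c (λ _ → zeroV)) (λ φ → 4 * ΣF (φ ∘ c))
  zeroAcc c = loosen (λ φ → ≤-trans (+-monoˡ-≤ _ (*-monoˡ-≤ (φ (c zero)) (n≤1+n 3))) (≤-reflexive (≡.trans (≡.sym (*-distribˡ-+ 4 (φ (c zero)) _)) (cong (4 *_) (≡.sym (ΣF-suc (φ ∘ c))))))) (go c)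
    where
    r₁ : ∀ p r S → (r + p) + ((p + p) + 0) + (3 * r + 4 * S) ≡ 3 * p + 4 * (r + S)
    r₁ = solve 3 (λ p r S → (r :+ p) :+ ((p :+ p) :+ con 0) :+ (con 3 :* r :+ con 4 :* S) := con 3 :* p :+ con 4 :* (r :+ S)) ≡.refl
    go : ∀ {k} (c : Fin (suc k) → I) → DerC [] (accL c (λ _ → zeroV)) (λ φ → 3 * φ (c zero) + 4 * ΣF (λ i → φ (c (suc i))))
    go {zero}  c = loosen (λ _ → z≤n) (permC ↭-refl)
    go {suc k} c = loosen (λ φ → ≤-reflexive (≡.trans (r₁ (φ (c zero)) (φ (c (suc zero))) (ΣF {k} (λ i → φ (c (suc (suc i)))))) (cong (λ t → 3 * φ (c zero) + 4 * t) (≡.sym (ΣF-suc (λ i → φ (c (suc i))))))))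
      (gadE [] (diffL (c (suc zero)) (c zero) zeroV) (s≤s (s≤s z≤n)) (λ _ φ → ≡.sym (cong (λ t → t * (φ (c zero) + φ (c zero)) + 0) (*-zeroʳ m'))) (λ _ → ≡.sym (cong (_+ 0) (*-zeroʳ m'))) ∥ go (c ∘ suc))

  rest : ∀ {k} → (Fin k → I) → I → (Fin k → Val) → Fin k → List Wire
  rest c w f zero    = colL (c ∘ suc) w (f ∘ suc)
  rest c w f (suc i) = W (c zero) w (f zero) ∷ rest (c ∘ suc) w (f ∘ suc) i

  upd : ∀ {k} → (Fin k → Val) → Fin k → Val → Fin k → Val
  upd f zero    v zero    = v
  upd f zero    v (suc j) = f (suc j)
  upd f (suc i) v zero    = f zero
  upd f (suc i) v (suc j) = upd (f ∘ suc) i v j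

  focus : ∀ {k} (c : Fin k → I) w f i → colL c w f ↭ W (c i) w (f i) ∷ rest c w f i
  focus c w f zero    = ↭-refl
  focus c w f (suc i) = trans (prep _ (focus (c ∘ suc) w (f ∘ suc) i)) (swap _ _ ↭-refl)

  unfocus : ∀ {k} (c : Fin k → I) w f i v → W (c i) w v ∷ rest c w f i ↭ colL c w (upd f i v)
  unfocus c w f zero    v = ↭-refl
  unfocus c w f (suc i) v = trans (swap _ _ ↭-refl) (prep _ (unfocus (c ∘ suc) w (f ∘ suc) i v))

  sumV-upd : ∀ {k} (f : Fin k → Val) i b c → sumV (upd f i (f i ⊞ b)) c ≡ sumV f c + b c
  sumV-upd f zero    b c = ≡.sym (+-assoc (sumV (f ∘ suc) c) _ _)
  sumV-upd f (suc i) b c = ≡.trans (cong (_+ f zero c) (sumV-upd (f ∘ suc) i b c)) (lem (sumV (f ∘ suc) c) (b c) (f zero c))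
    where
    lem : ∀ s b f → s + b + f ≡ s + f + b
    lem = solve 3 (λ s b f → s :+ b :+ f := s :+ f :+ b) ≡.refl

  sumV-zero : ∀ k c → sumV {k} (λ _ → zeroV) c ≡ 0
  sumV-zero zero    c = ≡.refl
  sumV-zero (suc k) c = ≡.trans (+-identityʳ _) (sumV-zero k c)

  mergeInto : ∀ {k} (r : Fin k → I) p f i κ → DerC (W p (r i) κ ∷ colL r p f) (colL r p (upd f i (f i ⊞ κ))) (λ φ → φ (r i) + φ p)
  mergeInto r p f i κ = loosen (λ φ → ≤-reflexive (+-identityʳ _)) (after (before (prep _ (focus r p f i))
      (frame (rest r p f i) (gadE (W p (r i) κ ∷ W (r i) p (f i) ∷ []) [ W (r i) p (f i ⊞ κ) ] (s≤s (s≤s (s≤s z≤n)))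
        (λ c φ → r₁ (κ c) (f i c) (φ p) (φ (r i))) (λ c → r₂ (κ c) (f i c)))))
      (unfocus r p f i (f i ⊞ κ)))
    where
    r₁ : ∀ κ f p r → κ * (p + r) + (f * (r + p) + 0) ≡ (f + κ) * (r + p) + 0
    r₁ = solve 4 (λ κ f p r → κ :* (p :+ r) :+ (f :* (r :+ p) :+ con 0) := (f :+ κ) :* (r :+ p) :+ con 0) ≡.refl
    r₂ : ∀ κ f → κ + (f + 0) ≡ f + κ + 0
    r₂ = solve 2 (λ κ f → κ :+ (f :+ con 0) := f :+ κ :+ con 0) ≡.refl

  module Hub {k k' : ℕ} (c : Fin k → I) (c' : Fin k' → I) (w : I) where

    hubL : (Fin k → Val) → (Fin k' → Val) → Val → List Wire
    hubL f f' κ = colL c w f ++ (colL c' w f' ++ [ W w w (m' ⊡ κ) ])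

    addEdge : ∀ i j b f f' κ → DerC (W (c i) (c' j) b ∷ hubL f f' κ) (hubL (upd f i (f i ⊞ b)) (upd f' j (f' j ⊞ b)) (κ ⊞ b))
      (λ φ → φ (c i) + φ (c' j) + 4 * φ w)
    addEdge i j b f f' κ = loosen (λ φ → ≤-reflexive (r₀ (φ (c i)) (φ (c' j)) (φ w))) (after
      (before (trans (prep _ (++⁺ (focus c w f i) (++⁺ʳ [ W w w (m' ⊡ κ) ] (focus c' w f' j))))
                     (perm₄ [ W (c i) (c' j) b ] [ W (c i) w (f i) ] (rest c w f i) [ W (c' j) w (f' j) ] (rest c' w f' j) [ W w w (m' ⊡ κ) ]))
        (frame (rest c w f i ++ rest c' w f' j) (gadC In Out (s≤s (s≤s (s≤s (s≤s (s≤s (s≤s (s≤s z≤n)))))))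
          (conserve In Out (λ x φ → 2 * b x * φ w , 0 , r₁ m' (b x) (f i x) (f' j x) (κ x) (φ (c i)) (φ (c' j)) (φ w)) (λ x → b x , 0 , r₂ m' (b x) (f i x) (f' j x) (κ x))))))
      (trans (perm₅ [ W (c i) w (f i ⊞ b) ] (rest c w f i) [ W (c' j) w (f' j ⊞ b) ] (rest c' w f' j) [ W w w (m' ⊡ (κ ⊞ b)) ])
        (++⁺ (unfocus c w f i (f i ⊞ b)) (++⁺ʳ [ W w w (m' ⊡ (κ ⊞ b)) ] (unfocus c' w f' j (f' j ⊞ b))))))
      where
      In Out : List Wire
      In = W (c i) (c' j) b ∷ W (c i) w (f i) ∷ W (c' j) w (f' j) ∷ W w w (m' ⊡ κ) ∷ []
      Out = W (c i) w (f i ⊞ b) ∷ W (c' j) w (f' j ⊞ b) ∷ W w w (m' ⊡ (κ ⊞ b)) ∷ []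
      r₀ : ∀ u v w → (u + w) + ((v + w) + ((w + w) + 0)) ≡ u + v + 4 * w
      r₀ = solve 3 (λ u v w → (u :+ w) :+ ((v :+ w) :+ ((w :+ w) :+ con 0)) := u :+ v :+ con 4 :* w) ≡.refl
      r₁ : ∀ m b f f' κ u v w → b * (u + v) + (f * (u + w) + (f' * (v + w) + (m * κ * (w + w) + 0))) + 2 * b * w * (1 + m) ≡ (f + b) * (u + w) + ((f' + b) * (v + w) + (m * (κ + b) * (w + w) + 0)) + 0
      r₁ = solve 8 (λ m b f f' κ u v w → b :* (u :+ v) :+ (f :* (u :+ w) :+ (f' :* (v :+ w) :+ (m :* κ :* (w :+ w) :+ con 0))) :+ con 2 :* b :* w :* (con 1 :+ m) := (f :+ b) :* (u :+ w) :+ ((f' :+ b) :* (v :+ w) :+ (m :* (κ :+ b) :* (w :+ w) :+ con 0)) :+ con 0) ≡.refl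
      r₂ : ∀ m b f f' κ → b + (f + (f' + (m * κ + 0))) + b * (1 + m) ≡ (f + b) + ((f' + b) + (m * (κ + b) + 0)) + 0
      r₂ = solve 5 (λ m b f f' κ → b :+ (f :+ (f' :+ (m :* κ :+ con 0))) :+ b :* (con 1 :+ m) := (f :+ b) :+ ((f' :+ b) :+ (m :* (κ :+ b) :+ con 0)) :+ con 0) ≡.refl

    edgeWires : List ((Fin k × Fin k') × Val) → List Wire
    edgeWires = map (λ ((i , j) , b) → W (c i) (c' j) b)

    edgeCost : List ((Fin k × Fin k') × Val) → Cost
    edgeCost es φ = Σl (λ ((i , j) , _) → φ (c i) + φ (c' j) + 4 * φ w) es

    -- The two totals say that each side of the hub has received as many edges as have been
    -- subtracted at ww. This is the condition under which `closeHub` can remove the hub.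
    record Filled (A : List Wire) (κ₀ : Cost) : Set where
      field
        f : Fin k → Val
        f' : Fin k' → Val
        κ : Val
        total : ∀ x → sumV f x ≡ κ x
        total' : ∀ x → sumV f' x ≡ κ x
        der : DerC A (hubL f f' κ) κ₀

    fill : ∀ es {f f' κ} → (∀ x → sumV f x ≡ κ x) → (∀ x → sumV f' x ≡ κ x) → Filled (edgeWires es ++ hubL f f' κ) (edgeCost es)
    fill [] s s' = record { total = s ; total' = s' ; der = permC ↭-refl }
    fill (((i , j) , b) ∷ es) {f} {f'} {κ} s s' = record { total = R.total ; total' = R.total'
        ; der = before (perm₃ [ W (c i) (c' j) b ] (edgeWires es) (hubL f f' κ)) (frameˡ (edgeWires es) (addEdge i j b f f' κ) ▸ R.der) }
      where
      R : Filled (edgeWires es ++ hubL (upd f i (f i ⊞ b)) (upd f' j (f' j ⊞ b)) (κ ⊞ b)) (edgeCost es)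
      R = fill es (λ x → ≡.trans (sumV-upd f i b x) (cong (_+ b x) (s x))) (λ x → ≡.trans (sumV-upd f' j b x) (cong (_+ b x) (s' x)))
      module R = Filled R

    fillCost : List ((Fin k × Fin k') × Val) → Cost
    fillCost es φ = (ΣF (φ ∘ c) + k * φ w) + ((ΣF (φ ∘ c') + k' * φ w) + 2 * φ w) + edgeCost es φ

    fillNew : ∀ es → Filled (edgeWires es) (fillCost es)
    fillNew es = record { total = R.total ; total' = R.total' ; der = before (↭-reflexive (≡.sym (++-identityʳ (edgeWires es)))) (frameˡ (edgeWires es) create ▸ R.der) }
      where
      R : Filled (edgeWires es ++ hubL (λ _ → zeroV) (λ _ → zeroV) zeroV) (edgeCost es)
      R = fill es (sumV-zero k) (sumV-zero k')
      module R = Filled R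
      create : DerC [] (hubL (λ _ → zeroV) (λ _ → zeroV) zeroV) (λ φ → (ΣF (φ ∘ c) + k * φ w) + ((ΣF (φ ∘ c') + k' * φ w) + 2 * φ w))
      create = zeroCol c w ∥ zeroCol c' w ∥ loosen (λ φ → ≤-reflexive (r₁ (φ w))) (gadE [] [ W w w (m' ⊡ zeroV) ] (s≤s z≤n)
        (λ _ φ → ≡.sym (cong (λ t → t * (φ w + φ w) + 0) (*-zeroʳ m'))) (λ _ → ≡.sym (cong (_+ 0) (*-zeroʳ m'))))
        where
        r₁ : ∀ w → w + w + 0 ≡ 2 * w
        r₁ = solve 1 (λ w → w :+ w :+ con 0 := con 2 :* w) ≡.refl

  -- After both columns are collapsed, the rule of `addEdge` is read backwards: κ·xw + κ·yw - κ·ww =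
  -- κ·xy.
  closeHub : ∀ x y w F F' κ → (∀ c → F c ≡ κ c) → (∀ c → F' c ≡ κ c) → DerC (W x w F ∷ W y w F' ∷ W w w (m' ⊡ κ) ∷ []) [ W x y κ ] (λ φ → φ x + φ y)
  closeHub x y w F F' κ e e' = loosen (λ φ → ≤-reflexive (+-identityʳ _)) (gadC In [ W x y κ ] (s≤s (s≤s (s≤s (s≤s z≤n)))) (conserve In [ W x y κ ]
      (λ c φ → 0 , 2 * κ c * φ w , ≡.trans (cong₂ (λ s t → s * (φ x + φ w) + (t * (φ y + φ w) + (m' * κ c * (φ w + φ w) + 0)) + 0) (e c) (e' c)) (r₁ m' (κ c) (φ x) (φ y) (φ w)))
      (λ c → 0 , κ c , ≡.trans (cong₂ (λ s t → s + (t + (m' * κ c + 0)) + 0) (e c) (e' c)) (r₂ m' (κ c)))))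
    where
    In : List Wire
    In = W x w F ∷ W y w F' ∷ W w w (m' ⊡ κ) ∷ []
    r₁ : ∀ m κ x y w → κ * (x + w) + (κ * (y + w) + (m * κ * (w + w) + 0)) + 0 ≡ κ * (x + y) + 0 + 2 * κ * w * (1 + m)
    r₁ = solve 5 (λ m κ x y w → κ :* (x :+ w) :+ (κ :* (y :+ w) :+ (m :* κ :* (w :+ w) :+ con 0)) :+ con 0 := κ :* (x :+ y) :+ con 0 :+ con 2 :* κ :* w :* (con 1 :+ m)) ≡.refl
    r₂ : ∀ m κ → κ + (κ + (m * κ + 0)) + 0 ≡ κ + 0 + κ * (1 + m)
    r₂ = solve 2 (λ m κ → κ :+ (κ :+ (m :* κ :+ con 0)) :+ con 0 := κ :+ con 0 :+ κ :* (con 1 :+ m)) ≡.refl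

  gaL : ∀ {t k} → (Fin t → Fin (suc k) → I) → (Fin t → Fin k → Val) → List Wire
  gaL {zero}  cs α = []
  gaL {suc t} cs α = accL (cs zero) (α zero) ++ gaL (cs ∘ suc) (α ∘ suc)

  zeroGA : ∀ {t k} (cs : Fin t → Fin (suc k) → I) → DerC [] (gaL cs (λ _ _ → zeroV)) (λ φ → 4 * ΣF (λ g → ΣF (φ ∘ cs g)))
  zeroGA {zero}  cs = loosen (λ _ → z≤n) (permC ↭-refl)
  zeroGA {suc t} cs = loosen (λ φ → ≤-reflexive (≡.trans (≡.sym (*-distribˡ-+ 4 (ΣF (φ ∘ cs zero)) _)) (cong (4 *_) (≡.sym (ΣF-suc (λ g → ΣF (φ ∘ cs g)))))))
    (zeroAcc (cs zero) ∥ zeroGA (cs ∘ suc))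

  atGA : ∀ {t k} (cs : Fin t → Fin (suc k) → I) g X Y {κ} → (∀ α → ∃[ α' ] DerC (X ++ accL (cs g) α) (Y ++ accL (cs g) α') κ) →
    ∀ α → ∃[ α' ] DerC (X ++ gaL cs α) (Y ++ gaL cs α') κ
  atGA {suc t} {k} cs zero X Y {κ} s α = cont (s (α zero))
    where
    G : List Wire
    G = gaL (cs ∘ suc) (α ∘ suc)
    cont : ∃[ a' ] DerC (X ++ accL (cs zero) (α zero)) (Y ++ accL (cs zero) a') κ → ∃[ α' ] DerC (X ++ gaL cs α) (Y ++ gaL cs α') κ
    cont (a' , d) = (λ { zero → a' ; (suc g) → α (suc g) }) ,
      after (before (↭-reflexive (≡.sym (++-assoc X (accL (cs zero) (α zero)) G))) (frame G d)) (↭-reflexive (++-assoc Y (accL (cs zero) a') G))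
  atGA {suc t} {k} cs (suc g) X Y {κ} s α = cont (atGA (cs ∘ suc) g X Y s (α ∘ suc))
    where
    A₀ : List Wire
    A₀ = accL (cs zero) (α zero)
    cont : ∃[ a' ] DerC (X ++ gaL (cs ∘ suc) (α ∘ suc)) (Y ++ gaL (cs ∘ suc) a') κ → ∃[ α' ] DerC (X ++ gaL cs α) (Y ++ gaL cs α') κ
    cont (a' , d) = (λ { zero → α zero ; (suc g) → a' g }) ,
      after (before (perm₃ X A₀ (gaL (cs ∘ suc) (α ∘ suc))) (frameˡ A₀ d)) (perm₃ A₀ Y (gaL (cs ∘ suc) a'))

  -- The order of the passes: blocks, rows, roots

  module Scheme {k : ℕ} (cs : Fin (suc k) → Fin (suc k) → I) where

    s : ℕ
    s = suc k

    root : Fin s → I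
    root g = cs g zero

    -- edges between two groups, gathered at a common hub
    record Block : Set where
      constructor block
      field
        right : Fin s
        hub   : I
        es    : List ((Fin s × Fin s) × Val)
    open Block

    blockWires : Fin s → Block → List Wire
    blockWires g B = Hub.edgeWires (cs g) (cs (right B)) (hub B) (es B)

    gatherCost : Fin s → Block → Cost
    gatherCost g B φ = Hub.fillCost (cs g) (cs (right B)) (hub B) (es B) φ + (collapseCost (cs g) (hub B) φ + (collapseCost (cs (right B)) (hub B) φ + (φ (root g) + φ (root (right B)))))

    -- A block is reduced to a single wire between the roots of its two groups. The groups may
    -- coincide, so edges inside a row are treated in the same way.
    gather : ∀ g B α → ∃[ κ ] ∃[ α' ] DerC (blockWires g B ++ gaL cs α) (W (root g) (root (right B)) κ ∷ gaL cs α') (gatherCost g B)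
    gather g (block h w es) α = step₁ (atGA cs g (colL (cs g) w f) [ Y ] (λ a → collapse (cs g) w f a) α)
      where
      open Hub (cs g) (cs h) w
      open Filled (fillNew es)
      Y Y' Z : Wire
      Y = W (root g) w (sumV f)
      Y' = W (root h) w (sumV f')
      Z = W w w (m' ⊡ κ)
      C' : List Wire
      C' = colL (cs h) w f'
      Goal : Set
      Goal = ∃[ κ ] ∃[ α' ] DerC (blockWires g (block h w es) ++ gaL cs α) (W (root g) (root h) κ ∷ gaL cs α') (gatherCost g (block h w es))
      step₁ : ∃[ α₁ ] DerC (colL (cs g) w f ++ gaL cs α) ([ Y ] ++ gaL cs α₁) (collapseCost (cs g) w) → Goal
      step₁ (α₁ , d₁) = step₂ (atGA cs h C' [ Y' ] (λ a → collapse (cs h) w f' a) α₁)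
        where
        step₂ : ∃[ α₂ ] DerC (C' ++ gaL cs α₁) ([ Y' ] ++ gaL cs α₂) (collapseCost (cs h) w) → Goal
        step₂ (α₂ , d₂) = κ , α₂ ,
          (frame (gaL cs α) der ▸
           before (perm₆ (colL (cs g) w f) C' [ Z ] (gaL cs α)) (frameˡ (C' ++ [ Z ]) d₁ ▸
           before (perm₇ C' [ Z ] [ Y ] (gaL cs α₁)) (frameˡ ([ Z ] ++ [ Y ]) d₂ ▸
           before (perm₈ [ Z ] [ Y ] [ Y' ] (gaL cs α₂)) (frame (gaL cs α₂) (closeHub (root g) (root h) w (sumV f) (sumV f') κ total total')))))

    blocksWires : Fin s → List Block → List Wire
    blocksWires g []       = []
    blocksWires g (B ∷ Bs) = blockWires g B ++ blocksWires g Bs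

    blockCost : Fin s → Block → Cost
    blockCost g B φ = gatherCost g B φ + (φ (root (right B)) + φ (root g))

    doBlocks : ∀ g Bs f α → ∃[ f' ] ∃[ α' ] DerC (blocksWires g Bs ++ (colL root (root g) f ++ gaL cs α)) (colL root (root g) f' ++ gaL cs α') (λ φ → Σl (λ B → blockCost g B φ) Bs)
    doBlocks g []       f α = f , α , permC ↭-refl
    doBlocks g (B ∷ Bs) f α = cont₁ (gather g B α)
      where
      Goal : Set
      Goal = ∃[ f' ] ∃[ α' ] DerC (blocksWires g (B ∷ Bs) ++ (colL root (root g) f ++ gaL cs α)) (colL root (root g) f' ++ gaL cs α') (λ φ → Σl (λ B → blockCost g B φ) (B ∷ Bs))
      R : List Wire
      R = blocksWires g Bs
      cont₁ : ∃[ κ ] ∃[ α' ] DerC (blockWires g B ++ gaL cs α) (W (root g) (root (right B)) κ ∷ gaL cs α') (gatherCost g B) → Goal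
      cont₁ (κ , α₁ , d₁) = cont₂ (doBlocks g Bs f₁ α₁)
        where
        x : Wire
        x = W (root g) (root (right B)) κ
        f₁ : Fin s → Val
        f₁ = upd f (right B) (f (right B) ⊞ κ)
        cont₂ : ∃[ f' ] ∃[ α' ] DerC (R ++ (colL root (root g) f₁ ++ gaL cs α₁)) (colL root (root g) f' ++ gaL cs α') (λ φ → Σl (λ B → blockCost g B φ) Bs) → Goal
        cont₂ (f₂ , α₂ , d₂) = f₂ , α₂ ,
          before (perm₉ (blockWires g B) R (colL root (root g) f) (gaL cs α)) (
          after (frame (R ++ colL root (root g) f) d₁ ▸
            before (perm₀ [ x ] (gaL cs α₁) R (colL root (root g) f)) (frame (R ++ gaL cs α₁) (mergeInto root (root g) f (right B) κ)))
            (perm₃ (colL root (root g) f₁) R (gaL cs α₁))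
          ▸ d₂)

    Row : Set
    Row = Fin s × List Block

    rowWires : Row → List Wire
    rowWires (g , Bs) = blocksWires g Bs

    rowCost : Row → Cost
    rowCost (g , Bs) φ = (ΣF (φ ∘ root) + s * φ (root g)) + (Σl (λ B → blockCost g B φ) Bs + collapseCost root (root g) φ)

    -- The memory shared by all rows: `α` for the steps inside the groups, `β` for the steps from
    -- root to root.
    GR : (Fin s → Fin k → Val) → (Fin k → Val) → List Wire
    GR α β = gaL cs α ++ accL root β

    doRow : ∀ (r : Row) α β → ∃[ F ] ∃[ α' ] ∃[ β' ] DerC (rowWires r ++ GR α β) (W (root zero) (root (proj₁ r)) F ∷ GR α' β') (rowCost r)
    doRow (g , Bs) α β = cont₁ (doBlocks g Bs (λ _ → zeroV) α)
      where
      Goal : Set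
      Goal = ∃[ F ] ∃[ α' ] ∃[ β' ] DerC (blocksWires g Bs ++ GR α β) (W (root zero) (root g) F ∷ GR α' β') (rowCost (g , Bs))
      X C₀ : List Wire
      X = blocksWires g Bs
      C₀ = colL root (root g) (λ _ → zeroV)
      cont₁ : ∃[ f' ] ∃[ α' ] DerC (X ++ (C₀ ++ gaL cs α)) (colL root (root g) f' ++ gaL cs α') (λ φ → Σl (λ B → blockCost g B φ) Bs) → Goal
      cont₁ (f , α₁ , d₁) = cont₂ (collapse root (root g) f β)
        where
        cont₂ : ∃[ β' ] DerC (colL root (root g) f ++ accL root β) (W (root zero) (root g) (sumV f) ∷ accL root β') (collapseCost root (root g)) → Goal
        cont₂ (β₁ , d₂) = sumV f , α₁ , β₁ ,
          (frameˡ X (frame (GR α β) (zeroCol root (root g))) ▸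
           before (assoc₄ X C₀ (gaL cs α) (accL root β)) (frame (accL root β) d₁ ▸
           before (perm₂ (colL root (root g) f) (gaL cs α₁) (accL root β))
           (after (frame (gaL cs α₁) d₂) (swapTail [ W (root zero) (root g) (sumV f) ] (accL root β₁) (gaL cs α₁)))))
          where
          assoc₄ : (x c g a : List Wire) → x ++ (c ++ (g ++ a)) ↭ (x ++ (c ++ g)) ++ a
          assoc₄ x c g a = ↭-reflexive (≡.trans (cong (x ++_) (≡.sym (++-assoc c g a))) (≡.sym (++-assoc x (c ++ g) a)))
          swapTail : (x a g : List Wire) → (x ++ a) ++ g ↭ x ++ (g ++ a)
          swapTail x a g = trans (perm₂ x a g) (↭-reflexive (++-assoc x g a))

    rowsWires : List Row → List Wire
    rowsWires []       = []
    rowsWires (r ∷ rs) = rowWires r ++ rowsWires rs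

    rowsCost : List Row → Cost
    rowsCost rs φ = Σl (λ r → rowCost r φ + (φ (root (proj₁ r)) + φ (root zero))) rs

    doRows : ∀ rs f α β → ∃[ f' ] ∃[ α' ] ∃[ β' ] DerC (rowsWires rs ++ (colL root (root zero) f ++ GR α β)) (colL root (root zero) f' ++ GR α' β') (rowsCost rs)
    doRows []       f α β = f , α , β , permC ↭-refl
    doRows (r ∷ rs) f α β = cont₁ (doRow r α β)
      where
      g : Fin s
      g = proj₁ r
      Goal : Set
      Goal = ∃[ f' ] ∃[ α' ] ∃[ β' ] DerC (rowsWires (r ∷ rs) ++ (colL root (root zero) f ++ GR α β)) (colL root (root zero) f' ++ GR α' β') (rowsCost (r ∷ rs))
      R : List Wire
      R = rowsWires rs
      cont₁ : ∃[ F ] ∃[ α' ] ∃[ β' ] DerC (rowWires r ++ GR α β) (W (root zero) (root g) F ∷ GR α' β') (rowCost r) → Goal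
      cont₁ (F , α₁ , β₁ , d₁) = cont₂ (doRows rs f₁ α₁ β₁)
        where
        f₁ : Fin s → Val
        f₁ = upd f g (f g ⊞ F)
        cont₂ : ∃[ f' ] ∃[ α' ] ∃[ β' ] DerC (R ++ (colL root (root zero) f₁ ++ GR α₁ β₁)) (colL root (root zero) f' ++ GR α' β') (rowsCost rs) → Goal
        cont₂ (f₂ , α₂ , β₂ , d₂) = f₂ , α₂ , β₂ ,
          before (perm₉ (rowWires r) R (colL root (root zero) f) (GR α β)) (
          after (frame (R ++ colL root (root zero) f) d₁ ▸
            before (perm₀ [ W (root zero) (root g) F ] (GR α₁ β₁) R (colL root (root zero) f)) (frame (R ++ GR α₁ β₁) (mergeInto root (root zero) f g F)))
            (perm₃ (colL root (root zero) f₁) R (GR α₁ β₁))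
          ▸ d₂)

    schemeCost : List Row → Cost
    schemeCost rs φ = ((ΣF (φ ∘ root) + s * φ (root zero)) + (4 * ΣF (λ g → ΣF (φ ∘ cs g)) + 4 * ΣF (φ ∘ root))) + (rowsCost rs φ + collapseCost root (root zero) φ)

    -- The edges are reduced to one loop and one accumulator for each step of a chain. Such a
    -- configuration is determined, modulo the invariants, by weights that can be chosen freely,
    -- which `circuit` exploits.
    scheme : ∀ rs → ∃[ F ] ∃[ α ] ∃[ β ] DerC (rowsWires rs) (W (root zero) (root zero) F ∷ GR α β) (schemeCost rs)
    scheme rs = cont₁ (doRows rs (λ _ → zeroV) (λ _ _ → zeroV) (λ _ → zeroV))
      where
      Goal : Set
      Goal = ∃[ F ] ∃[ α ] ∃[ β ] DerC (rowsWires rs) (W (root zero) (root zero) F ∷ GR α β) (schemeCost rs)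
      X C₀ : List Wire
      X = rowsWires rs
      C₀ = colL root (root zero) (λ _ → zeroV)
      cont₁ : ∃[ f' ] ∃[ α' ] ∃[ β' ] DerC (X ++ (C₀ ++ GR (λ _ _ → zeroV) (λ _ → zeroV))) (colL root (root zero) f' ++ GR α' β') (rowsCost rs) → Goal
      cont₁ (f , α₁ , β₁ , d₁) = cont₂ (collapse root (root zero) f β₁)
        where
        x : Wire
        x = W (root zero) (root zero) (sumV f)
        cont₂ : ∃[ β' ] DerC (colL root (root zero) f ++ accL root β₁) (x ∷ accL root β') (collapseCost root (root zero)) → Goal
        cont₂ (β₂ , d₂) = sumV f , α₁ , β₂ ,
          before (↭-reflexive (≡.sym (++-identityʳ X)))
          (frameˡ X (zeroCol root (root zero) ∥ zeroGA cs ∥ zeroAcc root) ▸ (d₁ ▸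
           before (↭-sym (trans (perm₂ (colL root (root zero) f) (accL root β₁) (gaL cs α₁)) (↭-reflexive (++-assoc (colL root (root zero) f) (gaL cs α₁) (accL root β₁)))))
           (after (frame (gaL cs α₁) d₂) (trans (perm₂ [ x ] (accL root β₂) (gaL cs α₁)) ↭-refl))))

  Φ-++ : ∀ φ A B c → Φ φ (A ++ B) c ≡ Φ φ A c + Φ φ B c
  Φ-++ φ A B c = Σl-++ (λ w → val w c * (φ (a w) + φ (b w))) A B

  N-++ : ∀ A B c → N (A ++ B) c ≡ N A c + N B c
  N-++ A B c = Σl-++ (λ w → val w c) A B

  -- Differences are balanced by testing against functions that are constant along the chain up to one step.
  Φ-diff-flat : ∀ φ x y f c → φ x ≡ φ y → Cong M₁ (Φ φ (diffL x y f) c) 0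
  Φ-diff-flat φ x y f c e = cong-trans (cong-≡ (≡.trans (cong (λ t → f c * (t + φ y) + (m' * f c * (φ y + φ y) + 0)) e)
      (≡.trans (r₁ m' (f c) (φ y)) (≡.trans (cong (2 * f c * φ y *_) m≡₁) (≡.sym (*-assoc (2 * f c * φ y) x₁ M₁)))))) (cong-mult (2 * f c * φ y * x₁))
    where
    r₁ : ∀ m f y → f * (y + y) + (m * f * (y + y) + 0) ≡ 2 * f * y * (1 + m)
    r₁ = solve 3 (λ m f y → f :* (y :+ y) :+ (m :* f :* (y :+ y) :+ con 0) := con 2 :* f :* y :* (con 1 :+ m)) ≡.refl

  Φ-diff-step : ∀ φ x y f c → φ x ≡ 1 → φ y ≡ 0 → Φ φ (diffL x y f) c ≡ f c
  Φ-diff-step φ x y f c e e' = ≡.trans (cong₂ (λ s t → f c * (s + t) + (m' * f c * (t + t) + 0)) e e') (r₁ m' (f c))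
    where
    r₁ : ∀ m f → f * (1 + 0) + (m * f * (0 + 0) + 0) ≡ f
    r₁ = solve 2 (λ m f → f :* (con 1 :+ con 0) :+ (m :* f :* (con 0 :+ con 0) :+ con 0) := f) ≡.refl

  Φ-acc-flat : ∀ {k} φ (c : Fin (suc k) → I) α t z → (∀ i → φ (c i) ≡ t) → Cong M₁ (Φ φ (accL c α) z) 0
  Φ-acc-flat {zero}  φ c α t z e = cong-≡ ≡.refl
  Φ-acc-flat {suc k} φ c α t z e = cong-trans (cong-≡ (Φ-++ φ (diffL (c (suc zero)) (c zero) (α zero)) (accL (c ∘ suc) (α ∘ suc)) z))
    (cong-+ (Φ-diff-flat φ (c (suc zero)) (c zero) (α zero) z (≡.trans (e (suc zero)) (≡.sym (e zero)))) (Φ-acc-flat φ (c ∘ suc) (α ∘ suc) t z (e ∘ suc)))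

  -- A weight that jumps from 0 to 1 between the positions i and i+1 of the chain reads off `α i`
  -- and nothing else.
  Φ-acc-step : ∀ {k} φ (c : Fin (suc k) → I) α (i : Fin k) z → (∀ j → toℕ j ≤ toℕ i → φ (c j) ≡ 0) → (∀ j → toℕ i < toℕ j → φ (c j) ≡ 1) →
    Cong M₁ (Φ φ (accL c α) z) (α i z)
  Φ-acc-step {suc k} φ c α zero z lo hi = cong-trans (cong-≡ (Φ-++ φ (diffL (c (suc zero)) (c zero) (α zero)) (accL (c ∘ suc) (α ∘ suc)) z))
    (cong-trans (cong-+ (cong-≡ (Φ-diff-step φ (c (suc zero)) (c zero) (α zero) z (hi (suc zero) (s≤s z≤n)) (lo zero z≤n)))
      (Φ-acc-flat φ (c ∘ suc) (α ∘ suc) 1 z (λ j → hi (suc j) (s≤s z≤n)))) (cong-≡ (+-identityʳ _)))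
  Φ-acc-step {suc k} φ c α (suc i) z lo hi = cong-trans (cong-≡ (Φ-++ φ (diffL (c (suc zero)) (c zero) (α zero)) (accL (c ∘ suc) (α ∘ suc)) z))
    (cong-+ (Φ-diff-flat φ (c (suc zero)) (c zero) (α zero) z (≡.trans (lo (suc zero) (s≤s z≤n)) (≡.sym (lo zero z≤n))))
      (Φ-acc-step φ (c ∘ suc) (α ∘ suc) i z (λ j p → lo (suc j) (s≤s p)) (λ j p → hi (suc j) (s≤s p))))

  Φ-ga-flat : ∀ {t k} φ (cs : Fin t → Fin (suc k) → I) α z → (∀ g → ∃[ v ] (∀ i → φ (cs g i) ≡ v)) → Cong M₁ (Φ φ (gaL cs α) z) 0
  Φ-ga-flat {zero}  φ cs α z e = cong-≡ ≡.refl
  Φ-ga-flat {suc t} φ cs α z e = cong-trans (cong-≡ (Φ-++ φ (accL (cs zero) (α zero)) (gaL (cs ∘ suc) (α ∘ suc)) z))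
    (cong-+ (Φ-acc-flat φ (cs zero) (α zero) (proj₁ (e zero)) z (proj₂ (e zero))) (Φ-ga-flat φ (cs ∘ suc) (α ∘ suc) z (e ∘ suc)))

  Φ-ga-at : ∀ {t k} φ (cs : Fin t → Fin (suc k) → I) α g z → (∀ h → h ≢ g → ∀ i → φ (cs h i) ≡ 0) → Cong M₁ (Φ φ (gaL cs α) z) (Φ φ (accL (cs g) (α g)) z)
  Φ-ga-at {suc t} φ cs α zero z e = cong-trans (cong-≡ (Φ-++ φ (accL (cs zero) (α zero)) (gaL (cs ∘ suc) (α ∘ suc)) z))
    (cong-trans (cong-+ (cong-≡ ≡.refl) (Φ-ga-flat φ (cs ∘ suc) (α ∘ suc) z (λ g → 0 , e (suc g) (λ ())))) (cong-≡ (+-identityʳ _)))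
  Φ-ga-at {suc t} φ cs α (suc g) z e = cong-trans (cong-≡ (Φ-++ φ (accL (cs zero) (α zero)) (gaL (cs ∘ suc) (α ∘ suc)) z))
    (cong-+ (Φ-acc-flat φ (cs zero) (α zero) 0 z (e zero (λ ()))) (Φ-ga-at φ (cs ∘ suc) (α ∘ suc) g z (λ h ne → e (suc h) (λ p → ne (Data.Fin.Properties.suc-injective p)))))

  N-acc : ∀ {k} (c : Fin (suc k) → I) α z → Cong M₂ (N (accL c α) z) 0
  N-acc {zero}  c α z = cong-≡ ≡.refl
  N-acc {suc k} c α z = cong-trans (cong-≡ (N-++ (diffL (c (suc zero)) (c zero) (α zero)) (accL (c ∘ suc) (α ∘ suc)) z))
    (cong-+ {c = N (accL (c ∘ suc) (α ∘ suc)) z} (cong-trans (cong-≡ (≡.trans (r₁ m' (α zero z)) (≡.trans (cong (α zero z *_) m≡₂) (≡.sym (*-assoc (α zero z) x₂ M₂))))) (cong-mult (α zero z * x₂))) (N-acc (c ∘ suc) (α ∘ suc) z))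
    where
    r₁ : ∀ m f → f + (m * f + 0) ≡ f * (1 + m)
    r₁ = solve 2 (λ m f → f :+ (m :* f :+ con 0) := f :* (con 1 :+ m)) ≡.refl

  N-ga : ∀ {t k} (cs : Fin t → Fin (suc k) → I) α z → Cong M₂ (N (gaL cs α) z) 0
  N-ga {zero}  cs α z = cong-≡ ≡.refl
  N-ga {suc t} cs α z = cong-trans (cong-≡ (N-++ (accL (cs zero) (α zero)) (gaL (cs ∘ suc) (α ∘ suc)) z)) (cong-+ {c = N (gaL (cs ∘ suc) (α ∘ suc)) z} (N-acc (cs zero) (α zero) z) (N-ga (cs ∘ suc) (α ∘ suc) z))

  -- As `f` copies of x - y contribute f·m edges, their number is always neutral; only the residue
  -- modulo `M₁` has to vanish for the accumulator to be consumed.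
  dropAcc : ∀ {k} (c : Fin (suc k) → I) α → (∀ i z → Cong M₁ (α i z) 0) → DerC (accL c α) [] (λ _ → 0)
  dropAcc {zero}  c α e = permC ↭-refl
  dropAcc {suc k} c α e = gadC (diffL x y f) [] (s≤s (s≤s z≤n)) (λ z → (λ φ → lin φ z) , cnt₀ z) ∥ dropAcc (c ∘ suc) (α ∘ suc) (e ∘ suc)
    where
    x y : I
    x = c (suc zero)
    y = c zero
    f : Val
    f = α zero
    lin : ∀ φ z → Cong M₁ (Φ φ (diffL x y f) z) 0
    lin φ z = cong-trans (cong-≡ (r₁ m' (f z) (φ x) (φ y))) (cong-trans (cong-* (φ x + φ y + m' * (φ y + φ y)) (e zero z)) (cong-≡ (*-zeroʳ (φ x + φ y + m' * (φ y + φ y)))))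
      where
      r₁ : ∀ m f x y → f * (x + y) + (m * f * (y + y) + 0) ≡ (x + y + m * (y + y)) * f
      r₁ = solve 4 (λ m f x y → f :* (x :+ y) :+ (m :* f :* (y :+ y) :+ con 0) := (x :+ y :+ m :* (y :+ y)) :* f) ≡.refl
    cnt₀ : ∀ z → Cong M₂ (N (diffL x y f) z) 0
    cnt₀ z = cong-trans (cong-≡ (≡.trans (r₂ m' (f z)) (≡.trans (cong (f z *_) m≡₂) (≡.sym (*-assoc (f z) x₂ M₂))))) (cong-mult (f z * x₂))
      where
      r₂ : ∀ m f → f + (m * f + 0) ≡ f * (1 + m)
      r₂ = solve 2 (λ m f → f :+ (m :* f :+ con 0) := f :* (con 1 :+ m)) ≡.refl

  dropGA : ∀ {t k} (cs : Fin t → Fin (suc k) → I) α → (∀ g i z → Cong M₁ (α g i z) 0) → DerC (gaL cs α) [] (λ _ → 0)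
  dropGA {zero}  cs α e = permC ↭-refl
  dropGA {suc t} cs α e = dropAcc (cs zero) (α zero) (e zero) ∥ dropGA (cs ∘ suc) (α ∘ suc) (e ∘ suc)

-- The closed circuit on the square grid

module GridCircuit (k : ℕ) (Cfg : Set) (M₁ M₂ m' x₁ x₂ : ℕ) (m≡₁ : suc m' ≡ x₁ * M₁) (m≡₂ : suc m' ≡ x₂ * M₂) where
  open Circuit (Fin (suc k) × Fin (suc k)) Cfg M₁ M₂ m' x₁ x₂ m≡₁ m≡₂ public
  open Scheme {k} _,_ public

  private
    I : Set
    I = Fin (suc k) × Fin (suc k)

    ind-yes : ∀ {P : Set} (d : Dec P) → P → ind d ≡ 1
    ind-yes (yes _) p = ≡.refl
    ind-yes (no ¬p) p = ⊥-elim (¬p p)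

    ind-no : ∀ {P : Set} (d : Dec P) → ¬ P → ind d ≡ 0
    ind-no (yes p) ¬p = ⊥-elim (¬p p)
    ind-no (no _)  ¬p = ≡.refl

    -- Isolates one accumulator of the group `g`. It vanishes at all roots, whose second coordinate
    -- is zero, and therefore sees neither `β` nor the final loop.
    inGroup : Fin (suc k) → ℕ → I → ℕ
    inGroup g i (h , j) = δ g h * ind (i <? toℕ j)

    -- Constant on each group and thus blind to `α`; along the roots it jumps once, and it is 0 at
    -- the root that carries the loop.
    above : ℕ → I → ℕ
    above g (h , j) = ind (g <? toℕ h)

  -- The invariants vanish at the start, hence also at the end. The two families of weights turn
  -- this into the vanishing of each accumulator, after which everything left can be consumed.
  circuit : ∀ rs → (∀ z φ → Cong M₁ (Φ φ (rowsWires rs) z) 0) → (∀ z → Cong M₂ (N (rowsWires rs) z) 0) → DerC (rowsWires rs) [] (schemeCost rs)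
  circuit rs bal₁ bal₂ = cont (scheme rs)
    where
    cont : ∃[ F ] ∃[ α ] ∃[ β ] DerC (rowsWires rs) (W (root zero) (root zero) F ∷ GR α β) (schemeCost rs) → DerC (rowsWires rs) [] (schemeCost rs)
    cont (F , α , β , d) = loosen (λ φ → ≤-reflexive (+-identityʳ _)) (d ▸ (gadC [ x ] [] (s≤s z≤n) dropx ∥ dropGA _,_ α α₀ ∥ dropAcc root β β₀))
      where
      x : Wire
      x = W (root zero) (root zero) F
      end₁ : ∀ z φ → Cong M₁ (Φ φ (x ∷ GR α β) z) 0
      end₁ z φ = cong-trans (cong-sym (proj₁ (conserves (proj₁ (proj₂ d)) z) φ)) (bal₁ z φ)
      end₂ : ∀ z → Cong M₂ (N (x ∷ GR α β) z) 0
      end₂ z = cong-trans (cong-sym (proj₂ (conserves (proj₁ (proj₂ d)) z))) (bal₂ z)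
      eval : ∀ z φ t → φ (root zero) ≡ 0 → Cong M₁ (Φ φ (gaL _,_ α) z + Φ φ (accL root β) z) t → Cong M₁ t 0
      eval z φ t e h = cong-trans (cong-sym h) (cong-trans (cong-≡ (≡.sym (≡.trans (cong (λ p → F z * (p + p) + Φ φ (GR α β) z) e)
          (≡.trans (cong (_+ Φ φ (GR α β) z) (*-zeroʳ (F z))) (Φ-++ φ (gaL _,_ α) (accL root β) z))))) (end₁ z φ))
      α₀ : ∀ g i z → Cong M₁ (α g i z) 0
      α₀ g i z = eval z φ (α g i z) (*-zeroʳ (δ g zero)) (cong-trans (cong-+
          (cong-trans (Φ-ga-at φ _,_ α g z (λ h ne j → cong (_* ind (toℕ i <? toℕ j)) (δ-≢ (ne ∘ ≡.sym))))
            (Φ-acc-step φ (g ,_) (α g) i z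
              (λ j p → ≡.trans (cong (δ g g *_) (ind-no (toℕ i <? toℕ j) (≤⇒≯ p))) (*-zeroʳ (δ g g)))
              (λ j p → ≡.trans (cong₂ _*_ (δ-refl g) (ind-yes (toℕ i <? toℕ j) p)) ≡.refl)))
          (Φ-acc-flat φ root β 0 z (λ h → *-zeroʳ (δ g h)))) (cong-≡ (+-identityʳ _)))
        where
        φ : I → ℕ
        φ = inGroup g (toℕ i)
      β₀ : ∀ g z → Cong M₁ (β g z) 0
      β₀ g z = eval z φ (β g z) ≡.refl (cong-+ (Φ-ga-flat φ _,_ α z (λ h → φ (h , zero) , λ _ → ≡.refl))
          (Φ-acc-step φ root β g z (λ j p → ind-no (toℕ g <? toℕ j) (≤⇒≯ p)) (λ j p → ind-yes (toℕ g <? toℕ j) p)))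
        where
        φ : I → ℕ
        φ = above (toℕ g)
      dropx : Conserves [ x ] []
      dropx z = (λ φ → cong-trans (cong-≡ (r₁ (F z) (φ (root zero)))) (cong-trans (cong-* (φ (root zero)) twice) (cong-≡ (*-zeroʳ (φ (root zero)))))) ,
                cong-trans (cong-≡ (+-identityʳ _)) (cong-trans (cong-sym (cong-trans (cong-≡ (cong (F z +_) (N-++ (gaL _,_ α) (accL root β) z)))
                  (cong-trans (cong-+ {a = F z} (cong-≡ ≡.refl) (cong-+ {c = N (accL root β) z} (N-ga _,_ α z) (N-acc root β z))) (cong-≡ (+-identityʳ _))))) (end₂ z))
        where
        r₁ : ∀ F p → F * (p + p) + 0 ≡ p * (F * 2)
        r₁ = solve 2 (λ F p → F :* (p :+ p) :+ con 0 := p :* (F :* con 2)) ≡.refl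
        one : I → ℕ
        one _ = 1
        -- The weight 1 yields only 2F ≡ 0 modulo `M₁`, but a loop adds 2F to a degree, so this is
        -- exactly enough. That F ≡ 0 modulo `M₂` comes from counting edges.
        twice : Cong M₁ (F z * 2) 0
        twice = cong-trans (cong-sym (cong-trans (cong-≡ (cong (F z * 2 +_) (Φ-++ one (gaL _,_ α) (accL root β) z)))
          (cong-trans (cong-+ {a = F z * 2} (cong-≡ ≡.refl) (cong-+ {c = Φ one (accL root β) z} (Φ-ga-flat one _,_ α z (λ _ → 1 , λ _ → ≡.refl)) (Φ-acc-flat one root β 1 z (λ _ → ≡.refl)))) (cong-≡ (+-identityʳ _))))) (end₁ z one)

-- Realisation of circuits by graphs

sumA : {X : Set} {P : X → Set} {xs : List X} → (∀ {x} → P x → ℕ) → All P xs → ℕ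
sumA f []       = 0
sumA f (p ∷ ps) = f p + sumA f ps

splitA : {X : Set} {P : X → Set} (xs : List X) {ys : List X} → All P (xs ++ ys) → All P xs × All P ys
splitA []       ps       = [] , ps
splitA (x ∷ xs) (p ∷ ps) = p ∷ proj₁ (splitA xs ps) , proj₂ (splitA xs ps)

sumA-split : {X : Set} {P : X → Set} (f : ∀ {x} → P x → ℕ) (xs : List X) {ys : List X} (ps : All P (xs ++ ys)) →
  sumA (λ {x} → f {x}) ps ≡ sumA (λ {x} → f {x}) (proj₁ (splitA xs ps)) + sumA (λ {x} → f {x}) (proj₂ (splitA xs ps))
sumA-split f []       ps       = ≡.refl
sumA-split f (x ∷ xs) (p ∷ ps) = ≡.trans (cong (f p +_) (sumA-split f xs ps)) (≡.sym (+-assoc (f p) _ _))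

sumA-++ : {X : Set} {P : X → Set} (f : ∀ {x} → P x → ℕ) {xs ys : List X} (ps : All P xs) (qs : All P ys) →
  sumA (λ {x} → f {x}) (All-++⁺ ps qs) ≡ sumA (λ {x} → f {x}) ps + sumA (λ {x} → f {x}) qs
sumA-++ f []       qs = ≡.refl
sumA-++ f (p ∷ ps) qs = ≡.trans (cong (f p +_) (sumA-++ f ps qs)) (≡.sym (+-assoc (f p) _ _))

permA : {X : Set} {P : X → Set} {xs ys : List X} → xs ↭ ys → All P xs → All P ys
permA refl         ps           = ps
permA (prep x r)   (p ∷ ps)     = p ∷ permA r ps
permA (swap x y r) (p ∷ p' ∷ ps) = p' ∷ p ∷ permA r ps
permA (trans r r') ps           = permA r' (permA r ps)

sumA-perm : {X : Set} {P : X → Set} (f : ∀ {x} → P x → ℕ) {xs ys : List X} (r : xs ↭ ys) (ps : All P xs) →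
  sumA (λ {x} → f {x}) (permA r ps) ≡ sumA (λ {x} → f {x}) ps
sumA-perm f refl         ps            = ≡.refl
sumA-perm f (prep x r)   (p ∷ ps)      = cong (f p +_) (sumA-perm f r ps)
sumA-perm f (swap x y r) (p ∷ p' ∷ ps) = ≡.trans (cong (λ t → f p' + (f p + t)) (sumA-perm f r ps)) (+-swap (f p') (f p) _)
sumA-perm f (trans r r') ps            = ≡.trans (sumA-perm f r' (permA r ps)) (sumA-perm f r ps)

cong0⇒multiple : ∀ {k a} → Cong k a 0 → ∃[ t ] a ≡ t * k
cong0⇒multiple {k} {a} (s , t , e) with ∣m+n∣m⇒∣n (divides t (≡.trans (+-comm (s * k) a) e)) (divides s ≡.refl)
... | divides c e' = c , e'

multiple⇒cong0 : ∀ {k a} → ∃[ t ] a ≡ t * k → Cong k a 0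
multiple⇒cong0 (t , e) = cong-trans (cong-≡ e) (cong-mult t)

-- two states of consumption
Piece : ℕ → Set
Piece n = List (Edge n) × List (Edge n)

-- All combinations of states, since which of them occurs depends on `L`. Each will get its own
-- absorber.
opts : ∀ {n} → List (Piece n) → List (List (Edge n))
opts []               = [] ∷ []
opts ((e , f) ∷ ps) = map (e ++_) (opts ps) ++ map (f ++_) (opts ps)

opts-∷₀ : ∀ {n} {e f : List (Edge n)} {ps B} → B ∈ opts ps → e ++ B ∈ opts ((e , f) ∷ ps)
opts-∷₀ {e = e} p = ∈-++⁺ˡ (∈-map⁺ (e ++_) p)

opts-∷₁ : ∀ {n} {e f : List (Edge n)} {ps B} → B ∈ opts ps → f ++ B ∈ opts ((e , f) ∷ ps)
opts-∷₁ {e = e} {f} {ps} p = ∈-++⁺ʳ (map (e ++_) (opts ps)) (∈-map⁺ (f ++_) p)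

opts-++ : ∀ {n} (ps : List (Piece n)) {qs B C} → B ∈ opts ps → C ∈ opts qs → B ++ C ∈ opts (ps ++ qs)
opts-++ [] (here ≡.refl) q = q
opts-++ ((e , f) ∷ ps) {qs} {C = C} p q with ∈-++⁻ (map (e ++_) (opts ps)) p
... | inj₁ r = let B' , r' , eq = ∈-map⁻ (e ++_) r in
  subst (_∈ opts (((e , f) ∷ ps) ++ qs)) (≡.sym (≡.trans (cong (_++ C) eq) (++-assoc e B' C))) (opts-∷₀ {e = e} {f} {ps ++ qs} (opts-++ ps r' q))
... | inj₂ r = let B' , r' , eq = ∈-map⁻ (f ++_) r in
  subst (_∈ opts (((e , f) ∷ ps) ++ qs)) (≡.sym (≡.trans (cong (_++ C) eq) (++-assoc f B' C))) (opts-∷₁ {e = e} {f} {ps ++ qs} (opts-++ ps r' q))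

module _ {n d : ℕ} {u v : Fin n} where
  open Port

  pieces : List (Port n d u v) → List (Piece n)
  pieces = map (λ p → e₀ p , e₁ p)

  -- The receivers take `c` ports in state `e₁` and the senders the opposite states. With `m` ports
  -- the sender's side thus amounts to m - c, that is to -c modulo `m`.
  on off : List (Port n d u v) → ℕ → List (Edge n)
  on []       c       = []
  on (p ∷ ps) zero    = e₀ p ++ on ps zero
  on (p ∷ ps) (suc c) = e₁ p ++ on ps c
  off []       c       = []
  off (p ∷ ps) zero    = e₁ p ++ off ps zero
  off (p ∷ ps) (suc c) = e₀ p ++ off ps c

  on∈ : ∀ ps c → on ps c ∈ opts (pieces ps)
  on∈ []       c       = here ≡.refl
  on∈ (p ∷ ps) zero    = opts-∷₀ {e = e₀ p} {e₁ p} {pieces ps} (on∈ ps zero)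
  on∈ (p ∷ ps) (suc c) = opts-∷₁ {e = e₀ p} {e₁ p} {pieces ps} (on∈ ps c)

  off∈ : ∀ ps c → off ps c ∈ opts (pieces ps)
  off∈ []       c       = here ≡.refl
  off∈ (p ∷ ps) zero    = opts-∷₁ {e = e₀ p} {e₁ p} {pieces ps} (off∈ ps zero)
  off∈ (p ∷ ps) (suc c) = opts-∷₀ {e = e₀ p} {e₁ p} {pieces ps} (off∈ ps c)

  private
    dg₀ : ∀ (p : Port n d u v) x → Cong (suc d) (degL (e₀ p) x) 0
    dg₀ p x = multiple⇒cong0 (deg₀ p x)
    dg₁ : ∀ (p : Port n d u v) x → Cong (suc d) (degL (e₁ p) x) (incψ x u v)
    dg₁ p x = cong-trans (cong-≡ (deg₁ p x)) (cong-+ {d = incψ x u v} (dg₀ p x) (cong-≡ ≡.refl))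
    ln₀ : ∀ (p : Port n d u v) → Cong (tri (2 + d)) (length (e₀ p)) 0
    ln₀ p = multiple⇒cong0 (len₀ p)
    ln₁ : ∀ (p : Port n d u v) → Cong (tri (2 + d)) (length (e₁ p)) 1
    ln₁ p = cong-trans (cong-≡ (≡.trans (len₁ p) (+-comm 1 _))) (cong-+ {d = 1} (ln₀ p) (cong-≡ ≡.refl))
    dg++ : ∀ (e f : List (Edge n)) x → degL (e ++ f) x ≡ degL e x + degL f x
    dg++ e f x = ev-++ (incψ x) e f
    r₁ : ∀ e o i c → e + o + (i + c) ≡ (e + i) + (o + c)
    r₁ = solve 4 (λ e o i c → e :+ o :+ (i :+ c) := (e :+ i) :+ (o :+ c)) ≡.refl
    r₂ : ∀ e o c → e + o + (1 + c) ≡ (e + 1) + (o + c)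
    r₂ = solve 3 (λ e o c → e :+ o :+ (con 1 :+ c) := (e :+ con 1) :+ (o :+ c)) ≡.refl

  on-deg : ∀ ps c x → c ≤ length ps → Cong (suc d) (degL (on ps c) x) (c * incψ x u v)
  on-deg []       zero    x le = cong-≡ ≡.refl
  on-deg (p ∷ ps) zero    x le = cong-trans (cong-≡ (dg++ (e₀ p) _ x)) (cong-+ (dg₀ p x) (on-deg ps zero x z≤n))
  on-deg (p ∷ ps) (suc c) x le = cong-trans (cong-≡ (dg++ (e₁ p) _ x)) (cong-+ (dg₁ p x) (on-deg ps c x (s≤s⁻¹ le)))

  off-deg : ∀ ps c x → c ≤ length ps → Cong (suc d) (degL (off ps c) x + c * incψ x u v) (length ps * incψ x u v)
  off-deg []       zero    x le = cong-≡ ≡.refl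
  off-deg (p ∷ ps) zero    x le = cong-trans (cong-≡ (≡.trans (cong (_+ 0) (dg++ (e₁ p) _ x)) (+-assoc (degL (e₁ p) x) _ 0))) (cong-+ (dg₁ p x) (off-deg ps zero x z≤n))
  off-deg (p ∷ ps) (suc c) x le = cong-trans (cong-≡ (≡.trans (cong (_+ suc c * incψ x u v) (dg++ (e₀ p) _ x)) (r₁ (degL (e₀ p) x) (degL (off ps c) x) (incψ x u v) (c * incψ x u v))))
    (cong-+ {c = degL (off ps c) x + c * incψ x u v} (cong-+ {d = incψ x u v} (dg₀ p x) (cong-≡ ≡.refl)) (off-deg ps c x (s≤s⁻¹ le)))

  on-len : ∀ ps c → c ≤ length ps → Cong (tri (2 + d)) (length (on ps c)) c
  on-len []       zero    le = cong-≡ ≡.refl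
  on-len (p ∷ ps) zero    le = cong-trans (cong-≡ (length-++ (e₀ p))) (cong-+ {c = length (on ps zero)} (ln₀ p) (on-len ps zero z≤n))
  on-len (p ∷ ps) (suc c) le = cong-trans (cong-≡ (length-++ (e₁ p))) (cong-+ {c = length (on ps c)} (ln₁ p) (on-len ps c (s≤s⁻¹ le)))

  off-len : ∀ ps c → c ≤ length ps → Cong (tri (2 + d)) (length (off ps c) + c) (length ps)
  off-len []       zero    le = cong-≡ ≡.refl
  off-len (p ∷ ps) zero    le = cong-trans (cong-≡ (≡.trans (cong (_+ 0) (length-++ (e₁ p))) (+-assoc (length (e₁ p)) _ 0))) (cong-+ {c = length (off ps zero) + 0} (ln₁ p) (off-len ps zero z≤n))
  off-len (p ∷ ps) (suc c) le = cong-trans (cong-≡ (≡.trans (cong (_+ suc c) (length-++ (e₀ p))) (r₂ (length (e₀ p)) (length (off ps c)) c)))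
    (cong-+ {c = length (off ps c) + c} (cong-+ {d = 1} (ln₀ p) (cong-≡ ≡.refl)) (off-len ps c (s≤s⁻¹ le)))

  receivers senders : ∀ {m E} → Tokens n d u v m E → List (Port n d u v)
  receivers []       = []
  receivers (t ∷ ts) = Token.receiver t ∷ receivers ts
  senders []       = []
  senders (t ∷ ts) = Token.sender t ∷ senders ts

  length-receivers : ∀ {m E} (ts : Tokens n d u v m E) → length (receivers ts) ≡ m
  length-receivers []       = ≡.refl
  length-receivers (t ∷ ts) = cong suc (length-receivers ts)

  length-senders : ∀ {m E} (ts : Tokens n d u v m E) → length (senders ts) ≡ m
  length-senders []       = ≡.refl
  length-senders (t ∷ ts) = cong suc (length-senders ts)

  on-off : ∀ {m E} (ts : Tokens n d u v m E) c ψ → Symmetric ψ → ev ψ (off (senders ts) c) + ev ψ (on (receivers ts) c) ≡ ev ψ E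
  on-off []       c ψ sy = ≡.refl
  on-off (_∷_ {a = a} {b} t ts) c ψ sy = go c
    where
    r : ∀ s o r q → s + o + (r + q) ≡ (o + q) + (r + s)
    r = solve 4 (λ s o r q → s :+ o :+ (r :+ q) := (o :+ q) :+ (r :+ s)) ≡.refl
    go : ∀ c → ev ψ (off (senders (t ∷ ts)) c) + ev ψ (on (receivers (t ∷ ts)) c) ≡ ev ψ (b ++ a)
    go zero    = ≡.trans (cong₂ _+_ (ev-++ ψ (e₁ (Token.sender t)) _) (ev-++ ψ (e₀ (Token.receiver t)) _)) (≡.trans (r (ev ψ (e₁ (Token.sender t))) _ _ _)
      (≡.trans (cong₂ _+_ (on-off ts zero ψ sy) (Token.split₀ t ψ sy)) (≡.sym (ev-++ ψ b a))))
    go (suc c) = ≡.trans (cong₂ _+_ (ev-++ ψ (e₀ (Token.sender t)) _) (ev-++ ψ (e₁ (Token.receiver t)) _)) (≡.trans (r (ev ψ (e₀ (Token.sender t))) _ _ _)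
      (≡.trans (cong₂ _+_ (on-off ts c ψ sy) (Token.split₁ t ψ sy)) (≡.sym (ev-++ ψ b a))))

  -- Both states of each port are counted, because the options contain both. Summed over the two
  -- sides of a token, every edge then counts exactly twice.
  fullP : (Fin n → Fin n → ℕ) → List (Port n d u v) → ℕ
  fullP ψ = Σl (λ p → ev ψ (e₀ p) + ev ψ (e₁ p))

  full-tokens : ∀ {m E} (ts : Tokens n d u v m E) ψ → Symmetric ψ → fullP ψ (senders ts) + fullP ψ (receivers ts) ≡ 2 * ev ψ E
  full-tokens []       ψ sy = ≡.refl
  full-tokens (_∷_ {a = a} {b} t ts) ψ sy = ≡.trans (r (s₀ t) (s₁ t) (fullP ψ (senders ts)) (r₀ t) (r₁' t) (fullP ψ (receivers ts)))
      (≡.trans (cong₂ _+_ (cong₂ _+_ (Token.split₀ t ψ sy) (Token.split₁ t ψ sy)) (full-tokens ts ψ sy)) (≡.trans (r' (ev ψ a) (ev ψ b)) (cong (2 *_) (≡.sym (ev-++ ψ b a)))))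
    where
    s₀ s₁ r₀ r₁' : ∀ {a} → Token n d u v a → ℕ
    s₀ t = ev ψ (e₀ (Token.sender t))
    s₁ t = ev ψ (e₁ (Token.sender t))
    r₀ t = ev ψ (e₀ (Token.receiver t))
    r₁' t = ev ψ (e₁ (Token.receiver t))
    r : ∀ s₀ s₁ S r₀ r₁ R → s₀ + s₁ + S + (r₀ + r₁ + R) ≡ (r₀ + s₁) + (r₁ + s₀) + (S + R)
    r = solve 6 (λ s₀ s₁ S r₀ r₁ R → s₀ :+ s₁ :+ S :+ (r₀ :+ r₁ :+ R) := (r₀ :+ s₁) :+ (r₁ :+ s₀) :+ (S :+ R)) ≡.refl
    r' : ∀ a b → a + a + 2 * b ≡ 2 * (b + a)
    r' = solve 2 (λ a b → a :+ a :+ con 2 :* b := con 2 :* (b :+ a)) ≡.refl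

module Realize (n d : ℕ) (I Cfg : Set) (π : I → Fin n) (m' x₁ x₂ : ℕ) (m≡₁ : suc m' ≡ x₁ * suc d) (m≡₂ : suc m' ≡ x₂ * tri (2 + d)) where
  open Circuit I Cfg (suc d) (tri (2 + d)) m' x₁ x₂ m≡₁ m≡₂
  open Wire

  m : ℕ
  m = suc m'

  -- The gadget that reads a wire sees it only through ports, `val % m` of them in state `e₁`. A
  -- wire made by a gadget has `m` ports, an edge of the given graph just one.
  record RW (w : Wire) : Set where
    field
      ps   : List (Port n d (π (a w)) (π (b w)))
      fits : ∀ z → val w z % m ≤ length ps
      few  : length ps ≤ m
  open RW

  Re : I × I → Set
  Re (x , y) = ∃ (Tokens n d (π x) (π y) m)

  SmallPiece : Piece n → Set
  SmallPiece (e , f) = length e ≤ suc (tri (2 + d)) × length f ≤ suc (tri (2 + d))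

  record Gadget : Set where
    field
      pcs  : List (Piece n)
      ch   : Cfg → List (Edge n)
      ch∈  : ∀ z → ch z ∈ opts pcs
      chDeg : ∀ z x → ∃[ t ] degL (ch z) x ≡ t * suc d
      chLen : ∀ z → ∃[ t ] length (ch z) ≡ t * tri (2 + d)
      lenP : length pcs ≤ 8 * m
      smallP : All SmallPiece pcs
  open Gadget

  cons : (Fin n → Fin n → ℕ) → Cfg → ∀ {w} → RW w → ℕ
  cons ψ z {w} r = ev ψ (on (ps r) (val w z % m))

  fullW : (Fin n → Fin n → ℕ) → ∀ {w} → RW w → ℕ
  fullW ψ r = fullP ψ (ps r)

  evRe : (Fin n → Fin n → ℕ) → ∀ {p} → Re p → ℕ
  evRe ψ (E , _) = ev ψ E

  fullPc : (Fin n → Fin n → ℕ) → List (Piece n) → ℕ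
  fullPc ψ = Σl (λ (e , f) → ev ψ e + ev ψ f)

  inP : ∀ {A} → All RW A → List (Piece n)
  inP []       = []
  inP (r ∷ rs) = pieces (ps r) ++ inP rs

  inC : ∀ {A} → All RW A → Cfg → List (Edge n)
  inC []               z = []
  inC (_∷_ {w} r rs) z = on (ps r) (val w z % m) ++ inC rs z

  outP : ∀ Out → All Re (endpoints Out) → List (Piece n)
  outP []        []             = []
  outP (w ∷ Out) ((_ , ts) ∷ rs) = pieces (senders ts) ++ outP Out rs

  outC : ∀ Out → All Re (endpoints Out) → Cfg → List (Edge n)
  outC []        []             z = []
  outC (w ∷ Out) ((_ , ts) ∷ rs) z = off (senders ts) (val w z % m) ++ outC Out rs z

  outR : ∀ Out → All Re (endpoints Out) → All RW Out
  outR []        []             = []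
  outR (w ∷ Out) ((_ , ts) ∷ rs) = record { ps = receivers ts
    ; fits = λ z → ≤-trans (<⇒≤ (m%n<n (val w z) m)) (≤-reflexive (≡.sym (length-receivers ts))) ; few = ≤-reflexive (length-receivers ts) } ∷ outR Out rs

  inC∈ : ∀ {A} (rs : All RW A) z → inC rs z ∈ opts (inP rs)
  inC∈ []             z = here ≡.refl
  inC∈ (_∷_ {w} r rs) z = opts-++ (pieces (ps r)) (on∈ (ps r) (val w z % m)) (inC∈ rs z)

  outC∈ : ∀ Out rs z → outC Out rs z ∈ opts (outP Out rs)
  outC∈ []        []              z = here ≡.refl
  outC∈ (w ∷ Out) ((_ , ts) ∷ rs) z = opts-++ (pieces (senders ts)) (off∈ (senders ts) (val w z % m)) (outC∈ Out rs z)

  ev-inC : ∀ {A} (rs : All RW A) z ψ → ev ψ (inC rs z) ≡ sumA (cons ψ z) rs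
  ev-inC []             z ψ = ≡.refl
  ev-inC (_∷_ {w} r rs) z ψ = ≡.trans (ev-++ ψ (on (ps r) (val w z % m)) _) (cong (ev ψ (on (ps r) (val w z % m)) +_) (ev-inC rs z ψ))

  ev-outC : ∀ Out rs z ψ → Symmetric ψ → ev ψ (outC Out rs z) + sumA (cons ψ z) (outR Out rs) ≡ sumA (evRe ψ) rs
  ev-outC []        []              z ψ sy = ≡.refl
  ev-outC (w ∷ Out) ((E , ts) ∷ rs) z ψ sy = ≡.trans (cong (_+ sumA (cons ψ z) (outR (w ∷ Out) ((E , ts) ∷ rs))) (ev-++ ψ (off (senders ts) (val w z % m)) _)) (≡.trans
    (+-interchange (ev ψ (off (senders ts) (val w z % m))) _ _ _) (cong₂ _+_ (on-off ts (val w z % m) ψ sy) (ev-outC Out rs z ψ sy)))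

  full-pieces : ∀ {u v} ψ (ps : List (Port n d u v)) → fullPc ψ (pieces ps) ≡ fullP ψ ps
  full-pieces ψ ps = Σl-map (λ (e , f) → ev ψ e + ev ψ f) (λ p → Port.e₀ p , Port.e₁ p) ps

  full-inP : ∀ {A} (rs : All RW A) ψ → fullPc ψ (inP rs) ≡ sumA (fullW ψ) rs
  full-inP []       ψ = ≡.refl
  full-inP (r ∷ rs) ψ = ≡.trans (Σl-++ _ (pieces (ps r)) (inP rs)) (cong₂ _+_ (full-pieces ψ (ps r)) (full-inP rs ψ))

  full-outP : ∀ Out rs ψ → Symmetric ψ → fullPc ψ (outP Out rs) + sumA (fullW ψ) (outR Out rs) ≡ 2 * sumA (evRe ψ) rs
  full-outP []        []              ψ sy = ≡.refl
  full-outP (w ∷ Out) ((E , ts) ∷ rs) ψ sy = ≡.trans (cong (_+ sumA (fullW ψ) (outR (w ∷ Out) ((E , ts) ∷ rs))) (≡.trans (Σl-++ _ (pieces (senders ts)) (outP Out rs)) (cong (_+ fullPc ψ (outP Out rs)) (full-pieces ψ (senders ts)))))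
    (≡.trans (+-interchange (fullP ψ (senders ts)) _ _ _) (≡.trans (cong₂ _+_ (full-tokens ts ψ sy) (full-outP Out rs ψ sy)) (≡.sym (*-distribˡ-+ 2 (ev ψ E) _))))

  private
    -- The weight whose `Φ` is the degree at the vertex `x`; all positions over `x` count together.
    φ : Fin n → I → ℕ
    φ x i = δ (π i) x

    mod-cong : ∀ {M} x → m ≡ x * M → ∀ v c → Cong M (v % m * c) (v * c)
    mod-cong {M} x e v c = v / m * c * x , 0 , ≡.trans (cong (v % m * c +_) (≡.trans (*-assoc (v / m * c) x M) (cong (v / m * c *_) (≡.sym e))))
      (≡.trans (r₁ (v % m) (v / m) c m) (≡.trans (cong (_* c) (≡.sym (m≡m%n+[m/n]*n v m))) (≡.sym (+-identityʳ _))))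
      where
      r₁ : ∀ r k c m → r * c + k * c * m ≡ (r + k * m) * c
      r₁ = solve 4 (λ r k c m → r :* c :+ k :* c :* m := (r :+ k :* m) :* c) ≡.refl

    mult-cong : ∀ {M} x → m ≡ x * M → ∀ c → Cong M (m * c) 0
    mult-cong {M} x e c = cong-trans (cong-≡ (≡.trans (cong (_* c) e) (r₁ x M c))) (cong-mult (x * c))
      where
      r₁ : ∀ x M c → x * M * c ≡ x * c * M
      r₁ = solve 3 (λ x M c → x :* M :* c := x :* c :* M) ≡.refl

  in-deg : ∀ {A} (rs : All RW A) z x → Cong (suc d) (degL (inC rs z) x) (Φ (φ x) A z)
  in-deg []             z x = cong-≡ ≡.refl
  in-deg (_∷_ {w} r rs) z x = cong-trans (cong-≡ (ev-++ (incψ x) (on (ps r) (val w z % m)) _))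
    (cong-+ (cong-trans (on-deg (ps r) (val w z % m) x (fits r z)) (mod-cong x₁ m≡₁ (val w z) (incψ x (π (a w)) (π (b w))))) (in-deg rs z x))

  out-deg : ∀ Out rs z x → Cong (suc d) (degL (outC Out rs z) x + Φ (φ x) Out z) 0
  out-deg []        []              z x = cong-≡ ≡.refl
  out-deg (w ∷ Out) ((_ , ts) ∷ rs) z x = cong-trans (cong-≡ (≡.trans (cong (_+ Φ (φ x) (w ∷ Out) z) (ev-++ (incψ x) (off (senders ts) (val w z % m)) _))
      (+-interchange (degL (off (senders ts) (val w z % m)) x) _ _ _)))
    (cong-+ {b = 0} (cong-trans (cong-+ {a = degL (off (senders ts) (val w z % m)) x} (cong-≡ ≡.refl) (cong-sym (mod-cong x₁ m≡₁ (val w z) i)))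
      (cong-trans (off-deg (senders ts) (val w z % m) x (≤-trans (<⇒≤ (m%n<n (val w z) m)) (≤-reflexive (≡.sym (length-senders ts)))))
        (cong-trans (cong-≡ (cong (_* i) (length-senders ts))) (mult-cong x₁ m≡₁ i)))) (out-deg Out rs z x))
    where
    i : ℕ
    i = incψ x (π (a w)) (π (b w))

  in-len : ∀ {A} (rs : All RW A) z → Cong (tri (2 + d)) (length (inC rs z)) (N A z)
  in-len []             z = cong-≡ ≡.refl
  in-len (_∷_ {w} {A} r rs) z = cong-trans (cong-≡ (length-++ (on (ps r) (val w z % m))))
    (cong-+ {d = N A z} (cong-trans (on-len (ps r) (val w z % m) (fits r z)) (one (val w z))) (in-len rs z))
    where
    one : ∀ v → Cong (tri (2 + d)) (v % m) v
    one v = cong-trans (cong-≡ (≡.sym (*-identityʳ _))) (cong-trans (mod-cong x₂ m≡₂ v 1) (cong-≡ (*-identityʳ v)))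

  out-len : ∀ Out rs z → Cong (tri (2 + d)) (length (outC Out rs z) + N Out z) 0
  out-len []        []              z = cong-≡ ≡.refl
  out-len (w ∷ Out) ((_ , ts) ∷ rs) z = cong-trans (cong-≡ (≡.trans (cong (_+ N (w ∷ Out) z) (length-++ (off (senders ts) (val w z % m))))
      (+-interchange (length (off (senders ts) (val w z % m))) _ _ _)))
    (cong-+ {b = 0} (cong-trans (cong-+ {a = length (off (senders ts) (val w z % m))} (cong-≡ ≡.refl) (cong-sym one))
      (cong-trans (off-len (senders ts) (val w z % m) (≤-trans (<⇒≤ (m%n<n (val w z) m)) (≤-reflexive (≡.sym (length-senders ts)))))
        (cong-trans (cong-≡ (≡.trans (length-senders ts) (≡.sym (*-identityʳ m)))) (mult-cong x₂ m≡₂ 1)))) (out-len Out rs z))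
    where
    one : Cong (tri (2 + d)) (val w z % m) (val w z)
    one = cong-trans (cong-≡ (≡.sym (*-identityʳ _))) (cong-trans (mod-cong x₂ m≡₂ (val w z) 1) (cong-≡ (*-identityʳ (val w z))))

  small-pieces : ∀ {u v} (ps : List (Port n d u v)) → All SmallPiece (pieces ps)
  small-pieces []       = []
  small-pieces (p ∷ ps) = (≤-trans (Port.small p) (n≤1+n _) , ≤-trans (≤-reflexive (Port.len₁ p)) (s≤s (Port.small p))) ∷ small-pieces ps

  small-inP : ∀ {A} (rs : All RW A) → All SmallPiece (inP rs)
  small-inP []       = []
  small-inP (r ∷ rs) = All-++⁺ (small-pieces (ps r)) (small-inP rs)

  small-outP : ∀ Out rs → All SmallPiece (outP Out rs)
  small-outP []        []              = []
  small-outP (w ∷ Out) ((_ , ts) ∷ rs) = All-++⁺ (small-pieces (senders ts)) (small-outP Out rs)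

  len-inP : ∀ {A} (rs : All RW A) → length (inP rs) ≤ length A * m
  len-inP []       = z≤n
  len-inP (r ∷ rs) = ≤-trans (≤-reflexive (length-++ (pieces (ps r)))) (+-mono-≤ (≤-trans (≤-reflexive (length-map _ (ps r))) (few r)) (len-inP rs))

  len-outP : ∀ Out rs → length (outP Out rs) ≤ length Out * m
  len-outP []        []              = z≤n
  len-outP (w ∷ Out) ((_ , ts) ∷ rs) = ≤-trans (≤-reflexive (length-++ (pieces (senders ts)))) (+-mono-≤ (≤-reflexive (≡.trans (length-map _ (senders ts)) (length-senders ts))) (len-outP Out rs))

  -- Modulo q-1 the inputs contribute `Φ` of `In`, and the outputs, seen from the sending side, the
  -- negative of `Φ` of `Out`. Conservation cancels the two, and likewise for the number of edges
  -- modulo (q choose 2).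
  gadget : ∀ In Out → length In + length Out ≤ 8 → Conserves In Out → All RW In → All Re (endpoints Out) → Gadget
  gadget In Out l h ins outs = record
    { pcs = inP ins ++ outP Out outs
    ; ch = λ z → inC ins z ++ outC Out outs z
    ; ch∈ = λ z → opts-++ (inP ins) (inC∈ ins z) (outC∈ Out outs z)
    ; chDeg = λ z x → cong0⇒multiple (cong-cancelˡ {a = Φ (φ x) Out z} (cong-trans (cong-≡ (≡.trans (cong (Φ (φ x) Out z +_) (ev-++ (incψ x) (inC ins z) _))
        (r₁ (Φ (φ x) Out z) (degL (inC ins z) x) (degL (outC Out outs z) x))))
        (cong-trans (cong-+ {d = 0} (in-deg ins z x) (out-deg Out outs z x)) (cong-+ {c = 0} {d = 0} (proj₁ (h z) (φ x)) (cong-≡ ≡.refl)))))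
    ; chLen = λ z → cong0⇒multiple (cong-cancelˡ {a = N Out z} (cong-trans (cong-≡ (≡.trans (cong (N Out z +_) (length-++ (inC ins z)))
        (r₁ (N Out z) (length (inC ins z)) (length (outC Out outs z)))))
        (cong-trans (cong-+ {d = 0} (in-len ins z) (out-len Out outs z)) (cong-+ {c = 0} {d = 0} (proj₂ (h z)) (cong-≡ ≡.refl)))))
    ; lenP = ≤-trans (≤-reflexive (length-++ (inP ins))) (≤-trans (+-mono-≤ (len-inP ins) (len-outP Out outs)) (≤-trans (≤-reflexive (≡.sym (*-distribʳ-+ m (length In) (length Out)))) (*-monoˡ-≤ m l)))
    ; smallP = All-++⁺ (small-inP ins) (small-outP Out outs) }
    where
    r₁ : ∀ p i o → p + (i + o) ≡ i + (o + p)
    r₁ = solve 3 (λ p i o → p :+ (i :+ o) := i :+ (o :+ p)) ≡.refl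

  -- `flow` telescopes: what a sender leaves is taken by the receiver, so gadgets and open wires use
  -- each token edge exactly once. `full` is the same account with both states counted; it bounds
  -- how often an edge occurs in options.
  record Realised {A B o} (ins : All RW A) (res : All Re o) : Set where
    field
      outs : All RW B
      gs   : List Gadget
      flow : ∀ z ψ → Symmetric ψ → Σl (λ g → ev ψ (ch g z)) gs + sumA (cons ψ z) outs ≡ sumA (cons ψ z) ins + sumA (evRe ψ) res
      full : ∀ ψ → Symmetric ψ → Σl (λ g → fullPc ψ (pcs g)) gs + sumA (fullW ψ) outs ≡ sumA (fullW ψ) ins + 2 * sumA (evRe ψ) res

  realise : ∀ {A B o} → Der A B o → (ins : All RW A) (rs : All Re o) → Realised {A} {B} {o} ins rs
  realise (perm p) ins [] = record { outs = permA p ins ; gs = []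
    ; flow = λ z ψ _ → ≡.trans (sumA-perm (cons ψ z) p ins) (≡.sym (+-identityʳ _))
    ; full = λ ψ _ → ≡.trans (sumA-perm (fullW ψ) p ins) (≡.sym (+-identityʳ _)) }
  realise (gad In Out l h) ins rs = record { outs = outR Out rs ; gs = [ gadget In Out l h ins rs ]
    ; flow = λ z ψ sy → ≡.trans (cong (λ t → t + 0 + sumA (cons ψ z) (outR Out rs)) (≡.trans (ev-++ ψ (inC ins z) (outC Out rs z)) (cong (_+ ev ψ (outC Out rs z)) (ev-inC ins z ψ))))
        (≡.trans (r₁ (sumA (cons ψ z) ins) (ev ψ (outC Out rs z)) (sumA (cons ψ z) (outR Out rs))) (cong (sumA (cons ψ z) ins +_) (ev-outC Out rs z ψ sy)))
    ; full = λ ψ sy → ≡.trans (cong (λ t → t + 0 + sumA (fullW ψ) (outR Out rs)) (≡.trans (Σl-++ _ (inP ins) (outP Out rs)) (cong (_+ fullPc ψ (outP Out rs)) (full-inP ins ψ))))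
        (≡.trans (r₁ (sumA (fullW ψ) ins) (fullPc ψ (outP Out rs)) (sumA (fullW ψ) (outR Out rs))) (cong (sumA (fullW ψ) ins +_) (full-outP Out rs ψ sy))) }
    where
    r₁ : ∀ i o r → i + o + 0 + r ≡ i + (o + r)
    r₁ = solve 3 (λ i o r → i :+ o :+ con 0 :+ r := i :+ (o :+ r)) ≡.refl
  realise (par {A} {B} {A'} {B'} {o} {o'} d e) ins rs = record { outs = All-++⁺ D.outs E.outs ; gs = D.gs ++ E.gs
    ; flow = λ z ψ sy → ≡.trans (cong₂ _+_ (Σl-++ _ D.gs E.gs) (sumA-++ (cons ψ z) D.outs E.outs)) (≡.trans (+-interchange (Σl (λ g → ev ψ (ch g z)) D.gs) _ _ _)
        (≡.trans (cong₂ _+_ (D.flow z ψ sy) (E.flow z ψ sy)) (≡.trans (+-interchange (sumA (cons ψ z) (proj₁ (splitA A ins))) _ _ _)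
          (≡.sym (cong₂ _+_ (sumA-split (cons ψ z) A ins) (sumA-split (evRe ψ) o rs))))))
    ; full = λ ψ sy → ≡.trans (cong₂ _+_ (Σl-++ _ D.gs E.gs) (sumA-++ (fullW ψ) D.outs E.outs)) (≡.trans (+-interchange (Σl (λ g → fullPc ψ (pcs g)) D.gs) _ _ _)
        (≡.trans (cong₂ _+_ (D.full ψ sy) (E.full ψ sy)) (≡.trans (+-interchange (sumA (fullW ψ) (proj₁ (splitA A ins))) _ _ _)
          (≡.sym (cong₂ _+_ (sumA-split (fullW ψ) A ins) (≡.trans (cong (2 *_) (sumA-split (evRe ψ) o rs)) (*-distribˡ-+ 2 (sumA (evRe ψ) (proj₁ (splitA o rs))) _))))))) }
    where
    module D = Realised (realise d (proj₁ (splitA A ins)) (proj₁ (splitA o rs)))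
    module E = Realised (realise e (proj₂ (splitA A ins)) (proj₂ (splitA o rs)))
  realise (seq {A} {B} {C} {o} {o'} d e) ins rs = record { outs = E.outs ; gs = E.gs ++ D.gs
    ; flow = λ z ψ sy → chain (Σl (λ g → ev ψ (ch g z)) E.gs) (Σl (λ g → ev ψ (ch g z)) D.gs) (sumA (cons ψ z) E.outs) (sumA (cons ψ z) D.outs) (sumA (cons ψ z) ins) (sumA (evRe ψ) (proj₁ (splitA o rs))) (sumA (evRe ψ) (proj₂ (splitA o rs)))
        (≡.trans (cong (_+ sumA (cons ψ z) E.outs) (Σl-++ _ E.gs D.gs)) (r₀ (Σl (λ g → ev ψ (ch g z)) E.gs) (Σl (λ g → ev ψ (ch g z)) D.gs) _)) (E.flow z ψ sy) (D.flow z ψ sy) (sumA-split (evRe ψ) o rs)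
    ; full = λ ψ sy → chain (Σl (λ g → fullPc ψ (pcs g)) E.gs) (Σl (λ g → fullPc ψ (pcs g)) D.gs) (sumA (fullW ψ) E.outs) (sumA (fullW ψ) D.outs) (sumA (fullW ψ) ins) (2 * sumA (evRe ψ) (proj₁ (splitA o rs))) (2 * sumA (evRe ψ) (proj₂ (splitA o rs)))
        (≡.trans (cong (_+ sumA (fullW ψ) E.outs) (Σl-++ _ E.gs D.gs)) (r₀ (Σl (λ g → fullPc ψ (pcs g)) E.gs) (Σl (λ g → fullPc ψ (pcs g)) D.gs) _)) (E.full ψ sy) (D.full ψ sy)
        (≡.trans (cong (2 *_) (sumA-split (evRe ψ) o rs)) (*-distribˡ-+ 2 (sumA (evRe ψ) (proj₁ (splitA o rs))) _)) }
    where
    module D = Realised (realise d ins (proj₁ (splitA o rs)))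
    module E = Realised (realise e D.outs (proj₂ (splitA o rs)))
    r₀ : ∀ e d o → e + d + o ≡ d + (e + o)
    r₀ = solve 3 (λ e d o → e :+ d :+ o := d :+ (e :+ o)) ≡.refl
    r₁ : ∀ g m t → g + (m + t) ≡ g + m + t
    r₁ = solve 3 (λ g m t → g :+ (m :+ t) := g :+ m :+ t) ≡.refl
    chain : ∀ gE gD oE oD i t t' {x tt} → x ≡ gD + (gE + oE) → gE + oE ≡ oD + t' → gD + oD ≡ i + t → tt ≡ t + t' → x ≡ i + tt
    chain gE gD oE oD i t t' e₁ e₂ e₃ e₄ = ≡.trans e₁ (≡.trans (cong (gD +_) e₂) (≡.trans (r₁ gD oD t') (≡.trans (cong (_+ t') e₃) (≡.trans (+-assoc i t t') (cong (i +_) (≡.sym e₄))))))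

  closed : ∀ {A o} → Der A [] o → (ins : All RW A) (rs : All Re o) → Σ[ gs ∈ List Gadget ]
    ((∀ z ψ → Symmetric ψ → Σl (λ g → ev ψ (ch g z)) gs ≡ sumA (cons ψ z) ins + sumA (evRe ψ) rs) ×
     (∀ ψ → Symmetric ψ → Σl (λ g → fullPc ψ (pcs g)) gs ≡ sumA (fullW ψ) ins + 2 * sumA (evRe ψ) rs))
  closed {A} {o} e ins rs = finish (realise e ins rs)
    where
    none : (f : ∀ {w} → RW w → ℕ) (ps : All RW []) → sumA (λ {w} → f {w}) ps ≡ 0
    none f [] = ≡.refl
    finish : Realised {A} {[]} {o} ins rs → Σ[ gs ∈ List Gadget ]
      ((∀ z ψ → Symmetric ψ → Σl (λ g → ev ψ (ch g z)) gs ≡ sumA (cons ψ z) ins + sumA (evRe ψ) rs) ×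
       (∀ ψ → Symmetric ψ → Σl (λ g → fullPc ψ (pcs g)) gs ≡ sumA (fullW ψ) ins + 2 * sumA (evRe ψ) rs))
    finish R = gs ,
      (λ z ψ sy → ≡.trans (≡.sym (≡.trans (cong (Σl (λ g → ev ψ (ch g z)) gs +_) (none (cons ψ z) outs)) (+-identityʳ _))) (flow z ψ sy)) ,
      (λ ψ sy → ≡.trans (≡.sym (≡.trans (cong (Σl (λ g → fullPc ψ (pcs g)) gs +_) (none (fullW ψ) outs)) (+-identityʳ _))) (full ψ sy))
      where open Realised R

-- The circuit of a graph X

ΣN : ℕ → (ℕ → ℕ) → ℕ
ΣN N f = ΣF {N} (λ i → f (toℕ i))

ΣN-+ : ∀ a b f → ΣN (a + b) f ≡ ΣN a f + ΣN b (λ i → f (a + i))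
ΣN-+ zero    b f = ≡.refl
ΣN-+ (suc a) b f = ≡.trans (ΣF-suc {a + b} (λ i → f (toℕ i))) (≡.trans (cong (f 0 +_) (ΣN-+ a b (f ∘ suc)))
  (≡.trans (≡.sym (+-assoc (f 0) _ _)) (cong (_+ ΣN b (λ i → f (suc a + i))) (≡.sym (ΣF-suc {a} (λ i → f (toℕ i)))))))

ΣN-mono : ∀ {a b} f → a ≤ b → ΣN a f ≤ ΣN b f
ΣN-mono {a} {b} f le = ≤-trans (m≤m+n _ _) (≤-reflexive (≡.trans (≡.sym (ΣN-+ a (b ∸ a) f)) (cong (λ t → ΣN t f) (m+[n∸m]≡n le))))

ΣN-grid : ∀ t s f → ΣF {t} (λ g → ΣF {s} (λ i → f (toℕ g * s + toℕ i))) ≡ ΣN (t * s) f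
ΣN-grid zero    s f = ≡.refl
ΣN-grid (suc t) s f = ≡.trans (ΣF-suc {t} (λ g → ΣF {s} (λ i → f (toℕ g * s + toℕ i)))) (≡.trans
  (cong (ΣN s f +_) (≡.trans (ΣF-cong {t} (λ g → ΣF-cong {s} (λ i → cong f (+-assoc s (toℕ g * s) (toℕ i))))) (ΣN-grid t s (λ N → f (s + N)))))
  (≡.sym (ΣN-+ s (t * s) f)))

module Layout (n' k : ℕ) where
  n s : ℕ
  n = suc n'
  s = suc k

  I : Set
  I = Fin s × Fin s

  -- The square is larger than the vertex set, so the positions wrap around modulo `n`. As there are
  -- at most 4n of them, each vertex is met at most four times; `ι` chooses one position for each
  -- vertex.
  π : I → Fin n
  π (g , i) = (toℕ g * s + toℕ i) mod n

  ι : n ≤ s * s → Fin n → I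
  ι le u = fromℕ< (m<n*o⇒m/o<n {toℕ u} {s} {s} (≤-trans (toℕ<n u) le)) , toℕ u mod s

  toℕ-mod : ∀ a b → toℕ (a mod suc b) ≡ a % suc b
  toℕ-mod a b = toℕ-fromℕ< (m%n<n a (suc b))

  π∘ι : ∀ le u → π (ι le u) ≡ u
  π∘ι le u = toℕ-injective (≡.trans (toℕ-mod N n') (≡.trans (cong (_% n) N≡u) (m<n⇒m%n≡m (toℕ<n u))))
    where
    N : ℕ
    N = toℕ (proj₁ (ι le u)) * s + toℕ (proj₂ (ι le u))
    N≡u : N ≡ toℕ u
    N≡u = ≡.trans (cong₂ (λ a b → a * s + b) (toℕ-fromℕ< (m<n*o⇒m/o<n {toℕ u} {s} {s} (≤-trans (toℕ<n u) le))) (toℕ-mod (toℕ u) k))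
      (≡.trans (+-comm (toℕ u / s * s) (toℕ u % s)) (≡.sym (m≡m%n+[m/n]*n (toℕ u) s)))

  fibre : ∀ x → s * s ≤ 4 * n → ΣF (λ g → ΣF (λ i → δ (π (g , i)) x)) ≤ 4
  fibre x le = ≤-trans (≤-reflexive (ΣN-grid s s f)) (≤-trans (ΣN-mono f le) (≤-reflexive (periods 4)))
    where
    f : ℕ → ℕ
    f N = δ (N mod n) x
    shift : ∀ N → f (n + N) ≡ f N
    shift N = cong (λ y → δ y x) (toℕ-injective (≡.trans (toℕ-mod (n + N) n') (≡.trans ([m+n]%m≡n%m n N) (≡.sym (toℕ-mod N n')))))
      where
      [m+n]%m≡n%m : ∀ m .{{_ : NonZero m}} N → (m + N) % m ≡ N % m
      [m+n]%m≡n%m m N = ≡.trans (cong (_% m) (+-comm m N)) ([m+n]%n≡m%n N m)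
    period : ΣN n f ≡ 1
    period = ≡.trans (ΣF-cong (λ i → ≡.trans (cong (λ y → δ y x) (toℕ-injective (≡.trans (toℕ-mod (toℕ i) n') (m<n⇒m%n≡m (toℕ<n i))))) (δ-sym i x))) (ΣF-δ x)
    periods : ∀ t → ΣN (t * n) f ≡ t
    periods zero    = ≡.refl
    periods (suc t) = ≡.trans (ΣN-+ n (t * n) f) (cong₂ _+_ period (≡.trans (ΣF-cong {t * n} (λ i → shift (toℕ i))) (periods t)))

  group-size : ∀ le g → ΣF (λ u → δ (proj₁ (ι le u)) g) ≤ s
  group-size le g = ≤-trans (≤-reflexive (ΣF-cong (λ u → ≡.sym (≡.trans (Σl-* (δ (proj₁ (ι le u)) g) (δ (proj₂ (ι le u))) (allFin s)) (≡.trans (cong (δ (proj₁ (ι le u)) g *_) (ΣF-δ (proj₂ (ι le u)))) (*-identityʳ _))))))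
    (≤-trans (≤-reflexive (Σl-swap (λ u i → δ (proj₁ (ι le u)) g * δ (proj₂ (ι le u)) i) (allFin n) (allFin s)))
    (≤-trans (ΣF-mono (λ i → ≤-trans (ΣF-mono (λ u → one u i)) (≤-reflexive (ΣF-δ (π (g , i)))))) (≤-reflexive (≡.trans (ΣF-const s 1) (*-identityʳ s)))))
    where
    one : ∀ u i → δ (proj₁ (ι le u)) g * δ (proj₂ (ι le u)) i ≤ δ (π (g , i)) u
    one u i with proj₁ (ι le u) ≟ᶠ g | proj₂ (ι le u) ≟ᶠ i
    ... | no _       | _          = z≤n
    ... | yes _      | no _       = z≤n
    ... | yes ≡.refl | yes ≡.refl = ≤-reflexive (≡.sym (≡.trans (cong (λ y → δ y u) (π∘ι le u)) (δ-refl u)))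

-- Blocks, hubs and loads

module Chunks {A : Set} (D : ℕ) (D>0 : 0 < D) where
  ins : A → List (List A) → List (List A)
  ins x []       = [ [ x ] ]
  ins x (c ∷ cs) with length c <? D
  ... | yes _ = (x ∷ c) ∷ cs
  ... | no _  = [ x ] ∷ c ∷ cs

  chunk : List A → List (List A)
  chunk []       = []
  chunk (x ∷ xs) = ins x (chunk xs)

  ins-sum : ∀ (F : A → ℕ) x cs → Σl (Σl F) (ins x cs) ≡ F x + Σl (Σl F) cs
  ins-sum F x [] = cong (_+ 0) (+-identityʳ (F x))
  ins-sum F x (c ∷ cs) with length c <? D
  ... | yes _ = +-assoc (F x) (Σl F c) _
  ... | no _  = cong (_+ (Σl F c + Σl (Σl F) cs)) (+-identityʳ (F x))

  chunk-sum : ∀ (F : A → ℕ) xs → Σl (Σl F) (chunk xs) ≡ Σl F xs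
  chunk-sum F []       = ≡.refl
  chunk-sum F (x ∷ xs) = ≡.trans (ins-sum F x (chunk xs)) (cong (F x +_) (chunk-sum F xs))

  ins-short : ∀ x cs → All (λ c → length c ≤ D) cs → All (λ c → length c ≤ D) (ins x cs)
  ins-short x []       []       = D>0 ∷ []
  ins-short x (c ∷ cs) (p ∷ ps) with length c <? D
  ... | yes q = q ∷ ps
  ... | no _  = D>0 ∷ p ∷ ps

  chunk-short : ∀ xs → All (λ c → length c ≤ D) (chunk xs)
  chunk-short []       = []
  chunk-short (x ∷ xs) = ins-short x (chunk xs) (chunk-short xs)

  -- The first list is the one being filled; each of the others has reached `D` entries.
  Full : List (List A) → ℕ → Set
  Full []       N = ⊤
  Full (c ∷ cs) N = D * length cs + length c ≤ N

  ins-full : ∀ x cs N → Full cs N → Full (ins x cs) (suc N)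
  ins-full x []       N _ = ≤-trans (≤-reflexive (cong (_+ 1) (*-zeroʳ D))) (s≤s z≤n)
  ins-full x (c ∷ cs) N h with length c <? D
  ... | yes _ = ≤-trans (≤-reflexive (+-suc (D * length cs) (length c))) (s≤s h)
  ... | no ¬p = ≤-trans (≤-reflexive (r D (length cs))) (s≤s (≤-trans (+-monoʳ-≤ (D * length cs) (≮⇒≥ ¬p)) h))
    where
    r : ∀ D l → D * (1 + l) + 1 ≡ 1 + (D * l + D)
    r = solve 2 (λ D l → D :* (con 1 :+ l) :+ con 1 := con 1 :+ (D :* l :+ D)) ≡.refl

  chunk-count : ∀ xs → D * length (chunk xs) ≤ D + length xs
  chunk-count xs = go (chunk xs) (full xs)
    where
    full : ∀ xs → Full (chunk xs) (length xs)
    full []       = tt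
    full (x ∷ xs) = ins-full x (chunk xs) (length xs) (full xs)
    go : ∀ cs → Full cs (length xs) → D * length cs ≤ D + length xs
    go []       _ = ≤-trans (≤-reflexive (*-zeroʳ D)) z≤n
    go (c ∷ cs) h = ≤-trans (≤-reflexive (*-suc D (length cs))) (+-monoʳ-≤ D (≤-trans (m≤m+n _ _) h))

module Rows (n' k : ℕ) (Cfg : Set) (M₁ M₂ m' x₁ x₂ : ℕ) (m≡₁ : suc m' ≡ x₁ * M₁) (m≡₂ : suc m' ≡ x₂ * M₂)
            (le : suc n' ≤ suc k * suc k) (D : ℕ) (s≤D : suc k ≤ D)
            (XE : List (Edge (suc n'))) (value : Edge (suc n') → Cfg → ℕ) (degX : ∀ x → degL XE x ≤ D) where
  open Layout n' k using (n; I; π; ι; π∘ι; group-size)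
  open GridCircuit k Cfg M₁ M₂ m' x₁ x₂ m≡₁ m≡₂

  E : Set
  E = (Fin s × Fin s) × Val

  D>0 : 0 < D
  D>0 = ≤-trans (s≤s z≤n) s≤D

  open Chunks {E} D D>0

  gr sn : Fin n → Fin s
  gr u = proj₁ (ι le u)
  sn u = proj₂ (ι le u)

  entry : Edge n → E
  entry (u , v) = (sn u , sn v) , value (u , v)

  between : Fin s → Fin s → List (Edge n) → List E
  between g h []             = []
  between g h ((u , v) ∷ es) with gr u ≟ᶠ g | gr v ≟ᶠ h
  ... | yes _ | yes _ = entry (u , v) ∷ between g h es
  ... | yes _ | no _  = between g h es
  ... | no _  | _     = between g h es

  between-sum : ∀ g h (F : E → ℕ) es → Σl F (between g h es) ≡ Σl (λ (u , v) → δ (gr u) g * (δ (gr v) h * F (entry (u , v)))) es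
  between-sum g h F []             = ≡.refl
  between-sum g h F ((u , v) ∷ es) with gr u ≟ᶠ g | gr v ≟ᶠ h
  ... | yes _ | yes _ = cong₂ _+_ (≡.sym (≡.trans (*-identityˡ _) (*-identityˡ _))) (between-sum g h F es)
  ... | yes _ | no _  = between-sum g h F es
  ... | no _  | _     = between-sum g h F es

  count : Fin s → Fin s → ℕ
  count g h = length (chunk (between g h XE))

  pre : Fin s → List (Fin s × List E)
  pre g = concatMap (λ h → map (h ,_) (chunk (between g h XE))) (allFin s)

  assign : Fin s → List (Fin s × List E) → List (Fin s) → List Block
  assign g []              ts       = []
  -- A default hub for an exhausted supply; `len-pre` shows that `blocks` never meets this case.
  assign g ((h , es) ∷ ps) []       = block h (g , zero) es ∷ assign g ps []
  assign g ((h , es) ∷ ps) (t ∷ ts) = block h (g , t) es ∷ assign g ps ts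

  -- Each position of the row may be a hub twice, which suffices for the at most `2 * s` blocks
  -- counted by `count-left`.
  supply : List (Fin s)
  supply = allFin s ++ allFin s

  blocks : Fin s → List Block
  blocks g = assign g (pre g) supply

  rows : List Row
  rows = map (λ g → g , blocks g) (allFin s)

  assign-sum : ∀ g (K : Fin s → List E → ℕ) ps ts → Σl (λ B → K (Block.right B) (Block.es B)) (assign g ps ts) ≡ Σl (λ (h , es) → K h es) ps
  assign-sum g K []              ts       = ≡.refl
  assign-sum g K ((h , es) ∷ ps) []       = cong (K h es +_) (assign-sum g K ps [])
  assign-sum g K ((h , es) ∷ ps) (t ∷ ts) = cong (K h es +_) (assign-sum g K ps ts)

  assign-hubs : ∀ g (φ : I → ℕ) ps ts → length ps ≤ length ts → Σl (λ B → φ (Block.hub B)) (assign g ps ts) ≤ Σl (λ t → φ (g , t)) ts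
  assign-hubs g φ []              ts       l = z≤n
  assign-hubs g φ ((h , es) ∷ ps) (t ∷ ts) l = +-monoʳ-≤ (φ (g , t)) (assign-hubs g φ ps ts (s≤s⁻¹ l))

  pre-sum : ∀ g (K : Fin s → List E → ℕ) → Σl (λ (h , es) → K h es) (pre g) ≡ ΣF (λ h → Σl (K h) (chunk (between g h XE)))
  pre-sum g K = ≡.trans (Σl-concatMap (λ (h , es) → K h es) (λ h → map (h ,_) (chunk (between g h XE))) (allFin s))
    (ΣF-cong (λ h → Σl-map (λ (h , es) → K h es) (h ,_) (chunk (between g h XE))))

  blocks-sum : ∀ g (K : Fin s → List E → ℕ) → Σl (λ B → K (Block.right B) (Block.es B)) (blocks g) ≡ ΣF (λ h → Σl (K h) (chunk (between g h XE)))
  blocks-sum g K = ≡.trans (assign-sum g K (pre g) supply) (pre-sum g K)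

  edges-sum : ∀ (G : Fin s → Fin s → E → ℕ) → ΣF (λ g → Σl (λ B → Σl (G g (Block.right B)) (Block.es B)) (blocks g)) ≡ Σl (λ (u , v) → G (gr u) (gr v) (entry (u , v))) XE
  edges-sum G = ≡.trans (ΣF-cong (λ g → ≡.trans (blocks-sum g (λ h → Σl (G g h))) (ΣF-cong (λ h → ≡.trans (chunk-sum (G g h) (between g h XE)) (between-sum g h (G g h) XE)))))
    (≡.trans (ΣF-cong (λ g → Σl-swap (λ h (u , v) → δ (gr u) g * (δ (gr v) h * G g h (entry (u , v)))) (allFin s) XE))
    (≡.trans (Σl-swap (λ g (u , v) → ΣF (λ h → δ (gr u) g * (δ (gr v) h * G g h (entry (u , v))))) (allFin s) XE)
    (Σl-cong (λ (u , v) → ≡.trans (ΣF-cong (λ g → ≡.trans (Σl-* (δ (gr u) g) (λ h → δ (gr v) h * G g h (entry (u , v))) (allFin s)) (cong (δ (gr u) g *_) (ΣF-δ* (gr v) (λ h → G g h (entry (u , v)))))))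
      (ΣF-δ* (gr u) (λ g → G g (gr v) (entry (u , v))))) XE)))

  wire : Edge n → Wire
  wire (u , v) = W (ι le u) (ι le v) (value (u , v))

  wires-sum : ∀ (F : Wire → ℕ) → Σl F (rowsWires rows) ≡ Σl (λ e → F (wire e)) XE
  wires-sum F = ≡.trans (go (allFin s)) (edges-sum (λ g h ((i , j) , b) → F (W (g , i) (h , j) b)))
    where
    go₁ : ∀ g Bs → Σl F (blocksWires g Bs) ≡ Σl (λ B → Σl (λ ((i , j) , b) → F (W (g , i) (Block.right B , j) b)) (Block.es B)) Bs
    go₁ g []       = ≡.refl
    go₁ g (B ∷ Bs) = ≡.trans (Σl-++ F (blockWires g B) _) (cong₂ _+_ (Σl-map F _ (Block.es B)) (go₁ g Bs))
    go : ∀ gs → Σl F (rowsWires (map (λ g → g , blocks g) gs)) ≡ Σl (λ g → Σl (λ B → Σl (λ ((i , j) , b) → F (W (g , i) (Block.right B , j) b)) (Block.es B)) (blocks g)) gs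
    go []       = ≡.refl
    go (g ∷ gs) = ≡.trans (Σl-++ F (blocksWires g (blocks g)) _) (cong₂ _+_ (go₁ g (blocks g)) (go gs))

  module _ (P : Wire → Set) (Pe : ∀ {e} → e ∈ XE → ∀ g h → P (W (g , sn (proj₁ e)) (h , sn (proj₂ e)) (value e))) where
    private
      Pg : Fin s → Fin s → E → Set
      Pg g h ((i , j) , b) = P (W (g , i) (h , j) b)

      between-All : ∀ g h es → (∀ {e} → e ∈ es → e ∈ XE) → All (Pg g h) (between g h es)
      between-All g h []             inc = []
      between-All g h ((u , v) ∷ es) inc with gr u ≟ᶠ g | gr v ≟ᶠ h
      ... | yes _ | yes _ = Pe (inc (here ≡.refl)) g h ∷ between-All g h es (inc ∘ there)
      ... | yes _ | no _  = between-All g h es (inc ∘ there)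
      ... | no _  | _     = between-All g h es (inc ∘ there)

      ins-All : ∀ {Q : E → Set} x cs → Q x → All (All Q) cs → All (All Q) (ins x cs)
      ins-All x []       q []       = (q ∷ []) ∷ []
      ins-All x (c ∷ cs) q (p ∷ ps) with length c <? D
      ... | yes _ = (q ∷ p) ∷ ps
      ... | no _  = (q ∷ []) ∷ p ∷ ps

      chunk-All : ∀ {Q : E → Set} xs → All Q xs → All (All Q) (chunk xs)
      chunk-All []       []       = []
      chunk-All (x ∷ xs) (q ∷ qs) = ins-All x (chunk xs) q (chunk-All xs qs)

      pre-All : ∀ g hs → All (λ (h , es) → All (Pg g h) es) (concatMap (λ h → map (h ,_) (chunk (between g h XE))) hs)
      pre-All g []       = []
      pre-All g (h ∷ hs) = All-++⁺ (tag (chunk-All (between g h XE) (between-All g h XE id))) (pre-All g hs)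
        where
        tag : ∀ {cs} → All (All (Pg g h)) cs → All (λ (h , es) → All (Pg g h) es) (map (h ,_) cs)
        tag []       = []
        tag (p ∷ ps) = p ∷ tag ps

      blockWires-All : ∀ g h w es → All (Pg g h) es → All P (blockWires g (block h w es))
      blockWires-All g h w []       []       = []
      blockWires-All g h w (e ∷ es) (p ∷ ps) = p ∷ blockWires-All g h w es ps

      assign-All : ∀ g ps ts → All (λ (h , es) → All (Pg g h) es) ps → All P (blocksWires g (assign g ps ts))
      assign-All g []              ts       []       = []
      assign-All g ((h , es) ∷ ps) []       (q ∷ qs) = All-++⁺ (blockWires-All g h (g , zero) es q) (assign-All g ps [] qs)
      assign-All g ((h , es) ∷ ps) (t ∷ ts) (q ∷ qs) = All-++⁺ (blockWires-All g h (g , t) es q) (assign-All g ps ts qs)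

    wires-All : All P (rowsWires rows)
    wires-All = go (allFin s)
      where
      go : ∀ gs → All P (rowsWires (map (λ g → g , blocks g) gs))
      go []       = []
      go (g ∷ gs) = All-++⁺ (assign-All g (pre g) supply (pre-All g (allFin s))) (go gs)

  private
    incident : ∀ g → Σl (λ (u , v) → δ (gr u) g + δ (gr v) g) XE ≤ s * D
    incident g = ≤-trans (≤-reflexive (≡.trans (Σl-cong (λ (u , v) → ≡.sym (≡.trans (ΣF-cong (λ x → *-distribʳ-+ (δ (gr x) g) (δ u x) (δ v x)))
        (≡.trans (ΣF-+ (λ x → δ u x * δ (gr x) g) (λ x → δ v x * δ (gr x) g)) (cong₂ _+_ (ΣF-δ* u (λ x → δ (gr x) g)) (ΣF-δ* v (λ x → δ (gr x) g)))))) XE)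
        (≡.trans (≡.sym (Σl-swap (λ x (u , v) → incψ x u v * δ (gr x) g) (allFin n) XE)) (ΣF-cong (λ x → Σl-*ʳ (δ (gr x) g) (uncurry (incψ x)) XE)))))
      (≤-trans (ΣF-mono (λ x → *-monoˡ-≤ (δ (gr x) g) (degX x))) (≤-trans (≤-reflexive (Σl-* D (λ x → δ (gr x) g) (allFin n)))
        (≤-trans (*-monoʳ-≤ D (group-size le g)) (≤-reflexive (*-comm D s)))))

    len-between : ∀ g h → length (between g h XE) ≡ Σl (λ (u , v) → δ (gr u) g * (δ (gr v) h * 1)) XE
    len-between g h = ≡.trans (≡.sym (≡.trans (Σl-const 1 (between g h XE)) (*-identityʳ _))) (between-sum g h (λ _ → 1) XE)

    -- One possibly unfilled block for each of the `s` opposite rows, and at most `s` filled ones,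
    -- because a row of at most `s` vertices meets at most s·D edges.
    twoS : ∀ (c : Fin s → ℕ) (l : Fin s → ℕ) → (∀ h → D * c h ≤ D + l h) → ΣF l ≤ s * D → ΣF c ≤ 2 * s
    twoS c l h hl = *-cancelˡ-≤ D ⦃ >-nonZero D>0 ⦄ (≤-trans (≤-reflexive (≡.sym (Σl-* D c (allFin s)))) (≤-trans (ΣF-mono h)
      (≤-trans (≤-reflexive (≡.trans (ΣF-+ (λ _ → D) l) (cong (_+ ΣF l) (ΣF-const s D)))) (≤-trans (+-monoʳ-≤ (s * D) hl) (≤-reflexive (r s D))))))
      where
      r : ∀ s D → s * D + s * D ≡ D * (2 * s)
      r = solve 2 (λ s D → s :* D :+ s :* D := D :* (con 2 :* s)) ≡.refl

  count-left : ∀ g → ΣF (λ h → count g h) ≤ 2 * s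
  count-left g = twoS (count g) (λ h → length (between g h XE)) (λ h → chunk-count (between g h XE)) (≤-trans (≤-reflexive
      (≡.trans (ΣF-cong (λ h → len-between g h)) (≡.trans (Σl-swap (λ h (u , v) → δ (gr u) g * (δ (gr v) h * 1)) (allFin s) XE)
        (Σl-cong (λ (u , v) → ≡.trans (Σl-* (δ (gr u) g) (λ h → δ (gr v) h * 1) (allFin s)) (≡.trans (cong (δ (gr u) g *_) (ΣF-δ* (gr v) (λ _ → 1))) (*-identityʳ _))) XE))))
    (≤-trans (Σl-mono (λ (u , v) → m≤m+n (δ (gr u) g) (δ (gr v) g)) XE) (incident g)))

  count-right : ∀ h → ΣF (λ g → count g h) ≤ 2 * s
  count-right h = twoS (λ g → count g h) (λ g → length (between g h XE)) (λ g → chunk-count (between g h XE)) (≤-trans (≤-reflexive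
      (≡.trans (ΣF-cong (λ g → len-between g h)) (≡.trans (Σl-swap (λ g (u , v) → δ (gr u) g * (δ (gr v) h * 1)) (allFin s) XE)
        (Σl-cong (λ (u , v) → ≡.trans (ΣF-δ* (gr u) (λ _ → δ (gr v) h * 1)) (*-identityʳ _)) XE))))
    (≤-trans (Σl-mono (λ (u , v) → m≤n+m (δ (gr v) h) (δ (gr u) h)) XE) (incident h)))

  module _ (φ : I → ℕ) where
    private
      S : Fin s → ℕ
      S g = ΣF (λ i → φ (g , i))

      P R r₀ : ℕ
      P = ΣF S
      R = ΣF (φ ∘ root)
      r₀ = φ (root zero)

      r≤S : ∀ g → φ (root g) ≤ S g
      r≤S g = ΣF-∈ (λ i → φ (g , i)) zero

      R≤P : R ≤ P
      R≤P = ΣF-mono r≤S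

      r₀≤P : r₀ ≤ P
      r₀≤P = ≤-trans (r≤S zero) (ΣF-∈ S zero)

      ends-of : Fin s → Fin s → E → ℕ
      ends-of g h ((i , j) , _) = φ (g , i) + φ (h , j)

      -- Positions of the two rows pay a constant for each block. The hub pays 4s for creating and
      -- collapsing two columns, 2 for its loop, and 4 for each of at most `D` edges, hence at most
      -- 10·D.
      blockBound : Fin s → Block → ℕ
      blockBound g B = (8 * S g + 8 * S (Block.right B)) + (10 * (D * φ (Block.hub B)) + Σl (ends-of g (Block.right B)) (Block.es B))

      block≤ : ∀ g B → length (Block.es B) ≤ D → blockCost g B φ ≤ blockBound g B
      block≤ g (block h w es) l = begin
        blockCost g (block h w es) φ ≡⟨ cong (λ q → ((S g + s * φ w) + ((S h + s * φ w) + 2 * φ w) + q) + ((5 * S g + s * φ w) + ((5 * S h + s * φ w) + (φ (root g) + φ (root h)))) + (φ (root h) + φ (root g))) edge ⟩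
        ((S g + s * φ w) + ((S h + s * φ w) + 2 * φ w) + (Q + length es * (4 * φ w))) + ((5 * S g + s * φ w) + ((5 * S h + s * φ w) + (φ (root g) + φ (root h)))) + (φ (root h) + φ (root g))
          ≡⟨ a₁ (S g) (S h) s (φ w) Q (length es) (φ (root g)) (φ (root h)) ⟩
        (6 * S g + 6 * S h + (2 * φ (root g) + 2 * φ (root h))) + (((4 * s + 2) + 4 * length es) * φ w + Q)
          ≤⟨ +-mono-≤ (+-monoʳ-≤ (6 * S g + 6 * S h) (+-mono-≤ (*-monoʳ-≤ 2 (r≤S g)) (*-monoʳ-≤ 2 (r≤S h))))
               (+-monoˡ-≤ Q (*-monoˡ-≤ (φ w) (+-mono-≤ (+-mono-≤ (*-monoʳ-≤ 4 s≤D) (*-monoʳ-≤ 2 D>0)) (*-monoʳ-≤ 4 l)))) ⟩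
        (6 * S g + 6 * S h + (2 * S g + 2 * S h)) + (((4 * D + 2 * D) + 4 * D) * φ w + Q)
          ≡⟨ a₂ (S g) (S h) D (φ w) Q ⟩
        blockBound g (block h w es) ∎
        where
        open ≤-Reasoning
        Q : ℕ
        Q = Σl (ends-of g h) es
        edge : Σl (λ ((i , j) , _) → φ (g , i) + φ (h , j) + 4 * φ w) es ≡ Q + length es * (4 * φ w)
        edge = ≡.trans (Σl-+ (ends-of g h) (λ _ → 4 * φ w) es) (cong (Q +_) (Σl-const (4 * φ w) es))
        a₁ : ∀ a b s w q l x y → ((a + s * w) + ((b + s * w) + 2 * w) + (q + l * (4 * w))) + ((5 * a + s * w) + ((5 * b + s * w) + (x + y))) + (y + x) ≡ (6 * a + 6 * b + (2 * x + 2 * y)) + (((4 * s + 2) + 4 * l) * w + q)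
        a₁ = solve 8 (λ a b s w q l x y → ((a :+ s :* w) :+ ((b :+ s :* w) :+ con 2 :* w) :+ (q :+ l :* (con 4 :* w))) :+ ((con 5 :* a :+ s :* w) :+ ((con 5 :* b :+ s :* w) :+ (x :+ y))) :+ (y :+ x) := (con 6 :* a :+ con 6 :* b :+ (con 2 :* x :+ con 2 :* y)) :+ (((con 4 :* s :+ con 2) :+ con 4 :* l) :* w :+ q)) ≡.refl
        a₂ : ∀ a b D w q → (6 * a + 6 * b + (2 * a + 2 * b)) + (((4 * D + 2 * D) + 4 * D) * w + q) ≡ (8 * a + 8 * b) + (10 * (D * w) + q)
        a₂ = solve 5 (λ a b D w q → (con 6 :* a :+ con 6 :* b :+ (con 2 :* a :+ con 2 :* b)) :+ (((con 4 :* D :+ con 2 :* D) :+ con 4 :* D) :* w :+ q) := (con 8 :* a :+ con 8 :* b) :+ (con 10 :* (D :* w) :+ q)) ≡.refl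

      short-blocks : ∀ g → All (λ B → length (Block.es B) ≤ D) (blocks g)
      short-blocks g = as (pre g) supply (pr (allFin s))
        where
        as : ∀ ps ts → All (λ (h , es) → length es ≤ D) ps → All (λ B → length (Block.es B) ≤ D) (assign g ps ts)
        as []              ts       []       = []
        as ((h , es) ∷ ps) []       (q ∷ qs) = q ∷ as ps [] qs
        as ((h , es) ∷ ps) (t ∷ ts) (q ∷ qs) = q ∷ as ps ts qs
        tag : ∀ h {cs} → All (λ c → length c ≤ D) cs → All (λ (h , es) → length es ≤ D) (map (h ,_) cs)
        tag h []       = []
        tag h (p ∷ ps) = p ∷ tag h ps
        pr : ∀ hs → All (λ (h , es) → length es ≤ D) (concatMap (λ h → map (h ,_) (chunk (between g h XE))) hs)
        pr []       = []
        pr (h ∷ hs) = All-++⁺ (tag h (chunk-short (between g h XE))) (pr hs)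

      len-pre : ∀ g → length (pre g) ≤ length supply
      len-pre g = ≤-trans (≤-reflexive (≡.trans (≡.sym (≡.trans (Σl-const 1 (pre g)) (*-identityʳ _))) (≡.trans (pre-sum g (λ _ _ → 1)) (ΣF-cong (λ h → ≡.trans (Σl-const 1 (chunk (between g h XE))) (*-identityʳ _))))))
        (≤-trans (count-left g) (≤-reflexive (≡.sym (≡.trans (length-++ (allFin s)) (≡.trans (cong₂ _+_ (length-tabulate {n = s} id) (length-tabulate {n = s} id)) (cong (s +_) (≡.sym (+-identityʳ s))))))))

      total : ℕ
      total = ΣF (λ g → Σl (λ B → blockCost g B φ) (blocks g))

      Qx : ℕ
      Qx = Σl (λ (u , v) → φ (ι le u) + φ (ι le v)) XE

      -- A row is the left row of at most 2s blocks and the right row of at most 2s, and pays 8 each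
      -- time; 32 is 2·2·8.
      near : ΣF (λ g → Σl (λ B → 8 * S g + 8 * S (Block.right B)) (blocks g)) ≤ 32 * (D * P)
      near = begin
        ΣF (λ g → Σl (λ B → 8 * S g + 8 * S (Block.right B)) (blocks g))
          ≡⟨ ΣF-cong (λ g → ≡.trans (blocks-sum g (λ h _ → 8 * S g + 8 * S h)) (ΣF-cong (λ h → Σl-const (8 * S g + 8 * S h) (chunk (between g h XE))))) ⟩
        ΣF (λ g → ΣF (λ h → count g h * (8 * S g + 8 * S h)))
          ≡⟨ ΣF-cong (λ g → ≡.trans (ΣF-cong (λ h → *-distribˡ-+ (count g h) (8 * S g) (8 * S h))) (ΣF-+ (λ h → count g h * (8 * S g)) (λ h → count g h * (8 * S h)))) ⟩
        ΣF (λ g → ΣF (λ h → count g h * (8 * S g)) + ΣF (λ h → count g h * (8 * S h)))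
          ≡⟨ ΣF-+ (λ g → ΣF (λ h → count g h * (8 * S g))) (λ g → ΣF (λ h → count g h * (8 * S h))) ⟩
        ΣF (λ g → ΣF (λ h → count g h * (8 * S g))) + ΣF (λ g → ΣF (λ h → count g h * (8 * S h)))
          ≡⟨ cong₂ _+_ (ΣF-cong (λ g → Σl-*ʳ (8 * S g) (count g) (allFin s))) (≡.trans (Σl-swap (λ g h → count g h * (8 * S h)) (allFin s) (allFin s)) (ΣF-cong (λ h → Σl-*ʳ (8 * S h) (λ g → count g h) (allFin s)))) ⟩
        ΣF (λ g → ΣF (count g) * (8 * S g)) + ΣF (λ h → ΣF (λ g → count g h) * (8 * S h))
          ≤⟨ +-mono-≤ (ΣF-mono (λ g → *-monoˡ-≤ (8 * S g) (count-left g))) (ΣF-mono (λ h → *-monoˡ-≤ (8 * S h) (count-right h))) ⟩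
        ΣF (λ g → 2 * s * (8 * S g)) + ΣF (λ h → 2 * s * (8 * S h))
          ≡⟨ cong₂ _+_ pull pull ⟩
        2 * s * (8 * P) + 2 * s * (8 * P)
          ≤⟨ +-mono-≤ (*-monoˡ-≤ (8 * P) (*-monoʳ-≤ 2 s≤D)) (*-monoˡ-≤ (8 * P) (*-monoʳ-≤ 2 s≤D)) ⟩
        2 * D * (8 * P) + 2 * D * (8 * P) ≡⟨ r D P ⟩
        32 * (D * P) ∎
        where
        open ≤-Reasoning
        pull : ΣF (λ g → 2 * s * (8 * S g)) ≡ 2 * s * (8 * P)
        pull = ≡.trans (Σl-* (2 * s) (λ g → 8 * S g) (allFin s)) (cong (2 * s *_) (Σl-* 8 S (allFin s)))
        r : ∀ D P → 2 * D * (8 * P) + 2 * D * (8 * P) ≡ 32 * (D * P)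
        r = solve 2 (λ D P → con 2 :* D :* (con 8 :* P) :+ con 2 :* D :* (con 8 :* P) := con 32 :* (D :* P)) ≡.refl

      hubs : ΣF (λ g → Σl (λ B → 10 * (D * φ (Block.hub B))) (blocks g)) ≤ 20 * (D * P)
      hubs = begin
        ΣF (λ g → Σl (λ B → 10 * (D * φ (Block.hub B))) (blocks g))
          ≡⟨ ΣF-cong (λ g → ≡.trans (Σl-* 10 (λ B → D * φ (Block.hub B)) (blocks g)) (cong (10 *_) (Σl-* D (λ B → φ (Block.hub B)) (blocks g)))) ⟩
        ΣF (λ g → 10 * (D * Σl (λ B → φ (Block.hub B)) (blocks g)))
          ≤⟨ ΣF-mono (λ g → *-monoʳ-≤ 10 (*-monoʳ-≤ D (≤-trans (assign-hubs g φ (pre g) supply (len-pre g)) (≤-reflexive (Σl-++ (λ t → φ (g , t)) (allFin s) (allFin s)))))) ⟩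
        ΣF (λ g → 10 * (D * (S g + S g)))
          ≡⟨ ≡.trans (Σl-* 10 (λ g → D * (S g + S g)) (allFin s)) (cong (10 *_) (≡.trans (Σl-* D (λ g → S g + S g) (allFin s)) (cong (D *_) (ΣF-+ S S)))) ⟩
        10 * (D * (P + P)) ≡⟨ r D P ⟩
        20 * (D * P) ∎
        where
        open ≤-Reasoning
        r : ∀ D P → 10 * (D * (P + P)) ≡ 20 * (D * P)
        r = solve 2 (λ D P → con 10 :* (D :* (P :+ P)) := con 20 :* (D :* P)) ≡.refl

      total≤ : total ≤ 52 * (D * P) + Qx
      total≤ = begin
        total ≤⟨ ΣF-mono (λ g → Σl-monoAll (bounds (short-blocks g))) ⟩
        ΣF (λ g → Σl (blockBound g) (blocks g))
          ≡⟨ ΣF-cong (λ g → ≡.trans (Σl-+ (λ B → 8 * S g + 8 * S (Block.right B)) (λ B → 10 * (D * φ (Block.hub B)) + Σl (ends-of g (Block.right B)) (Block.es B)) (blocks g))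
               (cong (X g +_) (Σl-+ (λ B → 10 * (D * φ (Block.hub B))) (λ B → Σl (ends-of g (Block.right B)) (Block.es B)) (blocks g)))) ⟩
        ΣF (λ g → X g + (Y g + Z g)) ≡⟨ ≡.trans (ΣF-+ X (λ g → Y g + Z g)) (cong (ΣF X +_) (ΣF-+ Y Z)) ⟩
        ΣF X + (ΣF Y + ΣF Z) ≤⟨ +-mono-≤ near (+-mono-≤ hubs (≤-reflexive (edges-sum ends-of))) ⟩
        32 * (D * P) + (20 * (D * P) + Qx) ≡⟨ r (D * P) Qx ⟩
        52 * (D * P) + Qx ∎
        where
        open ≤-Reasoning
        X Y Z : Fin s → ℕ
        X g = Σl (λ B → 8 * S g + 8 * S (Block.right B)) (blocks g)
        Y g = Σl (λ B → 10 * (D * φ (Block.hub B))) (blocks g)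
        Z g = Σl (λ B → Σl (ends-of g (Block.right B)) (Block.es B)) (blocks g)
        r : ∀ x q → 32 * x + (20 * x + q) ≡ 52 * x + q
        r = solve 2 (λ x q → con 32 :* x :+ (con 20 :* x :+ q) := con 52 :* x :+ q) ≡.refl
        bounds : ∀ {g Bs} → All (λ B → length (Block.es B) ≤ D) Bs → All (λ B → blockCost g B φ ≤ blockBound g B) Bs
        bounds []                   = []
        bounds {g} (_∷_ {B} p ps) = block≤ g B p ∷ bounds ps

    -- The constant 78 is 52 for the blocks (32 for their rows, 20 for the hubs) and 26 for the
    -- accumulators and the passes over the roots. The ends of the given edges enter through `Qx`
    -- without a factor `D`.
    cost-bound : schemeCost rows φ ≤ 78 * (D * P) + Qx
    cost-bound = begin
      schemeCost rows φ ≡⟨ cong (λ t → ((R + s * r₀) + (4 * P + 4 * R)) + (t + (5 * R + s * r₀))) rowsSum ⟩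
      ((R + s * r₀) + (4 * P + 4 * R)) + ((8 * (s * R) + R + s * r₀ + total) + (5 * R + s * r₀)) ≡⟨ a₁ R r₀ P s total ⟩
      (11 * R + 4 * P) + 8 * (s * R) + 3 * (s * r₀) + total
        ≤⟨ +-mono-≤ (+-mono-≤ (+-mono-≤ (+-monoˡ-≤ (4 * P) (*-monoʳ-≤ 11 R≤P)) (*-monoʳ-≤ 8 (*-mono-≤ s≤D R≤P))) (*-monoʳ-≤ 3 (*-mono-≤ s≤D r₀≤P))) total≤ ⟩
      (11 * P + 4 * P) + 8 * (D * P) + 3 * (D * P) + (52 * (D * P) + Qx)
        ≤⟨ +-monoˡ-≤ (52 * (D * P) + Qx) (+-monoˡ-≤ (3 * (D * P)) (+-monoˡ-≤ (8 * (D * P)) (+-mono-≤ (*-monoʳ-≤ 11 P≤DP) (*-monoʳ-≤ 4 P≤DP)))) ⟩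
      (11 * (D * P) + 4 * (D * P)) + 8 * (D * P) + 3 * (D * P) + (52 * (D * P) + Qx) ≡⟨ a₂ (D * P) Qx ⟩
      78 * (D * P) + Qx ∎
      where
      open ≤-Reasoning
      P≤DP : P ≤ D * P
      P≤DP = m≤n*m P D ⦃ >-nonZero D>0 ⦄
      a₁ : ∀ R r P s t → ((R + s * r) + (4 * P + 4 * R)) + ((8 * (s * R) + R + s * r + t) + (5 * R + s * r)) ≡ (11 * R + 4 * P) + 8 * (s * R) + 3 * (s * r) + t
      a₁ = solve 5 (λ R r P s t → ((R :+ s :* r) :+ (con 4 :* P :+ con 4 :* R)) :+ ((con 8 :* (s :* R) :+ R :+ s :* r :+ t) :+ (con 5 :* R :+ s :* r)) := (con 11 :* R :+ con 4 :* P) :+ con 8 :* (s :* R) :+ con 3 :* (s :* r) :+ t) ≡.refl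
      a₂ : ∀ x q → (11 * x + 4 * x) + 8 * x + 3 * x + (52 * x + q) ≡ 78 * x + q
      a₂ = solve 2 (λ x q → (con 11 :* x :+ con 4 :* x) :+ con 8 :* x :+ con 3 :* x :+ (con 52 :* x :+ q) := con 78 :* x :+ q) ≡.refl
      rowsSum : rowsCost rows φ ≡ 8 * (s * R) + R + s * r₀ + total
      rowsSum = ≡.trans (Σl-map (λ r → rowCost r φ + (φ (root (proj₁ r)) + r₀)) (λ g → g , blocks g) (allFin s))
        (≡.trans (ΣF-cong (λ g → a₃ R s (φ (root g)) (costs g) r₀))
        (≡.trans (ΣF-+ (λ g → (6 * R + r₀) + (2 * s + 1) * φ (root g)) costs) (cong (_+ total) (≡.trans (ΣF-+ (λ _ → 6 * R + r₀) (λ g → (2 * s + 1) * φ (root g)))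
          (≡.trans (cong₂ _+_ (ΣF-const s (6 * R + r₀)) (Σl-* (2 * s + 1) (φ ∘ root) (allFin s))) (a₄ s R r₀))))))
        where
        costs : Fin s → ℕ
        costs g = Σl (λ B → blockCost g B φ) (blocks g)
        a₃ : ∀ R s x t r → (R + s * x) + (t + (5 * R + s * x)) + (x + r) ≡ (6 * R + r) + (2 * s + 1) * x + t
        a₃ = solve 5 (λ R s x t r → (R :+ s :* x) :+ (t :+ (con 5 :* R :+ s :* x)) :+ (x :+ r) := (con 6 :* R :+ r) :+ (con 2 :* s :+ con 1) :* x :+ t) ≡.refl
        a₄ : ∀ s R r → s * (6 * R + r) + (2 * s + 1) * R ≡ 8 * (s * R) + R + s * r
        a₄ = solve 3 (λ s R r → s :* (con 6 :* R :+ r) :+ (con 2 :* s :+ con 1) :* R := con 8 :* (s :* R) :+ R :+ s :* r) ≡.refl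

-- Graphs as adjacency functions and as edge lists

tri≡C : ∀ n → tri n ≡ n choose 2
tri≡C zero    = ≡.refl
tri≡C (suc n) = ≡.trans (cong₂ _+_ (≡.sym (nC1≡n n)) (tri≡C n)) (nCk+nC[k+1]≡[n+1]C[k+1] n 1)

double-tri : ∀ d → (2 + d) * suc d ≡ 2 * tri (2 + d)
double-tri zero    = ≡.refl
double-tri (suc d) = ≡.trans (r₁ d) (≡.trans (cong (λ t → 2 * (2 + d) + t) (double-tri d)) (≡.sym (*-distribˡ-+ 2 (2 + d) (tri (2 + d)))))
  where
  r₁ : ∀ d → (3 + d) * (2 + d) ≡ 2 * (2 + d) + (2 + d) * (1 + d)
  r₁ = solve 1 (λ d → (con 3 :+ d) :* (con 2 :+ d) := con 2 :* (con 2 :+ d) :+ (con 2 :+ d) :* (con 1 :+ d)) ≡.refl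

b2n≤1 : ∀ b → b2n b ≤ 1
b2n≤1 true  = ≤-refl
b2n≤1 false = z≤n

T⇒b2n : ∀ {b} → T b → b2n b ≡ 1
T⇒b2n {true} _ = ≡.refl

b2n⇒T : ∀ {b} → 1 ≤ b2n b → T b
b2n⇒T {true} _ = tt

module EdgeList {n : ℕ} where

  lt : Fin n → Fin n → Bool
  lt u v = toℕ u <ᵇ toℕ v

  when : Bool → Edge n → List (Edge n)
  when true  e = [ e ]
  when false e = []

  edgeList : Adj n → List (Edge n)
  edgeList X = concatMap (λ u → concatMap (λ v → when (X u v ∧ lt u v) (u , v)) (allFin n)) (allFin n)

  edgeList-sum : ∀ X (F : Edge n → ℕ) → Σl F (edgeList X) ≡ ΣF (λ u → ΣF (λ v → b2n (X u v ∧ lt u v) * F (u , v)))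
  edgeList-sum X F = ≡.trans (Σl-concatMap F _ (allFin n)) (ΣF-cong (λ u → ≡.trans (Σl-concatMap F _ (allFin n)) (ΣF-cong (λ v → one (X u v ∧ lt u v) (u , v)))))
    where
    one : ∀ b e → Σl F (when b e) ≡ b2n b * F e
    one true  e = ≡.refl
    one false e = ≡.refl

  -- A subgraph `L` appears as a 0/1 value on each edge of the fixed list of `X`, since the circuit
  -- has one wire for each edge of `X`, whatever `L` is.
  partSum : (X : Adj n) → Adj n → (Fin n → Fin n → ℕ) → ℕ
  partSum X L ψ = Σl (λ (u , v) → b2n (L u v) * ψ u v) (edgeList X)

  module _ (X : Adj n) (L : Graph n) (L⊆X : adj L ⊆ᵍ X) where
    private
      l : Adj n
      l = adj L

      both : ∀ u v → b2n (X u v ∧ lt u v) * b2n (l u v) ≡ b2n (l u v ∧ lt u v)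
      both u v = go (l u v) (X u v) (lt u v) (L⊆X u v)
        where
        go : ∀ a b c → (T a → T b) → b2n (b ∧ c) * b2n a ≡ b2n (a ∧ c)
        go false b     c     h = *-zeroʳ (b2n (b ∧ c))
        go true  true  c     h = *-identityʳ (b2n c)
        go true  false c     h = ⊥-elim (h tt)

    partSum≡ : ∀ ψ → partSum X l ψ ≡ ΣF (λ u → ΣF (λ v → b2n (l u v ∧ lt u v) * ψ u v))
    partSum≡ ψ = ≡.trans (edgeList-sum X (λ (u , v) → b2n (l u v) * ψ u v)) (ΣF-cong (λ u → ΣF-cong (λ v →
      ≡.trans (≡.sym (*-assoc (b2n (X u v ∧ lt u v)) (b2n (l u v)) (ψ u v))) (cong (_* ψ u v) (both u v)))))

    part-edges : partSum X l (λ _ _ → 1) ≡ edges l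
    part-edges = ≡.trans (partSum≡ (λ _ _ → 1)) (≡.trans (ΣF-cong (λ u → ≡.trans (ΣF-cong (λ v → *-identityʳ (b2n (l u v ∧ lt u v)))) (Σl≡sum _ (allFin n)))) (Σl≡sum _ (allFin n)))

    part-adj : ∀ i j → partSum X l (adψ i j) ≡ b2n (l i j)
    part-adj i j = ≡.trans (partSum≡ (adψ i j)) (≡.trans (ΣF-cong (λ u → ≡.trans (ΣF-cong (λ v → r₁ u v (w u v)))
        (≡.trans (ΣF-+ (λ v → δ j v * (δ u i * w u v)) (λ v → δ i v * (δ u j * w u v))) (cong₂ _+_ (≡.trans (ΣF-δ* j (λ v → δ u i * w u v)) (cong (_* w u j) (δ-sym u i))) (≡.trans (ΣF-δ* i (λ v → δ u j * w u v)) (cong (_* w u i) (δ-sym u j)))))))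
        (≡.trans (ΣF-+ (λ u → δ i u * w u j) (λ u → δ j u * w u i)) (≡.trans (cong₂ _+_ (ΣF-δ* i (λ u → w u j)) (ΣF-δ* j (λ u → w u i))) final)))
      where
      w : Fin n → Fin n → ℕ
      w u v = b2n (l u v ∧ lt u v)
      r₁ : ∀ u v w → w * (δ u i * δ v j + δ v i * δ u j) ≡ δ j v * (δ u i * w) + δ i v * (δ u j * w)
      r₁ u v w = ≡.trans (r₂ w (δ u i) (δ v j) (δ v i) (δ u j)) (cong₂ _+_ (cong (_* (δ u i * w)) (δ-sym v j)) (cong (_* (δ u j * w)) (δ-sym v i)))
        where
        r₂ : ∀ w a b c d → w * (a * b + c * d) ≡ b * (a * w) + c * (d * w)
        r₂ = solve 5 (λ w a b c d → w :* (a :* b :+ c :* d) := b :* (a :* w) :+ c :* (d :* w)) ≡.refl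
      lt-yes : ∀ {u v} → toℕ u < toℕ v → lt u v ≡ true
      lt-yes p = T⇒true (<⇒<ᵇ p)
        where
        T⇒true : ∀ {b} → T b → b ≡ true
        T⇒true {true} _ = ≡.refl
      lt-no : ∀ {u v} → ¬ (toℕ u < toℕ v) → lt u v ≡ false
      lt-no {u} {v} ¬p with lt u v in eq
      ... | false = ≡.refl
      ... | true  = ⊥-elim (¬p (<ᵇ⇒< (toℕ u) (toℕ v) (subst T (≡.sym eq) tt)))
      ∧-true : ∀ b → b ∧ true ≡ b
      ∧-true true  = ≡.refl
      ∧-true false = ≡.refl
      ∧-false : ∀ b → b ∧ false ≡ false
      ∧-false true  = ≡.refl
      ∧-false false = ≡.refl
      final : w i j + w j i ≡ b2n (l i j)
      final with <-cmp (toℕ i) (toℕ j)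
      ... | tri< p _ ¬q = ≡.trans (cong₂ _+_ (cong b2n (≡.trans (cong (l i j ∧_) (lt-yes p)) (∧-true (l i j)))) (cong b2n (≡.trans (cong (l j i ∧_) (lt-no ¬q)) (∧-false (l j i))))) (+-identityʳ _)
      ... | tri≈ ¬p e _ = ≡.trans (cong₂ _+_ (cong b2n (≡.trans (cong (l i j ∧_) (lt-no ¬p)) (∧-false (l i j)))) (cong b2n (≡.trans (cong (_∧ lt j i) (≡.trans (cong (l j) i≡j) (irr L j))) ≡.refl)))
          (≡.sym (cong b2n (≡.trans (cong (λ t → l t j) i≡j) (irr L j))))
        where
        i≡j : i ≡ j
        i≡j = toℕ-injective e
      ... | tri> ¬p _ q = ≡.trans (cong₂ _+_ (cong b2n (≡.trans (cong (l i j ∧_) (lt-no ¬p)) (∧-false (l i j)))) (cong b2n (≡.trans (cong (l j i ∧_) (lt-yes q)) (∧-true (l j i))))) (cong b2n (Graph.sym L j i))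

    part-deg : ∀ x → partSum X l (incψ x) ≡ deg l x
    part-deg x = ≡.trans (Σl-cong (λ (u , v) → ≡.trans (cong (b2n (l u v) *_) (≡.sym (ΣF-adψ x u v))) (≡.sym (Σl-* (b2n (l u v)) (λ j → adψ x j u v) (allFin n)))) (edgeList X))
      (≡.trans (≡.sym (Σl-swap (λ j (u , v) → b2n (l u v) * adψ x j u v) (allFin n) (edgeList X))) (≡.trans (ΣF-cong (part-adj x)) (Σl≡sum _ (allFin n))))

  module _ (X : Graph n) where
    partSum-self : ∀ ψ → partSum (adj X) (adj X) ψ ≡ ev ψ (edgeList (adj X))
    partSum-self ψ = ≡.trans (partSum≡ (adj X) X (λ _ _ t → t) ψ) (≡.sym (edgeList-sum (adj X) (uncurry ψ)))

    mg-edgeList : ∀ i j → mg (edgeList (adj X)) i j ≡ b2n (adj X i j)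
    mg-edgeList i j = ≡.trans (≡.sym (partSum-self (adψ i j))) (part-adj (adj X) X (λ _ _ t → t) i j)

    degL-edgeList : ∀ x → degL (edgeList (adj X)) x ≡ deg (adj X) x
    degL-edgeList x = ≡.trans (≡.sym (partSum-self (incψ x))) (part-deg (adj X) X (λ _ _ t → t) x)

deg≤maxDeg : ∀ {n} (H : Adj n) v → deg H v ≤ maxDeg H
deg≤maxDeg {n} H v = go (allFin n) (∈-allFin v)
  where
  go : ∀ xs → v ∈ xs → deg H v ≤ foldr _⊔_ 0 (map (deg H) xs)
  go (x ∷ xs) (here ≡.refl) = m≤m⊔n _ _
  go (x ∷ xs) (there p)     = ≤-trans (go xs p) (m≤n⊔m (deg H x) _)

maxDeg≤ : ∀ {n} (H : Adj n) B → (∀ v → deg H v ≤ B) → maxDeg H ≤ B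
maxDeg≤ {n} H B h = go (allFin n)
  where
  go : ∀ xs → foldr _⊔_ 0 (map (deg H) xs) ≤ B
  go []       = z≤n
  go (x ∷ xs) = ⊔-lub (h x) (go xs)

isPos : ℕ → Bool
isPos zero    = false
isPos (suc _) = true

b2n-isPos : ∀ {a} → a ≤ 1 → b2n (isPos a) ≡ a
b2n-isPos {zero}        _ = ≡.refl
b2n-isPos {suc zero}    _ = ≡.refl
b2n-isPos {suc (suc _)} (s≤s ())

isPos⇒ : ∀ {a} → T (isPos a) → 1 ≤ a
isPos⇒ {suc _} _ = s≤s z≤n

toSubset : ∀ {n} → List (Fin n) → Subset n
toSubset S = Vec.tabulate (λ i → isPos (cnt i S))

lookup-toSubset : ∀ {n} (S : List (Fin n)) i → Vec.lookup (toSubset S) i ≡ isPos (cnt i S)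
lookup-toSubset S i = lookup∘tabulate (λ i → isPos (cnt i S)) i

∣tabulate∣ : ∀ {n} (f : Fin n → Bool) → ∣ Vec.tabulate f ∣ ≡ ΣF (b2n ∘ f)
∣tabulate∣ {zero}  f = ≡.refl
∣tabulate∣ {suc n} f = ≡.trans (go (f zero)) (≡.sym (ΣF-suc (b2n ∘ f)))
  where
  go : ∀ b → ∣ b Vec.∷ Vec.tabulate (f ∘ suc) ∣ ≡ b2n b + ΣF (λ i → b2n (f (suc i)))
  go true  = cong suc (∣tabulate∣ (f ∘ suc))
  go false = ∣tabulate∣ (f ∘ suc)

size-toSubset : ∀ {n} (S : List (Fin n)) → Unique S → ∣ toSubset S ∣ ≡ length S
size-toSubset S uq = ≡.trans (∣tabulate∣ (λ i → isPos (cnt i S))) (≡.trans (ΣF-cong (λ i → b2n-isPos (uq i))) (ΣF-cnt S))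

mg-cl : ∀ {n} {i j : Fin n} → i ≢ j → ∀ S → mg (cl S) i j ≡ cnt i S * cnt j S
mg-cl ne [] = ≡.refl
mg-cl {i = i} {j} ne (x ∷ S) = ≡.trans (ev-++ (adψ i j) (star x S) (cl S)) (≡.trans (cong₂ _+_ (mg-star x S i j) (mg-cl ne S))
  (≡.sym (≡.trans (r (δ x i) (δ x j) (cnt i S) (cnt j S)) (cong (_+ (δ x i * cnt j S + δ x j * cnt i S + cnt i S * cnt j S)) zero-prod))))
  where
  r : ∀ a b c d → (a + c) * (b + d) ≡ a * b + (a * d + b * c + c * d)
  r = solve 4 (λ a b c d → (a :+ c) :* (b :+ d) := a :* b :+ (a :* d :+ b :* c :+ c :* d)) ≡.refl
  zero-prod : δ x i * δ x j ≡ 0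
  zero-prod with x ≟ᶠ i
  ... | no _       = ≡.refl
  ... | yes ≡.refl = ≡.trans (*-identityˡ _) (δ-≢ ne)

-- A repeated vertex would produce a loop in `cl S`. Hence the cliques need not be tracked as
-- repetition-free during the construction: it follows from legality of the edges that they cover.
cl-unique : ∀ {n} (S : List (Fin n)) → (∀ i → mg (cl S) i i ≡ 0) → Unique S
cl-unique []      h v = z≤n
cl-unique (x ∷ S) h v = go (x ≟ᶠ v) (cl-unique S (λ i → m+n≡0⇒n≡0 (mg (star x S) i i) (h' i)) v)
  where
  h' : ∀ i → mg (star x S) i i + mg (cl S) i i ≡ 0
  h' i = ≡.trans (≡.sym (ev-++ (adψ i i) (star x S) (cl S))) (h i)
  go : Dec (x ≡ v) → cnt v S ≤ 1 → δ x v + cnt v S ≤ 1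
  go (no ne)      le = ≤-trans (≤-reflexive (cong (_+ cnt v S) (δ-≢ ne))) le
  go (yes ≡.refl) le = ≤-reflexive (≡.trans (cong (_+ cnt v S) (δ-refl v)) (cong suc (≡.trans (≡.sym (≡.trans (cong (_* cnt v S) (δ-refl v)) (*-identityˡ _)))
    (m+n≡0⇒m≡0 (δ v v * cnt v S) (≡.trans (≡.sym (mg-star v S v v)) (m+n≡0⇒m≡0 (mg (star v S) v v) (h' v)))))))

cover-cls : ∀ {n} {i j : Fin n} → i ≢ j → ∀ Q → All Unique Q → cover (map toSubset Q) i j ≡ mg (cls Q) i j
cover-cls {i = i} {j} ne []      []       = ≡.refl
cover-cls {i = i} {j} ne (S ∷ Q) (u ∷ us) = ≡.trans (cong₂ _+_ one (cover-cls ne Q us)) (≡.sym (ev-++ (adψ i j) (cl S) (cls Q)))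
  where
  and : ∀ a b → a ≤ 1 → b ≤ 1 → b2n (isPos a ∧ isPos b) ≡ a * b
  and zero       b          _ _ = ≡.refl
  and (suc zero) zero       _ _ = ≡.refl
  and (suc zero) (suc zero) _ _ = ≡.refl
  and (suc (suc _)) _ (s≤s ()) _
  and (suc zero) (suc (suc _)) _ (s≤s ())
  one : b2n (Vec.lookup (toSubset S) i ∧ Vec.lookup (toSubset S) j) ≡ mg (cl S) i j
  one = ≡.trans (cong₂ (λ a b → b2n (a ∧ b)) (lookup-toSubset S i) (lookup-toSubset S j)) (≡.trans (and (cnt i S) (cnt j S) (u i) (u j)) (≡.sym (mg-cl ne S)))

-- Parameters and execution of the two greedy embeddings

record Ground (n : ℕ) : Set where
  field
    g : Fin n → Fin n → ℕ
    gsym : ∀ i j → g i j ≡ g j i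
    girr : ∀ i → g i i ≡ 0
    k r : ℕ
    k>0   : 0 < k
    r>0   : 0 < r
    codeg : ∀ v → k * r * ΣF (λ w → 1 ∸ g w v) + k * n ≤ r * n

-- saturation threshold for programs of cost c with total demand at most Λ everywhere
threshold degBound : ℕ → ℕ → ℕ → ℕ
threshold r c Λ = 8 * r * c * Λ
degBound r c Λ = 2 * c + (threshold r c Λ + 2 * c + 2 * c * Λ)

mkHost : ∀ {n} (G : Ground n) (base : Fin n → Fin n → ℕ) → (∀ i j → base i j ≡ base j i) → ∀ b0 → (∀ v → ΣF (λ w → base w v) ≤ b0) →
  ∀ c Λ Av → 0 < c → 0 < Λ → 2 * (Ground.r G * (Ground.k G * (b0 + degBound (Ground.r G) c Λ) + Av)) < n → Host n
mkHost {n} G base bsym b0 bdeg c Λ Av c>0 Λ>0 room = record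
  { g = g ; base = base ; gsym = gsym ; girr = girr ; bsym = bsym ; k = k ; r = r
  ; τ = threshold r c Λ ; Bmax = degBound r c Λ ; Emax = c + c * (n * Λ) ; Av = Av ; b0 = b0
  ; k>0 = k>0 ; τ>0 = *-mono-≤ {1} {8 * r * c} (*-mono-≤ {1} {8 * r} (*-mono-≤ {1} {8} (s≤s z≤n) r>0) c>0) Λ>0
  ; codeg = codeg ; bdeg = bdeg ; room = room ; sparse = sparse }
  where
  open Ground G
  -- As `n` and `Λ` are positive, the single `c` is at most c·n·Λ, so at most 2·c·n·Λ edges are
  -- used. This is the origin of the 8 in `threshold`.
  sparse : 4 * r * (c + c * (n * Λ)) ≤ threshold r c Λ * n
  sparse = ≤-trans (*-monoʳ-≤ (4 * r) (+-monoˡ-≤ (c * (n * Λ)) (≤-trans (≤-reflexive (≡.sym (*-identityʳ c))) (*-monoʳ-≤ c (*-mono-≤ {1} (≤-trans (s≤s z≤n) room) Λ>0)))))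
    (≤-reflexive (lem r c n Λ))
    where
    lem : ∀ r c n Λ → 4 * r * (c * (n * Λ) + c * (n * Λ)) ≡ 8 * r * c * Λ * n
    lem = solve 4 (λ r c n Λ → con 4 :* r :* (c :* (n :* Λ) :+ c :* (n :* Λ)) := con 8 :* r :* c :* Λ :* n) ≡.refl

total-demand : ∀ {n} {Req : Set} (dem : Req → Fin n → ℕ) rs Λ → (∀ v → Σl (λ q → dem q v) rs ≤ Λ) → Σl (λ q → ΣF (dem q)) rs ≤ n * Λ
total-demand {n} dem rs Λ h = ≤-trans (≤-reflexive (≡.sym (Σl-swap (λ v q → dem q v) (allFin n) rs))) (≤-trans (ΣF-mono h) (≤-reflexive (ΣF-const n Λ)))

module _ {n : ℕ} (G : Ground n) (base : Fin n → Fin n → ℕ) (bsym : ∀ i j → base i j ≡ base j i) (b0 : ℕ) (bdeg : ∀ v → ΣF (λ w → base w v) ≤ b0)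
         (c Λ Av : ℕ) (c>0 : 0 < c) (Λ>0 : 0 < Λ) (room : 2 * (Ground.r G * (Ground.k G * (b0 + degBound (Ground.r G) c Λ) + Av)) < n) where
  private
    H : Host n
    H = mkHost G base bsym b0 bdeg c Λ Av c>0 Λ>0 room
    r : ℕ
    r = Ground.r G
  open Sequence H c

  greedyRun : ∀ {Req : Set} (dem : Req → Fin n → ℕ) (Out : Req → List (Edge n) → Set) → Executes dem Out → Greedy.Legal H [] →
    ∀ rs → (∀ v → Σl (λ q → dem q v) rs ≤ Λ) →
    Σ[ Es ∈ All (λ q → ∃ (Out q)) rs ] (Greedy.Legal H (flat Es) × (∀ v → degL (flat Es) v ≤ degBound r c Λ))
  greedyRun dem Out ex l0 rs h = finish (sequence dem Out ex rs (λ v → +-monoʳ-≤ (2 * c) (within v)) (+-monoʳ-≤ c (*-monoʳ-≤ c (total-demand dem rs Λ h))) l0)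
    where
    within : ∀ v → threshold r c Λ + 2 * c + 2 * c * Σl (λ q → dem q v) rs ≤ threshold r c Λ + 2 * c + 2 * c * Λ
    within v = +-monoʳ-≤ (threshold r c Λ + 2 * c) (*-monoʳ-≤ (2 * c) (h v))
    finish : Σ[ Es ∈ All (λ q → ∃ (Out q)) rs ] (Greedy.Legal H (flat Es) × (∀ v → degL (flat Es) v ≤ threshold r c Λ + 2 * c + 2 * c * Σl (λ q → dem q v) rs) ×
      length (flat Es) ≤ c * Σl (λ q → ΣF (dem q)) rs) → Σ[ Es ∈ All (λ q → ∃ (Out q)) rs ] (Greedy.Legal H (flat Es) × (∀ v → degL (flat Es) v ≤ degBound r c Λ))
    finish (Es , l , dg , _) = Es , l , λ v → ≤-trans (dg v) (≤-trans (within v) (m≤n+m _ (2 * c)))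

module _ {n : ℕ} {H : Host n} (Γ : Context H) where
  open Greedy H
  open Context Γ
  open Program Γ

  run : ∀ {P} → Res [] 0 P → ∃[ E ] (Legal (E ++ U0) × P E × length E ≤ K × All (λ (u , v) → Fr u × Fr v) E)
  run {P} (res new inv post) = new , subst (λ e → Legal (e ++ U0)) (++-identityʳ new) (Inv.leg inv) , post ,
    ≤-trans (≤-trans (m≤m+n _ 0) (≤-reflexive (cong (λ e → length e + 0) (≡.sym (++-identityʳ new))))) (Inv.bud inv) ,
    subst (All (λ (u , v) → Fr u × Fr v)) (++-identityʳ new) (Inv.frs inv)

tokenCost′ : ℕ → ℕ → ℕ
tokenCost′ d k = k + (k + (d * k + d * k))

module Executors {n : ℕ} (H : Host n) (d : ℕ) (k≡ : Host.k H ≡ 2 + (d + d)) where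
  open Host H
  open Greedy H

  tokenDem : Edge n → Fin n → ℕ
  tokenDem (u , v) x = incψ x u v

  tokenExec : ∀ m → 1 ≤ Av → Sequence.Executes H (m * tokenCost′ d k) tokenDem (λ (u , v) → Tokens n d u v m)
  tokenExec m av U lU dU eU (u , v) = finish (run Γ (tokens m u v (inj₁ (du u)) (inj₁ (dv v)) av (weaken (≤-reflexive (+-identityʳ _)) start)))
    where
    c : ℕ
    c = m * tokenCost′ d k
    Γ : Context H
    Γ = record { U0 = U ; dem = tokenDem (u , v) ; K = c ; legal0 = lU ; deg0 = dU ; len0 = eU }
    open Program Γ
    open TokenProgram Γ d k≡
    du : ∀ x → 0 < incψ x x v
    du x = ≤-trans (≤-reflexive (≡.sym (δ-refl x))) (m≤m+n _ _)
    dv : ∀ x → 0 < incψ x u x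
    dv x = ≤-trans (≤-reflexive (≡.sym (δ-refl x))) (m≤n+m _ (δ u x))
    two : ΣF (tokenDem (u , v)) ≡ 2
    two = ≡.trans (ΣF-+ (δ u) (δ v)) (cong₂ _+_ (ΣF-δ u) (ΣF-δ v))
    finish : ∃[ E ] (Legal (E ++ U) × Tokens n d u v m E × length E ≤ c × All (λ (a , b) → Fr a × Fr b) E) →
      ∃[ E ] (Legal (E ++ U) × Tokens n d u v m E × length E ≤ c × length E ≤ c * ΣF (tokenDem (u , v)) × All (λ (a , b) → Fr a × Fr b) E)
    finish (E , l , ts , le , fr) = E , l , ts , le , ≤-trans le (≤-trans (≤-trans (≤-reflexive (≡.sym (*-identityʳ c))) (*-monoʳ-≤ c (s≤s z≤n))) (≤-reflexive (cong (c *_) (≡.sym two)))) , fr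

  -- Decidability matters: the requests are all options of all gadgets, and not every option is
  -- divisible. Those that fail the test receive an empty absorber.
  Good : ℕ → List (Edge n) → Set
  Good κ B = ((∀ x → suc d ∣ degL B x) × tri (2 + d) ∣ length B) × (All (λ (u , v) → u ≢ v) B × length B ≤ κ)

  good? : ∀ κ B → Dec (Good κ B)
  good? κ B = (all? (λ x → suc d ∣? degL B x) ×-dec tri (2 + d) ∣? length B) ×-dec (AllDec.all? (λ (u , v) → ¬? (u ≟ᶠ v)) B ×-dec length B ≤? κ)

  AbsOut : ℕ → List (Edge n) → List (Edge n) → Set
  AbsOut κ B E = Good κ B × Exch (2 + d) B [] E ⊎ (¬ Good κ B × E ≡ [])

  swapC switchC halfC absC : ℕ → ℕ
  swapC k = suc d * (d * k)
  switchC k = d * k + (swapC k + swapC k)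
  halfC l = l * switchC k + 2 * l * swapC k
  absC κ = k + (κ * ((2 + d) * k) + (κ * (k + k) + (halfC κ + halfC κ)))

  -- The sum of the needs of `starSwap`, `absorb` and `switch`, in place of their maximum.
  absAv : ℕ → ℕ
  absAv κ = (suc d * d + (2 + suc d)) + ((1 + (κ * (2 + d) + 4 * κ)) + (d + 4))

  absorbExec : ∀ κ → 0 < d → absAv κ ≤ Av → Sequence.Executes H (absC κ) degL (AbsOut κ)
  absorbExec κ d>0 av U lU dU eU B with good? κ B
  ... | no ¬p = [] , lU , inj₂ (¬p , ≡.refl) , z≤n , z≤n , []
  ... | yes p = go B p
    where
    go : ∀ B → Good κ B → ∃[ E ] (Legal (E ++ U) × AbsOut κ B E × length E ≤ absC κ × length E ≤ absC κ * ΣF (degL B) ×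
            All (λ (u , v) → (0 < degL B u ⊎ degL U u < τ) × (0 < degL B v ⊎ degL U v < τ)) E)
    -- An empty `B` has no demand, so the bound by the total demand allows it no edge at all.
    go [] p = [] , lU , inj₁ (p , exch-[]) , z≤n , z≤n , []
    go B@(_ ∷ B') p@((dg , divides t lt) , ne , le) = finish (run Γ (absorb B t (touching B ne (λ _ → id)) lt (λ x → _∣_.quotient (dg x) , _∣_.equality (dg x))
        qk (≤-trans (≤-trans (+-monoʳ-≤ 1 (+-mono-≤ (*-monoˡ-≤ (2 + d) t≤κ) (*-monoʳ-≤ 4 le))) (≤-trans (m≤m+n _ (d + 4)) (m≤n+m _ (suc d * d + (2 + suc d))))) av)
        (≤-trans (≤-trans (m≤n+m (d + 4) (1 + (κ * (2 + d) + 4 * κ))) (m≤n+m _ (suc d * d + (2 + suc d)))) av) (weaken cost start)))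
      where
      Γ : Context H
      Γ = record { U0 = U ; dem = degL B ; K = absC κ ; legal0 = lU ; deg0 = dU ; len0 = eU }
      open Program Γ
      4≤k : 4 ≤ k
      4≤k = ≤-trans (s≤s (s≤s (+-mono-≤ d>0 d>0))) (≤-reflexive (≡.sym k≡))
      qk : 2 + d ≤ suc k
      qk = ≤-trans (≤-trans (s≤s (s≤s (m≤m+n d d))) (≤-reflexive (≡.sym k≡))) (n≤1+n k)
      open Absorber Γ d k≡ 4≤k (≤-trans (m≤m+n _ _) av)
      t≤κ : t ≤ κ
      t≤κ = ≤-trans (≤-trans (m≤m*n t (tri (2 + d))) (≤-reflexive (≡.sym lt))) le
      half≤ : halfCost (length B) ≤ halfC κ
      half≤ = +-mono-≤ (*-monoˡ-≤ (switchC k) le) (*-monoˡ-≤ (swapC k) (*-monoʳ-≤ 2 le))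
      cost : absCost t (length B) + 0 ≤ absC κ
      cost = ≤-trans (≤-reflexive (+-identityʳ _)) (+-monoʳ-≤ k (+-mono-≤ (*-monoˡ-≤ ((2 + d) * k) t≤κ) (+-mono-≤ (*-monoˡ-≤ (k + k) le) (+-mono-≤ half≤ half≤))))
      touching : ∀ C → All (λ (u , v) → u ≢ v) C → (∀ x → 0 < degL C x → 0 < degL B x) → All (λ (u , v) → u ≢ v × Fr u × Fr v) C
      touching []            []         inc = []
      touching ((u , v) ∷ C) (n ∷ ns) inc = (n , inj₁ (inc u (≤-trans (≤-reflexive (≡.sym (δ-refl u))) (≤-trans (m≤m+n _ _) (m≤m+n _ _)))) ,
          inj₁ (inc v (≤-trans (≤-reflexive (≡.sym (δ-refl v))) (≤-trans (m≤n+m _ (δ u v)) (m≤m+n _ _))))) ∷ touching C ns (λ x q → inc x (≤-trans q (m≤n+m _ (incψ x u v))))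
      finish : ∃[ E ] (Legal (E ++ U) × Exch (2 + d) B [] E × length E ≤ absC κ × All (λ (a , b) → Fr a × Fr b) E) →
        ∃[ E ] (Legal (E ++ U) × AbsOut κ B E × length E ≤ absC κ × length E ≤ absC κ * ΣF (degL B) × All (λ (a , b) → Fr a × Fr b) E)
      finish (E , l , X , le' , fr) = E , l , inj₁ (p , X) , le' , ≤-trans le' (≤-trans (≤-reflexive (≡.sym (*-identityʳ _))) (*-monoʳ-≤ (absC κ) (≤-trans (s≤s z≤n) (≤-reflexive (≡.sym (ΣF-degL B)))))) , fr

-- Options and families of cliques

opts-length : ∀ {n} (ps : List (Piece n)) → length (opts ps) ≡ 2 ^ length ps
opts-length []             = ≡.refl
opts-length ((e , f) ∷ ps) = ≡.trans (length-++ (map (e ++_) (opts ps))) (≡.trans (cong₂ _+_ (≡.trans (length-map _ (opts ps)) (opts-length ps)) (≡.trans (length-map _ (opts ps)) (opts-length ps)))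
  (cong (2 ^ length ps +_) (≡.sym (+-identityʳ _))))

opts-≤ : ∀ {n} (ψ : Fin n → Fin n → ℕ) (ps : List (Piece n)) {B} → B ∈ opts ps → ev ψ B ≤ Σl (λ (e , f) → ev ψ e + ev ψ f) ps
opts-≤ ψ []             (here ≡.refl) = z≤n
opts-≤ ψ ((e , f) ∷ ps) p with ∈-++⁻ (map (e ++_) (opts ps)) p
... | inj₁ q = let B , q' , eq = ∈-map⁻ (e ++_) q in ≤-trans (≤-reflexive (≡.trans (cong (ev ψ) eq) (ev-++ ψ e B))) (+-mono-≤ (m≤m+n _ _) (opts-≤ ψ ps q'))
... | inj₂ q = let B , q' , eq = ∈-map⁻ (f ++_) q in ≤-trans (≤-reflexive (≡.trans (cong (ev ψ) eq) (ev-++ ψ f B))) (+-mono-≤ (m≤n+m _ (ev ψ e)) (opts-≤ ψ ps q'))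

opts-sum : ∀ {n} (ψ : Fin n → Fin n → ℕ) (ps : List (Piece n)) → Σl (ev ψ) (opts ps) ≤ 2 ^ length ps * Σl (λ (e , f) → ev ψ e + ev ψ f) ps
opts-sum ψ ps = ≤-trans (Σl-monoAll {h = λ _ → full} (AllDec.tabulate (opts-≤ ψ ps))) (≤-reflexive (≡.trans (Σl-const full (opts ps)) (cong (_* full) (opts-length ps))))
  where
  full : ℕ
  full = Σl (λ (e , f) → ev ψ e + ev ψ f) ps

opts-short : ∀ {n} c (ps : List (Piece n)) → All (λ (e , f) → length e ≤ c × length f ≤ c) ps → ∀ {B} → B ∈ opts ps → length B ≤ length ps * c
opts-short c []             []             (here ≡.refl) = z≤n
opts-short c ((e , f) ∷ ps) ((l , l') ∷ ls) p with ∈-++⁻ (map (e ++_) (opts ps)) p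
... | inj₁ q = let B , q' , eq = ∈-map⁻ (e ++_) q in ≤-trans (≤-reflexive (≡.trans (cong length eq) (length-++ e))) (+-mono-≤ l (opts-short c ps ls q'))
... | inj₂ q = let B , q' , eq = ∈-map⁻ (f ++_) q in ≤-trans (≤-reflexive (≡.trans (cong length eq) (length-++ f))) (+-mono-≤ l' (opts-short c ps ls q'))

diag⇒≢ : ∀ {n} (B : List (Edge n)) → (∀ i → mg B i i ≡ 0) → All (λ (u , v) → u ≢ v) B
diag⇒≢ []            h = []
diag⇒≢ ((u , v) ∷ B) h = ne ∷ diag⇒≢ B (λ i → m+n≡0⇒n≡0 (adψ i i u v) (h i))
  where
  ne : u ≢ v
  ne ≡.refl with ≡.trans (≡.sym (cong (λ t → t * t + t * t) (δ-refl u))) (m+n≡0⇒m≡0 (adψ u u u u) (h u))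
  ... | ()

≢⇒diag : ∀ {n} (B : List (Edge n)) → All (λ (u , v) → u ≢ v) B → ∀ i → mg B i i ≡ 0
≢⇒diag []            []       i = ≡.refl
≢⇒diag ((u , v) ∷ B) (p ∷ ps) i = cong₂ _+_ (cong₂ _+_ (one u v p) (one v u (p ∘ ≡.sym))) (≢⇒diag B ps i)
  where
  one : ∀ a b → a ≢ b → δ a i * δ b i ≡ 0
  one a b ne with a ≟ᶠ i
  ... | no _       = ≡.refl
  ... | yes ≡.refl = ≡.trans (*-identityˡ _) (δ-≢ (ne ∘ ≡.sym))

cls-unique : ∀ {n} (Q : List (List (Fin n))) → (∀ i → mg (cls Q) i i ≡ 0) → All Unique Q
cls-unique []      h = []
cls-unique (S ∷ Q) h = cl-unique S (λ i → m+n≡0⇒m≡0 (mg (cl S) i i) (h' i)) ∷ cls-unique Q (λ i → m+n≡0⇒n≡0 (mg (cl S) i i) (h' i))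
  where
  h' : ∀ i → mg (cl S) i i + mg (cls Q) i i ≡ 0
  h' i = ≡.trans (≡.sym (ev-++ (adψ i i) (cl S) (cls Q))) (h i)

module Families {n : ℕ} (H : Host n) (d : ℕ) (k≡ : Host.k H ≡ 2 + (d + d)) (κ c : ℕ) where
  open Executors H d k≡ using (Good; AbsOut)
  open Sequence H c using (flat)

  Abs : List (Edge n) → Set
  Abs B = ∃ (AbsOut κ B)

  -- The family holds both decompositions of an absorber; `Q₀` is used whenever the option does not
  -- occur.
  fam idle : ∀ {B} → Abs B → List (List (Fin n))
  fam (_ , inj₁ (_ , X)) = Exch.Q₁ X ++ Exch.Q₀ X
  fam (_ , inj₂ _)       = []
  idle (_ , inj₁ (_ , X)) = Exch.Q₀ X
  idle (_ , inj₂ _)       = []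

  active : ∀ {B} → Good κ B → Abs B → List (List (Fin n))
  active p (_ , inj₁ (_ , X)) = Exch.Q₁ X
  active p (_ , inj₂ _)       = []

  family idles : ∀ {Bs} → All Abs Bs → List (List (Fin n))
  family []       = []
  family (r ∷ rs) = fam r ++ family rs
  idles []       = []
  idles (r ∷ rs) = idle r ++ idles rs

  -- Indexed by the occurrence `p` and not by `B`: equal options have separate absorbers, and only
  -- the one at this occurrence becomes active.
  chosen : ∀ {B Bs} → B ∈ Bs → Good κ B → All Abs Bs → List (List (Fin n))
  chosen (here ≡.refl) g (r ∷ rs) = active g r ++ idles rs
  chosen (there p)     g (r ∷ rs) = idle r ++ chosen p g rs

  ev-idle : ∀ {B} (r : Abs B) ψ → Symmetric ψ → ev ψ (cls (idle r)) ≡ ev ψ (proj₁ r)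
  ev-idle (_ , inj₁ (_ , X))      ψ sy = ≡.sym (Exch.bwd X ψ sy)
  ev-idle (_ , inj₂ (_ , ≡.refl)) ψ sy = ≡.refl

  ev-active : ∀ {B} (g : Good κ B) (r : Abs B) ψ → Symmetric ψ → ev ψ (cls (active g r)) ≡ ev ψ B + ev ψ (proj₁ r)
  ev-active g (_ , inj₁ (_ , X))  ψ sy = ≡.sym (Exch.fwd X ψ sy)
  ev-active g (_ , inj₂ (¬g , _)) ψ sy = ⊥-elim (¬g g)

  ev-idles : ∀ {Bs} (rs : All Abs Bs) ψ → Symmetric ψ → ev ψ (cls (idles rs)) ≡ ev ψ (flat rs)
  ev-idles []       ψ sy = ≡.refl
  ev-idles (r ∷ rs) ψ sy = ≡.trans (ev-cls-++ ψ (idle r) (idles rs)) (≡.trans (cong₂ _+_ (ev-idle r ψ sy) (ev-idles rs ψ sy)) (≡.sym (ev-++ ψ (proj₁ r) (flat rs))))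

  ev-chosen : ∀ {B Bs} (p : B ∈ Bs) (g : Good κ B) (rs : All Abs Bs) ψ → Symmetric ψ → ev ψ (cls (chosen p g rs)) ≡ ev ψ B + ev ψ (flat rs)
  ev-chosen {B} (here ≡.refl) g (r ∷ rs) ψ sy = ≡.trans (ev-cls-++ ψ (active g r) (idles rs)) (≡.trans (cong₂ _+_ (ev-active g r ψ sy) (ev-idles rs ψ sy))
    (≡.trans (+-assoc (ev ψ B) (ev ψ (proj₁ r)) _) (cong (ev ψ B +_) (≡.sym (ev-++ ψ (proj₁ r) (flat rs))))))
  ev-chosen {B} (there p) g (r ∷ rs) ψ sy = ≡.trans (ev-cls-++ ψ (idle r) (chosen p g rs)) (≡.trans (cong₂ _+_ (ev-idle r ψ sy) (ev-chosen p g rs ψ sy))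
    (≡.trans (+-swap (ev ψ (proj₁ r)) (ev ψ B) _) (cong (ev ψ B +_) (≡.sym (ev-++ ψ (proj₁ r) (flat rs))))))

  -- `Q₁` covers the option and its absorber, `Q₀` the absorber once more. Evaluated at a pair of
  -- vertices, this is the source of the refinement bound.
  ev-family : ∀ {Bs} (rs : All Abs Bs) ψ → Symmetric ψ → ev ψ (cls (family rs)) ≤ Σl (ev ψ) Bs + 2 * ev ψ (flat rs)
  ev-family []       ψ sy = z≤n
  ev-family {B ∷ Bs} (r ∷ rs) ψ sy = ≤-trans (≤-reflexive (ev-cls-++ ψ (fam r) (family rs))) (≤-trans (+-mono-≤ (one r) (ev-family rs ψ sy))
      (≤-reflexive (≡.trans (a₁ (ev ψ B) (ev ψ (proj₁ r)) (Σl (ev ψ) Bs) (ev ψ (flat rs))) (cong (λ t → ev ψ B + Σl (ev ψ) Bs + 2 * t) (≡.sym (ev-++ ψ (proj₁ r) (flat rs)))))))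
    where
    a₁ : ∀ b e S f → b + 2 * e + (S + 2 * f) ≡ b + S + 2 * (e + f)
    a₁ = solve 4 (λ b e S f → b :+ con 2 :* e :+ (S :+ con 2 :* f) := b :+ S :+ con 2 :* (e :+ f)) ≡.refl
    a₂ : ∀ b e → b + e + e ≡ b + 2 * e
    a₂ = solve 2 (λ b e → b :+ e :+ e := b :+ con 2 :* e) ≡.refl
    one : ∀ (r : Abs B) → ev ψ (cls (fam r)) ≤ ev ψ B + 2 * ev ψ (proj₁ r)
    one (E , inj₁ (_ , X)) = ≤-reflexive (≡.trans (ev-cls-++ ψ (Exch.Q₁ X) (Exch.Q₀ X)) (≡.trans (cong₂ _+_ (≡.sym (Exch.fwd X ψ sy)) (≡.sym (Exch.bwd X ψ sy))) (a₂ (ev ψ B) (ev ψ E))))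
    one (_ , inj₂ _)       = z≤n

  family-size : ∀ {Bs} (rs : All Abs Bs) → All (λ S → length S ≡ 2 + d) (family rs)
  family-size []                            = []
  family-size ((_ , inj₁ (_ , X)) ∷ rs) = All-++⁺ (All-++⁺ (Exch.size₁ X) (Exch.size₀ X)) (family-size rs)
  family-size ((_ , inj₂ _) ∷ rs)       = family-size rs

  family-unique : ∀ {Bs} (rs : All Abs Bs) → (∀ i → mg (flat rs) i i ≡ 0) → All Unique (family rs)
  family-unique []       h = []
  family-unique (_∷_ {B} r rs) h = All-++⁺ (one r (λ i → m+n≡0⇒m≡0 (mg (proj₁ r) i i) (h' i))) (family-unique rs (λ i → m+n≡0⇒n≡0 (mg (proj₁ r) i i) (h' i)))
    where
    h' : ∀ i → mg (proj₁ r) i i + mg (flat rs) i i ≡ 0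
    h' i = ≡.trans (≡.sym (ev-++ (adψ i i) (proj₁ r) (flat rs))) (h i)
    one : ∀ (r : Abs B) → (∀ i → mg (proj₁ r) i i ≡ 0) → All Unique (fam r)
    one (E , inj₁ ((_ , ne , _) , X)) e = All-++⁺
      (cls-unique (Exch.Q₁ X) (λ i → ≡.trans (≡.sym (Exch.fwd X (adψ i i) (adψ-sym i i))) (cong₂ _+_ (≢⇒diag B ne i) (e i))))
      (cls-unique (Exch.Q₀ X) (λ i → ≡.trans (≡.sym (Exch.bwd X (adψ i i) (adψ-sym i i))) (e i)))
    one (E , inj₂ _) e = []

  private
    left : ∀ {Q R P : List (List (Fin n))} → All (_∈ Q) P → All (_∈ (Q ++ R)) P
    left []       = []
    left (p ∷ ps) = ∈-++⁺ˡ p ∷ left ps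

    right : ∀ Q {R P : List (List (Fin n))} → All (_∈ R) P → All (_∈ (Q ++ R)) P
    right Q []       = []
    right Q (p ∷ ps) = ∈-++⁺ʳ Q p ∷ right Q ps

    refl-∈ : ∀ (Q : List (List (Fin n))) → All (_∈ Q) Q
    refl-∈ Q = AllDec.tabulate id

    idle∈ : ∀ {B} (r : Abs B) → All (_∈ fam r) (idle r)
    idle∈ (_ , inj₁ (_ , X)) = right (Exch.Q₁ X) (refl-∈ (Exch.Q₀ X))
    idle∈ (_ , inj₂ _)       = []

    active∈ : ∀ {B} (g : Good κ B) (r : Abs B) → All (_∈ fam r) (active g r)
    active∈ g (_ , inj₁ (_ , X)) = left (refl-∈ (Exch.Q₁ X))
    active∈ g (_ , inj₂ _)       = []

    idles∈ : ∀ {Bs} (rs : All Abs Bs) → All (_∈ family rs) (idles rs)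
    idles∈ []       = []
    idles∈ (r ∷ rs) = All-++⁺ (left (idle∈ r)) (right (fam r) (idles∈ rs))

  chosen∈ : ∀ {B Bs} (p : B ∈ Bs) (g : Good κ B) (rs : All Abs Bs) → All (_∈ family rs) (chosen p g rs)
  chosen∈ (here ≡.refl) g (r ∷ rs) = All-++⁺ (left (active∈ g r)) (right (fam r) (idles∈ rs))
  chosen∈ (there p)     g (r ∷ rs) = All-++⁺ (left (idle∈ r)) (right (fam r) (chosen∈ p g rs))

  choices : ∀ {X : Set} (opt : X → List (List (Edge n))) (gs : List X) (pickB : ∀ g → List (Edge n)) →
    (∀ g → pickB g ∈ opt g) → All (λ g → Good κ (pickB g)) gs → All Abs (concatMap opt gs) → List (List (Fin n))
  choices opt []       pickB h []         rs = []
  choices opt (g ∷ gs) pickB h (ok ∷ oks) rs = chosen (h g) ok (proj₁ (splitA (opt g) rs)) ++ choices opt gs pickB h oks (proj₂ (splitA (opt g) rs))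

  private
    ev-flat : ∀ ψ Bs {Cs} (rs : All Abs (Bs ++ Cs)) → ev ψ (flat rs) ≡ ev ψ (flat (proj₁ (splitA Bs rs))) + ev ψ (flat (proj₂ (splitA Bs rs)))
    ev-flat ψ []       rs       = ≡.refl
    ev-flat ψ (B ∷ Bs) (r ∷ rs) = ≡.trans (ev-++ ψ (proj₁ r) (flat rs)) (≡.trans (cong (ev ψ (proj₁ r) +_) (ev-flat ψ Bs rs))
      (≡.trans (≡.sym (+-assoc (ev ψ (proj₁ r)) _ _)) (cong (_+ _) (≡.sym (ev-++ ψ (proj₁ r) (flat (proj₁ (splitA Bs rs))))))))

    family-split : ∀ Bs {Cs} (rs : All Abs (Bs ++ Cs)) → family rs ≡ family (proj₁ (splitA Bs rs)) ++ family (proj₂ (splitA Bs rs))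
    family-split []       rs       = ≡.refl
    family-split (B ∷ Bs) (r ∷ rs) = ≡.trans (cong (fam r ++_) (family-split Bs rs)) (≡.sym (++-assoc (fam r) (family (proj₁ (splitA Bs rs))) _))

  ev-choices : ∀ {X : Set} (opt : X → List (List (Edge n))) gs pickB h oks rs ψ → Symmetric ψ →
    ev ψ (cls (choices opt gs pickB h oks rs)) ≡ Σl (λ g → ev ψ (pickB g)) gs + ev ψ (flat rs)
  ev-choices opt []       pickB h []         [] ψ sy = ≡.refl
  ev-choices opt (g ∷ gs) pickB h (ok ∷ oks) rs ψ sy = ≡.trans (ev-cls-++ ψ (chosen (h g) ok r₁) (choices opt gs pickB h oks r₂))
      (≡.trans (cong₂ _+_ (ev-chosen (h g) ok r₁ ψ sy) (ev-choices opt gs pickB h oks r₂ ψ sy))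
      (≡.trans (+-interchange (ev ψ (pickB g)) (ev ψ (flat r₁)) _ _) (cong (ev ψ (pickB g) + Σl (λ g → ev ψ (pickB g)) gs +_) (≡.sym (ev-flat ψ (opt g) rs)))))
    where
    r₁ : All Abs (opt g)
    r₁ = proj₁ (splitA (opt g) rs)
    r₂ : All Abs (concatMap opt gs)
    r₂ = proj₂ (splitA (opt g) rs)

  choices∈ : ∀ {X : Set} (opt : X → List (List (Edge n))) gs pickB h oks rs → All (_∈ family rs) (choices opt gs pickB h oks rs)
  choices∈ opt []       pickB h []         rs = []
  choices∈ opt (g ∷ gs) pickB h (ok ∷ oks) rs = subst (λ F → All (_∈ F) (choices opt (g ∷ gs) pickB h (ok ∷ oks) rs)) (≡.sym (family-split (opt g) rs))
    (All-++⁺ (left (chosen∈ (h g) ok (proj₁ (splitA (opt g) rs)))) (right (family (proj₁ (splitA (opt g) rs))) (choices∈ opt gs pickB h oks (proj₂ (splitA (opt g) rs)))))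

-- Constants and assembly of the absorber

module Constants (d r : ℕ) where
  -- `m` unfolds to (2+d)(1+d) = q(q-1), a multiple of q-1 and twice (q choose 2); `kk` is 2q-2.
  kk m' m cA : ℕ
  kk = 2 + (d + d)
  m' = d + suc d * suc d
  m = suc m'
  cA = m * tokenCost′ d kk

  -- The factor of `D` in `degBound` for the total demand `l * D`, as shown by `degBound≤`.
  Kdeg : ℕ → ℕ → ℕ
  Kdeg c l = 4 * c + 8 * r * c * l + 2 * c * l

  -- An option consists of at most 8m pieces with at most `tri q + 1` edges each, which gives `κ`.
  -- `LB` bounds the degrees of all options together: an edge of `X` occurs in one state and a token
  -- edge in two, each in at most 2^(8m) options. `cB` and `AvB` unfold to `absC κ` and `absAv κ`.
  -- In `RC`, at most 2·2^(8m) cliques come from options through an edge and at most 2 from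
  -- absorbers.
  KA κ cB LB KB AvB K₂ RC : ℕ
  KA = Kdeg cA 313
  κ = 8 * m * suc (tri (2 + d))
  cB = kk + (κ * ((2 + d) * kk) + (κ * (kk + kk) + (half + half)))
    where
    swapC half : ℕ
    swapC = suc d * (d * kk)
    half = κ * (d * kk + (swapC + swapC)) + 2 * κ * swapC
  LB = 2 ^ (8 * m) * (1 + 2 * KA)
  KB = Kdeg cB LB
  AvB = (suc d * d + (2 + suc d)) + ((1 + (κ * (2 + d) + 4 * κ)) + (d + 4))
  K₂ = 2 * (r * (kk * (1 + KA + KB) + (1 + AvB)))
  RC = 2 + 2 ^ (8 * m) * 2

  degBound≤ : ∀ c l D → 0 < D → degBound r c (l * D) ≤ Kdeg c l * D
  degBound≤ c l D D>0 = ≤-trans (≤-reflexive (a₁ r c l D)) (≤-trans (+-monoˡ-≤ _ (≤-trans (≤-reflexive (≡.sym (*-identityʳ (4 * c)))) (*-monoʳ-≤ (4 * c) D>0))) (≤-reflexive (a₂ r c l D)))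
    where
    a₁ : ∀ r c l D → 2 * c + (8 * r * c * (l * D) + 2 * c + 2 * c * (l * D)) ≡ 4 * c + (8 * r * c * l * D + 2 * c * l * D)
    a₁ = solve 4 (λ r c l D → con 2 :* c :+ (con 8 :* r :* c :* (l :* D) :+ con 2 :* c :+ con 2 :* c :* (l :* D)) := con 4 :* c :+ (con 8 :* r :* c :* l :* D :+ con 2 :* c :* l :* D)) ≡.refl
    a₂ : ∀ r c l D → 4 * c * D + (8 * r * c * l * D + 2 * c * l * D) ≡ (4 * c + 8 * r * c * l + 2 * c * l) * D
    a₂ = solve 4 (λ r c l D → con 4 :* c :* D :+ (con 8 :* r :* c :* l :* D :+ con 2 :* c :* l :* D) := (con 4 :* c :+ con 8 :* r :* c :* l :+ con 2 :* c :* l) :* D) ≡.refl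

module Core (d r n' k : ℕ) (d>0 : 0 < d) (r>0 : 0 < r) (G X : Graph (suc n')) (X⊆G : adj X ⊆ᵍ adj G)
            (codeg : ∀ v → (2 + (d + d)) * r * ΣF (λ w → 1 ∸ b2n (adj G w v)) + (2 + (d + d)) * suc n' ≤ r * suc n')
            (le : suc n' ≤ suc k * suc k) (le₄ : suc k * suc k ≤ 4 * suc n') (D : ℕ) (s≤D : suc k ≤ D)
            (degX≤D : ∀ x → deg (adj X) x ≤ D) (room : Constants.K₂ d r * D < suc n') where
  open Constants d r
  open EdgeList {suc n'}

  n : ℕ
  n = suc n'

  Cfg : Set
  Cfg = Σ[ L ∈ Graph n ] (adj L ⊆ᵍ adj X × Divisible (2 + d) (adj L))

  XE : List (Edge n)
  XE = edgeList (adj X)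

  value : Edge n → Cfg → ℕ
  value (u , v) (L , _) = b2n (adj L u v)

  degX : ∀ x → degL XE x ≤ D
  degX x = ≤-trans (≤-reflexive (degL-edgeList X x)) (degX≤D x)

  m≡₂ : m ≡ 2 * tri (2 + d)
  m≡₂ = double-tri d

  open Layout n' k using (I; π; ι; π∘ι; fibre)
  open Rows n' k Cfg (suc d) (tri (2 + d)) m' (2 + d) 2 ≡.refl m≡₂ le D s≤D XE value degX using (D>0; rows; wires-sum; wires-All; cost-bound)
  open GridCircuit k Cfg (suc d) (tri (2 + d)) m' (2 + d) 2 ≡.refl m≡₂ hiding (s)
  open Realize n d I Cfg π m' (2 + d) 2 ≡.refl m≡₂ using (RW; Re; Gadget; cons; fullW; evRe; fullPc; closed)

  -- Regrouped by vertices, the sum is that of deg L times the weight, and each degree is a multiple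
  -- of q-1.
  bal₁ : ∀ z φ → Cong (suc d) (Φ φ (rowsWires rows) z) 0
  bal₁ z@(L , L⊆X , (_ , dv)) φ = multiple⇒cong0 (ΣF (λ x → c x * φ' x) , (begin
      Φ φ (rowsWires rows) z                                  ≡⟨ wires-sum (λ w → Wire.val w z * (φ (Wire.a w) + φ (Wire.b w))) ⟩
      partSum (adj X) (adj L) (λ u v → φ' u + φ' v)           ≡⟨ Σl-cong (λ (u , v) → ≡.trans (cong (b2n (adj L u v) *_) (expand u v)) (≡.trans (≡.sym (Σl-* (b2n (adj L u v)) (λ x → incψ x u v * φ' x) (allFin n)))
                                                                     (ΣF-cong (λ x → ≡.sym (*-assoc (b2n (adj L u v)) (incψ x u v) (φ' x)))))) XE ⟩
      Σl (λ (u , v) → ΣF (λ x → b2n (adj L u v) * incψ x u v * φ' x)) XE ≡⟨ ≡.sym (Σl-swap (λ x (u , v) → b2n (adj L u v) * incψ x u v * φ' x) (allFin n) XE) ⟩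
      ΣF (λ x → Σl (λ (u , v) → b2n (adj L u v) * incψ x u v * φ' x) XE) ≡⟨ ΣF-cong (λ x → ≡.trans (Σl-*ʳ (φ' x) (λ (u , v) → b2n (adj L u v) * incψ x u v) XE) (cong (_* φ' x) (part-deg (adj X) L L⊆X x))) ⟩
      ΣF (λ x → deg (adj L) x * φ' x)                          ≡⟨ ΣF-cong (λ x → ≡.trans (cong (_* φ' x) (_∣_.equality (dv x))) (a₁ (c x) (suc d) (φ' x))) ⟩
      ΣF (λ x → c x * φ' x * suc d)                            ≡⟨ Σl-*ʳ (suc d) (λ x → c x * φ' x) (allFin n) ⟩
      ΣF (λ x → c x * φ' x) * suc d ∎))
    where
    open ≡.≡-Reasoning
    φ' : Fin n → ℕ
    φ' u = φ (ι le u)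
    c : Fin n → ℕ
    c x = _∣_.quotient (dv x)
    expand : ∀ u v → φ' u + φ' v ≡ ΣF (λ x → incψ x u v * φ' x)
    expand u v = ≡.sym (≡.trans (ΣF-cong (λ x → *-distribʳ-+ (φ' x) (δ u x) (δ v x))) (≡.trans (ΣF-+ (λ x → δ u x * φ' x) (λ x → δ v x * φ' x)) (cong₂ _+_ (ΣF-δ* u φ') (ΣF-δ* v φ'))))
    a₁ : ∀ c d f → c * d * f ≡ c * f * d
    a₁ = solve 3 (λ c d f → c :* d :* f := c :* f :* d) ≡.refl

  bal₂ : ∀ z → Cong (tri (2 + d)) (N (rowsWires rows) z) 0
  bal₂ z@(L , L⊆X , (de , _)) = multiple⇒cong0 (_∣_.quotient de , ≡.trans (wires-sum (λ w → Wire.val w z)) (≡.trans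
    (≡.trans (Σl-cong (λ (u , v) → ≡.sym (*-identityʳ (b2n (adj L u v)))) XE) (part-edges (adj X) L L⊆X)) (≡.trans (_∣_.equality de) (cong (_∣_.quotient de *_) (≡.sym (tri≡C (2 + d)))))))

  opaque
    derivation : DerC (rowsWires rows) [] (schemeCost rows)
    derivation = circuit rows bal₁ bal₂

  o : List (I × I)
  o = proj₁ derivation

  ground : Ground n
  ground = record { g = λ i j → b2n (adj G i j) ; gsym = λ i j → cong b2n (Graph.sym G i j) ; girr = λ i → cong b2n (irr G i)
    ; k = kk ; r = r ; k>0 = s≤s z≤n ; r>0 = r>0 ; codeg = codeg }

  demand : I × I → Fin n → ℕ
  demand (x , y) v = incψ v (π x) (π y)

  -- `cost-bound` for the indicator of the positions over `v`, of which there are at most four: 313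
  -- = 78·4 + 1.
  load : ∀ v → Σl (λ e → demand e v) o ≤ 313 * D
  load v = ≤-trans (proj₂ (proj₂ derivation) φ) (≤-trans (cost-bound φ) (≤-trans (+-mono-≤ (*-monoʳ-≤ 78 (*-monoʳ-≤ D (fibre v le₄))) (≤-trans (≤-reflexive
      (Σl-cong (λ (u , w) → cong₂ (λ a b → δ a v + δ b v) (π∘ι le u) (π∘ι le w)) XE)) (degX v))) (≤-reflexive a₁)))
    where
    φ : I → ℕ
    φ x = δ (π x) v
    a₁ : 78 * (D * 4) + D ≡ 313 * D
    a₁ = ≡.trans (cong (_+ D) (≡.trans (cong (78 *_) (*-comm D 4)) (≡.sym (*-assoc 78 4 D)))) (+-comm (312 * D) D)

  ΛA ΛB : ℕ
  ΛA = 313 * D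
  ΛB = LB * D

  cA>0 : 0 < cA
  cA>0 = s≤s z≤n

  ΛA>0 : 0 < ΛA
  ΛA>0 = *-mono-≤ {1} {313} (s≤s z≤n) D>0

  roomA : 2 * (r * (kk * (D + degBound r cA ΛA) + 1)) < n
  roomA = ≤-trans (s≤s (≤-trans (*-monoʳ-≤ 2 (*-monoʳ-≤ r (+-mono-≤ (*-monoʳ-≤ kk (+-monoʳ-≤ D (degBound≤ cA 313 D D>0))) D>0)))
      (≤-trans (≤-reflexive (a₁ r kk D KA)) (*-monoˡ-≤ D (*-monoʳ-≤ 2 (*-monoʳ-≤ r (+-mono-≤ (*-monoʳ-≤ kk (m≤m+n (1 + KA) KB)) (m≤m+n 1 AvB)))))))) room
    where
    a₁ : ∀ r k D A → 2 * (r * (k * (D + A * D) + D)) ≡ 2 * (r * (k * (1 + A) + 1)) * D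
    a₁ = solve 4 (λ r k D A → con 2 :* (r :* (k :* (D :+ A :* D) :+ D)) := con 2 :* (r :* (k :* (con 1 :+ A) :+ con 1)) :* D) ≡.refl

  degBX : ∀ v → ΣF (λ w → b2n (adj X w v)) ≤ D
  degBX v = ≤-trans (≤-reflexive (≡.trans (ΣF-cong (λ w → cong b2n (Graph.sym X w v))) (Σl≡sum (λ w → b2n (adj X v w)) (allFin n)))) (degX≤D v)

  HA : Host n
  HA = mkHost ground (λ i j → b2n (adj X i j)) (λ i j → cong b2n (Graph.sym X i j)) D degBX cA ΛA 1 cA>0 ΛA>0 roomA

  legalX : Greedy.Legal HA []
  legalX i j = go (adj X i j) (adj G i j) (X⊆G i j)
    where
    go : ∀ a b → (T a → T b) → b2n a ≤ b2n b
    go false b     h = z≤n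
    go true  true  h = ≤-refl
    go true  false h = ⊥-elim (h tt)

  flatA : ∀ {o} → All Re o → List (Edge n)
  flatA = Sequence.flat HA cA {I × I} {λ (x , y) → Tokens n d (π x) (π y) m}

  Tokened : Set
  Tokened = Σ[ Es ∈ All Re o ] (Greedy.Legal HA (flatA Es) × (∀ v → degL (flatA Es) v ≤ KA * D))

  opaque
    tokened : Tokened
    tokened = finish (greedyRun ground (λ i j → b2n (adj X i j)) (λ i j → cong b2n (Graph.sym X i j)) D degBX cA ΛA 1 cA>0 ΛA>0 roomA
        demand (λ (x , y) → Tokens n d (π x) (π y) m) (λ U l dg e (x , y) → Executors.tokenExec HA d ≡.refl m ≤-refl U l dg e (π x , π y)) legalX o load)
      where
      finish : Σ[ Es ∈ All Re o ] (Greedy.Legal HA (flatA Es) × (∀ v → degL (flatA Es) v ≤ degBound r cA ΛA)) → Tokened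
      finish (Es , l , dg) = Es , l , λ v → ≤-trans (dg v) (degBound≤ cA 313 D D>0)

  RL : List (Edge n)
  RL = flatA (proj₁ tokened)

  legalR : ∀ i j → mg RL i j + b2n (adj X i j) ≤ b2n (adj G i j)
  legalR = proj₁ (proj₂ tokened)

  degR : ∀ v → degL RL v ≤ KA * D
  degR = proj₂ (proj₂ tokened)

  ev-RL : ∀ ψ → sumA {P = Re} (λ {p} → evRe ψ {p}) (proj₁ tokened) ≡ ev ψ RL
  ev-RL ψ = go (proj₁ tokened)
    where
    go : ∀ {o} (Es : All Re o) → sumA {P = Re} (λ {p} → evRe ψ {p}) Es ≡ ev ψ (flatA Es)
    go []              = ≡.refl
    go ((E , _) ∷ Es) = ≡.trans (cong (ev ψ E +_) (go Es)) (≡.sym (ev-++ ψ E (flatA Es)))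

  Plain : Wire → Set
  Plain w = Σ[ t ∈ RW w ] ((∀ z ψ → cons ψ z t ≡ Wire.val w z * ψ (π (Wire.a w)) (π (Wire.b w))) × (∀ ψ → fullW ψ t ≡ ψ (π (Wire.a w)) (π (Wire.b w))))

  -- A value of at most 1 is unchanged modulo `m`, so one port suffices, which consumes either
  -- nothing or the edge itself.
  plain : ∀ w → (∀ z → Wire.val w z ≤ 1) → Plain w
  plain w small = record { ps = [ p ] ; fits = λ z → ≤-trans (≤-reflexive (mod1 z)) (small z) ; few = s≤s z≤n } , (λ z ψ → ≡.trans (cong (λ c → ev ψ (on [ p ] c)) (mod1 z)) (state ψ (Wire.val w z) (small z))) ,
      λ ψ → ≡.trans (+-identityʳ _) (+-identityʳ _)
    where
    u v : Fin n
    u = π (Wire.a w)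
    v = π (Wire.b w)
    p : Port n d u v
    p = record { e₀ = [] ; e₁ = [ (u , v) ] ; deg₀ = λ _ → 0 , ≡.refl ; len₀ = 0 , ≡.refl ; deg₁ = λ x → +-identityʳ _ ; len₁ = ≡.refl ; small = z≤n }
    1<m : 1 < m
    1<m = s≤s (≤-trans (s≤s z≤n) (m≤n+m (suc d * suc d) d))
    mod1 : ∀ z → Wire.val w z % m ≡ Wire.val w z
    mod1 z = m<n⇒m%n≡m (≤-trans (s≤s (small z)) 1<m)
    state : ∀ ψ c → c ≤ 1 → ev ψ (on [ p ] c) ≡ c * ψ u v
    state ψ zero       _ = ≡.refl
    state ψ (suc zero) _ = ≡.refl
    state ψ (suc (suc _)) (s≤s ())

  opaque
   plains : All Plain (rowsWires rows)
   plains = wires-All Plain (λ {e} _ g h → plain (W (g , proj₂ (ι le (proj₁ e))) (h , proj₂ (ι le (proj₂ e))) (value e)) (λ (L , _) → b2n≤1 (adj L (proj₁ e) (proj₂ e))))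

  strip : ∀ {A} → All Plain A → All RW A
  strip []             = []
  strip ((t , _) ∷ ts) = t ∷ strip ts

  strip-cons : ∀ {A} (ts : All Plain A) z ψ → sumA {P = RW} (λ {w} → cons ψ z {w}) (strip ts) ≡ Σl (λ w → Wire.val w z * ψ (π (Wire.a w)) (π (Wire.b w))) A
  strip-cons []                 z ψ = ≡.refl
  strip-cons ((t , e , _) ∷ ts) z ψ = cong₂ _+_ (e z ψ) (strip-cons ts z ψ)

  strip-full : ∀ {A} (ts : All Plain A) ψ → sumA {P = RW} (λ {w} → fullW ψ {w}) (strip ts) ≡ Σl (λ w → ψ (π (Wire.a w)) (π (Wire.b w))) A
  strip-full []                 ψ = ≡.refl
  strip-full ((t , _ , e) ∷ ts) ψ = cong₂ _+_ (e ψ) (strip-full ts ψ)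

  ins-cons : ∀ z ψ → sumA {P = RW} (λ {w} → cons ψ z {w}) (strip plains) ≡ partSum (adj X) (adj (proj₁ z)) ψ
  ins-cons z ψ = ≡.trans (strip-cons plains z ψ) (≡.trans (wires-sum (λ w → Wire.val w z * ψ (π (Wire.a w)) (π (Wire.b w))))
    (Σl-cong (λ (u , v) → cong₂ (λ a b → b2n (adj (proj₁ z) u v) * ψ a b) (π∘ι le u) (π∘ι le v)) XE))

  ins-full : ∀ ψ → sumA {P = RW} (λ {w} → fullW ψ {w}) (strip plains) ≡ ev ψ XE
  ins-full ψ = ≡.trans (strip-full plains ψ) (≡.trans (wires-sum (λ w → ψ (π (Wire.a w)) (π (Wire.b w)))) (Σl-cong (λ (u , v) → cong₂ ψ (π∘ι le u) (π∘ι le v)) XE))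

  Flow Full : List Gadget → Set
  Flow gs = ∀ z ψ → Symmetric ψ → Σl (λ t → ev ψ (Gadget.ch t z)) gs ≡ partSum (adj X) (adj (proj₁ z)) ψ + ev ψ RL
  Full gs = ∀ ψ → Symmetric ψ → Σl (λ t → fullPc ψ (Gadget.pcs t)) gs ≡ ev ψ XE + 2 * ev ψ RL

  Refiner : Set
  Refiner = Σ[ gs ∈ List Gadget ] (Flow gs × Full gs)

  opaque
    refiner : Refiner
    refiner = finish (closed (proj₁ (proj₂ derivation)) (strip plains) (proj₁ tokened))
      where
      finish : Σ[ gs ∈ List Gadget ]
        ((∀ z ψ → Symmetric ψ → Σl (λ t → ev ψ (Gadget.ch t z)) gs ≡ sumA {P = RW} (λ {w} → cons ψ z {w}) (strip plains) + sumA {P = Re} (λ {p} → evRe ψ {p}) (proj₁ tokened)) ×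
         (∀ ψ → Symmetric ψ → Σl (λ t → fullPc ψ (Gadget.pcs t)) gs ≡ sumA {P = RW} (λ {w} → fullW ψ {w}) (strip plains) + 2 * sumA {P = Re} (λ {p} → evRe ψ {p}) (proj₁ tokened))) → Refiner
      finish (gs , fl , fu) = gs , (λ z ψ sy → ≡.trans (fl z ψ sy) (cong₂ _+_ (ins-cons z ψ) (ev-RL ψ))) , (λ ψ sy → ≡.trans (fu ψ sy) (cong₂ _+_ (ins-full ψ) (cong (2 *_) (ev-RL ψ))))

  gs : List Gadget
  gs = proj₁ refiner

  flow : Flow gs
  flow = proj₁ (proj₂ refiner)

  full : Full gs
  full = proj₂ (proj₂ refiner)

  options : Gadget → List (List (Edge n))
  options t = opts (Gadget.pcs t)

  requests : List (List (Edge n))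
  requests = concatMap options gs

  opts-total : ∀ ψ → Symmetric ψ → Σl (ev ψ) requests ≤ 2 ^ (8 * m) * (ev ψ XE + 2 * ev ψ RL)
  opts-total ψ sy = ≤-trans (≤-reflexive (Σl-concatMap (ev ψ) options gs)) (≤-trans (Σl-mono (λ t → ≤-trans (opts-sum ψ (Gadget.pcs t)) (*-monoˡ-≤ (fullPc ψ (Gadget.pcs t)) (^-monoʳ-≤ 2 (Gadget.lenP t)))) gs)
    (≤-reflexive (≡.trans (Σl-* (2 ^ (8 * m)) (λ t → fullPc ψ (Gadget.pcs t)) gs) (cong (2 ^ (8 * m) *_) (full ψ sy)))))

  load-B : ∀ v → Σl (λ B → degL B v) requests ≤ ΛB
  load-B v = ≤-trans (opts-total (incψ v) (incψ-sym v)) (≤-trans (*-monoʳ-≤ (2 ^ (8 * m)) (+-mono-≤ (degX v) (*-monoʳ-≤ 2 (degR v)))) (≤-reflexive (a₁ (2 ^ (8 * m)) D KA)))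
    where
    a₁ : ∀ c D A → c * (D + 2 * (A * D)) ≡ c * (1 + 2 * A) * D
    a₁ = solve 3 (λ c D A → c :* (D :+ con 2 :* (A :* D)) := c :* (con 1 :+ con 2 :* A) :* D) ≡.refl

  ΛB>0 : 0 < ΛB
  ΛB>0 = *-mono-≤ {1} {LB} (*-mono-≤ {1} {2 ^ (8 * m)} (m^n>0 2 (8 * m)) (s≤s z≤n)) D>0

  -- In the second embedding the tokens of the first are barred like `X`. Tokens come first because
  -- the graphs to be absorbed are made of them.
  baseB : Fin n → Fin n → ℕ
  baseB i j = b2n (adj X i j) + mg RL i j

  degBB : ∀ v → ΣF (λ w → baseB w v) ≤ D + KA * D
  degBB v = ≤-trans (≤-reflexive (ΣF-+ (λ w → b2n (adj X w v)) (λ w → mg RL w v))) (+-mono-≤ (degBX v) (≤-trans (≤-reflexive (ΣF-mg′ RL v)) (degR v)))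

  roomB : 2 * (r * (kk * (D + KA * D + degBound r cB ΛB) + AvB)) < n
  roomB = ≤-trans (s≤s (≤-trans (*-monoʳ-≤ 2 (*-monoʳ-≤ r (+-mono-≤ (*-monoʳ-≤ kk (+-monoʳ-≤ (D + KA * D) (degBound≤ cB LB D D>0))) (m≤m*n AvB D ⦃ >-nonZero D>0 ⦄))))
      (≤-trans (≤-reflexive (a₁ r kk D KA KB AvB)) (*-monoˡ-≤ D (*-monoʳ-≤ 2 (*-monoʳ-≤ r (+-monoʳ-≤ (kk * (1 + KA + KB)) (n≤1+n AvB)))))))) room
    where
    a₁ : ∀ r k D A B v → 2 * (r * (k * (D + A * D + B * D) + v * D)) ≡ 2 * (r * (k * (1 + A + B) + v)) * D
    a₁ = solve 6 (λ r k D A B v → con 2 :* (r :* (k :* (D :+ A :* D :+ B :* D) :+ v :* D)) := con 2 :* (r :* (k :* (con 1 :+ A :+ B) :+ v)) :* D) ≡.refl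

  cB>0 : 0 < cB
  cB>0 = s≤s z≤n

  bsymB : ∀ i j → baseB i j ≡ baseB j i
  bsymB i j = cong₂ _+_ (cong b2n (Graph.sym X i j)) (mg-sym RL i j)

  HB : Host n
  HB = mkHost ground baseB bsymB (D + KA * D) degBB cB ΛB AvB cB>0 ΛB>0 roomB

  open Families HB d ≡.refl κ cB
  open Executors HB d ≡.refl using (Good; AbsOut; absorbExec)

  flatB : ∀ {Bs} → All Abs Bs → List (Edge n)
  flatB = Sequence.flat HB cB {List (Edge n)} {AbsOut κ}

  Absorbed : Set
  Absorbed = Σ[ Es ∈ All Abs requests ] (Greedy.Legal HB (flatB Es) × (∀ v → degL (flatB Es) v ≤ KB * D))

  opaque
    absorbed : Absorbed
    absorbed = finish (greedyRun ground baseB bsymB (D + KA * D) degBB cB ΛB AvB cB>0 ΛB>0 roomB degL (AbsOut κ) (absorbExec κ d>0 ≤-refl)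
        (λ i j → ≤-trans (≤-reflexive (+-comm (b2n (adj X i j)) (mg RL i j))) (legalR i j)) requests load-B)
      where
      finish : Σ[ Es ∈ All Abs requests ] (Greedy.Legal HB (flatB Es) × (∀ v → degL (flatB Es) v ≤ degBound r cB ΛB)) → Absorbed
      finish (Es , l , dg) = Es , l , λ v → ≤-trans (dg v) (degBound≤ cB LB D D>0)

  UB : List (Edge n)
  UB = flatB (proj₁ absorbed)

  legalB : ∀ i j → mg UB i j + (b2n (adj X i j) + mg RL i j) ≤ b2n (adj G i j)
  legalB = proj₁ (proj₂ absorbed)

  degUB : ∀ v → degL UB v ≤ KB * D
  degUB = proj₂ (proj₂ absorbed)

  used : Fin n → Fin n → ℕ
  used i j = mg UB i j + mg RL i j

  used+X≤G : ∀ i j → used i j + b2n (adj X i j) ≤ b2n (adj G i j)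
  used+X≤G i j = ≤-trans (≤-reflexive (lem (mg UB i j) (mg RL i j) (b2n (adj X i j)))) (legalB i j)
    where
    lem : ∀ u r x → u + r + x ≡ u + (x + r)
    lem = solve 3 (λ u r x → u :+ r :+ x := u :+ (x :+ r)) ≡.refl

  used≤G : ∀ i j → used i j ≤ b2n (adj G i j)
  used≤G i j = ≤-trans (m≤m+n _ _) (used+X≤G i j)

  used≤1 : ∀ i j → used i j ≤ 1
  used≤1 i j = ≤-trans (used≤G i j) (b2n≤1 (adj G i j))

  used-diag : ∀ i → used i i ≡ 0
  used-diag i = n≤0⇒n≡0 (≤-trans (used≤G i i) (≤-reflexive (cong b2n (irr G i))))

  A : Graph n
  A = record { adj = λ i j → isPos (used i j) ; sym = λ i j → cong isPos (cong₂ _+_ (mg-sym UB i j) (mg-sym RL i j)) ; irr = λ i → cong isPos (used-diag i) }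

  cliques : List (List (Fin n))
  cliques = family (proj₁ absorbed)

  cliques-unique : All Unique cliques
  cliques-unique = family-unique (proj₁ absorbed) (λ i → m+n≡0⇒m≡0 (mg UB i i) (used-diag i))

  F : List (Subset n)
  F = map toSubset cliques

  areKq : ∀ {Q : List (List (Fin n))} → All (λ S → length S ≡ 2 + d) Q → All Unique Q → All (IsKq (2 + d)) (map toSubset Q)
  areKq []       []       = []
  areKq {S ∷ _} (e ∷ es) (u ∷ us) = ≡.trans (size-toSubset S u) e ∷ areKq es us

  goods : ∀ z → All (λ t → Good κ (Gadget.ch t z)) gs
  goods z = AllDec.tabulate good
    where
    good : ∀ {t} → t ∈ gs → Good κ (Gadget.ch t z)
    good {t} t∈ = ((λ x → divides (proj₁ (Gadget.chDeg t z x)) (proj₂ (Gadget.chDeg t z x))) , divides (proj₁ (Gadget.chLen t z)) (proj₂ (Gadget.chLen t z))) ,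
        -- An option has no loops: its diagonal is bounded by `full`, which consists of edges of `X`
        -- and of tokens.
        diag⇒≢ (Gadget.ch t z) (λ i → n≤0⇒n≡0 (≤-trans (opts-≤ (adψ i i) (Gadget.pcs t) (Gadget.ch∈ t z)) (≤-trans (Σl-∈ (λ t → fullPc (adψ i i) (Gadget.pcs t)) t∈)
          (≤-reflexive (≡.trans (full (adψ i i) (adψ-sym i i)) (cong₂ (λ a b → a + 2 * b) (≡.trans (mg-edgeList X i i) (cong b2n (irr X i))) (m+n≡0⇒n≡0 (mg UB i i) (used-diag i)))))))) ,
        ≤-trans (opts-short (suc (tri (2 + d))) (Gadget.pcs t) (Gadget.smallP t) (Gadget.ch∈ t z)) (*-monoˡ-≤ (suc (tri (2 + d))) (Gadget.lenP t))

  module Decomposition (z : Cfg) where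
    L : Graph n
    L = proj₁ z

    Q : List (List (Fin n))
    Q = choices options gs (λ t → Gadget.ch t z) (λ t → Gadget.ch∈ t z) (goods z) (proj₁ absorbed)

    Q⊆ : All (_∈ cliques) Q
    Q⊆ = choices∈ options gs (λ t → Gadget.ch t z) (λ t → Gadget.ch∈ t z) (goods z) (proj₁ absorbed)

    -- By `flow` the choices of all gadgets use `L` and the tokens exactly once, and each absorber
    -- is used exactly once, active or idle. Together this is `L` and all of `A`.
    mg-Q : ∀ i j → mg (cls Q) i j ≡ b2n (adj L i j) + used i j
    mg-Q i j = ≡.trans (ev-choices options gs (λ t → Gadget.ch t z) (λ t → Gadget.ch∈ t z) (goods z) (proj₁ absorbed) (adψ i j) (adψ-sym i j))
      (≡.trans (cong (_+ mg UB i j) (≡.trans (flow z (adψ i j) (adψ-sym i j)) (cong (_+ mg RL i j) (part-adj (adj X) L (proj₁ (proj₂ z)) i j)))) (lem (b2n (adj L i j)) (mg RL i j) (mg UB i j)))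
      where
      lem : ∀ l r u → l + r + u ≡ l + (u + r)
      lem = solve 3 (λ l r u → l :+ r :+ u := l :+ (u :+ r)) ≡.refl

    unique : All Unique Q
    unique = AllDec.map (AllDec.lookup cliques-unique) Q⊆

    sizes : All (λ S → length S ≡ 2 + d) Q
    sizes = AllDec.map (AllDec.lookup (family-size (proj₁ absorbed))) Q⊆

    pos⇒T : ∀ u l → 1 ≤ b2n l + u → T (isPos u ∨ l)
    pos⇒T (suc _) _    p = tt
    pos⇒T zero    true p = tt

    T⇒pos : ∀ u l → T (isPos u ∨ l) → 1 ≤ b2n l + u
    T⇒pos (suc u) l    p = ≤-trans (s≤s z≤n) (m≤n+m (suc u) (b2n l))
    T⇒pos zero    true p = s≤s z≤n

    at-most : ∀ i j → b2n (adj L i j) + used i j ≤ 1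
    at-most i j = ≤-trans (≤-trans (+-monoˡ-≤ (used i j) (below (adj L i j) (adj X i j) (proj₁ (proj₂ z) i j))) (≤-trans (≤-reflexive (+-comm _ (used i j))) (used+X≤G i j))) (b2n≤1 (adj G i j))
      where
      below : ∀ a b → (T a → T b) → b2n a ≤ b2n b
      below false b     h = z≤n
      below true  true  h = ≤-refl
      below true  false h = ⊥-elim (h tt)

    inside : ∀ S → S ∈ map toSubset Q → ∀ i j → i ≢ j → T (Vec.lookup S i) → T (Vec.lookup S j) → T (isPos (used i j) ∨ adj L i j)
    inside S S∈ i j ne ti tj = go (∈-map⁻ toSubset S∈)
      where
      go : ∃[ S₀ ] (S₀ ∈ Q × S ≡ toSubset S₀) → T (isPos (used i j) ∨ adj L i j)
      go (S₀ , S₀∈ , ≡.refl) = pos⇒T (used i j) (adj L i j) (≤-trans (*-mono-≤ (isPos⇒ (subst T (lookup-toSubset S₀ i) ti)) (isPos⇒ (subst T (lookup-toSubset S₀ j) tj)))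
        (≤-trans (≤-reflexive (≡.sym (mg-cl ne S₀))) (≤-trans (Σl-∈ (λ S → mg (cl S) i j) S₀∈) (≤-reflexive (≡.trans (≡.sym (Σl-concatMap (uncurry (adψ i j)) cl Q)) (mg-Q i j))))))

    covers : ∀ i j → T (isPos (used i j) ∨ adj L i j) → cover (map toSubset Q) i j ≡ 1
    covers i j t = ≡.trans (cover-cls ne Q unique) (≡.trans (mg-Q i j) (≤-antisym (at-most i j) (T⇒pos (used i j) (adj L i j) t)))
      where
      ne : i ≢ j
      ne ≡.refl = subst T (cong₂ _∨_ (cong isPos (used-diag i)) (irr L i)) t

    decomposition : All (_∈ F) (map toSubset Q) × IsDecomp (2 + d) (adj A ∪ᵃ adj L) (map toSubset Q)
    decomposition = members Q⊆ , areKq sizes unique , inside , covers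
      where
      members : ∀ {P} → All (_∈ cliques) P → All (_∈ F) (map toSubset P)
      members []       = []
      members (p ∷ ps) = ∈-map⁺ toSubset p ∷ members ps

  A⊆G : adj A ⊆ᵍ adj G
  A⊆G i j t = b2n⇒T (≤-trans (isPos⇒ t) (used≤G i j))

  disjoint : EdgeDisjoint (adj X) (adj A)
  disjoint i j x a = <⇒≱ (s≤s (s≤s z≤n)) (≤-trans (+-mono-≤ (isPos⇒ a) (≤-reflexive (≡.sym (T⇒b2n x)))) (≤-trans (used+X≤G i j) (b2n≤1 (adj G i j))))

  omni : OmniAbsorber (2 + d) (adj X) (adj A) F
  omni = disjoint , areKq (family-size (proj₁ absorbed)) cliques-unique , λ L L⊆X dv → map toSubset (Decomposition.Q (L , L⊆X , dv)) , Decomposition.decomposition (L , L⊆X , dv)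

  refined : Refined RC (adj X) (adj A) F
  refined i j t = ≤-trans (≤-reflexive (cover-cls ne cliques cliques-unique)) (≤-trans (ev-family (proj₁ absorbed) (adψ i j) (adψ-sym i j)) (≤-trans (+-mono-≤ (≤-trans (opts-total (adψ i j) (adψ-sym i j))
      (*-monoʳ-≤ (2 ^ (8 * m)) two)) (*-monoʳ-≤ 2 (≤-trans (m≤m+n (mg UB i j) (mg RL i j)) (used≤1 i j)))) (≤-reflexive (+-comm (2 ^ (8 * m) * 2) 2))))
    where
    ne : i ≢ j
    ne ≡.refl = subst T (cong₂ _∨_ (irr X i) (cong isPos (used-diag i))) t
    two : mg XE i j + 2 * mg RL i j ≤ 2
    two = ≤-trans (+-monoˡ-≤ (2 * mg RL i j) (≤-trans (≤-reflexive (mg-edgeList X i j)) (m≤m+n _ (b2n (adj X i j) + 0)))) (≤-trans (≤-reflexive (≡.trans (≡.sym (*-distribˡ-+ 2 (b2n (adj X i j)) (mg RL i j))) (cong (2 *_) (+-comm (b2n (adj X i j)) (mg RL i j)))))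
      (*-monoʳ-≤ 2 (≤-trans (legalR i j) (b2n≤1 (adj G i j)))))

  degA : ∀ v → deg (adj A) v ≤ (KA + KB) * D
  degA v = ≤-trans (≤-reflexive (≡.trans (≡.sym (Σl≡sum (λ u → b2n (isPos (used v u))) (allFin n))) (≡.trans (ΣF-cong (λ u → b2n-isPos (used≤1 v u))) (≡.trans (ΣF-+ (mg UB v) (mg RL v)) (cong₂ _+_ (ΣF-mg UB v) (ΣF-mg RL v))))))
    (≤-trans (+-mono-≤ (degUB v) (degR v)) (≤-reflexive (≡.trans (+-comm (KB * D) (KA * D)) (≡.sym (*-distribʳ-+ D KA KB)))))

-- The choice of D and of the final constant

sqrt : ∀ n → ∃[ k ] (suc n ≤ suc k * suc k × suc k * suc k ≤ 4 * suc n)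
sqrt zero    = 0 , ≤-refl , s≤s z≤n
sqrt (suc n) = step (sqrt n)
  where
  step : ∃[ k ] (suc n ≤ suc k * suc k × suc k * suc k ≤ 4 * suc n) → ∃[ k ] (2 + n ≤ suc k * suc k × suc k * suc k ≤ 4 * (2 + n))
  step (k , lo , hi) with 2 + n ≤? suc k * suc k
  ... | yes p = k , p , ≤-trans hi (*-monoʳ-≤ 4 (n≤1+n (suc n)))
  -- Here (k+1)² ≤ n+1, and k+2 is at most twice k+1; this is where the factor 4 is spent.
  ... | no ¬p = suc k , ≤-trans (s≤s lo) (≤-trans (m≤m+n _ (2 + 2 * k)) (≤-reflexive (a₁ k))) ,
                ≤-trans (*-mono-≤ {suc (suc k)} {2 * suc k} two two) (≤-trans (≤-reflexive (a₂ k)) (*-monoʳ-≤ 4 (≤-trans (s≤s⁻¹ (≰⇒> ¬p)) (n≤1+n (suc n)))))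
    where
    a₁ : ∀ k → 1 + (1 + k) * (1 + k) + (2 + 2 * k) ≡ (2 + k) * (2 + k)
    a₁ = solve 1 (λ k → con 1 :+ (con 1 :+ k) :* (con 1 :+ k) :+ (con 2 :+ con 2 :* k) := (con 2 :+ k) :* (con 2 :+ k)) ≡.refl
    a₂ : ∀ k → 2 * (1 + k) * (2 * (1 + k)) ≡ 4 * ((1 + k) * (1 + k))
    a₂ = solve 1 (λ k → con 2 :* (con 1 :+ k) :* (con 2 :* (con 1 :+ k)) := con 4 :* ((con 1 :+ k) :* (con 1 :+ k))) ≡.refl
    two : suc (suc k) ≤ 2 * suc k
    two = ≤-trans (s≤s (m≤n+m (suc k) k)) (≤-reflexive (cong suc (cong (k +_) (≡.sym (+-identityʳ (suc k))))))

square-≤ : ∀ {a b} → a * a ≤ b * b → a ≤ b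
square-≤ {a} {b} h = ≮⇒≥ (λ b<a → <⇒≱ (*-mono-< b<a b<a) h)

-- Hence any 2q-2 vertices have at least n/r common neighbours.
codegree : ∀ n d p r (deg nn : ℕ) → 0 < p → nn + deg ≡ n →
  ((1 + (d + d)) * r + p * (2 + (d + d))) * n ≤ (2 + (d + d)) * r * deg → (2 + (d + d)) * r * nn + (2 + (d + d)) * n ≤ r * n
codegree n d p r deg nn p>0 e h = +-cancelˡ-≤ ((1 + (d + d)) * r * n) _ _ (begin
  (1 + (d + d)) * r * n + ((2 + (d + d)) * r * nn + (2 + (d + d)) * n)
    ≤⟨ +-monoʳ-≤ ((1 + (d + d)) * r * n) (+-monoʳ-≤ ((2 + (d + d)) * r * nn) (≤-trans (≤-reflexive (≡.sym (*-identityˡ _))) (*-monoˡ-≤ ((2 + (d + d)) * n) p>0))) ⟩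
  (1 + (d + d)) * r * n + ((2 + (d + d)) * r * nn + p * ((2 + (d + d)) * n)) ≡⟨ a₁ (d + d) r n nn p ⟩
  ((1 + (d + d)) * r + p * (2 + (d + d))) * n + (2 + (d + d)) * r * nn ≤⟨ +-monoˡ-≤ ((2 + (d + d)) * r * nn) h ⟩
  (2 + (d + d)) * r * deg + (2 + (d + d)) * r * nn ≡⟨ a₂ (d + d) r deg nn ⟩
  (2 + (d + d)) * r * (nn + deg) ≡⟨ cong ((2 + (d + d)) * r *_) e ⟩
  (2 + (d + d)) * r * n ≡⟨ a₃ (d + d) r n ⟩
  (1 + (d + d)) * r * n + r * n ∎)
  where
  open ≤-Reasoning
  a₁ : ∀ e r n m p → (1 + e) * r * n + ((2 + e) * r * m + p * ((2 + e) * n)) ≡ ((1 + e) * r + p * (2 + e)) * n + (2 + e) * r * m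
  a₁ = solve 5 (λ e r n m p → (con 1 :+ e) :* r :* n :+ ((con 2 :+ e) :* r :* m :+ p :* ((con 2 :+ e) :* n)) := ((con 1 :+ e) :* r :+ p :* (con 2 :+ e)) :* n :+ (con 2 :+ e) :* r :* m) ≡.refl
  a₂ : ∀ e r g m → (2 + e) * r * g + (2 + e) * r * m ≡ (2 + e) * r * (m + g)
  a₂ = solve 4 (λ e r g m → (con 2 :+ e) :* r :* g :+ (con 2 :+ e) :* r :* m := (con 2 :+ e) :* r :* (m :+ g)) ≡.refl
  a₃ : ∀ e r n → (2 + e) * r * n ≡ (1 + e) * r * n + r * n
  a₃ = solve 3 (λ e r n → (con 2 :+ e) :* r :* n := (con 1 :+ e) :* r :* n :+ r :* n) ≡.refl

non-neighbours : ∀ {n} (G : Graph n) v → ΣF (λ w → 1 ∸ b2n (adj G w v)) + deg (adj G) v ≡ n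
non-neighbours {n} G v = ≡.trans (cong (ΣF (λ w → 1 ∸ b2n (adj G w v)) +_) (≡.sym (Σl≡sum (λ w → b2n (adj G v w)) (allFin n))))
  (≡.trans (≡.sym (ΣF-+ (λ w → 1 ∸ b2n (adj G w v)) (λ w → b2n (adj G v w)))) (≡.trans (ΣF-cong (λ w → ≡.trans (cong (λ b → 1 ∸ b2n (adj G w v) + b2n b) (Graph.sym G v w)) (m∸n+n≡m (b2n≤1 (adj G w v)))))
    (≡.trans (ΣF-const n 1) (*-identityʳ n))))

module Main (d p r : ℕ) (d>0 : 0 < d) (p>0 : 0 < p) (r>0 : 0 < r) where
  open Constants d r using (KA; KB; K₂; RC)

  -- One summand for each requirement: refinement; maximum degree, doubled because the side of the
  -- grid may reach 2√n; and `room`, through n ≥ 4(K₂+1)² when the side of the grid serves as `D`,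
  -- and through (K₂+1)·Δ ≤ n when Δ does.
  C₀ : ℕ
  C₀ = RC + (2 * (KA + KB) + (4 * (suc K₂ * suc K₂) + suc K₂))

  RC≤C : RC ≤ C₀
  RC≤C = m≤m+n _ _

  2K≤C : 2 * (KA + KB) ≤ C₀
  2K≤C = ≤-trans (m≤m+n _ _) (m≤n+m _ RC)

  sq≤C : 4 * (suc K₂ * suc K₂) ≤ C₀
  sq≤C = ≤-trans (m≤m+n _ _) (≤-trans (m≤n+m _ (2 * (KA + KB))) (m≤n+m _ RC))

  K₂<C : suc K₂ ≤ C₀
  K₂<C = ≤-trans (m≤n+m _ (4 * (suc K₂ * suc K₂))) (≤-trans (m≤n+m _ (2 * (KA + KB))) (m≤n+m _ RC))

  Absorbs : ∀ {n} → Graph n → Graph n → Set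
  Absorbs {n} G X = ∃[ A ] ∃[ F ] (adj A ⊆ᵍ adj G × OmniAbsorber (2 + d) (adj X) (adj A) F ×
    Refined C₀ (adj X) (adj A) F × DegBound C₀ n (maxDeg (adj A)) (maxDeg (adj X)))

  -- If Δ(X) = 0 then Δ(X)·C ≤ n says nothing about `n`, which may be too small for any embedding.
  -- But then `X` has no edges, and the empty graph absorbs.
  edgeless : ∀ {n} (G X : Graph n) → maxDeg (adj X) ≡ 0 → Absorbs G X
  edgeless {n} G X Δ0 = ∅ , [] , (λ i j ()) , ((λ i j _ ()) , [] , λ L L⊆X _ → [] , [] , [] , (λ S ()) , λ i j t → ⊥-elim (no-edge i j (L⊆X i j t))) , (λ i j _ → z≤n) ,
      inj₁ (≤-trans (maxDeg≤ (adj ∅) 0 (λ v → ≤-reflexive (≡.trans (≡.sym (Σl≡sum (λ _ → 0) (allFin n))) (Σl-zero (allFin n))))) z≤n)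
    where
    ∅ : Graph n
    ∅ = record { adj = λ _ _ → false ; sym = λ _ _ → ≡.refl ; irr = λ _ → ≡.refl }
    no-edge : ∀ i j → ¬ T (adj X i j)
    no-edge i j t = <⇒≱ (s≤s z≤n) (≤-trans (≤-reflexive (≡.sym (T⇒b2n t))) (≤-trans (ΣF-∈ (λ u → b2n (adj X i u)) j)
      (≤-trans (≤-reflexive (Σl≡sum (λ u → b2n (adj X i u)) (allFin n))) (≤-trans (deg≤maxDeg (adj X) i) (≤-reflexive Δ0)))))

  module _ (n' : ℕ) (G X : Graph (suc n')) (X⊆G : adj X ⊆ᵍ adj G) where
    n Δ : ℕ
    n = suc n'
    Δ = maxDeg (adj X)

    Codeg : Set
    Codeg = ∀ v → (2 + (d + d)) * r * ΣF (λ w → 1 ∸ b2n (adj G w v)) + (2 + (d + d)) * n ≤ r * n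

    large : Codeg → 1 ≤ Δ → Δ * C₀ ≤ n → Absorbs G X
    large cd Δ>0 ΔC = choose (sqrt n')
      where
      -- A single edge of `X` already forces `n` to be large; all lower bounds on `n` start from
      -- here.
      C≤n : C₀ ≤ n
      C≤n = ≤-trans (≤-trans (≤-reflexive (≡.sym (*-identityˡ C₀))) (*-monoˡ-≤ C₀ Δ>0)) ΔC
      choose : ∃[ k ] (n ≤ suc k * suc k × suc k * suc k ≤ 4 * n) → Absorbs G X
      choose (k , lo , hi) = go (≤-total (suc k) Δ)
        where
        s : ℕ
        s = suc k
        go : s ≤ Δ ⊎ Δ ≤ s → Absorbs G X
        go (inj₁ s≤Δ) = A , F , A⊆G , omni , (λ i j t → ≤-trans (refined i j t) RC≤C) ,
            inj₁ (maxDeg≤ (adj A) (C₀ * Δ) (λ v → ≤-trans (degA v) (*-monoˡ-≤ Δ (≤-trans (m≤m+n (KA + KB) _) 2K≤C))))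
          where
          room : K₂ * Δ < n
          room = ≤-trans (+-monoˡ-≤ (K₂ * Δ) Δ>0) (≤-trans (≤-reflexive (*-comm (suc K₂) Δ)) (≤-trans (*-monoʳ-≤ Δ K₂<C) ΔC))
          open Core d r n' k d>0 r>0 G X X⊆G cd lo hi Δ s≤Δ (deg≤maxDeg (adj X)) room using (A; F; A⊆G; omni; refined; degA)
        go (inj₂ Δ≤s) = A , F , A⊆G , omni , (λ i j t → ≤-trans (refined i j t) RC≤C) , inj₂ bound
          where
          -- Proved by squaring, as only s² is compared with `n`.
          ss : s * suc K₂ ≤ n
          ss = square-≤ (begin
            s * suc K₂ * (s * suc K₂)     ≡⟨ a₁ s (suc K₂) ⟩
            s * s * (suc K₂ * suc K₂)     ≤⟨ *-monoˡ-≤ (suc K₂ * suc K₂) hi ⟩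
            4 * n * (suc K₂ * suc K₂)     ≡⟨ a₂ n (suc K₂ * suc K₂) ⟩
            n * (4 * (suc K₂ * suc K₂))   ≤⟨ *-monoʳ-≤ n (≤-trans sq≤C C≤n) ⟩
            n * n                         ∎)
            where
            open ≤-Reasoning
            a₁ : ∀ s K → s * K * (s * K) ≡ s * s * (K * K)
            a₁ = solve 2 (λ s K → s :* K :* (s :* K) := s :* s :* (K :* K)) ≡.refl
            a₂ : ∀ n K → 4 * n * K ≡ n * (4 * K)
            a₂ = solve 2 (λ n K → con 4 :* n :* K := n :* (con 4 :* K)) ≡.refl
          room : K₂ * s < n
          room = ≤-trans (+-monoˡ-≤ (K₂ * s) (s≤s z≤n)) (≤-trans (≤-reflexive (*-comm (suc K₂) s)) ss)
          open Core d r n' k d>0 r>0 G X X⊆G cd lo hi s ≤-refl (λ x → ≤-trans (deg≤maxDeg (adj X) x) Δ≤s) room using (A; F; A⊆G; omni; refined; degA)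
          ΔA : ℕ
          ΔA = maxDeg (adj A)
          ΔA≤ : ΔA ≤ (KA + KB) * s
          ΔA≤ = maxDeg≤ (adj A) ((KA + KB) * s) degA
          -- `RC` is at least 2, hence so is `n`, and the logarithm does not vanish.
          log≥1 : 1 ≤ ⌈log₂ n ⌉
          log≥1 = ⌈log₂⌉-mono-≤ {2} {n} (≤-trans (s≤s (s≤s z≤n)) (≤-trans RC≤C C≤n))
          bound : ΔA ^ 2 ≤ C₀ ^ 2 * n * ⌈log₂ n ⌉ ^ 2
          bound = begin
            ΔA ^ 2                                   ≤⟨ ^-monoˡ-≤ 2 ΔA≤ ⟩
            ((KA + KB) * s) ^ 2                      ≡⟨ a₁ (KA + KB) s ⟩
            (KA + KB) * (KA + KB) * (s * s)          ≤⟨ *-monoʳ-≤ ((KA + KB) * (KA + KB)) hi ⟩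
            (KA + KB) * (KA + KB) * (4 * n)          ≡⟨ a₂ (KA + KB) n ⟩
            (2 * (KA + KB)) ^ 2 * n                  ≤⟨ *-monoˡ-≤ n (^-monoˡ-≤ 2 2K≤C) ⟩
            C₀ ^ 2 * n                               ≡⟨ *-identityʳ _ ⟨
            C₀ ^ 2 * n * 1 ^ 2                       ≤⟨ *-monoʳ-≤ (C₀ ^ 2 * n) (^-monoˡ-≤ 2 log≥1) ⟩
            C₀ ^ 2 * n * ⌈log₂ n ⌉ ^ 2               ∎
            where
            open ≤-Reasoning
            a₁ : ∀ K s → K * s * (K * s * 1) ≡ K * K * (s * s)
            a₁ = solve 2 (λ K s → K :* s :* (K :* s :* con 1) := K :* K :* (s :* s)) ≡.refl
            a₂ : ∀ K n → K * K * (4 * n) ≡ 2 * K * (2 * K * 1) * n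
            a₂ = solve 2 (λ K n → K :* K :* (con 4 :* n) := con 2 :* K :* (con 2 :* K :* con 1) :* n) ≡.refl

  absorbs : ∀ n (G X : Graph n) → adj X ⊆ᵍ adj G →
    (∀ v → ((1 + (d + d)) * r + p * (2 + (d + d))) * n ≤ (2 + (d + d)) * r * deg (adj G) v) → maxDeg (adj X) * C₀ ≤ n → Absorbs G X
  absorbs zero     G X X⊆G h ΔC = edgeless G X ≡.refl
  absorbs (suc n') G X X⊆G h ΔC = go (maxDeg (adj X)) ≡.refl
    where
    go : ∀ Δ → maxDeg (adj X) ≡ Δ → Absorbs G X
    go zero    e = edgeless G X e
    go (suc Δ) e = large n' G X X⊆G (λ v → codegree (suc n') d p r (deg (adj G) v) _ p>0 (non-neighbours G v) (h v)) (≤-trans (s≤s z≤n) (≤-reflexive (≡.sym e))) ΔC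

-- The rational p/r stands for ε. A real ε may be replaced by a smaller positive rational, which
-- only weakens the degree condition; this condition appears multiplied by (2q-2)·r.
theorem2p5 : (q : ℕ) → 3 ≤ q → (p r : ℕ) → 0 < p → p < r →
    ∃[ C ] (1 ≤ C ×
    ((n : ℕ) (G X : Graph n) → adj X ⊆ᵍ adj G →
    (∀ v → ((2 * q ∸ 3) * r + p * (2 * q ∸ 2)) * n ≤ (2 * q ∸ 2) * r * deg (adj G) v) →
    maxDeg (adj X) * C ≤ n →
    ∃[ A ] ∃[ F ] (adj A ⊆ᵍ adj G × OmniAbsorber q (adj X) (adj A) F ×
    Refined C (adj X) (adj A) F × DegBound C n (maxDeg (adj A)) (maxDeg (adj X)))))
theorem2p5 (suc (suc (suc e))) (s≤s (s≤s (s≤s _))) p r 0<p p<r = C₀ , ≤-trans (s≤s z≤n) RC≤C ,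
    λ n G X X⊆G h ΔC → absorbs n G X X⊆G (λ v → subst₂ (λ a b → (a * r + p * b) * n ≤ b * r * deg (adj G) v) (eq₃ e) (eq₂ e) (h v)) ΔC
  where
  -- With q = 3 + e the parameter `d` is q-2, which is positive.
  open Main (suc e) p r (s≤s z≤n) 0<p (≤-trans (s≤s z≤n) p<r)
  eq₂ : ∀ e → 2 * (3 + e) ∸ 2 ≡ 2 + (suc e + suc e)
  eq₂ e = ≡.trans (cong (λ t → suc (e + t)) (+-identityʳ (3 + e))) (lem e)
    where
    lem : ∀ e → 1 + (e + (3 + e)) ≡ 2 + ((1 + e) + (1 + e))
    lem = solve 1 (λ e → con 1 :+ (e :+ (con 3 :+ e)) := con 2 :+ ((con 1 :+ e) :+ (con 1 :+ e))) ≡.refl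
  eq₃ : ∀ e → 2 * (3 + e) ∸ 3 ≡ 1 + (suc e + suc e)
  eq₃ e = ≡.trans (cong (λ t → e + t) (+-identityʳ (3 + e))) (lem e)
    where
    lem : ∀ e → e + (3 + e) ≡ 1 + ((1 + e) + (1 + e))
    lem = solve 1 (λ e → e :+ (con 3 :+ e) := con 1 :+ ((con 1 :+ e) :+ (con 1 :+ e))) ≡.refl
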